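{- There is an integer $r_0$ such that for every integer $r \ge r_0$, the maximum number of nonzero, pairwise non-parallel rows of a rank-$r$ $2$-modular matrix is $\binom{r+2}{2} - 2$.
   Context: For a positive integer $\Delta$, an integer matrix $A$ is $\Delta$-modular if the determinant of every $\operatorname{rank}(A) \times \operatorname{rank}(A)$ submatrix of $A$ has absolute value at most $\Delta$. Two rows are parallel if one is a scalar multiple of the other. -}

module Defs where

open import Data.Nat using (ℕ; zero; suc; _≤_)
open import Data.Nat.Properties using ()
open import Data.Fin using (Fin; zero; suc; punchIn)
open import Data.Integer using (ℤ; +_; -_; _*_; _+_; ∣_∣)
open import Data.Product using (Σ; _×_; ∃)
open import Data.Sum using (_⊎_)
open import Relation.Binary.PropositionalEquality using (_≡_; _≢_)
open import Relation.Nullary using (¬_)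

Matrix : ℕ → ℕ → Set
Matrix m n = Fin m → Fin n → ℤ

sumFin : ∀ k → (Fin k → ℤ) → ℤ
sumFin zero    f = + 0
sumFin (suc k) f = f zero + sumFin k (λ i → f (suc i))

det : ∀ k → Matrix k k → ℤ
det zero    M = + 1
det (suc k) M = go (suc k) (+ 1) (λ j → j)
  where
  go : ∀ l → ℤ → (Fin l → Fin (suc k)) → ℤ
  go zero    s c = + 0
  go (suc l) s c =
    s * M zero (c zero) * det k (λ i j → M (suc i) (punchIn (c zero) j))
    + go l (- s) (λ i → c (suc i))

-- The k×k submatrix of A with rows f and columns g (non-injective choices
-- just give a matrix with determinant 0, so this covers all k×k submatrices).
sub : ∀ {m n} k → Matrix m n → (Fin k → Fin m) → (Fin k → Fin n) → Matrix k k
sub k A f g i j = A (f i) (g j)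

HasRank : ∀ {m n} → Matrix m n → ℕ → Set
HasRank {m} {n} A r =
  (Σ (Fin r → Fin m) λ f → Σ (Fin r → Fin n) λ g → det r (sub r A f g) ≢ + 0)
  × (∀ k (f : Fin k → Fin m) (g : Fin k → Fin n) → det k (sub k A f g) ≢ + 0 → k ≤ r)

IsModular : ∀ {m n} → ℕ → (r : ℕ) → Matrix m n → Set
IsModular {m} {n} Δ r A =
  ∀ (f : Fin r → Fin m) (g : Fin r → Fin n) → ∣ det r (sub r A f g) ∣ ≤ Δ

NonZeroRow : ∀ {n} → (Fin n → ℤ) → Set
NonZeroRow {n} u = ¬ (∀ j → u j ≡ + 0)

-- u is a (rational) scalar multiple of v: a·u = b·v with a ≠ 0, i.e. u = (b/a)·v.
ScalarMultipleOf : ∀ {n} → (Fin n → ℤ) → (Fin n → ℤ) → Set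
ScalarMultipleOf {n} u v =
  Σ ℤ λ a → Σ ℤ λ b → (a ≢ + 0) × (∀ j → a * u j ≡ b * v j)

Parallel : ∀ {n} → (Fin n → ℤ) → (Fin n → ℤ) → Set
Parallel u v = ScalarMultipleOf u v ⊎ ScalarMultipleOf v u

SimpleRows : ∀ {m n} → Matrix m n → Set
SimpleRows {m} A = (∀ i → NonZeroRow (A i)) × (∀ i j → i ≢ j → ¬ Parallel (A i) (A j))

IsMaxRows : ℕ → ℕ → ℕ → Set
IsMaxRows Δ r h =
  (Σ ℕ λ n → Σ (Matrix h n) λ A → HasRank A r × IsModular Δ r A × SimpleRows A)
  × (∀ m n (A : Matrix m n) → HasRank A r → IsModular Δ r A → SimpleRows A → m ≤ h)

{-# OPTIONS --safe #-}
module Submission where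

-- Upper bound.  Only the alternating function D of the maximal minors in a fixed
-- basis of columns is used: it is multilinear, satisfies the Plücker relations and
-- takes values of size at most 2 on the rows.  Contracting an element e turns a
-- configuration of rank r into one of rank r − 1.  Call a set S of rows heavy if all
-- minors containing S are even, but not all vanish.  If no set of at most four rows
-- is heavy, every contraction loses at most r + 1 rows, which is less than the
-- increment r + 2 of the claimed bound, so that a surplus over the bound decreases
-- with the rank; its start is controlled by a crude bound in rank 6.  If a set of at
-- most four rows is heavy, contracting it leaves a matrix that is unimodular up to a
-- factor 2, and the rows parallel after the contraction are counted directly.
-- Lower bound.  Take all differences e_j − e_i, together with e_j − a e_0 for
-- a = −1, 0, 1 and with e_0.  A pivot on such a row substitutes a point for a vertex
-- and stays in the class, so that a minor ends as a difference of two of −1, 0, 1.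

open import Defs
open import Data.Nat as ℕ using (ℕ; zero; suc; z≤n; s≤s; _≤_; _<_; _∸_)
open import Data.Nat.Properties as ℕP using (*-cancelʳ-≤; *-cancelˡ-≤; *-monoʳ-≤; *-monoˡ-≤; *-suc; +-assoc; +-mono-≤; +-monoʳ-≤; +-monoˡ-≤; +-suc; <-irrefl; <⇒≤; m+[n∸m]≡n; m+n∸m≡n; m+n≤o⇒m≤o∸n; m≤n⇒m<n∨m≡n; m≤n⇒m∸n≡0; m≤n⇒m≤1+n; n≢0⇒n>0; suc-injective; ≤-pred; ≤-refl; ≤-reflexive; ≤-trans; ≤⇒≤ᵇ; ≤∧≢⇒<; ≮⇒≥; ≰⇒>)
open import Data.Integer as ℤ using (ℤ; +_; -[1+_]; -_; _+_; _*_; _-_; ∣_∣; _⊖_)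
open import Data.Integer.Properties as ℤP using (*-comm; *-zeroʳ; +-identityˡ; +-inverseʳ; +∣i∣≡i⊎+∣i∣≡-i; [1+m]⊖[1+n]≡m⊖n; i*j≡0⇒i≡0∨j≡0; i-j≡0⇒i≡j; neg-involutive; ∣-i∣≡∣i∣; ∣i*j∣≡∣i∣*∣j∣; ∣i-j∣≤∣i∣+∣j∣; ∣i∣≡0⇒i≡0)
open import Data.Integer.Tactic.RingSolver using (solve-∀)
open import Data.Nat.Solver using (module +-*-Solver)
open import Data.Bool using (Bool; true; false; not; _∧_; _∨_; _xor_; T?) renaming (T to So)
import Data.Bool
open import Data.Bool.Properties using (∧-identityʳ; xor-identityʳ; ∧-zeroʳ; xor-comm; not-distribˡ-xor; not-distribʳ-xor; xor-annihilates-not)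
open import Data.Fin using (Fin; zero; suc)
import Data.Fin as Fin
import Data.Fin.Properties as FinP
open import Data.List using (List; []; _∷_; _++_; length; map; concatMap; tabulate; lookup)
open import Data.List.Properties using (++-assoc; length-++; length-map; map-++; ++-identityʳ; tabulate-lookup; length-tabulate; map-tabulate)
open import Data.List.Relation.Unary.All as All using (All; []; _∷_)
open import Data.List.Relation.Unary.All.Properties as AllP using (++⁻ʳ; ++⁻ˡ)
open import Data.List.Relation.Unary.Any as Any using (Any; here; there)
open import Data.List.Relation.Unary.AllPairs as AllPairs using (AllPairs; []; _∷_)
import Data.List.Relation.Unary.AllPairs.Properties as AllPairsP
open import Data.List.Membership.Propositional using (_∈_) renaming (find to find∈; lose to lose∈)
open import Data.List.Membership.Propositional.Properties using (∈-++⁺ʳ; ∈-++⁺ˡ; ∈-++⁻; ∈-concat⁺′; ∈-concat⁻′; ∈-lookup; ∈-map⁺; ∈-map⁻; ∈-tabulate⁺; ∈-tabulate⁻)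
open import Data.List.Relation.Binary.Permutation.Propositional as Perm using (_↭_; ↭-sym; ↭-refl; ↭-prep; ↭-trans; ↭-swap)
open import Data.List.Relation.Binary.Permutation.Propositional.Properties as PermP using (++-comm; ++⁺ʳ; ++⁺ˡ; All-resp-↭; drop-mid; ↭-length; ∈-resp-↭)
open import Data.Product using (Σ; ∃; ∃₂; _×_; _,_) renaming (proj₁ to fst; proj₂ to snd)
open import Data.Sum using (_⊎_) renaming (inj₁ to inl; inj₂ to inr)
open import Data.Unit using (⊤; tt)
open import Data.Empty using (⊥; ⊥-elim)
open import Relation.Nullary using (¬_; Dec; yes; no)
open import Relation.Nullary.Decidable using (toWitness; ⌊_⌋)
open import Relation.Binary.PropositionalEquality using (_≡_; _≢_; refl; sym; trans; cong; cong₂; subst; subst₂; module ≡-Reasoning)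
import Data.List.Relation.Unary.Any.Properties as AnyP
open import Data.Vec as Vec using (Vec)
import Data.Vec.Properties as VecP
import Relation.Nullary.Decidable as Dec

-- The number four comes from a budget. If vectors may be displaced along `e`, then `D` depends
-- affinely on the choice between displaced and undisplaced vectors, because a second displacement
-- would repeat `e`. Its values lie between -2 and 2, so its total variation is at most 4. A minimal
-- dependent family of unit displacements therefore has at most four members, and with three or four
-- members some value ±2 faces a minor ±1, which produces a heavy tuple of the same size. In the
-- heavy case all nonzero minors through the heavy set are ±2. Coordinates are then half-integers
-- with numerator at most 2, and for a minimal heavy set, a circuit modulo 2, these numerators share
-- one parity. This is why displacements carry doubled coefficients, and why most contradictions are
-- small determinants beyond the bound. The hardest case is a heavy quadruple for which all half
-- sign vectors occur: four of them, halves of the rows of a Hadamard matrix, form another heavy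
-- quadruple, and the two frames are incompatible.

-- Polynomial identities over the integers

ring-1 : ∀ a b → + 0 ≡ a * + 0 + b * + 0
ring-1 = solve-∀
ring-2 : ∀ f a g b h s t → f * (a * g + b * h) - (a * s + b * t) ≡ a * (f * g - s) + b * (f * h - t)
ring-2 = solve-∀
ring-3 : ∀ a f b h g s t → (a * f + b * h) * g - (a * s + b * t) ≡ a * (f * g - s) + b * (h * g - t)
ring-3 = solve-∀
ring-4 : ∀ f g s → f * (- g) - (- s) ≡ - (f * g - s)
ring-4 = solve-∀
ring-5 : ∀ a b c d e → a * b - (c * d - (- e)) ≡ - (c * d - (a * b - e))
ring-5 = solve-∀
ring-6 : ∀ a b → a - b ≡ a + (- + 1) * b
ring-6 = solve-∀
ring-7 : ∀ a b c → - a * b + (- c) ≡ - (a * b + c)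
ring-7 = solve-∀
ring-8 : ∀ a b c → a * - b + (- c) ≡ - (a * b + c)
ring-8 = solve-∀
ring-9 : ∀ b → + 0 * b + + 0 ≡ + 0
ring-9 = solve-∀
ring-10 : ∀ a b → + 0 * a + b ≡ b
ring-10 = solve-∀
ring-11 : ∀ x → - + 2 * x ≡ + 2 * - x
ring-11 = solve-∀
ring-12 : ∀ g h → + 2 * g + + 2 * h ≡ + 2 * (g + h)
ring-12 = solve-∀
ring-13 : ∀ a → a ≡ + 1 * (+ 1 * a)
ring-13 = solve-∀
ring-14 : ∀ a → a ≡ - + 1 * (- + 1 * a)
ring-14 = solve-∀
ring-15 : ∀ a → - + 1 * a + + 0 * a ≡ - a
ring-15 = solve-∀
ring-16 : ∀ a → - a ≡ - + 1 * a + + 0 * a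
ring-16 = solve-∀
ring-17 : ∀ a b → - b ≡ + 0 * a - b
ring-17 = solve-∀
ring-18 : ∀ a b c → a * b - c ≡ b * a + - c
ring-18 = solve-∀
ring-19 : ∀ a d → a * + 0 + + 0 ≡ d * + 0
ring-19 = solve-∀
ring-20 : ∀ a b → a * - b ≡ - a * b
ring-20 = solve-∀
ring-21 : ∀ a → - a * - a ≡ a * a
ring-21 = solve-∀
ring-22 : ∀ a b → + 2 * (a * b) ≡ a * (+ 2 * b)
ring-22 = solve-∀
ring-23 : ∀ a b c d → a * (+ 2 * b + c * d) ≡ + 2 * (a * b) + c * (a * d)
ring-23 = solve-∀
ring-24 : ∀ a b → + 2 * a + b * + 0 ≡ + 2 * a
ring-24 = solve-∀
ring-25 : ∀ a → + 2 * (a - a) ≡ + 0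
ring-25 = solve-∀
ring-26 : ∀ a l → + 2 * (a - l) ≡ + 2 * a - + 2 * l
ring-26 = solve-∀
ring-27 : ∀ t b l → + 2 * t + b - + 2 * l ≡ b + + 2 * (t - l)
ring-27 = solve-∀
ring-28 : ∀ a h → + 2 * (h - a) ≡ + 2 * h - + 2 * a
ring-28 = solve-∀
ring-29 : ∀ t b h → + 2 * h - (+ 2 * t + b) ≡ - b + + 2 * (h - t)
ring-29 = solve-∀
ring-30 : ∀ x → + 2 * x ≡ - + 2 * - x
ring-30 = solve-∀
ring-31 : ∀ a b c → a * - b + - c ≡ - (a * b + c)
ring-31 = solve-∀
ring-32 : ∀ a b → a * + 0 + b ≡ b
ring-32 = solve-∀
ring-33 : ∀ a → + 2 * - a ≡ - (+ 2 * a)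
ring-33 = solve-∀
ring-34 : ∀ s Z → + 0 ≡ s * (+ 0 * Z)
ring-34 = solve-∀
ring-35 : ∀ s a b → s * (- a * b) ≡ - s * (a * b)
ring-35 = solve-∀
ring-36 : ∀ a s h Z w → a * (s * (+ 1 * (h * Z))) + - s * (w * Z) ≡ s * ((a * h - w) * Z)
ring-36 = solve-∀
ring-37 : ∀ a b → + 2 * a * b ≡ a * (+ 2 * b)
ring-37 = solve-∀
ring-38 : ∀ p a g s → p * (a * g + s) ≡ a * (p * g) + p * s
ring-38 = solve-∀
ring-39 : ∀ h s z → h * (s * z) ≡ + 1 * (s * (h * z))
ring-39 = solve-∀
ring-40 : ∀ x τ τ' e → + 2 * x + τ' * e ≡ + 2 * x + τ * e + (τ' - τ) * e
ring-40 = solve-∀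
ring-41 : ∀ x τ e → + 2 * x ≡ + 2 * x + τ * e + - τ * e
ring-41 = solve-∀
ring-42 : ∀ x τ e → - (+ 2 * x + τ * e) ≡ + 2 * - x + - τ * e
ring-42 = solve-∀
ring-43 : ∀ a b → + 2 * a + + 0 * b ≡ + 2 * a
ring-43 = solve-∀
ring-44 : ∀ a → + 2 * + 0 + a ≡ a
ring-44 = solve-∀
ring-45 : ∀ a d e x → a * e + (- (- d) * x + + 0) ≡ a * e + d * x
ring-45 = solve-∀
ring-46 : ∀ y → + 2 * y ≡ - (- + 2 * y)
ring-46 = solve-∀
ring-47 : ∀ a e x → - (a * e + - + 2 * x) ≡ + 2 * x + - a * e
ring-47 = solve-∀
ring-48 : ∀ x τ e → - (+ 2 * x + τ * e) ≡ + 2 * - x + τ * - e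
ring-48 = solve-∀
ring-49 : ∀ a t → + 2 * a + t * + 0 ≡ + 2 * a
ring-49 = solve-∀
ring-50 : ∀ a b c → + 2 * b + + 2 * c ≡ + 0 * a + (+ 2 * b + (+ 2 * c + + 0))
ring-50 = solve-∀
ring-51 : ∀ t a b c → + 2 * b + t * a ≡ t * a + (+ 2 * b + (+ 0 * c + + 0))
ring-51 = solve-∀
ring-52 : ∀ a b c → + 2 * c + + 2 * a ≡ + 2 * a + (+ 0 * b + (+ 2 * c + + 0))
ring-52 = solve-∀
ring-53 : ∀ a → a * + 0 + + 0 ≡ + 0
ring-53 = solve-∀
ring-54 : ∀ P k e → + 2 * P + + 1 * e + + 2 * k ≡ + 2 * P + + 2 * k + + 1 * e
ring-54 = solve-∀
ring-55 : ∀ P k e → + 2 * P + + 1 * e + (+ 2 * k + + 1 * e) ≡ + 2 * P + + 2 * e + + 2 * k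
ring-55 = solve-∀
ring-56 : ∀ e p P k → + 2 * p + + 2 * k ≡ + 0 * e + (+ 2 * p + (+ 0 * P + (+ 2 * k + + 0)))
ring-56 = solve-∀
ring-57 : ∀ e p P k → + 2 * p + + 1 * e ≡ + 1 * e + (+ 2 * p + (+ 0 * P + (+ 0 * k + + 0)))
ring-57 = solve-∀
ring-58 : ∀ e p P k → + 2 * P + + 2 * e + + 2 * k ≡ + 2 * e + (+ 0 * p + (+ 2 * P + (+ 2 * k + + 0)))
ring-58 = solve-∀
ring-59 : ∀ e p P k → + 2 * P ≡ + 0 * e + (+ 0 * p + (+ 2 * P + (+ 0 * k + + 0)))
ring-59 = solve-∀
ring-60 : ∀ p k e → + 2 * p + + 0 * e + + 2 * e + + 2 * k ≡ + 2 * p + + 2 * k + + 2 * e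
ring-60 = solve-∀
ring-61 : ∀ m → + 2 * m ≡ - (- + 2 * m)
ring-61 = solve-∀
ring-62 : ∀ k c → - (- + 2 * k + - c) ≡ + 2 * k + c
ring-62 = solve-∀
ring-63 : ∀ b e s → + 2 * b + + 2 * s + + 2 * e ≡ + 2 * e + (+ 2 * s + + 2 * b)
ring-63 = solve-∀
ring-64 : ∀ b e s → + 2 * b + + 2 * e ≡ + 2 * e + (- + 2 * s + (+ 2 * b + + 2 * s))
ring-64 = solve-∀
ring-65 : ∀ e s y u → + 2 * y ≡ + 0 * e + (+ 0 * s + (+ 2 * y + (+ 0 * u + + 0)))
ring-65 = solve-∀
ring-66 : ∀ e s y u → + 2 * e + (+ 2 * s + + 2 * y) ≡ + 2 * e + (+ 2 * s + (+ 2 * y + (+ 0 * u + + 0)))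
ring-66 = solve-∀
ring-67 : ∀ e s y u → + 2 * u ≡ + 0 * e + (+ 0 * s + (+ 0 * y + (+ 2 * u + + 0)))
ring-67 = solve-∀
ring-68 : ∀ e s y u → + 2 * e + (- + 2 * s + + 2 * u) ≡ + 2 * e + (- + 2 * s + (+ 0 * y + (+ 2 * u + + 0)))
ring-68 = solve-∀
ring-69 : ∀ a → - (+ 2 * a + + 2 * + 0) ≡ + 2 * - a
ring-69 = solve-∀
ring-70 : ∀ a → - + 2 * a ≡ + 2 * - a
ring-70 = solve-∀
ring-71 : ∀ a h → + 2 * + 0 + + 2 * h + + 2 * a ≡ + 2 * (a + h)
ring-71 = solve-∀
ring-72 : ∀ k x → x ≡ + 2 * k + x - + 2 * k
ring-72 = solve-∀
ring-73 : ∀ k y w → + 2 * k + y + w - + 2 * k ≡ y + w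
ring-73 = solve-∀
ring-74 : ∀ x y → y ≡ x + y - x
ring-74 = solve-∀
ring-75 : ∀ a c x → a * x + c * x ≡ x * (a + c)
ring-75 = solve-∀
ring-76 : ∀ k e t → e * t ≡ k + t * e - k
ring-76 = solve-∀
ring-77 : ∀ t d → t * - d ≡ - (+ 2 * + 0 + t * d)
ring-77 = solve-∀
ring-78 : ∀ a b → + 2 * a + + 2 * b ≡ + 2 * (a + b)
ring-78 = solve-∀
ring-79 : ∀ a b → - (- a + b) ≡ a - b
ring-79 = solve-∀
ring-80 : ∀ f → - + 1 * f ≡ - (+ 1 * f)
ring-80 = solve-∀
ring-81 : ∀ x → - (+ 2 * x) ≡ + 2 * - x
ring-81 = solve-∀
ring-82 : ∀ f → + 1 * f ≡ - (- + 1 * f)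
ring-82 = solve-∀
ring-83 : ∀ y' y p e s a b c → + 2 * y' - (+ 2 * e + (c * s + + 2 * y)) ≡ + 2 * y' - + 2 * y - (+ 2 * p + ((a + + 2) * e + (b + c) * s) - (+ 2 * p + (a * e + b * s)))
ring-83 = solve-∀
ring-84 : ∀ p e s → + 2 * p ≡ + 2 * p + (+ 0 * e + + 0 * s)
ring-84 = solve-∀
ring-85 : ∀ a → a ≡ a + - + 2 + + 2
ring-85 = solve-∀
ring-86 : ∀ a → a ≡ a + + 2 + - + 2
ring-86 = solve-∀
ring-87 : ∀ a → + 2 * - a ≡ - + 1 * (+ 2 * a)
ring-87 = solve-∀
ring-88 : ∀ a b → + 1 * a + (+ 1 * b + + 0) ≡ + 1 * (a + b)
ring-88 = solve-∀
ring-89 : ∀ a b → - + 1 * a + (- + 1 * b + + 0) ≡ - + 1 * (a + b)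
ring-89 = solve-∀
ring-90 : ∀ a b → + 1 * a + (- + 1 * b + + 0) ≡ - + 1 * (- a + b)
ring-90 = solve-∀
ring-91 : ∀ a b → - + 1 * a + (+ 1 * b + + 0) ≡ + 1 * (- a + b)
ring-91 = solve-∀
ring-92 : ∀ y → + 2 * - y ≡ - (+ 2 * y)
ring-92 = solve-∀
ring-93 : ∀ x a e b → - (+ 2 * x + (a * e + b * + 0)) ≡ + 2 * - x + a * - e
ring-93 = solve-∀
ring-94 : ∀ x a s b → - (+ 2 * x + (a * + 0 + b * s)) ≡ + 2 * - x + b * - s
ring-94 = solve-∀
ring-95 : ∀ p e s → + 2 * p + + 2 * e ≡ + 2 * p + (+ 2 * e + + 0 * s)
ring-95 = solve-∀
ring-96 : ∀ p e s a b c → + 2 * p + (a * e + b * s) + (c * e + + 2 * s) ≡ + 2 * p + ((a + c) * e + (b + + 2) * s)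
ring-96 = solve-∀
ring-97 : ∀ x y b → + 2 * - b - + 2 * (y - x) ≡ + 2 * x - (+ 2 * y + b * + 2)
ring-97 = solve-∀
ring-98 : ∀ x y b → + 2 * - b - + 2 * (x - y) ≡ + 2 * y + b * - + 2 - + 2 * x
ring-98 = solve-∀
ring-99 : ∀ y → + 2 * - y ≡ - + 2 * y
ring-99 = solve-∀
ring-100 : ∀ b c d → - (b * + 0 + c * - d) ≡ c * d
ring-100 = solve-∀
ring-101 : ∀ b c d → - (b * d + c * + 0) ≡ - b * d
ring-101 = solve-∀
ring-102 : ∀ b c t s → b * (+ 2 * t) + c * (+ 2 * s) ≡ + 2 * (b * t + c * s)
ring-102 = solve-∀
ring-103 : ∀ d b c b' c' → d * (b * c') - d * (c * b') ≡ b * (c' * d) + c * (- b' * d) - + 0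
ring-103 = solve-∀
ring-104 : ∀ s b → + 2 * b ≡ + 0 * s + + 2 * b
ring-104 = solve-∀
ring-105 : ∀ b e s → + 2 * b + + 2 * e ≡ + 2 * e + (+ 0 * s + + 2 * b)
ring-105 = solve-∀
ring-106 : ∀ a b c e s s' k k' → a * e + (b * s + (c * s' + + 0)) ≡ a * e + (b * s + (c * s' + (+ 0 * k + (+ 0 * k' + + 0))))
ring-106 = solve-∀
ring-107 : ∀ p e s s' k k' → p * s + + 2 * k ≡ + 0 * e + (p * s + (+ 0 * s' + (+ 2 * k + (+ 0 * k' + + 0))))
ring-107 = solve-∀
ring-108 : ∀ p e s s' k k' → + 2 * e + (p * s + + 2 * k) ≡ + 2 * e + (p * s + (+ 0 * s' + (+ 2 * k + (+ 0 * k' + + 0))))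
ring-108 = solve-∀
ring-109 : ∀ p e s s' k k' → p * s' + + 2 * k' ≡ + 0 * e + (+ 0 * s + (p * s' + (+ 0 * k + (+ 2 * k' + + 0))))
ring-109 = solve-∀
ring-110 : ∀ p e s s' k k' → + 2 * e + (p * s' + + 2 * k') ≡ + 2 * e + (+ 0 * s + (p * s' + (+ 0 * k + (+ 2 * k' + + 0))))
ring-110 = solve-∀
ring-111 : ∀ a b c → a * + 0 + (b + (c + + 0)) ≡ b + c
ring-111 = solve-∀
ring-112 : ∀ e t s a b c → b * (a * b * e + (t + b * c * s)) ≡ b * b * (a * e) + (b * t + b * b * (c * s))
ring-112 = solve-∀
ring-113 : ∀ x y z → + 1 * x + (y + + 1 * z) ≡ x + (y + (z + + 0))
ring-113 = solve-∀
ring-114 : ∀ t s → + 0 * t + + 0 * s ≡ + 2 * + 0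
ring-114 = solve-∀
ring-115 : ∀ e t s → + 0 * e + (t + (+ 0 * s + + 0)) ≡ t
ring-115 = solve-∀
ring-116 : ∀ e t s → + 0 * e + (+ 0 * t + (s + + 0)) ≡ s
ring-116 = solve-∀
ring-117 : ∀ a b c → a + (b + (c + + 0)) ≡ a + (c + (b + + 0))
ring-117 = solve-∀
ring-118 : ∀ a b → + 1 * a + - + 1 * b ≡ a - b
ring-118 = solve-∀
ring-119 : ∀ a b c → a + (b + c) ≡ b + (a + c)
ring-119 = solve-∀
ring-120 : ∀ o a b c → o + (a + (b + c)) ≡ o + (b + (a + c))
ring-120 = solve-∀
ring-121 : ∀ p h g k l → + 2 * p ≡ + 2 * p + (+ 0 * h + (+ 0 * g + (+ 0 * k + (+ 0 * l + + 0))))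
ring-121 = solve-∀
ring-122 : ∀ p h g k l → + 2 * p + + 2 * h ≡ + 2 * p + (+ 2 * h + (+ 0 * g + (+ 0 * k + (+ 0 * l + + 0))))
ring-122 = solve-∀
ring-123 : ∀ p h b g k l → p + (h + (b * g + (k + (l + + 0)))) + + 2 * g ≡ p + (h + ((b + + 2) * g + (k + (l + + 0))))
ring-123 = solve-∀
ring-124 : ∀ y' y p h g k l a b c d α β γ δ → + 2 * y' - (+ 2 * y + (α * h + (β * g + (γ * k + (δ * l + + 0))))) ≡ + 2 * y' - + 2 * y - (+ 2 * p + ((a + α) * h + ((b + β) * g + ((c + γ) * k + ((d + δ) * l + + 0)))) - (+ 2 * p + (a * h + (b * g + (c * k + (d * l + + 0))))))
ring-124 = solve-∀
ring-125 : ∀ a → - + 16 * a ≡ + 16 * - a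
ring-125 = solve-∀
ring-126 : ∀ a b c d → + 2 * (+ 1 * a + (+ 1 * b + (+ 1 * c + (+ 1 * d + + 0)))) ≡ + 2 * a + + 2 * b + (+ 2 * c + + 2 * d)
ring-126 = solve-∀
ring-127 : ∀ e t s u → (+ 1 * e + (+ 1 * t + (+ 1 * s + (+ 1 * u + + 0)))) + (+ 1 * e + (+ 1 * t + (- + 1 * s + (- + 1 * u + + 0)))) + ((+ 1 * e + (- + 1 * t + (+ 1 * s + (- + 1 * u + + 0)))) + (+ 1 * e + (- + 1 * t + (- + 1 * s + (+ 1 * u + + 0))))) ≡ + 2 * (+ 2 * e)
ring-127 = solve-∀
ring-128 : ∀ y a b c d h1 h2 h3 h4 → + 2 * (+ 2 * y + (a * h1 + (b * h2 + (c * h3 + (d * h4 + + 0))))) ≡ + 4 * y + (a * (+ 2 * h1) + b * (+ 2 * h2) + (c * (+ 2 * h3) + d * (+ 2 * h4)))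
ring-128 = solve-∀
ring-129 : ∀ y a b c d e t s u → + 4 * y + (a * (+ 1 * e + (+ 1 * t + (+ 1 * s + (+ 1 * u + + 0)))) + b * (+ 1 * e + (+ 1 * t + (- + 1 * s + (- + 1 * u + + 0)))) + (c * (+ 1 * e + (- + 1 * t + (+ 1 * s + (- + 1 * u + + 0)))) + d * (+ 1 * e + (- + 1 * t + (- + 1 * s + (+ 1 * u + + 0)))))) ≡ + 4 * y + ((a + b + c + d) * e + (a + b - c - d) * t + ((a - b + c - d) * s + (a - b - c + d) * u))
ring-129 = solve-∀
ring-130 : ∀ y α β γ δ e t s u → + 4 * y + (+ 2 * α * e + + 2 * β * t + (+ 2 * γ * s + + 2 * δ * u)) ≡ + 2 * (+ 2 * y + (α * e + (β * t + (γ * s + δ * u))))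
ring-130 = solve-∀
ring-131 : ∀ e t s u k y → + 2 * y ≡ + 0 * e + (+ 0 * t + (+ 0 * s + (+ 0 * u + (+ 0 * k + (+ 2 * y + + 0)))))
ring-131 = solve-∀
ring-132 : ∀ α β γ δ e t s u k y → + 2 * y + (α * e + (β * t + (γ * s + δ * u))) ≡ α * e + (β * t + (γ * s + (δ * u + (+ 0 * k + (+ 2 * y + + 0)))))
ring-132 = solve-∀
ring-133 : ∀ p e t s u k y → p * t + + 2 * k ≡ + 0 * e + (p * t + (+ 0 * s + (+ 0 * u + (+ 2 * k + (+ 0 * y + + 0)))))
ring-133 = solve-∀
ring-134 : ∀ p e t s u k y → + 2 * e + (p * t + + 2 * k) ≡ + 2 * e + (p * t + (+ 0 * s + (+ 0 * u + (+ 2 * k + (+ 0 * y + + 0)))))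
ring-134 = solve-∀
ring-135 : ∀ a b c d e t s u k y → a * e + (b * t + (c * s + (d * u + + 0))) ≡ a * e + (b * t + (c * s + (d * u + (+ 0 * k + (+ 0 * y + + 0)))))
ring-135 = solve-∀
ring-136 : ∀ e t s u → + 2 * s ≡ + 0 * e + (+ 0 * t + (+ 2 * s + (+ 0 * u + + 0)))
ring-136 = solve-∀
ring-137 : ∀ e t s u → + 2 * u ≡ + 0 * e + (+ 0 * t + (+ 0 * s + (+ 2 * u + + 0)))
ring-137 = solve-∀
ring-138 : ∀ a b c d → a + (b + (c + d)) ≡ a + (c + (b + d))
ring-138 = solve-∀
ring-139 : ∀ a a' b c d → a + (a' + (b + (c + d))) ≡ a + (a' + (c + (b + d)))
ring-139 = solve-∀
ring-140 : ∀ a b c d → a * + 0 + (b + (c + (d * + 0 + + 0))) ≡ b + c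
ring-140 = solve-∀
ring-141 : ∀ e t s u a b c d → b * (a * b * e + (t + (b * c * s + b * d * u))) ≡ b * b * (a * e) + (b * t + (b * b * (c * s) + b * b * (d * u)))
ring-141 = solve-∀
ring-142 : ∀ x y z w → + 1 * x + (y + (+ 1 * z + + 1 * w)) ≡ x + (y + (z + (w + + 0)))
ring-142 = solve-∀
ring-143 : ∀ a t s u → a * + 0 + (+ 0 * t + (+ 0 * s + (+ 0 * u + + 0))) ≡ + 2 * + 0
ring-143 = solve-∀
ring-144 : ∀ e t s u → + 0 * e + (t + (+ 0 * s + (+ 0 * u + + 0))) ≡ t
ring-144 = solve-∀
ring-145 : ∀ e t s u → + 0 * e + (+ 0 * t + (s + (+ 0 * u + + 0))) ≡ s
ring-145 = solve-∀
ring-146 : ∀ e t s u → + 0 * e + (+ 0 * t + (+ 0 * s + (u + + 0))) ≡ u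
ring-146 = solve-∀
ring-147 : ∀ a b c d → a + (b + (c + (d * + 0 + + 0))) ≡ a + (b + (c + + 0))
ring-147 = solve-∀
ring-148 : ∀ x → + 2 * - x ≡ - (+ 2 * x)
ring-148 = solve-∀
ring-149 : ∀ b f → - (b * f) ≡ - b * f
ring-149 = solve-∀
ring-150 : ∀ a → - (- (- + 1)) * a ≡ - a
ring-150 = solve-∀
ring-151 : ∀ x a h b c d → - (+ 2 * x + (a * h + (b * + 0 + (c * + 0 + (d * + 0 + + 0))))) ≡ + 2 * - x + a * - h
ring-151 = solve-∀
ring-152 : ∀ a b c d → a + (b + (c + d)) ≡ c + (a + (b + d))
ring-152 = solve-∀
ring-153 : ∀ x₁ x₂ x₃ d a₁ a₂ a₃ a₄ b₁ b₂ b₃ b₄ c₁ c₂ c₃ c₄ → d * b₁ - d * (a₁ + c₁) ≡ + 2 * x₃ - + 2 * x₃ + + 2 * x₂ - (+ 2 * x₂ + (c₂ * + 0 + (c₃ * + 0 + (c₁ * d + (c₄ * + 0 + + 0)))) - (+ 2 * x₁ + (b₁ * d + (b₃ * + 0 + (b₂ * + 0 + (b₄ * + 0 + + 0))))) + (+ 2 * x₁ + (a₁ * d + (a₂ * + 0 + (a₃ * + 0 + (a₄ * + 0 + + 0))))))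
ring-153 = solve-∀
ring-154 : ∀ x → + 4 * x ≡ + 2 * (+ 2 * x)
ring-154 = solve-∀
ring-155 : ∀ x → - + 4 * x ≡ + 2 * (- + 2 * x)
ring-155 = solve-∀
ring-156 : ∀ a e d x → a * e + (- (- d) * x + + 0) ≡ a * e + d * x
ring-156 = solve-∀
ring-157 : ∀ d e → d * (+ 0 * e + d * + 0) ≡ + 0
ring-157 = solve-∀
ring-158 : ∀ d a e x → + 2 * (d * (a * e + d * x)) ≡ + 2 * (d * d * x) + + 2 * (d * a) * e
ring-158 = solve-∀
ring-159 : ∀ x k → + 2 * (+ 1 * x) + k ≡ + 2 * x + k
ring-159 = solve-∀
ring-160 : ∀ a → + 1 * (+ 1 * a) ≡ a
ring-160 = solve-∀
ring-161 : ∀ a → + 1 * (- + 1 * a) ≡ - a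
ring-161 = solve-∀
ring-162 : ∀ a → - + 1 * (+ 1 * a) ≡ - a
ring-162 = solve-∀
ring-163 : ∀ a → - + 1 * (- + 1 * a) ≡ a
ring-163 = solve-∀
ring-164 : ∀ a b → + 2 * a ≡ + 2 * a + + 0 * b
ring-164 = solve-∀
ring-165 : ∀ d c₀ c₁ c₂ θ e x₁ x₂ → + 2 * (d * (c₀ * e + (c₁ * x₁ + (c₂ * x₂ + + 0)))) + θ * e ≡ (+ 2 * (d * c₀) + θ) * e + (+ 2 * (d * c₁) * x₁ + (+ 2 * (d * c₂) * x₂ + + 0))
ring-165 = solve-∀
ring-166 : ∀ θ e x₁ x₂ → + 2 * x₁ + θ * e ≡ θ * e + (+ 2 * x₁ + (+ 0 * x₂ + + 0))
ring-166 = solve-∀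
ring-167 : ∀ θ e x₁ x₂ → + 2 * x₂ + θ * e ≡ θ * e + (+ 0 * x₁ + (+ 2 * x₂ + + 0))
ring-167 = solve-∀
ring-168 : ∀ d c₀ c₁ c₂ c₃ θ e x₁ x₂ x₃ → + 2 * (d * (c₀ * e + (c₁ * x₁ + (c₂ * x₂ + (c₃ * x₃ + + 0))))) + θ * e ≡ (+ 2 * (d * c₀) + θ) * e + (+ 2 * (d * c₁) * x₁ + (+ 2 * (d * c₂) * x₂ + (+ 2 * (d * c₃) * x₃ + + 0)))
ring-168 = solve-∀
ring-169 : ∀ θ e x₁ x₂ x₃ → + 2 * x₁ + θ * e ≡ θ * e + (+ 2 * x₁ + (+ 0 * x₂ + (+ 0 * x₃ + + 0)))
ring-169 = solve-∀
ring-170 : ∀ θ e x₁ x₂ x₃ → + 2 * x₂ + θ * e ≡ θ * e + (+ 0 * x₁ + (+ 2 * x₂ + (+ 0 * x₃ + + 0)))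
ring-170 = solve-∀
ring-171 : ∀ θ e x₁ x₂ x₃ → + 2 * x₃ + θ * e ≡ θ * e + (+ 0 * x₁ + (+ 0 * x₂ + (+ 2 * x₃ + + 0)))
ring-171 = solve-∀
ring-172 : ∀ a b → a - b ≡ + 1 * a + (- + 1) * b
ring-172 = solve-∀
ring-173 : ∀ a b → a * b ≡ a * b + + 0 * b
ring-173 = solve-∀
ring-174 : ∀ a b c → a * b - c ≡ b * a + (- + 1) * c
ring-174 = solve-∀
ring-175 : ∀ a → a * + 0 + (- + 1) * + 0 ≡ + 0
ring-175 = solve-∀
ring-176 : ∀ s a b w → s * a * b + - s * w ≡ s * (a * b - w)
ring-176 = solve-∀
ring-177 : ∀ a b → a ≡ a - b + b
ring-177 = solve-∀
ring-178 : ∀ x → - + 1 * (- + 1 * x + + 0 * x) + + 0 * (- + 1 * x + + 0 * x) ≡ x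
ring-178 = solve-∀
ring-179 : ∀ v e → v * e - + 0 ≡ e * v
ring-179 = solve-∀
ring-180 : ∀ a b → a ≡ a - + 0 * b
ring-180 = solve-∀
ring-181 : ∀ a b → b ≡ a - + 1 * (a - b)
ring-181 = solve-∀
ring-182 : ∀ a b c d y → (a - b * y) - (c - d * y) ≡ + 1 * (a - c) + - (b - d) * y
ring-182 = solve-∀
ring-183 : ∀ a b → + 1 * a + b * + 0 ≡ a
ring-183 = solve-∀
ring-184 : ∀ a b s c → + 1 * a + - b * (s * c) ≡ + 1 * a + - b * s * c
ring-184 = solve-∀
ring-185 : ∀ a → + 1 * a + - a * (+ 1 - + 0) ≡ + 0
ring-185 = solve-∀
ring-186 : ∀ a → a - + 0 ≡ a
ring-186 = solve-∀
ring-187 : ∀ a b → a - b ≡ + 1 * (a - b)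
ring-187 = solve-∀
ring-188 : ∀ a b → a - b ≡ - + 1 * (b - a)
ring-188 = solve-∀
ring-189 : ∀ a → a ≡ a * + 1 - + 0
ring-189 = solve-∀
ring-190 : ∀ c a → a ≡ c - (c - a)
ring-190 = solve-∀
ring-191 : ∀ a b c → a * (b * c) ≡ a * b * c
ring-191 = solve-∀
ring-192 : ∀ b v w → b * v * w ≡ b * w * v
ring-192 = solve-∀

-- Nonvanishing and parity of integers

0≢ : ℤ → Set
0≢ x = x ≢ + 0

x≡-x⇒0 : ∀ x → x ≡ - x → x ≡ + 0
x≡-x⇒0 (+ zero) _ = refl
x≡-x⇒0 (+ suc n) ()
x≡-x⇒0 -[1+ n ] ()

*≢0 : ∀ {x y} → 0≢ x → 0≢ y → 0≢ (x * y)
*≢0 {x} {y} p q e with i*j≡0⇒i≡0∨j≡0 x e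
... | inl a = p a
... | inr b = q b

*≢0ˡ : ∀ {x y} → 0≢ (x * y) → 0≢ x
*≢0ˡ p refl = p refl

*≢0ʳ : ∀ {x y} → 0≢ (x * y) → 0≢ y
*≢0ʳ {x} p refl = p (*-zeroʳ x)

cancel-≡ : ∀ {d} x y → 0≢ d → d * x ≡ d * y → x ≡ y
cancel-≡ {d} x y d≢0 e = ℤP.*-cancelˡ-≡ d x y {{ℤ.≢-nonZero d≢0}} e

odd : ℕ → Bool
odd zero = false
odd (suc n) = not (odd n)

par : ℤ → Bool
par x = odd ∣ x ∣

odd-+ : ∀ m n → odd (m ℕ.+ n) ≡ odd m xor odd n
odd-+ zero n = refl
odd-+ (suc m) n = trans (cong not (odd-+ m n)) (not-distribˡ-xor (odd m) (odd n))

odd-* : ∀ m n → odd (m ℕ.* n) ≡ odd m ∧ odd n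
odd-* zero n = refl
odd-* (suc m) n = trans (odd-+ n (m ℕ.* n)) (trans (cong (odd n xor_) (odd-* m n)) (lem (odd n) (odd m))) where
 lem : ∀ a b → a xor (b ∧ a) ≡ not b ∧ a
 lem true true = refl
 lem true false = refl
 lem false true = refl
 lem false false = refl

par-⊖ : ∀ m n → par (m ⊖ n) ≡ odd m xor odd n
par-⊖ zero zero = refl
par-⊖ zero (suc n) = refl
par-⊖ (suc m) zero = sym (xor-identityʳ (not (odd m)))
par-⊖ (suc m) (suc n) = trans (cong par ([1+m]⊖[1+n]≡m⊖n m n)) (trans (par-⊖ m n) (sym (xor-annihilates-not (odd m) (odd n))))

par-+ : ∀ x y → par (x + y) ≡ par x xor par y
par-+ (+ m) (+ n) = odd-+ m n
par-+ (+ m) -[1+ n ] = par-⊖ m (suc n)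
par-+ -[1+ m ] (+ n) = trans (par-⊖ n (suc m)) (xor-comm (odd n) (not (odd m)))
par-+ -[1+ m ] -[1+ n ] = trans (cong (λ t → not (not t)) (odd-+ m n)) (trans (cong not (not-distribˡ-xor (odd m) (odd n))) (not-distribʳ-xor (not (odd m)) (odd n)))

par-* : ∀ x y → par (x * y) ≡ par x ∧ par y
par-* x y = trans (cong odd (∣i*j∣≡∣i∣*∣j∣ x y)) (odd-* ∣ x ∣ ∣ y ∣)

par-neg : ∀ x → par (- x) ≡ par x
par-neg x = cong odd (∣-i∣≡∣i∣ x)

-- Alternating sums over the deletion of one list entry

module _ {X : Set} where

 -- The pattern of Laplace expansion: an entry is evaluated by `φ` and removed, the rest is passed
 -- to `G`, and the sign alternates with the position. Cramer's rule, the Plücker relations and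
 -- determinants are all instances.
 W : (X → ℤ) → (List X → ℤ) → List X → ℤ
 W φ G [] = + 0
 W φ G (x ∷ xs) = φ x * G xs - W φ (λ ys → G (x ∷ ys)) xs

 W-cong : ∀ {φ ψ : X → ℤ} {G H : List X → ℤ} → (∀ x → φ x ≡ ψ x) → (∀ xs → G xs ≡ H xs) → ∀ xs → W φ G xs ≡ W ψ H xs
 W-cong p q [] = refl
 W-cong p q (x ∷ xs) = cong₂ _-_ (cong₂ _*_ (p x) (q xs)) (W-cong p (λ ys → q (x ∷ ys)) xs)

 W-linʳ : ∀ φ a (G : List X → ℤ) b H xs → W φ (λ ys → a * G ys + b * H ys) xs ≡ a * W φ G xs + b * W φ H xs
 W-linʳ φ a G b H [] = (lem a b) where
  lem = ring-1
 W-linʳ φ a G b H (x ∷ xs) = trans (cong (λ t → φ x * (a * G xs + b * H xs) - t) (W-linʳ φ a _ b _ xs)) (lem (φ x) a (G xs) b (H xs) _ _) where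
  lem = ring-2

 W-linˡ : ∀ a φ b ψ (G : List X → ℤ) xs → W (λ x → a * φ x + b * ψ x) G xs ≡ a * W φ G xs + b * W ψ G xs
 W-linˡ a φ b ψ G [] = (lem a b) where
  lem = ring-1
 W-linˡ a φ b ψ G (x ∷ xs) = trans (cong (λ t → (a * φ x + b * ψ x) * G xs - t) (W-linˡ a φ b ψ _ xs)) (lem a (φ x) b (ψ x) (G xs) _ _) where
  lem = ring-3

 W-neg : ∀ φ (G : List X → ℤ) xs → W φ (λ ys → - G ys) xs ≡ - W φ G xs
 W-neg φ G [] = refl
 W-neg φ G (x ∷ xs) = trans (cong (λ t → φ x * (- G xs) - t) (W-neg φ _ xs)) (lem (φ x) (G xs) _) where
  lem = ring-4

 -- Two successive deletions remove a pair of entries. Exchanging `φ` and `ψ` exchanges the order of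
 -- removal, which changes the sign of every term.
 W-anti : ∀ φ ψ (G : List X → ℤ) xs → W φ (W ψ G) xs ≡ - W ψ (W φ G) xs
 W-anti φ ψ G [] = refl
 W-anti φ ψ G (x ∷ xs) = begin
  φ x * W ψ G xs - W φ (λ ys → ψ x * G ys - W ψ G' ys) xs
   ≡⟨ cong (λ t → φ x * W ψ G xs - t) (step φ ψ) ⟩
  φ x * W ψ G xs - (ψ x * W φ G xs - W φ (W ψ G') xs)
   ≡⟨ cong (λ t → φ x * W ψ G xs - (ψ x * W φ G xs - t)) (W-anti φ ψ G' xs) ⟩
  φ x * W ψ G xs - (ψ x * W φ G xs - (- W ψ (W φ G') xs))
   ≡⟨ lem (φ x) (W ψ G xs) (ψ x) (W φ G xs) _ ⟩
  - (ψ x * W φ G xs - (φ x * W ψ G xs - W ψ (W φ G') xs))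
   ≡⟨ cong (λ t → - (ψ x * W φ G xs - t)) (sym (step ψ φ)) ⟩
  - (ψ x * W φ G xs - W ψ (λ ys → φ x * G ys - W φ G' ys) xs) ∎ where
  open ≡-Reasoning
  G' : List X → ℤ
  G' ys = G (x ∷ ys)
  lem = ring-5
  l2 = ring-6
  step : ∀ φ ψ → W φ (λ ys → ψ x * G ys - W ψ G' ys) xs ≡ ψ x * W φ G xs - W φ (W ψ G') xs
  step φ ψ = trans (W-cong (λ _ → refl) (λ ys → l2 (ψ x * G ys) (W ψ G' ys)) xs)
   (trans (W-linʳ φ (ψ x) G (- + 1) (W ψ G') xs) (sym (l2 (ψ x * W φ G xs) (W φ (W ψ G') xs))))

 W-vanish : ∀ φ (G : List X → ℤ) xs → (∀ l x r → xs ≡ l ++ x ∷ r → φ x * G (l ++ r) ≡ + 0) → W φ G xs ≡ + 0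
 W-vanish φ G [] h = refl
 W-vanish φ G (x ∷ xs) h = cong₂ _-_ (h [] x xs refl) (W-vanish φ _ xs (λ l y r e → h (x ∷ l) y r (cong (x ∷_) e)))

 -- Basis exchange rests on this: applied to Cramer's rule, it finds the member of a basis that can
 -- be exchanged.
 W-find : ∀ φ (G : List X → ℤ) xs → 0≢ (W φ G xs) →
      ∃ λ l → ∃₂ λ x r → xs ≡ l ++ x ∷ r × 0≢ (φ x) × 0≢ (G (l ++ r))
 W-find φ G [] h = ⊥-elim (h refl)
 W-find φ G (x ∷ xs) h with φ x * G xs ℤ.≟ + 0
 ... | no ne = [] , x , xs , refl , *≢0ˡ ne , *≢0ʳ {φ x} ne
 ... | yes e with W-find φ (λ ys → G (x ∷ ys)) xs (λ e' → h (cong₂ _-_ e e'))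
 ...   | l , y , r , eq , p , q = x ∷ l , y , r , cong (x ∷_) eq , p , q

-- Vectors, coefficient lists and permutations of lists

-- `A` is the finite set of vectors whose minors are bounded. Closure under negation allows parallel
-- vectors to be aligned instead of being compared up to sign.
record Space : Set₁ where
 field
  V    : Set
  lc   : ℤ → V → ℤ → V → V
  A    : List V
  neg∈ : ∀ {v} → v ∈ A → lc (- + 1) v (+ 0) v ∈ A

dot : List ℤ → List ℤ → ℤ
dot [] _ = + 0
dot (_ ∷ _) [] = + 0
dot (a ∷ as) (b ∷ bs) = a * b + dot as bs

dot-neg : ∀ as bs → dot (map -_ as) bs ≡ - dot as bs
dot-neg [] bs = refl
dot-neg (a ∷ as) [] = refl
dot-neg (a ∷ as) (b ∷ bs) = trans (cong (λ t → - a * b + t) (dot-neg as bs)) (lem a b (dot as bs)) where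
 lem = ring-7

dot-negʳ : ∀ as {X : Set} (f : X → ℤ) xs → dot as (map (λ x → - f x) xs) ≡ - dot as (map f xs)
dot-negʳ [] f xs = refl
dot-negʳ (a ∷ as) f [] = refl
dot-negʳ (a ∷ as) f (x ∷ xs) = trans (cong (λ t → a * - f x + t) (dot-negʳ as f xs)) (lem a (f x) (dot as (map f xs))) where
 lem = ring-8

dot-congʳ : ∀ as {X : Set} {f g : X → ℤ} → (∀ x → f x ≡ g x) → ∀ xs → dot as (map f xs) ≡ dot as (map g xs)
dot-congʳ [] e xs = refl
dot-congʳ (a ∷ as) e [] = refl
dot-congʳ (a ∷ as) e (x ∷ xs) = cong₂ (λ s t → a * s + t) (e x) (dot-congʳ as e xs)

∈-split : ∀ {X : Set} {x : X} {xs} → x ∈ xs → ∃₂ λ l r → xs ≡ l ++ x ∷ r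
∈-split (here refl) = [] , _ , refl
∈-split (there {x = y} p) with ∈-split p
... | l , r , refl = y ∷ l , r , refl

∈-mid : ∀ {X : Set} l (x : X) r → x ∈ l ++ x ∷ r
∈-mid l x r = ∈-++⁺ʳ l (here refl)

All-mid : ∀ {X : Set} {P : X → Set} l {x r} → All P (l ++ x ∷ r) → All P (l ++ r)
All-mid l ps with AllP.++⁻ l ps
... | a , (_ ∷ b) = AllP.++⁺ a b

Alt : {V : Set} → (List V → ℤ) → Set
Alt D = ∀ us u v zs → D (us ++ u ∷ v ∷ zs) ≡ - D (us ++ v ∷ u ∷ zs)

-- Only the disjunction is kept, since most applications need an absolute value, a parity or
-- nonvanishing, none of which sees the sign.
perm± : ∀ {V : Set} (D : List V → ℤ) → Alt D → ∀ {xs ys} → xs ↭ ys → (D xs ≡ D ys) ⊎ (D xs ≡ - D ys)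
perm± D alt Perm.refl = inl refl
perm± D alt (Perm.prep x p) = perm± (λ ys → D (x ∷ ys)) (λ us → alt (x ∷ us)) p
perm± D alt {_ ∷ _ ∷ xs} (Perm.swap x y p) with perm± (λ zs → D (y ∷ x ∷ zs)) (λ us → alt (y ∷ x ∷ us)) p
... | inl e = inr (trans (alt [] x y xs) (cong -_ e))
... | inr e = inl (trans (alt [] x y xs) (trans (cong -_ e) (neg-involutive _)))
perm± D alt (Perm.trans p q) with perm± D alt p | perm± D alt q
... | inl e | inl f = inl (trans e f)
... | inl e | inr f = inr (trans e f)
... | inr e | inl f = inr (trans e (cong -_ f))
... | inr e | inr f = inl (trans e (trans (cong -_ f) (neg-involutive _)))

module _ {X : Set} where

 AP-resp : ∀ {R : X → X → Set} → (∀ {x y} → R x y → R y x) → ∀ {xs ys} → xs ↭ ys → AllPairs R xs → AllPairs R ys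
 AP-resp s Perm.refl ps = ps
 AP-resp s (Perm.prep x p) (a ∷ ps) = All-resp-↭ p a ∷ AP-resp s p ps
 AP-resp s (Perm.swap x y p) ((r ∷ a) ∷ (b ∷ ps)) =
  (s r ∷ All-resp-↭ p b) ∷ All-resp-↭ p a ∷ AP-resp s p ps
 AP-resp s (Perm.trans p q) ps = AP-resp s q (AP-resp s p ps)

 AP-++⁻ : ∀ {R : X → X → Set} as {bs} → AllPairs R (as ++ bs) → AllPairs R as × AllPairs R bs × All (λ a → All (R a) bs) as
 AP-++⁻ [] ps = [] , ps , []
 AP-++⁻ (a ∷ as) (p ∷ ps) with AP-++⁻ as ps | AllP.++⁻ as p
 ... | x , y , z | u , v = (u ∷ x) , y , (v ∷ z)

 divide : ∀ {P : X → Set} → (∀ x → Dec (P x)) → ∀ xs → ∃₂ λ as bs → xs ↭ as ++ bs × All P as × All (λ x → ¬ P x) bs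
 divide P? [] = [] , [] , ↭-refl , [] , []
 divide P? (x ∷ xs) with divide P? xs | P? x
 ... | as , bs , p , a , b | yes px = x ∷ as , bs , ↭-prep x p , px ∷ a , b
 ... | as , bs , p , a , b | no px = as , x ∷ bs , ↭-trans (↭-prep x p) (↭-sym (PermP.shift x as bs)) , a , px ∷ b

 module _ {R : X → X → Set} (R? : ∀ x y → Dec (R x y)) where

  findPar : ∀ x rs → (∃ λ r → r ∈ rs × ¬ R x r) ⊎ All (R x) rs
  findPar x [] = inr []
  findPar x (r ∷ rs) with R? x r
  ... | no h = inl (r , here refl , h)
  ... | yes h with findPar x rs
  ...   | inl (r' , m , h') = inl (r' , there m , h')
  ...   | inr a = inr (h ∷ a)

  -- Greedy choice: an entry joins `reps` unless it fails `R` against some representative, which is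
  -- then stored with it. With `R` as non-parallelism, each surplus entry in `exs` carries a
  -- representative parallel to it.
  classify : ∀ xs → ∃ λ reps → ∃ λ (exs : List (X × X)) → xs ↭ reps ++ map fst exs × AllPairs R reps ×
        All (λ p → snd p ∈ reps × ¬ R (fst p) (snd p)) exs
  classify [] = [] , [] , ↭-refl , [] , []
  classify (x ∷ xs) with classify xs
  ... | reps , exs , p , ap , a with findPar x reps
  ...   | inl (r , m , h) = reps , (x , r) ∷ exs , ↭-trans (↭-prep x p) (↭-sym (PermP.shift x reps _)) , ap , (m , h) ∷ a
  ...   | inr all = x ∷ reps , exs , ↭-prep x p , all ∷ ap , All.map (λ { (m , h) → there m , h }) a

 All-∈ : ∀ {P : X → Set} {xs x} → All P xs → x ∈ xs → P x
 All-∈ ps m = All.lookup ps m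

 keep : ∀ l (p : X) r {ys} → All (_∈ (l ++ p ∷ r)) ys → (p ∈ ys) ⊎ All (_∈ (l ++ r)) ys
 keep l p r [] = inr []
 keep l p r (m ∷ ms) with keep l p r ms
 ... | inl q = inl (there q)
 ... | inr q with ∈-++⁻ l m
 ...   | inl a = inr (∈-++⁺ˡ a ∷ q)
 ...   | inr (here refl) = inl (here refl)
 ...   | inr (there a) = inr (∈-++⁺ʳ l a ∷ q)

 distinct-length : ∀ {ys b : List X} → AllPairs _≢_ ys → All (_∈ b) ys → length ys ≤ length b
 distinct-length [] [] = z≤n
 distinct-length {y ∷ ys} (d ∷ ds) (m ∷ ms) with ∈-split m
 ... | l , r , refl with keep l y r ms
 ...   | inl y∈ = ⊥-elim (All-∈ d y∈ refl)
 ...   | inr q = ≤-trans (s≤s (distinct-length ds q)) (≤-reflexive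
      (sym (trans (length-++ l) (trans (+-suc (length l) (length r)) (cong suc (sym (length-++ l)))))))

-- The claimed bound and values between -2 and 2

tri : ℕ → ℕ
tri zero = 0
tri (suc n) = suc n ℕ.+ tri n

even-val : ∀ {x} → par x ≡ false → ∣ x ∣ ≤ 2 → 0≢ x → ∣ x ∣ ≡ 2
even-val {x} p b ne with ∣ x ∣ in eq
... | 0 = ⊥-elim (ne (∣i∣≡0⇒i≡0 eq))
even-val {x} () b ne | 1
... | 2 = refl
even-val {x} p (s≤s (s≤s ())) ne | suc (suc (suc _))

abs2 : ∀ {x} → ∣ x ∣ ≡ 2 → (x ≡ + 2) ⊎ (x ≡ - + 2)
abs2 {+ .2} refl = inl refl
abs2 { -[1+ .1 ]} refl = inr refl

abs2-≢ : ∀ {x} → ∣ x ∣ ≡ 2 → 0≢ x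
abs2-≢ () refl

hd : List ℤ → ℤ
hd [] = + 0
hd (a ∷ _) = a

tl : List ℤ → List ℤ
tl [] = []
tl (_ ∷ as) = as

pow2 : ℕ → ℤ
pow2 zero = + 1
pow2 (suc k) = + 2 * pow2 k

-- The bound of the theorem in rank N + 1, that is C(N + 3, 2) - 2. The summand `tri N` is the
-- maximum of the unimodular case in rank N.
f1 : ℕ → ℕ
f1 N = tri N ℕ.+ (N ℕ.+ N) ℕ.+ 1

-- The budget of a contraction: 3 + N rows may be lost, one of them being the contracted vector.
f1-suc : ∀ N → f1 (suc N) ≡ f1 N ℕ.+ (3 ℕ.+ N)
f1-suc N = lem N (tri N) where
 open +-*-Solver
 lem : ∀ n t → (suc n ℕ.+ t) ℕ.+ (suc n ℕ.+ suc n) ℕ.+ 1 ≡ t ℕ.+ (n ℕ.+ n) ℕ.+ 1 ℕ.+ (3 ℕ.+ n)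
 lem = solve 2 (λ n t → (con 1 :+ n :+ t) :+ (con 1 :+ n :+ (con 1 :+ n)) :+ con 1 := t :+ (n :+ n) :+ con 1 :+ (con 3 :+ n)) refl

data Small : ℤ → Set where
 sp1 : Small (+ 1)
 sp2 : Small (+ 2)
 sm1 : Small (- + 1)
 sm2 : Small (- + 2)
 sz0 : Small (+ 0)

small : ∀ τ → ∣ τ ∣ ≤ 2 → Small τ
small (+ 0) _ = sz0
small (+ 1) _ = sp1
small (+ 2) _ = sp2
small (+ suc (suc (suc _))) (s≤s (s≤s ()))
small -[1+ 0 ] _ = sm1
small -[1+ 1 ] _ = sm2
small -[1+ suc (suc _) ] (s≤s (s≤s ()))

-- The three terms are at least 2, 4 and 4, and their sum 10 exceeds the limit of the range of three
-- displacements.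
too-big : ∀ {t s r a b c} → 1 ≤ t → s ≡ 2 → r ≡ 2 → a ≡ 2 → b ≡ 2 → c ≡ 2 → ¬ (t ℕ.* a ℕ.+ (s ℕ.* b ℕ.+ r ℕ.* c) ≤ 8)
too-big {t} t1 refl refl refl refl refl h = <-irrefl refl (≤-trans (≤-trans (ℕP.n≤1+n 9) (+-monoˡ-≤ 8 (*-monoˡ-≤ 2 t1))) h)

nonzeros : List ℤ
nonzeros = + 1 ∷ + 2 ∷ - + 1 ∷ - + 2 ∷ []

-- Two reasons why displaced vectors cannot coexist: equal offsets give equal vectors, and offsets
-- more than 2 apart give too large a minor.
clash : ℤ → ℤ → Bool
clash a b = ⌊ a ℤ.≟ b ⌋ ∨ not (∣ b - a ∣ ℕ.≤ᵇ 2)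

small-∈ : ∀ {τ} → Small τ → 0≢ τ → τ ∈ nonzeros
small-∈ sp1 _ = here refl
small-∈ sp2 _ = there (here refl)
small-∈ sm1 _ = there (there (here refl))
small-∈ sm2 _ = there (there (there (here refl)))
small-∈ sz0 h = ⊥-elim (h refl)

-- The offset 0 belongs to the reference vector, so three further points of a line need three
-- offsets among ±1, ±2. All 64 triples are checked by evaluation.
three-offsets : All (λ a → All (λ b → All (λ c → So (clash a b ∨ clash a c ∨ clash b c)) nonzeros) nonzeros) nonzeros
three-offsets = toWitness {a? = All.all? (λ a → All.all? (λ b → All.all? (λ c → T? (clash a b ∨ clash a c ∨ clash b c)) nonzeros) nonzeros) nonzeros} tt

T-∨ : ∀ {a b} → So (a ∨ b) → So a ⊎ So b
T-∨ {true} h = inl tt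
T-∨ {false} h = inr h

clash-⊥ : ∀ a b → a ≢ b → ∣ b - a ∣ ≤ 2 → ¬ So (clash a b)
clash-⊥ a b ne le h with a ℤ.≟ b
... | yes e = ne e
... | no _ with ∣ b - a ∣ ℕ.≤ᵇ 2 in eq
...   | true = h
...   | false = subst So eq (≤⇒≤ᵇ le)

-- Doubled coefficients: these are the integral coefficients -1, 0 and 1.
data Ev : ℤ → Set where
 ev0 : Ev (+ 0)
 ev+ : Ev (+ 2)
 ev- : Ev (- + 2)

ev-small : ∀ {x} → par x ≡ false → ∣ x ∣ ≤ 2 → Ev x
ev-small {x} p b = go (small x b) p where
 go : ∀ {x} → Small x → par x ≡ false → Ev x
 go sz0 _ = ev0
 go sp2 _ = ev+
 go sm2 _ = ev-
 go sp1 ()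
 go sm1 ()

Ev-neg : ∀ {x} → Ev x → Ev (- x)
Ev-neg ev0 = ev0
Ev-neg ev+ = ev-
Ev-neg ev- = ev+

-- Deletion sums modulo 2

module _ {X : Set} where

 pw : (X → Bool) → (List X → Bool) → List X → Bool
 pw φ G [] = false
 pw φ G (x ∷ xs) = (φ x ∧ G xs) xor pw φ (λ ys → G (x ∷ ys)) xs

 par-W : ∀ φ (G : List X → ℤ) xs → par (W φ G xs) ≡ pw (λ x → par (φ x)) (λ ys → par (G ys)) xs
 par-W φ G [] = refl
 par-W φ G (x ∷ xs) = trans (par-+ (φ x * G xs) (- W φ (λ ys → G (x ∷ ys)) xs))
  (cong₂ _xor_ (par-* (φ x) (G xs)) (trans (par-neg (W φ (λ ys → G (x ∷ ys)) xs)) (par-W φ (λ ys → G (x ∷ ys)) xs)))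

 pw-vanish : ∀ (φ : X → Bool) G xs → (∀ l x r → xs ≡ l ++ x ∷ r → G (l ++ r) ≡ false) → pw φ G xs ≡ false
 pw-vanish φ G [] h = refl
 pw-vanish φ G (x ∷ xs) h = cong₂ _xor_ (trans (cong (φ x ∧_) (h [] x xs refl)) (∧-zeroʳ (φ x)))
  (pw-vanish φ (λ ys → G (x ∷ ys)) xs (λ l y r e → h (x ∷ l) y r (cong (x ∷_) e)))

 -- The part of `pw φ G (T ++ w)` in which the deleted entry belongs to `T`.
 pt : (X → Bool) → (List X → Bool) → List X → List X → Bool
 pt φ G [] w = false
 pt φ G (t ∷ T) w = (φ t ∧ G (T ++ w)) xor pt φ (λ ys → G (t ∷ ys)) T w

 pw-app : ∀ (φ : X → Bool) G T w → pw φ (λ ys → G (T ++ ys)) w ≡ false → pw φ G (T ++ w) ≡ pt φ G T w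
 pw-app φ G [] w h = h
 pw-app φ G (t ∷ T) w h = cong ((φ t ∧ G (T ++ w)) xor_) (pw-app φ (λ ys → G (t ∷ ys)) T w h)

 xsum : (X → Bool) → List X → Bool
 xsum φ [] = false
 xsum φ (x ∷ xs) = φ x xor xsum φ xs

 xsum-0 : ∀ (φ : X → Bool) xs → All (λ x → φ x ≡ false) xs → xsum φ xs ≡ false
 xsum-0 φ [] [] = refl
 xsum-0 φ (x ∷ xs) (p ∷ ps) = cong₂ _xor_ p (xsum-0 φ xs ps)

 pt-all : ∀ (φ : X → Bool) G T w → (∀ l t r → T ≡ l ++ t ∷ r → G (l ++ r ++ w) ≡ true) → pt φ G T w ≡ xsum φ T
 pt-all φ G [] w h = refl
 pt-all φ G (t ∷ T) w h = cong₂ _xor_ (trans (cong (φ t ∧_) (h [] t T refl)) (∧-identityʳ (φ t)))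
  (pt-all φ (λ ys → G (t ∷ ys)) T w (λ l s r e → h (t ∷ l) s r (cong (t ∷_) e)))

 pt-0 : ∀ (φ : X → Bool) G T w → All (λ t → φ t ≡ false) T → pt φ G T w ≡ false
 pt-0 φ G [] w [] = refl
 pt-0 φ G (t ∷ T) w (p ∷ ps) = cong₂ _xor_ (cong (_∧ G (T ++ w)) p) (pt-0 φ (λ ys → G (t ∷ ys)) T w ps)

 pt-one : ∀ (φ : X → Bool) G l t r w → All (λ s → φ s ≡ false) l → All (λ s → φ s ≡ false) r → pt φ G (l ++ t ∷ r) w ≡ φ t ∧ G (l ++ r ++ w)
 pt-one φ G [] t r w _ pr = trans (cong ((φ t ∧ G (r ++ w)) xor_) (pt-0 φ (λ ys → G (t ∷ ys)) r w pr)) (xor-identityʳ _)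
 pt-one φ G (s ∷ l) t r w (p ∷ pl) pr = trans (cong₂ _xor_ (cong (_∧ G ((l ++ t ∷ r) ++ w)) p) (pt-one φ (λ ys → G (s ∷ ys)) l t r w pl pr)) refl

true∧ : ∀ {a b} → true ≡ a ∧ b → b ≡ true
true∧ {true} e = sym e
true∧ {false} ()

data AllZero : List ℤ → Set where
 []  : AllZero []
 _∷_ : ∀ {a as} → a ≡ + 0 → AllZero as → AllZero (a ∷ as)

-- Counting by codes

module _ {X : Set} where

 AP-lookup : ∀ {R : X → X → Set} {xs x y} → (∀ {x y} → R x y → R y x) → AllPairs R xs → x ∈ xs → y ∈ xs → x ≡ y ⊎ R x y
 AP-lookup s (a ∷ ps) (here refl) (here refl) = inl refl
 AP-lookup s (a ∷ ps) (here refl) (there m) = inr (All-∈ a m)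
 AP-lookup s (a ∷ ps) (there m) (here refl) = inr (s (All-∈ a m))
 AP-lookup s (a ∷ ps) (there m) (there m') = AP-lookup s ps m m'

 AP-tab : ∀ {R : X → X → Set} {Q : X → X → Set} {xs} → AllPairs R xs → (∀ {x y} → x ∈ xs → y ∈ xs → R x y → Q x y) → AllPairs Q xs
 AP-tab [] f = []
 AP-tab (a ∷ ps) f = All.tabulate (λ m → f (here refl) (there m) (All-∈ a m)) ∷ AP-tab ps (λ m m' → f (there m) (there m'))

 -- The code need not be a function of the entry: each entry selects some code, and the selected
 -- codes are distinct because entries with a common code violate `R`.
 coded : ∀ {K : Set} {R : X → X → Set} {Code : X → K → Set} (univ : List K) → ∀ xs → AllPairs R xs →
     All (λ x → ∃ λ k → k ∈ univ × Code x k) xs → (∀ {x y k} → x ∈ xs → y ∈ xs → Code x k → Code y k → ¬ R x y) → length xs ≤ length univ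
 coded {K} {R} {Code} univ xs ap cs h = ≤-trans (≤-reflexive (sym (len cs))) (distinct-length (dist ap cs (λ m → m)) (inU cs)) where
  Coded : X → Set
  Coded x = ∃ λ k → k ∈ univ × Code x k
  codes : ∀ {xs} → All Coded xs → List K
  codes [] = []
  codes ((k , _) ∷ cs) = k ∷ codes cs
  len : ∀ {xs} (cs : All Coded xs) → length (codes cs) ≡ length xs
  len [] = refl
  len (_ ∷ cs) = cong suc (len cs)
  inU : ∀ {xs} (cs : All Coded xs) → All (_∈ univ) (codes cs)
  inU [] = []
  inU ((_ , m , _) ∷ cs) = m ∷ inU cs
  differ : ∀ {x k ys} → x ∈ xs → Code x k → All (R x) ys → (cs : All Coded ys) → (∀ {y} → y ∈ ys → y ∈ xs) → All (k ≢_) (codes cs)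
  differ mx c [] [] sub = []
  differ mx c (r ∷ rs) ((k' , _ , c') ∷ cs) sub = (λ { refl → h mx (sub (here refl)) c c' r }) ∷ differ mx c rs cs (λ m → sub (there m))
  dist : ∀ {ys} → AllPairs R ys → (cs : All Coded ys) → (∀ {y} → y ∈ ys → y ∈ xs) → AllPairs _≢_ (codes cs)
  dist [] [] sub = []
  dist (a ∷ ap) ((k , _ , c) ∷ cs) sub = differ (sub (here refl)) c a cs (λ m → sub (there m)) ∷ dist ap cs (λ m → sub (there m))

xor-eq : ∀ {a b} → a xor b ≡ false → a ≡ b
xor-eq {true} {true} _ = refl
xor-eq {false} {false} _ = refl

-- Coefficient vectors with entries 0 and ±2

data PM2 : ℤ → Set where
 pm+ : PM2 (+ 2)
 pm- : PM2 (- + 2)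

PM2-≢ : ∀ {a} → PM2 a → 0≢ a
PM2-≢ pm+ ()
PM2-≢ pm- ()

pm-or : ∀ {a} → PM2 a → a ≡ + 2 ⊎ a ≡ - + 2
pm-or pm+ = inl refl
pm-or pm- = inr refl

-- Modulo 4 the left side is 2 and the right side is 0.
PM2-sum : ∀ {a b c} → PM2 a → PM2 b → PM2 c → b ≢ a + c
PM2-sum pm+ pm+ pm+ ()
PM2-sum pm+ pm+ pm- ()
PM2-sum pm+ pm- pm+ ()
PM2-sum pm+ pm- pm- ()
PM2-sum pm- pm+ pm+ ()
PM2-sum pm- pm+ pm- ()
PM2-sum pm- pm- pm+ ()
PM2-sum pm- pm- pm- ()

-- A coefficient vector with entries 0, ±2 that is not zero, split into its first nonzero entry, the other nonzero ones and the zero ones.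
record Part {X : Set} (as : List ℤ) (S : List X) : Set where
 field
  {a}  : ℤ
  {s}  : X
  Is Zs  : List X
  a2   : PM2 a
  perm : S ↭ s ∷ Is ++ Zs
  only : ∀ (φ : X → ℤ) → All (λ x → φ x ≡ + 0) Is → dot as (map φ S) ≡ a * φ s
  -- If `φ` vanishes where the coefficients do, half of the combination is a sum with coefficients
  -- ±1, so its parity is that of the sum over all of `S`. This is how circuits modulo 2 enter.
  half : ∀ (φ : X → ℤ) → All (λ x → φ x ≡ + 0) Zs → ∃ λ h → dot as (map φ S) ≡ + 2 * h × par h ≡ xsum (λ x → par (φ x)) S

module _ {X : Set} where

 dot-0 : ∀ {as} → AllZero as → ∀ bs → dot as bs ≡ + 0
 dot-0 [] bs = refl
 dot-0 (_ ∷ _) [] = refl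
 dot-0 (refl ∷ h) (b ∷ bs) = trans (cong (λ t → + 0 * b + t) (dot-0 h bs)) (l b) where
  l = ring-9

 dot-∷0 : ∀ as (φ : X → ℤ) S (s : X) → dot (+ 0 ∷ as) (map φ (s ∷ S)) ≡ dot as (map φ S)
 dot-∷0 as φ S s = l (φ s) (dot as (map φ S)) where
  l = ring-10

 halve : ∀ {a} → PM2 a → ∀ x → ∃ λ h → a * x ≡ + 2 * h × par h ≡ par x
 halve pm+ x = x , refl , refl
 halve pm- x = - x , l x , par-neg x where
  l = ring-11

 half-cons : ∀ {a} → PM2 a → ∀ x (y : ℤ) b → (∃ λ h → y ≡ + 2 * h × par h ≡ b) → ∃ λ h → a * x + y ≡ + 2 * h × par h ≡ (par x xor b)
 half-cons pa x y b (h , e , p) with halve pa x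
 ... | g , e' , p' = g + h , trans (cong₂ _+_ e' e) (l g h) , trans (par-+ g h) (cong₂ _xor_ p' p) where
  l = ring-12

 part-new : ∀ {a as} (s : X) {S} → PM2 a → AllZero as → Part (a ∷ as) (s ∷ S)
 part-new {a} {as} s {S} p z = record { Is = [] ; Zs = S ; a2 = p ; perm = ↭-refl
  ; only = λ φ _ → trans (cong (λ t → a * φ s + t) (dot-0 z (map φ S))) (ℤP.+-identityʳ _)
  ; half = λ φ h → half-cons p (φ s) (dot as (map φ S)) _ (+ 0 , dot-0 z (map φ S) , sym (xsum-0 (λ x → par (φ x)) S (All.map (cong par) h))) }

 part-more : ∀ {a as} (s : X) {S} → PM2 a → Part as S → Part (a ∷ as) (s ∷ S)
 part-more {a} {as} s {S} p P = record { Is = P.s ∷ Is ; Zs = Zs ; a2 = p ; perm = ↭-prep s perm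
   ; only = λ { φ (h0 ∷ h) → trans (cong (λ t → a * φ s + t) (trans (only φ h) (trans (cong (P.a *_) h0) (*-zeroʳ P.a)))) (ℤP.+-identityʳ _) }
   ; half = λ φ h → half-cons p (φ s) (dot as (map φ S)) _ (half φ h) } where
  module P = Part P
  open Part P using (Is; Zs; perm; only; half)

 part-skip : ∀ {as} (s : X) {S} → Part as S → Part (+ 0 ∷ as) (s ∷ S)
 part-skip {as} s {S} P = record { Is = Is ; Zs = s ∷ Zs ; a2 = a2
   ; perm = ↭-trans (↭-prep s perm) (↭-sym (PermP.shift s (P.s ∷ Is) Zs))
   ; only = λ φ h → trans (dot-∷0 as φ S s) (only φ h)
   ; half = λ { φ (h0 ∷ h) → let (g , e , p) = half φ h in g , trans (dot-∷0 as φ S s) e , trans p (cong (_xor xsum (λ x → par (φ x)) S) (sym (cong par h0))) } } where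
  module P = Part P
  open Part P using (Is; Zs; a2; perm; only; half)

 part : ∀ {as} (S : List X) → All Ev as → length as ≡ length S → AllZero as ⊎ Part as S
 part [] [] _ = inl []
 part (s ∷ S) (e ∷ es) len = go e (part S es (suc-injective len)) where
  go : ∀ {a as} → Ev a → AllZero as ⊎ Part as S → AllZero (a ∷ as) ⊎ Part (a ∷ as) (s ∷ S)
  go ev0 (inl z) = inl (refl ∷ z)
  go ev+ (inl z) = inr (part-new s pm+ z)
  go ev- (inl z) = inr (part-new s pm- z)
  go ev0 (inr P) = inr (part-skip s P)
  go ev+ (inr P) = inr (part-more s pm+ P)
  go ev- (inr P) = inr (part-more s pm- P)

data PM1 : ℤ → Set where
 o+ : PM1 (+ 1)
 o- : PM1 (- + 1)

odd-small : ∀ {a} → par a ≡ true → ∣ a ∣ ≤ 2 → PM1 a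
odd-small {a} p b = go (small a b) p where
 go : ∀ {a} → Small a → par a ≡ true → PM1 a
 go sp1 _ = o+
 go sm1 _ = o-
 go sz0 ()
 go sp2 ()
 go sm2 ()

false≢ : ∀ {a} → a ≢ true → a ≡ false
false≢ {true} h = ⊥-elim (h refl)
false≢ {false} _ = refl

∈-≡ : ∀ {X : Set} l {s : X} {r s'} → s' ∈ l ++ s ∷ r → s' ≡ s ⊎ s' ∈ l ++ r
∈-≡ l m with ∈-++⁻ l m
... | inl a = inr (∈-++⁺ˡ a)
... | inr (here refl) = inl refl
... | inr (there a) = inr (∈-++⁺ʳ l a)

sum-diff : ∀ {a b x y} → x ≡ y → a - b ≡ x - y → a ≡ b
sum-diff {a} {b} {x} refl h = i-j≡0⇒i≡j a b (trans h (+-inverseʳ x))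

-- The contracted vector and 2 + N surplus points use up the increment 3 + N exactly.
fit : ∀ N {L r x} → L ≤ 1 ℕ.+ (r ℕ.+ x) → r ≤ f1 N → x ≤ 2 ℕ.+ N → L ≤ f1 (suc N)
fit N h hr hx = ≤-trans h (≤-trans (s≤s (+-mono-≤ hr hx)) (≤-reflexive (trans (sym (+-suc (f1 N) (2 ℕ.+ N))) (sym (f1-suc N)))))

-- One more surplus point is affordable if the contraction misses its own bound by one.
fit' : ∀ N {L r x} → L ≤ 1 ℕ.+ (r ℕ.+ x) → suc r ≤ f1 N → x ≤ 3 ℕ.+ N → L ≤ f1 (suc N)
fit' N h hr hx = ≤-trans h (≤-trans (+-mono-≤ hr hx) (≤-reflexive (sym (f1-suc N))))

-- A signed unit vector in doubled coordinates: exactly one entry ±2, the others 0.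
data Axis : List ℤ → Set where
 hereA  : ∀ {a as} → PM2 a → AllZero as → Axis (a ∷ as)
 thereA : ∀ {as} → Axis as → Axis (+ 0 ∷ as)

zeros : ∀ {X : Set} (S : List X) → ∃ λ as → AllZero as × length as ≡ length S
zeros [] = [] , [] , refl
zeros (_ ∷ S) = let (as , z , l) = zeros S in + 0 ∷ as , refl ∷ z , cong suc l

axis-at : ∀ {X : Set} {s : X} {S a} → PM2 a → s ∈ S → ∃ λ as → Axis as × length as ≡ length S × (∀ φ → dot as (map φ S) ≡ a * φ s)
axis-at {X} {S = s ∷ S} {a} pa (here refl) = let (as , z , l) = zeros S in a ∷ as , hereA pa z , cong suc l , λ φ → trans (cong (λ t → a * φ s + t) (dot-0 {X} z (map φ S))) (ℤP.+-identityʳ _)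
axis-at {S = s ∷ S} {a} pa (there m) = let (as , x , l , h) = axis-at pa m in + 0 ∷ as , thereA x , cong suc l , λ φ → trans (dot-∷0 as φ S s) (h φ)

PM1-≢ : ∀ {a} → PM1 a → 0≢ a
PM1-≢ o+ ()
PM1-≢ o- ()

PM1-* : ∀ {a b} → PM1 a → PM1 b → PM1 (a * b)
PM1-* o+ o+ = o+
PM1-* o+ o- = o-
PM1-* o- o+ = o-
PM1-* o- o- = o+

PM1-sq : ∀ {a} → PM1 a → a * a ≡ + 1
PM1-sq o+ = refl
PM1-sq o- = refl

signs₂ : List ℤ
signs₂ = + 1 ∷ - + 1 ∷ []

PM1-∈ : ∀ {a} → PM1 a → a ∈ signs₂
PM1-∈ o+ = here refl
PM1-∈ o- = there (here refl)

PM1-pigeon : ∀ {a b c} → PM1 a → PM1 b → PM1 c → a ≡ b ⊎ a ≡ c ⊎ b ≡ c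
PM1-pigeon o+ o+ _ = inl refl
PM1-pigeon o- o- _ = inl refl
PM1-pigeon o+ o- o+ = inr (inl refl)
PM1-pigeon o+ o- o- = inr (inr refl)
PM1-pigeon o- o+ o- = inr (inl refl)
PM1-pigeon o- o+ o+ = inr (inr refl)

-- ratios of signs
PM1-ratio : ∀ {b c b' c'} → PM1 b → PM1 c → PM1 b' → PM1 c' → b * c' ≡ c * b' → b * c ≡ b' * c'
PM1-ratio o+ o+ o+ o+ _ = refl
PM1-ratio o+ o+ o- o- _ = refl
PM1-ratio o- o- o+ o+ _ = refl
PM1-ratio o- o- o- o- _ = refl
PM1-ratio o+ o- o+ o- _ = refl
PM1-ratio o+ o- o- o+ _ = refl
PM1-ratio o- o+ o+ o- _ = refl
PM1-ratio o- o+ o- o+ _ = refl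
PM1-ratio o+ o+ o+ o- ()
PM1-ratio o+ o+ o- o+ ()
PM1-ratio o- o- o+ o- ()
PM1-ratio o- o- o- o+ ()
PM1-ratio o+ o- o+ o+ ()
PM1-ratio o+ o- o- o- ()
PM1-ratio o- o+ o+ o+ ()
PM1-ratio o- o+ o- o- ()

data TwoL : List ℤ → Set where
 hereT  : ∀ {a as} → PM2 a → Axis as → TwoL (a ∷ as)
 thereT : ∀ {as} → TwoL as → TwoL (+ 0 ∷ as)

-- While `Axis` and `TwoL` fix the number of nonzero entries, this means at least three.
data ThreeL : List ℤ → Set where
 hereM : ∀ {a as} → PM2 a → TwoL as → ThreeL (a ∷ as)
 moreM : ∀ {a as} → Ev a → ThreeL as → ThreeL (a ∷ as)

data Count (as : List ℤ) : Set where
 cnt0 : AllZero as → Count as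
 cnt1  : Axis as → Count as
 cnt2  : TwoL as → Count as
 cnt3 : ThreeL as → Count as

tally : ∀ {as} → All Ev as → Count as
tally [] = cnt0 []
tally (e ∷ es) = go e (tally es) where
 pos : ∀ {a as} → PM2 a → Ev a → Count as → Count (a ∷ as)
 pos p _ (cnt0 z) = cnt1 (hereA p z)
 pos p _ (cnt1 x) = cnt2 (hereT p x)
 pos p _ (cnt2 t) = cnt3 (hereM p t)
 pos p e (cnt3 t) = cnt3 (moreM e t)
 go : ∀ {a as} → Ev a → Count as → Count (a ∷ as)
 go ev+ c = pos pm+ ev+ c
 go ev- c = pos pm- ev- c
 go ev0 (cnt0 z) = cnt0 (refl ∷ z)
 go ev0 (cnt1 x) = cnt1 (thereA x)
 go ev0 (cnt2 t) = cnt2 (thereT t)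
 go ev0 (cnt3 t) = cnt3 (moreM ev0 t)

axis-swap : ∀ {a b as} → Axis (a ∷ b ∷ as) → Axis (b ∷ a ∷ as)
axis-swap (hereA p (refl ∷ z)) = thereA (hereA p z)
axis-swap (thereA (hereA p z)) = hereA p (refl ∷ z)
axis-swap (thereA (thereA x)) = thereA (thereA x)

twoL-swap : ∀ {a b as} → TwoL (a ∷ b ∷ as) → TwoL (b ∷ a ∷ as)
twoL-swap (hereT p (hereA q z)) = hereT q (hereA p z)
twoL-swap (hereT p (thereA x)) = thereT (hereT p x)
twoL-swap (thereT (hereT q x)) = hereT q (thereA x)
twoL-swap (thereT (thereT t)) = thereT (thereT t)

twoL-swap₂ : ∀ {a b c as} → TwoL (a ∷ b ∷ c ∷ as) → TwoL (a ∷ c ∷ b ∷ as)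
twoL-swap₂ (hereT p x) = hereT p (axis-swap x)
twoL-swap₂ (thereT t) = thereT (twoL-swap t)

module _ {X : Set} where

 part-axis : ∀ {as} → Axis as → (S : List X) → length as ≡ length S → Part as S
 part-axis (hereA p z) (s ∷ S) _ = part-new s p z
 part-axis (thereA x) (s ∷ S) l = part-skip s (part-axis x S (suc-injective l))

 part-two : ∀ {as} → TwoL as → (S : List X) → length as ≡ length S → Σ (Part as S) λ P → 1 ≤ length (Part.Is P)
 part-two (hereT p x) (s ∷ S) l = part-more s p (part-axis x S (suc-injective l)) , s≤s z≤n
 part-two (thereT t) (s ∷ S) l = let (P , h) = part-two t S (suc-injective l) in part-skip s P , h

 part-three : ∀ {as} → ThreeL as → (S : List X) → length as ≡ length S → Σ (Part as S) λ P → 2 ≤ length (Part.Is P)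
 part-three (hereM p t) (s ∷ S) l = let (P , h) = part-two t S (suc-injective l) in part-more s p P , s≤s h
 part-three (moreM e t) (s ∷ S) l = go e (part-three t S (suc-injective l)) where
  go : ∀ {a as} → Ev a → (Σ (Part as S) λ P → 2 ≤ length (Part.Is P)) → Σ (Part (a ∷ as) (s ∷ S)) λ P → 2 ≤ length (Part.Is P)
  go ev0 (P , h) = part-skip s P , h
  go ev+ (P , h) = part-more s pm+ P , m≤n⇒m≤1+n h
  go ev- (P , h) = part-more s pm- P , m≤n⇒m≤1+n h

univ₄ : List (ℤ × ℤ)
univ₄ = (+ 1 , + 1) ∷ (+ 1 , - + 1) ∷ (- + 1 , + 1) ∷ (- + 1 , - + 1) ∷ []

univ₄-∈ : ∀ {a b} → PM1 a → PM1 b → (a , b) ∈ univ₄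
univ₄-∈ o+ o+ = here refl
univ₄-∈ o+ o- = there (here refl)
univ₄-∈ o- o+ = there (there (here refl))
univ₄-∈ o- o- = there (there (there (here refl)))

∃⊎∀ : ∀ {X G : Set} (xs : List X) {Q : ∀ {x} → x ∈ xs → Set} → (∀ {x} (m : x ∈ xs) → G ⊎ Q m) → G ⊎ (∀ {x} (m : x ∈ xs) → Q m)
∃⊎∀ [] f = inr (λ ())
∃⊎∀ (x ∷ xs) {Q} f with f (here refl) | ∃⊎∀ xs {λ m → Q (there m)} (λ m → f (there m))
... | inl g | _ = inl g
... | _ | inl g = inl g
... | inr q | inr qs = inr (λ { (here refl) → q ; (there m) → qs m })

neg-0 : ∀ x → - x ≡ + 0 → x ≡ + 0
neg-0 x h = trans (sym (neg-involutive x)) (cong -_ h)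

odd-abs : ∀ {x} → par x ≡ true → ∣ x ∣ ≤ 2 → ∣ x ∣ ≡ 1
odd-abs {x} p b = go (odd-small {x} p b) where
 go : ∀ {x} → PM1 x → ∣ x ∣ ≡ 1
 go o+ = refl
 go o- = refl

abs1 : ∀ {x} → ∣ x ∣ ≡ 1 → PM1 x
abs1 {+ .1} refl = o+
abs1 { -[1+ .0 ]} refl = o-

odd-double : ∀ m → odd (2 ℕ.* m) ≡ false
odd-double m = odd-* 2 m

PM1-scale : ∀ {d a b} → PM1 d → d * a ≡ b → a ≡ d * b
PM1-scale {a = a} o+ refl = l a where
 l = ring-13
PM1-scale {a = a} o- refl = l a where
 l = ring-14

-- If both absolute values were at most 1, twice the difference would be at most 4.
sum-two : ∀ {a b R} → ∣ a ∣ ≤ 2 → ∣ b ∣ ≤ 2 → + 2 * (a - b) ≡ + R → 6 ≤ R → ∣ a ∣ ≡ 2 ⊎ ∣ b ∣ ≡ 2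
sum-two {a} {b} {R} ha hb h le = go (∣ a ∣ ℕ.≟ 2) (∣ b ∣ ℕ.≟ 2) where
 tot : 6 ≤ 2 ℕ.* (∣ a ∣ ℕ.+ ∣ b ∣)
 tot = ≤-trans le (≤-trans (≤-reflexive (trans (cong ∣_∣ (sym h)) (∣i*j∣≡∣i∣*∣j∣ (+ 2) (a - b)))) (*-monoʳ-≤ 2 (∣i-j∣≤∣i∣+∣j∣ a b)))
 go : Dec (∣ a ∣ ≡ 2) → Dec (∣ b ∣ ≡ 2) → ∣ a ∣ ≡ 2 ⊎ ∣ b ∣ ≡ 2
 go (yes p) _ = inl p
 go _ (yes p) = inr p
 go (no p) (no q) = ⊥-elim (≤⇒≤ᵇ (≤-trans tot (*-monoʳ-≤ 2 (+-mono-≤ (ℕ.s≤s⁻¹ (≤∧≢⇒< ha p)) (ℕ.s≤s⁻¹ (≤∧≢⇒< hb q))))))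

no-split : ∀ {X : Set} l {v : X} {r} → [] ≢ l ++ v ∷ r
no-split [] ()
no-split (_ ∷ _) ()

-- A crude count and the decreasing surplus

box : List ℤ
box = + 0 ∷ nonzeros

boxes : ℕ → List (List ℤ)
boxes zero = [] ∷ []
boxes (suc n) = concatMap (λ a → map (a ∷_) (boxes n)) box

box-∈ : ∀ {a} → ∣ a ∣ ≤ 2 → a ∈ box
box-∈ {a} b = go (small a b) where
 go : ∀ {a} → Small a → a ∈ box
 go sz0 = here refl
 go sp1 = there (here refl)
 go sp2 = there (there (here refl))
 go sm1 = there (there (there (here refl)))
 go sm2 = there (there (there (there (here refl))))

boxes-∈ : ∀ {as} → All (λ a → ∣ a ∣ ≤ 2) as → as ∈ boxes (length as)
boxes-∈ [] = here refl
boxes-∈ {a ∷ as} (b ∷ bs) = ∈-concat⁺′ (∈-map⁺ (a ∷_) (boxes-∈ bs)) (∈-map⁺ (λ a → map (a ∷_) (boxes (length as))) (box-∈ b))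

-- The bound grows by 8 + j, whereas the contraction costs at most 7 + j rows, including the
-- contracted vector. So the surplus `K ∸ j` falls by one, and truncated subtraction keeps it at 0
-- afterwards.
surplus : ∀ K j {L r f} → L ≤ 1 ℕ.+ (r ℕ.+ (6 ℕ.+ j)) → r ≤ f ℕ.+ (K ∸ j) → L ≤ f ℕ.+ (8 ℕ.+ j) ℕ.+ (K ∸ suc j)
surplus K j {L} {r} {f} h hr = ≤-trans h (≤-trans (s≤s (+-monoˡ-≤ (6 ℕ.+ j) hr)) (≤-trans (≤-reflexive (l f (K ∸ j) j))
  (≤-trans (+-monoʳ-≤ (f ℕ.+ (7 ℕ.+ j)) (drop-one K j)) (≤-reflexive (l2 f j (K ∸ suc j)))))) where
 open +-*-Solver
 l : ∀ f k j → 1 ℕ.+ (f ℕ.+ k ℕ.+ (6 ℕ.+ j)) ≡ f ℕ.+ (7 ℕ.+ j) ℕ.+ k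
 l = solve 3 (λ f k j → con 1 :+ (f :+ k :+ (con 6 :+ j)) := f :+ (con 7 :+ j) :+ k) refl
 l2 : ∀ f j k → f ℕ.+ (7 ℕ.+ j) ℕ.+ suc k ≡ f ℕ.+ (8 ℕ.+ j) ℕ.+ k
 l2 = solve 3 (λ f j k → f :+ (con 7 :+ j) :+ (con 1 :+ k) := f :+ (con 8 :+ j) :+ k) refl
 drop-one : ∀ K j → K ∸ j ≤ suc (K ∸ suc j)
 drop-one zero zero = z≤n
 drop-one zero (suc j) = z≤n
 drop-one (suc K) zero = ≤-refl
 drop-one (suc K) (suc j) = drop-one K j

-- the number 5⁶ must not be computed
abstract
 K₀ : ℕ
 K₀ = length (boxes 6)

 boxes≤K₀ : length (boxes 6) ≤ K₀
 boxes≤K₀ = ≤-refl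

data Four {X : Set} : List X → Set where
 quad : ∀ a b c d → Four (a ∷ b ∷ c ∷ d ∷ [])

view₄ : ∀ {X : Set} (xs : List X) → length xs ≡ 4 → Four xs
view₄ (a ∷ b ∷ c ∷ d ∷ []) _ = quad a b c d

-- Configurations: bounded alternating functions with Plücker relations

module Theory (Sp : Space) where

 open Space Sp public

 Ms : List V → Set
 Ms = All (_∈ A)

 neg : V → V
 neg v = lc (- + 1) v (+ 0) v

 -- An integral chirotope. Vectors are seen only through `D`: contraction inserts a fixed entry, and
 -- equality of vectors becomes equality of the functionals sending `z` to `D (x ∷ z)`. `D` takes
 -- lists of every length, and `rank` makes it vanish outside length `n`.
 record Config (n : ℕ) : Set where
  field
   D    : List V → ℤ
   lin  : ∀ us a u b v zs → D (us ++ lc a u b v ∷ zs) ≡ a * D (us ++ u ∷ zs) + b * D (us ++ v ∷ zs)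
   alt  : ∀ us u v zs → D (us ++ u ∷ v ∷ zs) ≡ - D (us ++ v ∷ u ∷ zs)
   -- Informative if `b` has n + 1 and `z` has n - 1 entries; on other lists every term vanishes.
   gp   : ∀ z b → W (λ x → D (x ∷ z)) D b ≡ + 0
   rank : ∀ xs → 0≢ (D xs) → length xs ≡ n
   bdd  : ∀ {z} → Ms z → ∣ D z ∣ ≤ 2

 module _ {n} (C : Config n) where
  open Config C

  perm-abs : ∀ {xs ys} → xs ↭ ys → ∣ D xs ∣ ≡ ∣ D ys ∣
  perm-abs {ys = ys} p with perm± D alt p
  ... | inl e = cong ∣_∣ e
  ... | inr e = trans (cong ∣_∣ e) (∣-i∣≡∣i∣ (D ys))

  perm-par : ∀ {xs ys} → xs ↭ ys → par (D xs) ≡ par (D ys)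
  perm-par p = cong odd (perm-abs p)

  perm-0 : ∀ {xs ys} → xs ↭ ys → D xs ≡ + 0 → D ys ≡ + 0
  perm-0 p e = ∣i∣≡0⇒i≡0 (trans (sym (perm-abs p)) (cong ∣_∣ e))

  perm-≢ : ∀ {xs ys} → xs ↭ ys → 0≢ (D xs) → 0≢ (D ys)
  perm-≢ p ne e = ne (perm-0 (↭-sym p) e)

  D-twice : ∀ x z → D (x ∷ x ∷ z) ≡ + 0
  D-twice x z = x≡-x⇒0 _ (alt [] x x z)

  D-mem : ∀ {x us} → x ∈ us → D (x ∷ us) ≡ + 0
  D-mem {x} p with ∈-split p
  ... | l , r , refl = perm-0 (↭-prep x (↭-sym (PermP.shift x l r))) (D-twice x _)

  D-neg : ∀ v z → D (neg v ∷ z) ≡ - D (v ∷ z)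
  D-neg v z = trans (lin [] (- + 1) v (+ 0) v z) (lem (D (v ∷ z))) where
   lem = ring-15

  -- The Plücker relation for the list `v ∷ b`, with the term that deletes `v` on the other side.
  cramer : ∀ v z b → D (v ∷ z) * D b ≡ W (λ x → D (x ∷ z)) (λ ys → D (v ∷ ys)) b
  cramer v z b = lem _ _ (gp z (v ∷ b)) where
   lem : ∀ a b → a - b ≡ + 0 → a ≡ b
   lem a b e = i-j≡0⇒i≡j a b e

  Lin : ℤ → V → List ℤ → List V → Set
  Lin m v cs S = ∀ z → m * D (v ∷ z) ≡ dot cs (map (λ x → D (x ∷ z)) S)

  -- Linear independence of `us`, witnessed by a completion within `A` to a nonzero minor.
  NzL : List V → Set
  NzL us = ∃ λ z → Ms z × 0≢ (D (us ++ z))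

  Nz : V → Set
  Nz x = NzL (x ∷ [])

  Ind2 : V → V → Set
  Ind2 x y = NzL (x ∷ y ∷ [])

  Even : Set
  Even = ∀ {z} → Ms z → par (D z) ≡ false

  Ind2-sym : ∀ {x y} → Ind2 x y → Ind2 y x
  Ind2-sym {x} {y} (z , mz , ne) = z , mz , perm-≢ (↭-swap x y ↭-refl) ne

  ¬NzL : ∀ {us} → ¬ NzL us → ∀ {z} → Ms z → D (us ++ z) ≡ + 0
  ¬NzL {us} h {z} mz with D (us ++ z) ℤ.≟ + 0
  ... | yes e = e
  ... | no ne = ⊥-elim (h (z , mz , ne))

 open Config public

 infixl 20 _⟋_
 -- Contraction in the sense of matroids: a leading entry `e` divides out its span. The bound 2 is
 -- inherited because `e` belongs to `A`.
 _⟋_ : ∀ {n} → Config (suc n) → ∀ {e} → e ∈ A → Config n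
 _⟋_ C {e} m = record
  { D = λ z → D C (e ∷ z)
  ; lin = λ us → lin C (e ∷ us)
  ; alt = λ us → alt C (e ∷ us)
  ; gp = gp'
  ; rank = λ xs ne → suc-injective (rank C (e ∷ xs) ne)
  ; bdd = λ mz → bdd C (m ∷ mz)
  } where
  -- The relation for `e ∷ z` and `e ∷ b`; the term that deletes `e` contains `e` twice and
  -- vanishes.
  gp' : ∀ z b → W (λ x → D C (e ∷ x ∷ z)) (λ ys → D C (e ∷ ys)) b ≡ + 0
  gp' z b = begin
   W (λ x → D C (e ∷ x ∷ z)) G b
    ≡⟨ W-cong (λ x → trans (alt C [] e x z) (l1 (D C (x ∷ e ∷ z)))) (λ _ → refl) b ⟩
   W (λ x → - + 1 * D C (x ∷ e ∷ z) + + 0 * D C (x ∷ e ∷ z)) G b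
    ≡⟨ W-linˡ (- + 1) φ (+ 0) φ G b ⟩
   - + 1 * W φ G b + + 0 * W φ G b ≡⟨ l2 _ ⟩
   - W φ G b ≡⟨ l3 (D C b) (W φ G b) ⟩
   + 0 * D C b - W φ G b ≡⟨ cong (λ t → t * D C b - W φ G b) (sym (D-twice C e z)) ⟩
   W φ (D C) (e ∷ b) ≡⟨ gp C (e ∷ z) (e ∷ b) ⟩
   + 0 ∎ where
   open ≡-Reasoning
   G : List V → ℤ
   G ys = D C (e ∷ ys)
   φ : V → ℤ
   φ x = D C (x ∷ e ∷ z)
   l1 = ring-16
   l2 = ring-15
   l3 = ring-17

 -- finite search
 tuples : ℕ → List (List V)
 tuples zero = [] ∷ []
 tuples (suc n) = concatMap (λ v → map (v ∷_) (tuples n)) A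

 tuples-∈ : ∀ {z} → Ms z → z ∈ tuples (length z)
 tuples-∈ [] = here refl
 tuples-∈ {v ∷ z} (m ∷ ms) = ∈-concat⁺′ (∈-map⁺ (v ∷_) (tuples-∈ ms)) (∈-map⁺ (λ v → map (v ∷_) (tuples (length z))) m)

 tuples-Ms : ∀ n {z} → z ∈ tuples n → Ms z
 tuples-Ms zero (here refl) = []
 tuples-Ms (suc n) p with ∈-concat⁻′ (map (λ v → map (v ∷_) (tuples n)) A) p
 ... | xs , q , r with ∈-map⁻ (λ v → map (v ∷_) (tuples n)) r
 ...   | v , mv , refl with ∈-map⁻ (v ∷_) q
 ...     | z' , mz , refl = mv ∷ tuples-Ms n mz

 module _ {n} (C : Config n) where

  -- `D` vanishes on lists of the wrong length and `P` fails at 0, so only the finitely many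
  -- completions of length `n ∸ length us` matter.
  search : (P : ℤ → Set) → (∀ x → Dec (P x)) → ¬ P (+ 0) → ∀ us → Dec (∃ λ z → Ms z × P (D C (us ++ z)))
  search P P? ¬P0 us with Any.any? (λ z → P? (D C (us ++ z))) (tuples (n ∸ length us))
  ... | yes a = let z , m , p = satisfied' a in yes (z , tuples-Ms (n ∸ length us) m , p) where
   satisfied' : ∀ {xs} → Any (λ z → P (D C (us ++ z))) xs → ∃ λ z → z ∈ xs × P (D C (us ++ z))
   satisfied' (here p) = _ , here refl , p
   satisfied' (there a) = let z , m , p = satisfied' a in z , there m , p
  ... | no na = no λ { (z , mz , p) → na (lose' (mem z mz p) p) } where
   lose' : ∀ {z xs} → z ∈ xs → P (D C (us ++ z)) → Any (λ z → P (D C (us ++ z))) xs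
   lose' (here refl) p = here p
   lose' (there m) p = there (lose' m p)
   mem : ∀ z → Ms z → P (D C (us ++ z)) → z ∈ tuples (n ∸ length us)
   mem z mz p = subst (λ k → z ∈ tuples k) len (tuples-∈ mz) where
    ne : 0≢ (D C (us ++ z))
    ne e = ¬P0 (subst P e p)
    len : length z ≡ n ∸ length us
    len = sym (trans (cong (_∸ length us) (trans (sym (rank C _ ne)) (length-++ us))) (m+n∸m≡n (length us) (length z)))

  NzL? : ∀ us → Dec (NzL C us)
  NzL? = search 0≢ (λ x → dec¬ (x ℤ.≟ + 0)) (λ h → h refl) where
   dec¬ : ∀ {P : Set} → Dec P → Dec (¬ P)
   dec¬ (yes p) = no (λ h → h p)
   dec¬ (no p) = yes p

  Odd? : ∀ us → Dec (∃ λ z → Ms z × par (D C (us ++ z)) ≡ true)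
  Odd? = search (λ x → par x ≡ true) (λ x → par x Data.Bool.≟ true) (λ ())

 -- v lies in the span of S modulo the radical
 coefs : (List V → ℤ) → List V → List V → List ℤ
 coefs G [] r = []
 coefs G (e ∷ S) r = G (S ++ r) ∷ map -_ (coefs (λ ys → G (e ∷ ys)) S r)

 -- The deletions within `r` sum to 0 by assumption; the deletions within `S` form a linear
 -- combination of values of `φ`.
 W-app : ∀ φ G S r → W φ (λ ys → G (S ++ ys)) r ≡ + 0 → W φ G (S ++ r) ≡ dot (coefs G S r) (map φ S)
 W-app φ G [] r e = e
 W-app φ G (s ∷ S) r e = trans (cong (λ t → φ s * G (S ++ r) - t) (W-app φ (λ ys → G (s ∷ ys)) S r e))
  (trans (lem (φ s) (G (S ++ r)) (dot (coefs (λ ys → G (s ∷ ys)) S r) (map φ S)))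
   (cong (λ t → G (S ++ r) * φ s + t) (sym (dot-neg (coefs (λ ys → G (s ∷ ys)) S r) (map φ S))))) where
  lem = ring-18

 -- Cramer's rule for the list `S ++ w`: the coefficients at entries of `w` are minors containing
 -- `v` and all of `S`, which vanish by dependence.
 spanned : ∀ {n} (C : Config n) v S w → Ms w → (∀ {z} → Ms z → D C (v ∷ S ++ z) ≡ + 0) →
      Lin C (D C (S ++ w)) v (coefs (λ ys → D C (v ∷ ys)) S w) S
 spanned C v S w mw h z = trans (*-comm (D C (S ++ w)) (D C (v ∷ z)))
  (trans (cramer C v z (S ++ w)) (W-app φ (λ ys → D C (v ∷ ys)) S w (W-vanish φ _ w v0))) where
  φ : V → ℤ
  φ x = D C (x ∷ z)
  v0 : ∀ l x r → w ≡ l ++ x ∷ r → φ x * D C (v ∷ S ++ (l ++ r)) ≡ + 0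
  v0 l x r refl = trans (cong (φ x *_) (h (All-mid l mw))) (*-zeroʳ (φ x))

 -- Bases and triangles

 module _ {n} (C : Config n) where

  Basis : List V → Set
  Basis ys = ∃ λ b → Ms b × 0≢ (D C b) × All (_∈ b) ys

  -- Three vectors that become pairwise independent in a plane when `w` is contracted.
  Tri : V → V → V → Set
  Tri y p q = ∃ λ w → Ms w × 0≢ (D C (p ∷ q ∷ w)) × 0≢ (D C (y ∷ q ∷ w)) × 0≢ (D C (y ∷ p ∷ w))

  Triple : V → List V → Set
  Triple y ys = ∃₂ λ p q → p ∈ ys × q ∈ ys × Tri y p q

  -- Exchange `y` into a basis containing `ys`. If the vector `p` that leaves belongs to `ys`, keep
  -- it and exchange `y` for another vector `q`. If `q` belongs to `ys` as well, the three bases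
  -- differ in p, q, y only and show a triangle.
  step : ∀ {y ys} → y ∈ A → Basis ys → Nz C y → All (Ind2 C y) ys → Basis (y ∷ ys) ⊎ Triple y ys
  step {y} {ys} my (b , mb , db , sub) (z , mz , dz) ind
   with W-find (λ x → D C (x ∷ z)) (λ us → D C (y ∷ us)) b (λ e → *≢0 dz db (trans (cramer C y z b) e))
  ... | l , p , r , refl , _ , dy with keep l p r sub
  ...   | inr sub' = inl (y ∷ l ++ r , my ∷ All-mid l mb , dy , here refl ∷ All.map there sub')
  ...   | inl p∈ with All-∈ ind p∈
  ...     | z' , mz' , dz' with W-find (λ x → D C (x ∷ p ∷ z')) (λ us → D C (y ∷ p ∷ us)) (l ++ r) nz where
   db1 : 0≢ (D C (p ∷ l ++ r))
   db1 = perm-≢ C (PermP.shift p l r) db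
   nz : 0≢ (W (λ x → D C (x ∷ p ∷ z')) (λ us → D C (y ∷ p ∷ us)) (l ++ r))
   nz e = *≢0 dz' db1 (trans (cramer C y (p ∷ z') (p ∷ l ++ r))
    (cong₂ _-_ (trans (cong (_* D C (y ∷ l ++ r)) (D-twice C p z')) refl) e))
  ...       | l2 , q , r2 , eq , _ , dyp = go (keep (p ∷ l2) q r2 sub2) where
   mlr : Ms (l ++ r)
   mlr = All-mid l mb
   mlr2 : Ms (l2 ++ q ∷ r2)
   mlr2 = subst Ms eq mlr
   mp : p ∈ A
   mp = All-∈ mb (∈-mid l p r)
   sub2 : All (_∈ ((p ∷ l2) ++ q ∷ r2)) ys
   sub2 = All.map (λ m → subst (λ t → _ ∈ p ∷ t) eq (∈-resp-↭ (PermP.shift p l r) m)) sub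
   sh : l ++ r ↭ q ∷ l2 ++ r2
   sh = subst (_↭ q ∷ l2 ++ r2) (sym eq) (PermP.shift q l2 r2)
   go : q ∈ ys ⊎ All (_∈ (p ∷ l2 ++ r2)) ys → Basis (y ∷ ys) ⊎ Triple y ys
   go (inr s) = inl (y ∷ p ∷ l2 ++ r2 , my ∷ mp ∷ All-mid l2 mlr2 , dyp , here refl ∷ All.map there s)
   go (inl q∈) = inr (p , q , p∈ , q∈ , l2 ++ r2 , All-mid l2 mlr2 ,
    perm-≢ C (↭-trans (PermP.shift p l r) (↭-prep p sh)) db , perm-≢ C (↭-prep y sh) dy , dyp)

  Ind2-≢ : ∀ {x y} → Ind2 C x y → x ≢ y
  Ind2-≢ (z , _ , ne) refl = ne (D-twice C _ z)

  basis-length : ∀ {ys} → AllPairs (Ind2 C) ys → Basis ys → length ys ≤ n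
  basis-length ap (b , _ , db , sub) = ≤-trans (distinct-length (AllPairs.map Ind2-≢ ap) sub) (≤-reflexive (rank C b db))

  -- Pairwise independence without triangles is already independence, one vector at a time. The
  -- vector `x` supplies the basis with which the induction starts.
  basis : ∀ {x} ys → x ∈ A → Nz C x → Ms ys → All (Nz C) ys → AllPairs (Ind2 C) ys →
      (∀ {y p q} → y ∈ ys → p ∈ ys → q ∈ ys → ¬ Tri y p q) → Basis ys
  basis [] mx (z , mz , ne) _ _ _ _ = _ ∷ z , mx ∷ mz , ne , []
  basis (y ∷ ys) mx nx (my ∷ ms) (ny ∷ nz) (a ∷ ap) nt
   with step my (basis ys mx nx ms nz ap (λ a b c → nt (there a) (there b) (there c))) ny a
  ... | inl b = b
  ... | inr (p , q , p∈ , q∈ , t) = ⊥-elim (nt (here refl) (there p∈) (there q∈) t)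

  independent : ∀ ys → Ms ys → All (Nz C) ys → AllPairs (Ind2 C) ys →
         (∀ {y p q} → y ∈ ys → p ∈ ys → q ∈ ys → ¬ Tri y p q) → length ys ≤ n
  independent [] _ _ _ _ = z≤n
  independent (y ∷ ys) ms@(m ∷ _) nz@(ny ∷ _) ap nt = basis-length ap (basis (y ∷ ys) m ny ms nz ap nt)

  -- a basis of the right size: everything else is parallel to a member or forms a triple with two members
  spanning : ∀ {y ys} → y ∈ A → Nz C y → Ms ys → All (Nz C) ys → AllPairs (Ind2 C) ys →
        (∀ {y p q} → y ∈ ys → p ∈ ys → q ∈ ys → ¬ Tri y p q) → n ≤ length ys → All (Ind2 C y) ys → Triple y ys
  spanning {y} {ys} my ny ms nz ap nt len ind with step my (basis ys my ny ms nz ap nt) ny ind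
  ... | inr t = t
  ... | inl b = ⊥-elim (<-irrefl refl (≤-trans (basis-length (ind ∷ ap) b) len))

  Ind2? : ∀ x y → Dec (Ind2 C x y)
  Ind2? x y = NzL? C (x ∷ y ∷ [])

  Nz? : ∀ x → Dec (Nz C x)
  Nz? x = NzL? C (x ∷ [])

  record Simple (xs : List V) : Set where
   constructor simple
   field
    mem : Ms xs
    nz  : All (Nz C) xs
    ap  : AllPairs (Ind2 C) xs

  open Simple public

  simple-resp : ∀ {xs ys} → xs ↭ ys → Simple xs → Simple ys
  simple-resp p s = simple (All-resp-↭ p (mem s)) (All-resp-↭ p (nz s)) (AP-resp (Ind2-sym C) p (ap s))

  simple-++ : ∀ xs {ys} → Simple (xs ++ ys) → Simple xs × Simple ys
  simple-++ xs s with AllP.++⁻ xs (mem s) | AllP.++⁻ xs (nz s) | AP-++⁻ xs (ap s)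
  ... | a , b | c , d | e , f , _ = simple a c e , simple b d f

 -- Contraction of e

 -- Vectors that vanish when `e` is contracted are multiples of `e`. So at most one entry of a
 -- simple list disappears in a contraction.
 parallel-e : ∀ {n} (C : Config (suc n)) {e} (me : e ∈ A) → Nz C e → ∀ {x y} → ¬ Nz (C ⟋ me) x → ¬ Nz (C ⟋ me) y → ¬ Ind2 C x y
 parallel-e C {e} me (w , mw , ne) {x} {y} hx hy (z , mz , nz) = nz (cancel-≡ _ _ ne (trans (spanned C x (e ∷ []) w mw h0 (y ∷ z))
  (trans (cong (λ t → D C (x ∷ w) * t + + 0) (¬NzL (C ⟋ me) hy mz)) (lem (D C (x ∷ w)) (D C (e ∷ w)))))) where
  h0 : ∀ {z} → Ms z → D C (x ∷ e ∷ z) ≡ + 0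
  h0 mz = trans (alt C [] x e _) (cong -_ (¬NzL (C ⟋ me) hx mz))
  lem = ring-19

 -- A simple list after contracting `e`: `zs` holds the entry parallel to `e`, if any, `reps` stays
 -- simple, and the first components in `exs` are lost because they became parallel to the second
 -- ones.
 record Split {n} (C : Config (suc n)) {e} (me : e ∈ A) (xs : List V) : Set where
  field
   zs reps : List V
   exs     : List (V × V)
   perm    : xs ↭ zs ++ reps ++ map fst exs
   zs≤1    : length zs ≤ 1
   simp    : Simple C (zs ++ reps ++ map fst exs)
   simp'   : Simple (C ⟋ me) reps
   zs0     : All (λ x → ¬ Nz (C ⟋ me) x) zs
   exs-nz  : All (λ p → Nz (C ⟋ me) (fst p)) exs
   exs-par : All (λ p → snd p ∈ reps × ¬ Ind2 (C ⟋ me) (fst p) (snd p)) exs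

 length≤1 : ∀ {X : Set} {R : X → X → Set} {zs : List X} → AllPairs R zs → (∀ {x y} → x ∈ zs → y ∈ zs → ¬ R x y) → length zs ≤ 1
 length≤1 [] h = z≤n
 length≤1 ([] ∷ []) h = s≤s z≤n
 length≤1 ((r ∷ _) ∷ _ ∷ _) h = ⊥-elim (h (here refl) (there (here refl)) r)

 split : ∀ {n} (C : Config (suc n)) {e} (me : e ∈ A) → Nz C e → ∀ {xs} → Simple C xs → Split C me xs
 split C me ne {xs} s with divide (λ x → Nz? (C ⟋ me) x) xs
 ... | as , zs , p , a , z with classify (Ind2? (C ⟋ me)) as
 ...   | reps , exs , q , ap' , par' = record
  { zs = zs ; reps = reps ; exs = exs ; perm = pm
  ; zs≤1 = length≤1 (ap (fst (simple-++ C zs sm))) (λ mx my → parallel-e C me ne (All-∈ z mx) (All-∈ z my))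
  ; simp = sm
  ; simp' = simple (mem sr) (++⁻ˡ reps a') ap'
  ; zs0 = z
  ; exs-nz = AllP.map⁻ (++⁻ʳ reps a')
  ; exs-par = par'
  } where
  pm : xs ↭ zs ++ reps ++ map fst exs
  pm = ↭-trans p (↭-trans (++-comm as zs) (++⁺ˡ zs q))
  sm = simple-resp C pm s
  sr : Simple C reps
  sr = fst (simple-++ C reps (snd (simple-++ C zs sm)))
  a' : All (Nz (C ⟋ me)) (reps ++ map fst exs)
  a' = All-resp-↭ q a

 split-length : ∀ {n} {C : Config (suc n)} {e} {me : e ∈ A} {xs} (S : Split C me xs) → length xs ≤ 1 ℕ.+ (length (Split.reps S) ℕ.+ length (Split.exs S))
 split-length S = ≤-trans (≤-reflexive (trans (↭-length perm) (trans (length-++ zs)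
   (cong (length zs ℕ.+_) (trans (length-++ reps) (cong (length reps ℕ.+_) (length-map fst exs)))))))
   (+-monoˡ-≤ _ zs≤1)
  where open Split S

 module SplitFacts {n} {C : Config (suc n)} {e} {me : e ∈ A} {xs} (S : Split C me xs) where
  open Split S
  private
   sre = snd (simple-++ C zs simp)
   sr = fst (simple-++ C reps sre)
   se = snd (simple-++ C reps sre)
   cross = snd (snd (AP-++⁻ reps (ap sre)))

  ρ∈ : ∀ {p} → p ∈ exs → snd p ∈ reps
  ρ∈ m = fst (All-∈ exs-par m)
  x∈A : ∀ {p} → p ∈ exs → fst p ∈ A
  x∈A m = All-∈ (mem se) (∈-map⁺ fst m)
  ρ∈A : ∀ {p} → p ∈ exs → snd p ∈ A
  ρ∈A m = All-∈ (mem sr) (ρ∈ m)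
  x-nz : ∀ {p} → p ∈ exs → Nz (C ⟋ me) (fst p)
  x-nz m = All-∈ exs-nz m
  ρ-nz : ∀ {p} → p ∈ exs → Nz (C ⟋ me) (snd p)
  ρ-nz m = All-∈ (nz simp') (ρ∈ m)
  x∥ρ : ∀ {p} → p ∈ exs → ¬ Ind2 (C ⟋ me) (fst p) (snd p)
  x∥ρ m = snd (All-∈ exs-par m)
  ρ-ind : ∀ {p ρ} → p ∈ exs → ρ ∈ reps → Ind2 C ρ (fst p)
  ρ-ind m mρ = All-∈ (All-∈ cross mρ) (∈-map⁺ fst m)
  exs-ap : AllPairs (λ p q → Ind2 C (fst p) (fst q)) exs
  exs-ap = AllPairsP.map⁻ (ap se)

 -- Moving entries, and the range of `D` under displacements

 sgn : List V → ℤ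
 sgn [] = + 1
 sgn (_ ∷ us) = - sgn us

 -- Unlike `perm±`, this determines the sign, which is the same for all vectors `x` at this
 -- position.
 alt-shift : ∀ (G : List V → ℤ) → Alt G → ∀ us x z → G (us ++ x ∷ z) ≡ sgn us * G (x ∷ us ++ z)
 alt-shift G al [] x z = sym (ℤP.*-identityˡ _)
 alt-shift G al (u ∷ us) x z = trans (alt-shift (λ ys → G (u ∷ ys)) (λ vs → al (u ∷ vs)) us x z)
  (trans (cong (sgn us *_) (al [] u x (us ++ z))) (lem (sgn us) (G (x ∷ u ∷ us ++ z)))) where
  lem = ring-20

 sgn² : ∀ us → sgn us * sgn us ≡ + 1
 sgn² [] = refl
 sgn² (u ∷ us) = trans (lem (sgn us)) (sgn² us) where
  lem = ring-21

 alt-mem : ∀ (G : List V → ℤ) → Alt G → ∀ {x us} → x ∈ us → G (x ∷ us) ≡ + 0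
 alt-mem G al {x} p with ∈-split p
 ... | l , r , refl = trans (alt-shift (λ ys → G (x ∷ ys)) (λ vs → al (x ∷ vs)) l x r)
    (trans (cong (sgn l *_) (x≡-x⇒0 _ (al [] x x (l ++ r)))) (*-zeroʳ (sgn l)))

 -- In terms of vectors, x' = x + (τ/2) e. Doubling keeps the coefficient integral when the pivot
 -- minor is ±2.
 record Vary {n} (C : Config n) (e x x' : V) (τ : ℤ) : Set where
  constructor mkV
  field
   at : ∀ z → + 2 * D C (x' ∷ z) ≡ + 2 * D C (x ∷ z) + τ * D C (e ∷ z)
 open Vary public

 record Vr {n} (C : Config n) (e : V) : Set where
  constructor vr
  field
   base alter : V
   τ     : ℤ
   b∈    : base ∈ A
   a∈    : alter ∈ A
   vary  : Vary C e base alter τ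
 open Vr public

 module _ {n} {C : Config n} {e : V} where

  data Choice : List (Vr C e) → List V → Set where
   []  : Choice [] []
   keepB : ∀ {v vs hs} → Choice vs hs → Choice (v ∷ vs) (base v ∷ hs)
   flip : ∀ {v vs hs} → Choice vs hs → Choice (v ∷ vs) (alter v ∷ hs)

  choice-Ms : ∀ {vs hs} → Choice vs hs → Ms hs
  choice-Ms [] = []
  choice-Ms (keepB {v} c) = b∈ v ∷ choice-Ms c
  choice-Ms (flip {v} c) = a∈ v ∷ choice-Ms c

  -- Stated for every `G`, since the inductions below absorb leading entries into `G`.
  VaryG : (List V → ℤ) → Set
  VaryG G = ∀ (v : Vr C e) us z → + 2 * G (us ++ alter v ∷ z) ≡ + 2 * G (us ++ base v ∷ z) + τ v * G (us ++ e ∷ z)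

  varyD : VaryG (D C)
  varyD v us z = begin
   + 2 * D C (us ++ alter v ∷ z) ≡⟨ cong (+ 2 *_) (sh (alter v)) ⟩
   + 2 * (s * D C (alter v ∷ us ++ z)) ≡⟨ l1 s (D C (alter v ∷ us ++ z)) ⟩
   s * (+ 2 * D C (alter v ∷ us ++ z)) ≡⟨ cong (s *_) (at (vary v) (us ++ z)) ⟩
   s * (+ 2 * D C (base v ∷ us ++ z) + τ v * D C (e ∷ us ++ z)) ≡⟨ l2 s (D C (base v ∷ us ++ z)) (τ v) (D C (e ∷ us ++ z)) ⟩
   + 2 * (s * D C (base v ∷ us ++ z)) + τ v * (s * D C (e ∷ us ++ z)) ≡⟨ cong₂ (λ a b → + 2 * a + τ v * b) (sym (sh (base v))) (sym (sh e)) ⟩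
   + 2 * D C (us ++ base v ∷ z) + τ v * D C (us ++ e ∷ z) ∎ where
   open ≡-Reasoning
   s = sgn us
   sh : ∀ x → D C (us ++ x ∷ z) ≡ s * D C (x ∷ us ++ z)
   sh x = alt-shift (D C) (Config.alt C) us x z
   l1 = ring-22
   l2 = ring-23

  bases : List (Vr C e) → List V
  bases = map base

  -- Once `e` occurs in the list, displacing another entry along `e` only adds a multiple of a minor
  -- in which `e` is repeated.
  inv-keep : ∀ G → Alt G → VaryG G → ∀ us {vs} v {hs} → e ∈ us → Choice vs hs → ∀ w → G (us ++ base v ∷ hs ++ w) ≡ G (us ++ base v ∷ bases vs ++ w)
  invariant : ∀ G → Alt G → VaryG G → ∀ us {vs hs} → e ∈ us → Choice vs hs → ∀ w → G (us ++ hs ++ w) ≡ G (us ++ bases vs ++ w)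
  invariant G al vg us m [] w = refl
  invariant G al vg us {v ∷ vs} m (keepB {hs = hs} c) w = inv-keep G al vg us v m c w
  invariant G al vg us {v ∷ vs} m (flip {hs = hs} c) w = trans
   (cancel-≡ {+ 2} _ _ (λ ()) (trans (vg v us (hs ++ w)) (trans (cong (λ t → + 2 * G (us ++ base v ∷ hs ++ w) + τ v * t) z0) (lem (G (us ++ base v ∷ hs ++ w)) (τ v)))))
   (inv-keep G al vg us v m c w) where
   z0 : G (us ++ e ∷ hs ++ w) ≡ + 0
   z0 = trans (alt-shift G al us e (hs ++ w)) (trans (cong (sgn us *_) (alt-mem G al (∈-++⁺ˡ m))) (*-zeroʳ (sgn us)))
   lem = ring-24

  inv-keep G al vg us {vs} v {hs} m c w = subst₂ (λ a b → G a ≡ G b) (++-assoc us (base v ∷ []) (hs ++ w)) (++-assoc us (base v ∷ []) (bases vs ++ w))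
   (invariant G al vg (us ++ base v ∷ []) (∈-++⁺ˡ m) c w)

  -- Twice the variation of `G` over all choices: the term of `v` puts `e` in its place and leaves
  -- the other entries at their bases.
  R : (List V → ℤ) → List (Vr C e) → List V → ℕ
  R G [] w = 0
  R G (v ∷ vs) w = ∣ τ v ∣ ℕ.* ∣ G (e ∷ bases vs ++ w) ∣ ℕ.+ R (λ ys → G (base v ∷ ys)) vs w

  -- `G` is affine in the choices, so its extreme values are found by deciding each `v` by the sign
  -- of its own contribution.
  spread : ∀ G → Alt G → VaryG G → ∀ vs w → ∃₂ λ hi lo → Choice vs hi × Choice vs lo ×
       + 2 * (G (hi ++ w) - G (lo ++ w)) ≡ + R G vs w
  spread G al vg [] w = [] , [] , [] , [] , lem (G w) where
   lem = ring-25
  spread G al vg (v ∷ vs) w with spread (λ ys → G (base v ∷ ys)) (λ us → al (base v ∷ us)) (λ v' us → vg v' (base v ∷ us)) vs w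
  ... | hi , lo , ch , cl , eq = go (+∣i∣≡i⊎+∣i∣≡-i (τ v * c)) where
   open ≡-Reasoning
   c : ℤ
   c = G (e ∷ bases vs ++ w)
   r = R (λ ys → G (base v ∷ ys)) vs w
   Gv : ∀ {hs} → Choice vs hs → + 2 * G (alter v ∷ hs ++ w) ≡ + 2 * G (base v ∷ hs ++ w) + τ v * c
   Gv {hs} ch = trans (vg v [] (hs ++ w)) (cong (λ t → + 2 * G (base v ∷ hs ++ w) + τ v * t) (invariant G al vg (e ∷ []) (here refl) ch w))
   tot : + (∣ τ v ∣ ℕ.* ∣ c ∣ ℕ.+ r) ≡ + ∣ τ v * c ∣ + + r
   tot = cong (λ t → + (t ℕ.+ r)) (sym (∣i*j∣≡∣i∣*∣j∣ (τ v) c))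
   l1 : ∀ a b t → + 2 * a ≡ + 2 * t + b → ∀ l → + 2 * (a - l) ≡ b + + 2 * (t - l)
   l1 a b t e l = trans (q1 a l) (trans (cong (_- + 2 * l) e) (q2 t b l)) where
    q1 = ring-26
    q2 = ring-27
   l2 : ∀ a b t → + 2 * a ≡ + 2 * t + b → ∀ h → + 2 * (h - a) ≡ - b + + 2 * (h - t)
   l2 a b t e h = trans (q1 a h) (trans (cong (λ s → + 2 * h - s) e) (q2 t b h)) where
    q1 = ring-28
    q2 = ring-29
   go : (+ ∣ τ v * c ∣ ≡ τ v * c ⊎ + ∣ τ v * c ∣ ≡ - (τ v * c)) → _
   go (inl p) = alter v ∷ hi , base v ∷ lo , flip ch , keepB cl ,
    trans (l1 (G (alter v ∷ hi ++ w)) (τ v * c) (G (base v ∷ hi ++ w)) (Gv ch) (G (base v ∷ lo ++ w))) (trans (cong₂ _+_ (sym p) eq) (sym tot))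
   go (inr p) = base v ∷ hi , alter v ∷ lo , keepB ch , flip cl ,
    trans (l2 (G (alter v ∷ lo ++ w)) (τ v * c) (G (base v ∷ lo ++ w)) (Gv cl) (G (base v ∷ hi ++ w))) (trans (cong₂ _+_ (sym p) eq) (sym tot))

  -- Two values between -2 and 2 differ by at most 4, and `R` is doubled.
  range≤8 : ∀ vs {w} → Ms w → R (D C) vs w ≤ 8
  range≤8 vs {w} mw with spread (D C) (Config.alt C) varyD vs w
  ... | hi , lo , ch , cl , eq = ≤-trans (≤-reflexive (trans (sym (cong ∣_∣ eq)) (∣i*j∣≡∣i∣*∣j∣ (+ 2) (D C (hi ++ w) - D C (lo ++ w)))))
   (*-monoʳ-≤ 2 (≤-trans (∣i-j∣≤∣i∣+∣j∣ (D C (hi ++ w)) (D C (lo ++ w)))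
    (+-mono-≤ (bdd C (AllP.++⁺ (choice-Ms ch) mw)) (bdd C (AllP.++⁺ (choice-Ms cl) mw)))))

  -- three varying vectors in general position
  triple-range : ∀ (u v w : Vr C e) {zs} → Ms zs →
   ∣ τ u ∣ ℕ.* ∣ D C (e ∷ base v ∷ base w ∷ zs) ∣ ℕ.+ (∣ τ v ∣ ℕ.* ∣ D C (e ∷ base u ∷ base w ∷ zs) ∣ ℕ.+ ∣ τ w ∣ ℕ.* ∣ D C (e ∷ base u ∷ base v ∷ zs) ∣) ≤ 8
  triple-range u v w {zs} mz = subst (_≤ 8) (cong (∣ τ u ∣ ℕ.* ∣ D C (e ∷ base v ∷ base w ∷ zs) ∣ ℕ.+_) (cong₂ ℕ._+_ (cong (∣ τ v ∣ ℕ.*_) p1)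
    (trans (ℕP.+-identityʳ (∣ τ w ∣ ℕ.* ∣ D C (base u ∷ base v ∷ e ∷ zs) ∣)) (cong (∣ τ w ∣ ℕ.*_) p2)))) (range≤8 (u ∷ v ∷ w ∷ []) mz) where
   p1 : ∣ D C (base u ∷ e ∷ base w ∷ zs) ∣ ≡ ∣ D C (e ∷ base u ∷ base w ∷ zs) ∣
   p1 = perm-abs C (↭-swap (base u) e ↭-refl)
   p2 : ∣ D C (base u ∷ base v ∷ e ∷ zs) ∣ ≡ ∣ D C (e ∷ base u ∷ base v ∷ zs) ∣
   p2 = perm-abs C (↭-trans (↭-prep (base u) (↭-swap (base v) e ↭-refl)) (↭-swap (base u) e ↭-refl))

 -- Even configurations and coefficient determinants

 even-abs : ∀ {n} {C : Config n} → Even C → ∀ {z} → Ms z → 0≢ (D C z) → ∣ D C z ∣ ≡ 2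
 even-abs {C = C} ev mz ne = even-val (ev mz) (bdd C mz) ne

 -- All nonzero minors are ±2, so the factor between parallel vectors is ±1.
 even-parallel : ∀ {n} {C : Config n} → Even C → ∀ {x y} → x ∈ A → y ∈ A → Nz C x → Nz C y → ¬ Ind2 C x y →
         (∀ z → D C (y ∷ z) ≡ D C (x ∷ z)) ⊎ (∀ z → D C (y ∷ z) ≡ - D C (x ∷ z))
 even-parallel {C = C} ev {x} {y} mx my (w , mw , dw) (z₀ , mz₀ , dz₀) h = go (abs2 {D C (x ∷ w)} (even-abs {C = C} ev (mx ∷ mw) dw)) (abs2 {D C (y ∷ w)} (even-abs {C = C} ev (my ∷ mw) dy)) where
  rel : ∀ z → D C (x ∷ w) * D C (y ∷ z) ≡ D C (y ∷ w) * D C (x ∷ z)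
  rel z = trans (spanned C y (x ∷ []) w mw (λ mz → trans (alt C [] y x _) (cong -_ (¬NzL C h mz))) z) (ℤP.+-identityʳ _)
  dy : 0≢ (D C (y ∷ w))
  dy e = *≢0 dw dz₀ (trans (rel z₀) (cong (_* D C (x ∷ z₀)) e))
  l1 = ring-30
  l2 = ring-11
  go : _ → _ → _
  go (inl a) (inl b) = inl (λ z → cancel-≡ {+ 2} _ _ (λ ()) (trans (cong (_* D C (y ∷ z)) (sym a)) (trans (rel z) (cong (_* D C (x ∷ z)) b))))
  go (inr a) (inr b) = inl (λ z → cancel-≡ { - + 2} _ _ (λ ()) (trans (cong (_* D C (y ∷ z)) (sym a)) (trans (rel z) (cong (_* D C (x ∷ z)) b))))
  go (inl a) (inr b) = inr (λ z → cancel-≡ {+ 2} _ _ (λ ()) (trans (cong (_* D C (y ∷ z)) (sym a)) (trans (rel z) (trans (cong (_* D C (x ∷ z)) b) (l2 (D C (x ∷ z)))))))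
  go (inr a) (inl b) = inr (λ z → cancel-≡ { - + 2} _ _ (λ ()) (trans (cong (_* D C (y ∷ z)) (sym a)) (trans (rel z) (trans (cong (_* D C (x ∷ z)) b) (l1 (D C (x ∷ z)))))))

 -- a family of vectors together with the corresponding columns of a coefficient matrix
 Cols : Set
 Cols = List (V × List ℤ)

 tlP : V × List ℤ → V × List ℤ
 tlP (v , c) = v , tl c

 -- The determinant of the coefficient matrix, expanded along its top row, which consists of the
 -- first coefficients of all columns.
 detP : ℕ → Cols → ℤ
 detP zero [] = + 1
 detP zero (_ ∷ _) = + 0
 detP (suc k) ps = W (λ p → hd (snd p)) (λ qs → detP k (map tlP qs)) ps

 vecs : Cols → List V
 vecs = map fst

 sumP : Cols → (V → ℤ) → ℤ
 sumP [] f = + 0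
 sumP ((x , c) ∷ ps) f = hd c * f x + sumP ps f

 -- Each vector of `us` uses the top coefficients of all columns, and the next one continues with
 -- the remaining coefficients.
 Rows : (List V → ℤ) → List V → Cols → Set
 Rows G [] ps = ⊤
 Rows G (u ∷ us) ps = (∀ z → + 2 * G (u ∷ z) ≡ sumP ps (λ x → G (x ∷ z))) × Rows G us (map tlP ps)

 sumP-cong : ∀ ps {f g} → (∀ x → f x ≡ g x) → sumP ps f ≡ sumP ps g
 sumP-cong [] e = refl
 sumP-cong ((x , c) ∷ ps) e = cong₂ (λ a b → hd c * a + b) (e x) (sumP-cong ps e)

 sumP-neg : ∀ ps f → sumP ps (λ x → - f x) ≡ - sumP ps f
 sumP-neg [] f = refl
 sumP-neg ((x , c) ∷ ps) f = trans (cong (λ t → hd c * - f x + t) (sumP-neg ps f)) (lem (hd c) (f x) (sumP ps f)) where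
  lem = ring-31

 sumP-drop : ∀ l {p} r f → f (fst p) ≡ + 0 → sumP (l ++ p ∷ r) f ≡ sumP (l ++ r) f
 sumP-drop [] {x , c} r f e = trans (cong (λ t → hd c * t + sumP r f) e) (lem (hd c) (sumP r f)) where
  lem = ring-32
 sumP-drop ((x , c) ∷ l) r f e = cong (λ t → hd c * f x + t) (sumP-drop l r f e)

 -- In a minor that already contains a vector, the column of this vector contributes nothing to the
 -- later rows.
 Rows-drop : ∀ G → Alt G → ∀ us l p r → Rows G us (l ++ p ∷ r) → Rows (λ ys → G (fst p ∷ ys)) us (l ++ r)
 Rows-drop G al [] l p r h = _
 Rows-drop G al (u ∷ us) l p@(x , c) r (h , hs) = h' ,
  subst (Rows _ us) (sym (map-++ tlP l r)) (Rows-drop G al us (map tlP l) (tlP p) (map tlP r) (subst (Rows G us) (map-++ tlP l (p ∷ r)) hs)) where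
  h' : ∀ z → + 2 * G (x ∷ u ∷ z) ≡ sumP (l ++ r) (λ y → G (x ∷ y ∷ z))
  h' z = trans (cong (+ 2 *_) (al [] x u z)) (trans (lem (G (u ∷ x ∷ z))) (trans (cong -_ (h (x ∷ z)))
   (trans (sym (sumP-neg (l ++ p ∷ r) (λ y → G (y ∷ x ∷ z)))) (trans (sumP-cong (l ++ p ∷ r) (λ y → sym (al [] x y z)))
    (sumP-drop l r (λ y → G (x ∷ y ∷ z)) (x≡-x⇒0 _ (al [] x x z))))))) where
   lem = ring-33

 sgP : Cols → ℤ
 sgP [] = + 1
 sgP (_ ∷ l) = - sgP l

 sgP-sgn : ∀ l → sgn (vecs l) ≡ sgP l
 sgP-sgn [] = refl
 sgP-sgn (_ ∷ l) = cong -_ (sgP-sgn l)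

 sumT : Cols → (V × List ℤ → ℤ) → ℤ
 sumT [] T = + 0
 sumT (p ∷ ps) T = hd (snd p) * T p + sumT ps T

 sumT-W : ∀ (T : V × List ℤ → ℤ) s Z (H : Cols → ℤ) ps →
      (∀ l p r → ps ≡ l ++ p ∷ r → T p ≡ s * (sgP l * (H (l ++ r) * Z))) → sumT ps T ≡ s * (W (λ p → hd (snd p)) H ps * Z)
 sumT-W T s Z H [] h = lem s Z where
  lem = ring-34
 sumT-W T s Z H (p ∷ ps) h = trans (cong₂ (λ a b → hd (snd p) * a + b) (h [] p ps refl)
  (sumT-W T (- s) Z (λ qs → H (p ∷ qs)) ps (λ l q r e → trans (h (p ∷ l) q r (cong (p ∷_) e)) (l1 s (sgP l) (H (p ∷ l ++ r) * Z)))))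
  (l2 (hd (snd p)) s (H ps) Z (W (λ p → hd (snd p)) (λ qs → H (p ∷ qs)) ps)) where
  l1 = ring-35
  l2 = ring-36

 vecs-tl : ∀ ps → vecs (map tlP ps) ≡ vecs ps
 vecs-tl [] = refl
 vecs-tl (p ∷ ps) = cong (fst p ∷_) (vecs-tl ps)

 -- Multiplicativity of the determinant for half-integral coordinates: each row contributes one
 -- factor 2 on the left.
 expand : ∀ G → Alt G → ∀ us ps → length ps ≡ length us → Rows G us ps → ∀ w →
      pow2 (length us) * G (us ++ w) ≡ detP (length us) ps * G (vecs ps ++ w)
 expand G al [] [] len rows w = refl
 expand G al (u ∷ us) ps len (h , hs) w = begin
  + 2 * pow2 k * G (u ∷ us ++ w) ≡⟨ l1 (pow2 k) (G (u ∷ us ++ w)) ⟩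
  pow2 k * (+ 2 * G (u ∷ us ++ w)) ≡⟨ cong (pow2 k *_) (h (us ++ w)) ⟩
  pow2 k * sumP ps (λ x → G (x ∷ us ++ w)) ≡⟨ dist ps ⟩
  sumT ps (λ p → pow2 k * G (fst p ∷ us ++ w)) ≡⟨ sumT-W _ (+ 1) Z H ps term ⟩
  + 1 * (detP (suc k) ps * Z) ≡⟨ ℤP.*-identityˡ _ ⟩
  detP (suc k) ps * Z ∎ where
  open ≡-Reasoning
  k = length us
  Z = G (vecs ps ++ w)
  H : Cols → ℤ
  H qs = detP k (map tlP qs)
  l1 = ring-37
  dist : ∀ ps → pow2 k * sumP ps (λ x → G (x ∷ us ++ w)) ≡ sumT ps (λ p → pow2 k * G (fst p ∷ us ++ w))
  dist [] = *-zeroʳ (pow2 k)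
  dist ((x , c) ∷ ps) = trans (l2 (pow2 k) (hd c) (G (x ∷ us ++ w)) _) (cong (λ t → hd c * (pow2 k * G (x ∷ us ++ w)) + t) (dist ps)) where
   l2 = ring-38
  term : ∀ l p r → ps ≡ l ++ p ∷ r → pow2 k * G (fst p ∷ us ++ w) ≡ + 1 * (sgP l * (H (l ++ r) * Z))
  term l p@(x , c) r refl = trans (expand (λ ys → G (x ∷ ys)) (λ vs → al (x ∷ vs)) us (map tlP (l ++ r)) len' rows' w)
   (trans (cong (λ t → H (l ++ r) * t) mv) (l3 (H (l ++ r)) (sgP l) Z)) where
   l3 = ring-39
   len' : length (map tlP (l ++ r)) ≡ length us
   len' = trans (length-map tlP (l ++ r)) (suc-injective (trans (cong suc (length-++ l)) (trans (sym (+-suc (length l) (length r))) (trans (sym (length-++ l)) len))))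
   rows' : Rows (λ ys → G (x ∷ ys)) us (map tlP (l ++ r))
   rows' = subst (Rows _ us) (sym (map-++ tlP l r)) (Rows-drop G al us (map tlP l) (tlP p) (map tlP r) (subst (Rows G us) (map-++ tlP l (p ∷ r)) hs))
   s = sgn (vecs l)
   mv : G (x ∷ vecs (map tlP (l ++ r)) ++ w) ≡ sgP l * G (vecs (l ++ p ∷ r) ++ w)
   mv = trans (cong (λ t → G (x ∷ t ++ w)) (trans (vecs-tl (l ++ r)) (map-++ fst l r)))
    (trans (trans (cong (λ t → G (x ∷ t)) (++-assoc (vecs l) (vecs r) w)) (l4 s (G (x ∷ vecs l ++ vecs r ++ w)) (sgn² (vecs l))))
    (cong₂ _*_ (sgP-sgn l) (trans (sym (alt-shift G al (vecs l) x (vecs r ++ w))) (cong G (trans (sym (++-assoc (vecs l) (x ∷ vecs r) w)) (cong (_++ w) (sym (map-++ fst l (p ∷ r))))))))) where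
    l4 : ∀ s g → s * s ≡ + 1 → g ≡ s * (s * g)
    l4 s g e = trans (sym (ℤP.*-identityˡ g)) (trans (cong (_* g) (sym e)) (ℤP.*-assoc s s g))

 -- The tool for the explicit contradictions: in a frame with minor ±2, vectors of `A` have a
 -- coordinate determinant of absolute value at most 1, and doubling each row turns this limit into
 -- a power of 2.
 det-bound : ∀ {n} (C : Config n) us ps {w} → length ps ≡ length us → Rows (D C) us ps → Ms us → Ms w → ∣ D C (vecs ps ++ w) ∣ ≡ 2 →
       ∣ detP (length us) ps ∣ ≤ ∣ pow2 (length us) ∣
 det-bound C us ps {w} len rows mu mw d2 = *-cancelʳ-≤ _ _ 2 (begin
  ∣ detP (length us) ps ∣ ℕ.* 2 ≡⟨ cong (∣ detP (length us) ps ∣ ℕ.*_) (sym d2) ⟩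
  ∣ detP (length us) ps ∣ ℕ.* ∣ D C (vecs ps ++ w) ∣ ≡⟨ sym (∣i*j∣≡∣i∣*∣j∣ (detP (length us) ps) _) ⟩
  ∣ detP (length us) ps * D C (vecs ps ++ w) ∣ ≡⟨ cong ∣_∣ (sym (expand (D C) (alt C) us ps len rows w)) ⟩
  ∣ pow2 (length us) * D C (us ++ w) ∣ ≡⟨ ∣i*j∣≡∣i∣*∣j∣ (pow2 (length us)) _ ⟩
  ∣ pow2 (length us) ∣ ℕ.* ∣ D C (us ++ w) ∣ ≤⟨ *-monoʳ-≤ ∣ pow2 (length us) ∣ (bdd C (AllP.++⁺ mu mw)) ⟩
  ∣ pow2 (length us) ∣ ℕ.* 2 ∎)
  where open ℕP.≤-Reasoning

 -- Displacements along e

 module _ {n} {C : Config n} {e : V} where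

  vary-comp : ∀ {x y y' τ τ'} → Vary C e x y τ → Vary C e x y' τ' → Vary C e y y' (τ' - τ)
  vary-comp {x} {y} {y'} {τ} {τ'} p q = mkV λ z → lem (D C (x ∷ z)) (D C (y ∷ z)) (D C (y' ∷ z)) τ τ' (D C (e ∷ z)) (at p z) (at q z) where
   lem : ∀ x y y' τ τ' e → + 2 * y ≡ + 2 * x + τ * e → + 2 * y' ≡ + 2 * x + τ' * e → + 2 * y' ≡ + 2 * y + (τ' - τ) * e
   lem x y y' τ τ' e p q = trans q (trans (l1 x τ τ' e) (cong (_+ (τ' - τ) * e) (sym p))) where
    l1 = ring-40

  vary-sym : ∀ {x y τ} → Vary C e x y τ → Vary C e y x (- τ)
  vary-sym {x} {y} {τ} p = mkV λ z → trans (l1 (D C (x ∷ z)) τ (D C (e ∷ z))) (cong (_+ - τ * D C (e ∷ z)) (sym (at p z))) where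
   l1 = ring-41

  vary-neg : ∀ {x y τ} → Vary C e x y τ → Vary C e (neg x) (neg y) (- τ)
  vary-neg {x} {y} {τ} p = mkV λ z → trans (cong (+ 2 *_) (D-neg C y z)) (trans (l1 (D C (y ∷ z))) (trans (cong -_ (at p z))
   (trans (l2 (D C (x ∷ z)) τ (D C (e ∷ z))) (cong (λ t → + 2 * t + - τ * D C (e ∷ z)) (sym (D-neg C x z)))))) where
   l1 = ring-33
   l2 = ring-42

  vary-0 : ∀ {x y} → Vary C e x y (+ 0) → ∀ z → D C (y ∷ z) ≡ D C (x ∷ z)
  vary-0 {x} p z = cancel-≡ {+ 2} _ _ (λ ()) (trans (at p z) (lem (D C (x ∷ z)) (D C (e ∷ z)))) where
   lem = ring-43

  equal-dep : ∀ {x y} → (∀ z → D C (y ∷ z) ≡ D C (x ∷ z)) → ¬ Ind2 C x y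
  equal-dep {x} {y} h (z , _ , ne) = ne (trans (alt C [] x y z) (cong -_ (trans (h (x ∷ z)) (D-twice C x z))))

  -- The minor with `y` and `x` is τ/2 times the minor ±2 with `e` and `x`, and may not exceed 2.
  vary-bound : ∀ {x y τ w} → x ∈ A → y ∈ A → Ms w → Vary C e x y τ → ∣ D C (e ∷ x ∷ w) ∣ ≡ 2 → ∣ τ ∣ ≤ 2
  vary-bound {x} {y} {τ} {w} mx my mw p d2 = *-cancelʳ-≤ _ _ 2 (begin
   ∣ τ ∣ ℕ.* 2 ≡⟨ cong (∣ τ ∣ ℕ.*_) (sym d2) ⟩
   ∣ τ ∣ ℕ.* ∣ D C (e ∷ x ∷ w) ∣ ≡⟨ sym (∣i*j∣≡∣i∣*∣j∣ τ _) ⟩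
   ∣ τ * D C (e ∷ x ∷ w) ∣ ≡⟨ cong ∣_∣ (sym eq) ⟩
   ∣ + 2 * D C (y ∷ x ∷ w) ∣ ≡⟨ ∣i*j∣≡∣i∣*∣j∣ (+ 2) (D C (y ∷ x ∷ w)) ⟩
   2 ℕ.* ∣ D C (y ∷ x ∷ w) ∣ ≤⟨ *-monoʳ-≤ 2 (bdd C (my ∷ mx ∷ mw)) ⟩
   2 ℕ.* 2 ∎) where
   open ℕP.≤-Reasoning
   eq : + 2 * D C (y ∷ x ∷ w) ≡ τ * D C (e ∷ x ∷ w)
   eq = trans (at p (x ∷ w)) (trans (cong (λ t → + 2 * t + τ * D C (e ∷ x ∷ w)) (D-twice C x w)) (lem (τ * D C (e ∷ x ∷ w)))) where
    lem = ring-44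

  -- Cramer's rule for the dependent vectors y, e, x. The coefficient of `x` is 1 because x and y
  -- agree modulo `e`; the coefficient of `e` is a minor divided by the pivot ±2.
  offset : ∀ {x y w} → Ms w → ∣ D C (e ∷ x ∷ w) ∣ ≡ 2 → D C (e ∷ y ∷ w) ≡ D C (e ∷ x ∷ w) →
       (∀ {z} → Ms z → D C (e ∷ x ∷ y ∷ z) ≡ + 0) → ∃ λ τ → Vary C e x y τ × ∣ τ ∣ ≡ ∣ D C (y ∷ x ∷ w) ∣
  offset {x} {y} {w} mw d2 eqd dep = go (abs2 {D C (e ∷ x ∷ w)} d2) where
   a = D C (y ∷ x ∷ w)
   d = D C (e ∷ x ∷ w)
   rel : ∀ z → d * D C (y ∷ z) ≡ a * D C (e ∷ z) + d * D C (x ∷ z)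
   rel z = trans (spanned C y (e ∷ x ∷ []) w mw (λ mz → perm-0 C (↭-trans (↭-prep e (↭-swap x y ↭-refl)) (↭-swap e y ↭-refl)) (dep mz)) z)
    (trans (cong (λ t → a * D C (e ∷ z) + (- t * D C (x ∷ z) + + 0)) (trans (alt C [] y e w) (cong -_ eqd))) (lem a d (D C (e ∷ z)) (D C (x ∷ z)))) where
    lem = ring-45
   go : _ → _
   go (inl p) = a , (mkV λ z → trans (cong (_* D C (y ∷ z)) (sym p)) (trans (rel z) (trans (ℤP.+-comm (a * D C (e ∷ z)) _) (cong (λ t → t * D C (x ∷ z) + a * D C (e ∷ z)) p)))) , refl
   go (inr p) = - a , (mkV λ z → l1 (D C (y ∷ z)) (D C (x ∷ z)) (D C (e ∷ z)) (trans (cong (_* D C (y ∷ z)) (sym p)) (trans (rel z) (cong (λ t → a * D C (e ∷ z) + t * D C (x ∷ z)) p)))) , ∣-i∣≡∣i∣ a where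
    l1 : ∀ y x e → - + 2 * y ≡ a * e + - + 2 * x → + 2 * y ≡ + 2 * x + - a * e
    l1 y x e h = trans (q1 y) (trans (cong -_ h) (q2 a e x)) where
     q1 = ring-46
     q2 = ring-47

  offset-≢0 : ∀ {x y τ} → Ind2 C x y → Vary C e x y τ → 0≢ τ
  offset-≢0 {x} {y} ind v refl = equal-dep {x} {y} (vary-0 {x} {y} v) ind

 -- A displacement by ±e itself, since `Vary` counts in steps of e/2.
 Full : ∀ {n} → Config n → V → V → Set
 Full C e y = ∃₂ λ y' τ → y' ∈ A × Vary C e y y' τ × ∣ τ ∣ ≡ 2

 Varies : ∀ {n} → Config n → V → V → Set
 Varies C e y = ∃₂ λ y' τ → y' ∈ A × Vary C e y y' τ × 0≢ τ

 full-varies : ∀ {n} {C : Config n} {e y} → Full C e y → Varies C e y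
 full-varies (y' , τ , m , v , e2) = y' , τ , m , v , λ { refl → lem e2 } where
  lem : ∣ + 0 ∣ ≢ 2
  lem ()

 -- A triangle with one nonzero and two full displacements would have range at least 2 + 4 + 4.
 no-tri : ∀ {n} (C : Config (suc n)) {e} (me : e ∈ A) → Even (C ⟋ me) → ∀ {y p q} → y ∈ A → p ∈ A → q ∈ A →
      Varies C e y → Full C e p → Full C e q → ¬ Tri (C ⟋ me) y p q
 no-tri C {e} me ev {y} {p} {q} my mp mq (y' , τ , my' , vy , τ≢0) (p' , σ , mp' , vp , σ2) (q' , ρ , mq' , vq , ρ2) (w , mw , d1 , d2 , d3)
  = too-big t1 σ2 ρ2 (ea (mp ∷ mq ∷ mw) d1) (ea (my ∷ mq ∷ mw) d2) (ea (my ∷ mp ∷ mw) d3) (triple-range (vr y y' τ my my' vy) (vr p p' σ mp mp' vp) (vr q q' ρ mq mq' vq) mw) where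
  ea : ∀ {z} → Ms z → 0≢ (D C (e ∷ z)) → ∣ D C (e ∷ z) ∣ ≡ 2
  ea = even-abs {C = C ⟋ me} ev
  t1 : 1 ≤ ∣ τ ∣
  t1 with ∣ τ ∣ in eq
  ... | zero = ⊥-elim (τ≢0 (∣i∣≡0⇒i≡0 eq))
  ... | suc _ = s≤s z≤n

 -- Full displacements exclude triangles, so pairwise independence of their classes becomes
 -- independence, and the rank of the contraction bounds their number.
 full-independent : ∀ {n} (C : Config (suc n)) {e} (me : e ∈ A) → Even (C ⟋ me) → ∀ ys → Ms ys → All (Nz (C ⟋ me)) ys →
           All (Full C e) ys → AllPairs (Ind2 (C ⟋ me)) ys → length ys ≤ n
 full-independent C me ev ys ms nz fs ap = independent (C ⟋ me) ys ms nz ap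
  λ my mp mq → no-tri C me ev (All-∈ ms my) (All-∈ ms mp) (All-∈ ms mq) (full-varies {C = C} (All-∈ fs my)) (All-∈ fs mp) (All-∈ fs mq)

 Pm : ∀ {n} → Config n → V → V → Set
 Pm C x y = (∀ z → D C (y ∷ z) ≡ D C (x ∷ z)) ⊎ (∀ z → D C (y ∷ z) ≡ - D C (x ∷ z))

 Pm-dep : ∀ {n} (C : Config n) {x y} → Pm C x y → ¬ Ind2 C x y
 Pm-dep C {x} {y} (inl h) (z , _ , ne) = ne (trans (alt C [] x y z) (cong -_ (trans (h (x ∷ z)) (D-twice C x z))))
 Pm-dep C {x} {y} (inr h) (z , _ , ne) = ne (trans (alt C [] x y z) (cong -_ (trans (h (x ∷ z)) (cong -_ (D-twice C x z)))))

 Pm-neg : ∀ {n} (C : Config n) x → Pm C x (neg x)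
 Pm-neg C x = inr (D-neg C x)

 Pm-refl : ∀ {n} (C : Config n) {x} → Pm C x x
 Pm-refl C = inl (λ _ → refl)

 Pm-trans : ∀ {n} (C : Config n) {x y z} → Pm C x y → Pm C y z → Pm C x z
 Pm-trans C (inl p) (inl q) = inl (λ z → trans (q z) (p z))
 Pm-trans C (inl p) (inr q) = inr (λ z → trans (q z) (cong -_ (p z)))
 Pm-trans C (inr p) (inl q) = inr (λ z → trans (q z) (p z))
 Pm-trans C (inr p) (inr q) = inl (λ z → trans (q z) (trans (cong -_ (p z)) (neg-involutive _)))

 Pm-sym : ∀ {n} (C : Config n) {x y} → Pm C x y → Pm C y x
 Pm-sym C (inl p) = inl (λ z → sym (p z))
 Pm-sym C {x} (inr p) = inr (λ z → trans (sym (neg-involutive (D C (x ∷ z)))) (cong -_ (sym (p z))))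

 -- the sign of y can be chosen so that it agrees with x in an even contraction
 align : ∀ {n k} (C : Config n) {F : Config k} → Even F → ∀ {x y} → x ∈ A → y ∈ A → Nz F x → Nz F y → ¬ Ind2 F x y →
     ∃ λ y' → y' ∈ A × Pm C y y' × (∀ z → D F (y' ∷ z) ≡ D F (x ∷ z)) × (y' ≡ y ⊎ y' ≡ neg y)
 align C {F} ev {x} {y} mx my nx ny h with even-parallel {C = F} ev mx my nx ny h
 ... | inl p = y , my , Pm-refl C , p , inl refl
 ... | inr p = neg y , neg∈ my , Pm-neg C y , (λ z → trans (D-neg F y z) (trans (cong -_ (p z)) (neg-involutive _))) , inr refl

 vary-con : ∀ {n} (C : Config (suc n)) {e x y τ a} (ma : a ∈ A) → Vary C e x y τ → Vary (C ⟋ ma) e x y τ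
 vary-con C {e} {x} {y} {τ} {a} ma v = mkV λ z → trans (cong (+ 2 *_) (alt C [] a y z)) (trans (l1 (D C (y ∷ a ∷ z))) (trans (cong -_ (at v (a ∷ z)))
  (trans (l2 (D C (x ∷ a ∷ z)) τ (D C (e ∷ a ∷ z))) (cong₂ (λ s t → + 2 * s + τ * t) (sym (alt C [] a x z)) (sym (alt C [] a e z)))))) where
  l1 = ring-33
  l2 = ring-48

 Ind2-con : ∀ {n} (C : Config (suc n)) {e x y} (me : e ∈ A) → Ind2 (C ⟋ me) x y → Ind2 C x y
 Ind2-con C {e} {x} {y} me (z , mz , ne) = e ∷ z , me ∷ mz , perm-≢ C (↭-trans (↭-swap e x ↭-refl) (↭-prep x (↭-swap e y ↭-refl))) ne

 Pm-ind : ∀ {n} (C : Config n) {u v v'} → Pm C v v' → Ind2 C u v → Ind2 C u v'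
 Pm-ind C {u} {v} {v'} pm (z , mz , ne) = z , mz , λ e0 → ne (pm0 pm e0) where
  pm0 : Pm C v v' → D C (u ∷ v' ∷ z) ≡ + 0 → D C (u ∷ v ∷ z) ≡ + 0
  pm0 (inl p) e0 = trans (alt C [] u v z) (cong -_ (trans (sym (p (u ∷ z))) (trans (alt C [] v' u z) (cong -_ e0))))
  pm0 (inr p) e0 = trans (alt C [] u v z) (trans (sym (p (u ∷ z))) (trans (alt C [] v' u z) (cong -_ e0)))

 four≰2 : ¬ (4 ≤ 2)
 four≰2 (s≤s (s≤s ()))

 -- Even configurations: lines through a point and Heller's bound

 module _ {n} (C : Config (suc n)) (ev : Even C) {x} (mx : x ∈ A) where

  private
   ev' : Even (C ⟋ mx)
   ev' mz = ev (mx ∷ mz)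

  -- The offset along `x` is a minor up to sign, hence even, and independence of `u` and `v` makes
  -- it nonzero; so it is ±2.
  move : ∀ {u v} → u ∈ A → v ∈ A → Nz (C ⟋ mx) u → Nz (C ⟋ mx) v → ¬ Ind2 (C ⟋ mx) u v → Ind2 C u v →
      ∃₂ λ v' τ → v' ∈ A × Pm C v v' × Vary C x u v' τ × ∣ τ ∣ ≡ 2
  move {u} {v} mu mv nu@(w , mw , dw) nv h ind =
   let v' , mv' , pm , eqv , _ = align C {C ⟋ mx} ev' mu mv nu nv h
       τ , va , eqτ = offset {C = C} {x} {u} {v'} {w} mw (even-abs {C = C ⟋ mx} ev' (mu ∷ mw) dw) (eqv w)
          (λ {z} mz → trans (alt C (x ∷ []) u v' z) (cong -_ (trans (eqv (u ∷ z)) (D-twice (C ⟋ mx) u z))))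
   in v' , τ , mv' , pm , va , trans eqτ (even-abs {C = C} ev (mv' ∷ mu ∷ mw)
       (λ e0 → offset-≢0 {C = C} {x} {u} {v'} {τ} (Pm-ind C {u} {v} {v'} pm ind) va (∣i∣≡0⇒i≡0 (trans eqτ (cong ∣_∣ e0)))))

  vary-D : ∀ {u a τ} w → Vary C x u a τ → D C (x ∷ a ∷ w) ≡ D C (x ∷ u ∷ w)
  vary-D {u} {a} {τ} w va = cancel-≡ {+ 2} _ _ (λ ()) (trans (at (vary-con C mx va) w)
    (trans (cong (λ t → + 2 * D C (x ∷ u ∷ w) + τ * t) (D-twice C x w)) (l (D C (x ∷ u ∷ w)) τ))) where
   l = ring-49

  -- a line contains at most three points
  four : ∀ {u v v'} → u ∈ A → v ∈ A → v' ∈ A → Nz (C ⟋ mx) u → Nz (C ⟋ mx) v → Nz (C ⟋ mx) v' →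
      ¬ Ind2 (C ⟋ mx) u v → ¬ Ind2 (C ⟋ mx) u v' → Ind2 C u v → Ind2 C u v' → Ind2 C v v' → ⊥
  four {u} {v} {v'} mu mv mv' nu@(w , mw , dw) nv nv' h h' i i' i'' =
   let a , τ , ma , pa , va , t2 = move mu mv nu nv h i
       b , σ , mb , pb , vb , s2 = move mu mv' nu nv' h' i'
   in fin a τ ma pa va t2 b σ mb pb vb s2 where
   fin : ∀ a τ → a ∈ A → Pm C v a → Vary C x u a τ → ∣ τ ∣ ≡ 2 → ∀ b σ → b ∈ A → Pm C v' b → Vary C x u b σ → ∣ σ ∣ ≡ 2 → ⊥
   fin a τ ma pa va t2 b σ mb pb vb s2 = go (abs2 {τ} t2) (abs2 {σ} s2) where
    d2 : ∣ D C (x ∷ u ∷ w) ∣ ≡ 2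
    d2 = even-abs {C = C ⟋ mx} ev' (mu ∷ mw) dw
    same : τ ≡ σ → ⊥
    same refl = Pm-dep C {v} {v'} (Pm-trans C {v} {a} {v'} pa (Pm-trans C {a} {b} {v'} (inl ab) (Pm-sym C {v'} {b} pb))) i'' where
     ab : ∀ z → D C (b ∷ z) ≡ D C (a ∷ z)
     ab z = cancel-≡ {+ 2} _ _ (λ ()) (trans (at vb z) (sym (at va z)))
    -- Equal signs would give equal points, opposite signs an offset of 4.
    diff : ∣ σ - τ ∣ ≤ 2
    diff = vary-bound {C = C} {x} {a} {b} {σ - τ} {w} ma mb mw (vary-comp {C = C} {x} {u} {a} {b} {τ} {σ} va vb)
         (trans (cong ∣_∣ (vary-D {u} {a} {τ} w va)) d2)
    go : (τ ≡ + 2) ⊎ (τ ≡ - + 2) → (σ ≡ + 2) ⊎ (σ ≡ - + 2) → ⊥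
    go (inl p) (inl q) = same (trans p (sym q))
    go (inr p) (inr q) = same (trans p (sym q))
    go (inl p) (inr q) = four≰2 (subst₂ (λ s t → ∣ s - t ∣ ≤ 2) q p diff)
    go (inr p) (inl q) = four≰2 (subst₂ (λ s t → ∣ s - t ∣ ≤ 2) q p diff)

  module Lines {xs} (S : Split C mx xs) where
   open Split S
   sre = snd (simple-++ C zs simp)
   sr = fst (simple-++ C reps sre)
   se = snd (simple-++ C reps sre)
   cross = snd (snd (AP-++⁻ reps (ap sre)))
   rho-nz : ∀ {ρ} → ρ ∈ reps → Nz (C ⟋ mx) ρ
   rho-nz m = All-∈ (nz simp') m
   fulls : All (Full C x) (map fst exs)
   fulls = AllP.map⁺ (All.tabulate λ {p} m → let (ρ∈ , h) = All-∈ exs-par m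
                                                 my = All-∈ (mem se) (∈-map⁺ fst m)
                                                 ind = Ind2-sym C (All-∈ (All-∈ cross ρ∈) (∈-map⁺ fst m))
                                                 (v' , τ , mv , _ , va , t2) = move my (All-∈ (mem sr) ρ∈) (All-∈ exs-nz m) (rho-nz ρ∈) h ind
                        in v' , τ , mv , va , t2)
   one : ∀ {p q} → p ∈ exs → q ∈ exs → Ind2 C (fst p) (fst q) → Dec (Ind2 (C ⟋ mx) (fst p) (fst q)) → Ind2 (C ⟋ mx) (fst p) (fst q)
   one mp mq a (yes i) = i
   one mp mq a (no h) = let (ρ∈ , hρ) = All-∈ exs-par mp
                            mp' = ∈-map⁺ fst mp
                            mq' = ∈-map⁺ fst mq
                            cr = All-∈ cross ρ∈
              in ⊥-elim (four (All-∈ (mem se) mp') (All-∈ (mem se) mq') (All-∈ (mem sr) ρ∈)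
                (All-∈ exs-nz mp) (All-∈ exs-nz mq) (rho-nz ρ∈)
                h hρ a (Ind2-sym C (All-∈ cr mp')) (Ind2-sym C (All-∈ cr mq')))
   pairs : ∀ ps → (∀ {p} → p ∈ ps → p ∈ exs) → AllPairs (Ind2 C) (map fst ps) → AllPairs (Ind2 (C ⟋ mx)) (map fst ps)
   pairs [] _ [] = []
   pairs (p ∷ ps) sub (a ∷ aps) = AllP.map⁺ (All.tabulate (λ {q} mq → one (sub (here refl)) (sub (there mq)) (All-∈ a (∈-map⁺ fst mq)) (Ind2? (C ⟋ mx) (fst p) (fst q))))
    ∷ pairs ps (λ m → sub (there m)) aps
   lines : List V
   lines = map fst exs
   lines-ap : AllPairs (Ind2 (C ⟋ mx)) lines
   lines-ap = pairs exs (λ m → m) (ap se)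
   lines-mem : Ms lines
   lines-mem = mem se
   lines-nz : All (Nz (C ⟋ mx)) lines
   lines-nz = AllP.map⁺ exs-nz

  -- the lines through x are independent
  lines≤ : ∀ {xs} (S : Split C mx xs) → length (Split.exs S) ≤ n
  lines≤ S = ≤-trans (≤-reflexive (sym (length-map fst (Split.exs S))))
    (full-independent C mx ev' lines lines-mem lines-nz fulls lines-ap)
   where open Lines S

 -- Heller's bound for unimodular matrices, with all minors doubled. Contracting `x` loses `x`
 -- itself and one point for each line with a surplus point, at most `n` in number.
 heller : ∀ n (C : Config n) → Even C → ∀ {xs} → Simple C xs → length xs ≤ tri n
 heller n C ev {[]} s = z≤n
 heller zero C ev {x ∷ xs} s with nz s
 ... | (z , _ , ne) ∷ _ with rank C _ ne
 ...   | ()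
 heller (suc n) C ev {x ∷ xs} s = go (mem s) (nz s) where
  go : Ms (x ∷ xs) → All (Nz C) (x ∷ xs) → suc (length xs) ≤ tri (suc n)
  go (mx ∷ _) (nx ∷ _) = fin (split C mx nx s) where
   fin : Split C mx (x ∷ xs) → suc (length xs) ≤ tri (suc n)
   fin S = ≤-trans (split-length S) (s≤s (≤-trans (≤-reflexive (ℕP.+-comm (length (Split.reps S)) (length (Split.exs S))))
    (+-mono-≤ (lines≤ C ev mx S) (heller n (C ⟋ mx) (λ mz → ev (mx ∷ mz)) (Split.simp' S)))))

 cyc : ∀ {n} (C : Config n) a b c z → D C (a ∷ b ∷ c ∷ z) ≡ D C (c ∷ a ∷ b ∷ z)
 cyc C a b c z = trans (alt C (a ∷ []) b c z) (trans (cong -_ (alt C [] a c (b ∷ z))) (neg-involutive _))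

 neg-ind : ∀ {n} (F : Config n) {x y y'} → (y' ≡ y ⊎ y' ≡ neg y) → ¬ Ind2 F x y → ¬ Ind2 F x y'
 neg-ind F (inl refl) h = h
 neg-ind F {x} {y} (inr refl) h i = h (Pm-ind F {x} {neg y} {y} (Pm-sym F {y} {neg y} (Pm-neg F y)) i)

 eq-dep : ∀ {n} (F : Config n) {x y} → (∀ z → D F (y ∷ z) ≡ D F (x ∷ z)) → ∀ z → D F (x ∷ y ∷ z) ≡ + 0
 eq-dep F {x} {y} h z = trans (alt F [] x y z) (cong -_ (trans (h (x ∷ z)) (D-twice F x z)))

 vary-same : ∀ {n} (C : Config (suc n)) {e x y τ} (me : e ∈ A) → Vary C e x y τ → ∀ w → D C (e ∷ y ∷ w) ≡ D C (e ∷ x ∷ w)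
 vary-same C {e} {x} {y} {τ} me va w = cancel-≡ {+ 2} _ _ (λ ()) (trans (at (vary-con C me va) w)
    (trans (cong (λ t → + 2 * D C (e ∷ x ∷ w) + τ * t) (D-twice C e w)) (l (D C (e ∷ x ∷ w)) τ))) where
  l = ring-49

 vary-2 : ∀ {n} {C : Config n} {e x y y' τ σ} → Vary C e x y τ → Vary C e y y' σ → Vary C e x y' (σ - - τ)
 vary-2 p q = vary-comp (vary-sym p) q

 -- A single heavy vector: parallelograms

 module _ {N} (C : Config (suc (suc N))) {e} (me : e ∈ A) (ev : Even (C ⟋ me)) where

  private
   E = C ⟋ me

  -- The obstruction to counting through `κ`: a parallelogram p, p + κ, q, q + κ with q - p equal to
  -- e/2 or e, and with e, p, κ independent.
  record Bad (κ : V) : Set where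
   field
    {p q p' q'} : V
    {λe} : ℤ
    p∈   : p ∈ A
    q∈   : q ∈ A
    p'∈  : p' ∈ A
    q'∈  : q' ∈ A
    pq   : Vary C e p q λe
    pos  : λe ≡ + 1 ⊎ λe ≡ + 2
    pp'  : Vary C κ p p' (+ 2)
    qq'  : Vary C κ q q' (+ 2)
    w    : List V
    mw   : Ms w
    d2   : ∣ D C (e ∷ p ∷ κ ∷ w) ∣ ≡ 2

  -- In doubled coordinates with respect to e, p, κ, the vectors p + κ, q and κ + e have a
  -- determinant of absolute value 4λ + 8, where λ is 1 or 2; the limit is 8.
  full-bad : ∀ {κ κ⁺} → κ ∈ A → κ⁺ ∈ A → Vary C e κ κ⁺ (+ 2) → Bad κ → ⊥
  full-bad {κ} {κ⁺} mκ mκ⁺ vκ B = go pos pq where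
   open Bad B
   r1 : ∀ y a b c → + 2 * y ≡ + 2 * b + + 2 * c → + 2 * y ≡ + 0 * a + (+ 2 * b + (+ 2 * c + + 0))
   r1 y a b c h = trans h (l a b c) where
    l = ring-50
   r2 : ∀ t y a b c → + 2 * y ≡ + 2 * b + t * a → + 2 * y ≡ t * a + (+ 2 * b + (+ 0 * c + + 0))
   r2 t y a b c h = trans h (l t a b c) where
    l = ring-51
   r3 : ∀ y a b c → + 2 * y ≡ + 2 * c + + 2 * a → + 2 * y ≡ + 2 * a + (+ 0 * b + (+ 2 * c + + 0))
   r3 y a b c h = trans h (l a b c) where
    l = ring-52
   cols : ℤ → Cols
   cols t = (e , + 0 ∷ t ∷ + 2 ∷ []) ∷ (p , + 2 ∷ + 2 ∷ + 0 ∷ []) ∷ (κ , + 2 ∷ + 0 ∷ + 2 ∷ []) ∷ []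
   bd : ∀ t → Vary C e p q t → ∣ detP 3 (cols t) ∣ ≤ 8
   bd t v = det-bound C (p' ∷ q ∷ κ⁺ ∷ []) (cols t) {w} refl
    ((λ z → r1 (D C (p' ∷ z)) (D C (e ∷ z)) (D C (p ∷ z)) (D C (κ ∷ z)) (at pp' z)) ,
     (λ z → r2 t (D C (q ∷ z)) (D C (e ∷ z)) (D C (p ∷ z)) (D C (κ ∷ z)) (at v z)) ,
     (λ z → r3 (D C (κ⁺ ∷ z)) (D C (e ∷ z)) (D C (p ∷ z)) (D C (κ ∷ z)) (at vκ z)) , tt)
    (p'∈ ∷ q∈ ∷ mκ⁺ ∷ []) mw d2
   go : λe ≡ + 1 ⊎ λe ≡ + 2 → Vary C e p q λe → ⊥
   go (inl refl) v = ≤⇒≤ᵇ (bd (+ 1) v)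
   go (inr refl) v = ≤⇒≤ᵇ (bd (+ 2) v)

  module _ {κ} (mκ : κ ∈ A) where

   private
    F = E ⟋ mκ
    evF : Even F
    evF mz = ev (mκ ∷ mz)

   -- A pair p, p + κ that consists of `x` and `ρ` up to signs and order, with the sign of `p`
   -- adjusted to `x` modulo `e` and `κ`.
   record NPair (x ρ : V) : Set where
    field
     {p p⁺} : V
     p∈   : p ∈ A
     p⁺∈  : p⁺ ∈ A
     pp   : Vary C κ p p⁺ (+ 2)
     cov  : (Pm C p x × Pm C p⁺ ρ) ⊎ (Pm C p ρ × Pm C p⁺ x)
     same : ∀ z → D F (p ∷ z) ≡ D F (x ∷ z)
     fl   : Full E κ x

   -- The offset along `κ` is given by a minor containing `e`, so it is even; being nonzero, it is
   -- ±2.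
   npair : ∀ {x ρ} → x ∈ A → ρ ∈ A → Nz F x → Nz F ρ → ¬ Ind2 (C ⟋ mκ) x ρ → Ind2 C x ρ → NPair x ρ
   npair {x} {ρ} mx mρ nx@(w , mw , dw) nρ h ind = fin (align C {F} evF mx mρ nx nρ hF) where
    hF : ¬ Ind2 F x ρ
    hF (z , mz , ne) = h (e ∷ z , me ∷ mz , λ e0 → ne (trans (sym (trans (alt C (κ ∷ x ∷ []) ρ e z) (cong -_ (trans (cyc C κ x e (ρ ∷ z)) refl)))) e0 ⨾ lem)) where
     _⨾_ : ∀ {a : Set} {b : Set} → a → (a → b) → b
     a ⨾ f = f a
     lem : - D C (e ∷ κ ∷ x ∷ ρ ∷ z) ≡ + 0 → D C (e ∷ κ ∷ x ∷ ρ ∷ z) ≡ + 0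
     lem p = trans (sym (neg-involutive _)) (cong -_ p)
    fin : (∃ λ ρ' → ρ' ∈ A × Pm C ρ ρ' × (∀ z → D F (ρ' ∷ z) ≡ D F (x ∷ z)) × (ρ' ≡ ρ ⊎ ρ' ≡ neg ρ)) → NPair x ρ
    fin (ρ' , mρ' , pm , eqF , or) = fin2 (offset {C = C} {κ} {x} {ρ'} {e ∷ w} (me ∷ mw) d2 eqd dep) where
     d2 : ∣ D C (κ ∷ x ∷ e ∷ w) ∣ ≡ 2
     d2 = trans (cong ∣_∣ (cyc C κ x e w)) (even-abs {C = F} evF (mx ∷ mw) dw)
     eqd : D C (κ ∷ ρ' ∷ e ∷ w) ≡ D C (κ ∷ x ∷ e ∷ w)
     eqd = trans (cyc C κ ρ' e w) (trans (eqF w) (sym (cyc C κ x e w)))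
     dep : ∀ {z} → Ms z → D C (κ ∷ x ∷ ρ' ∷ z) ≡ + 0
     dep mz = ¬NzL (C ⟋ mκ) (neg-ind (C ⟋ mκ) or h) mz
     fin2 : (∃ λ τ → Vary C κ x ρ' τ × ∣ τ ∣ ≡ ∣ D C (ρ' ∷ x ∷ e ∷ w) ∣) → NPair x ρ
     fin2 (τ , va , eqτ) = fin3 (abs2 {τ} (trans eqτ (even-val par0 (bdd C (mρ' ∷ mx ∷ me ∷ mw)) ne0))) va where
      par0 : par (D C (ρ' ∷ x ∷ e ∷ w)) ≡ false
      par0 = trans (cong par (cyc C ρ' x e w)) (ev (mρ' ∷ mx ∷ mw))
      ne0 : 0≢ (D C (ρ' ∷ x ∷ e ∷ w))
      ne0 e0 = offset-≢0 {C = C} (Pm-ind C {x} {ρ} {ρ'} pm ind) va (∣i∣≡0⇒i≡0 (trans eqτ (cong ∣_∣ e0)))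
      fin3 : (τ ≡ + 2) ⊎ (τ ≡ - + 2) → Vary C κ x ρ' τ → NPair x ρ
      fin3 (inl refl) v = record { p∈ = mx ; p⁺∈ = mρ' ; pp = v ; cov = inl (Pm-refl C , Pm-sym C {ρ} {ρ'} pm) ; same = λ _ → refl ; fl = ρ' , + 2 , mρ' , vary-con C me v , refl }
      fin3 (inr refl) v = record { p∈ = mρ' ; p⁺∈ = mx ; pp = vary-sym v ; cov = inr (Pm-sym C {ρ} {ρ'} pm , Pm-refl C) ; same = eqF ; fl = ρ' , - + 2 , mρ' , vary-con C me v , refl }

   vary-F : ∀ {p p⁺ τ} → Vary C κ p p⁺ τ → ∀ z → D F (p⁺ ∷ z) ≡ D F (p ∷ z)
   vary-F v = vary-same E mκ (vary-con C me v)

   -- two parallel displacements by κ in the same class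
   collide : ∀ {p p⁺ q q⁺ w} → p ∈ A → p⁺ ∈ A → q ∈ A → q⁺ ∈ A → Ms w → ∣ D F (p ∷ w) ∣ ≡ 2 →
        Vary E κ p p⁺ (+ 2) → Vary E κ q q⁺ (+ 2) → (∀ z → D F (q ∷ z) ≡ D F (p ∷ z)) →
        ∃ λ τ → Vary C e p q τ × ∣ τ ∣ ≤ 2
   collide {p} {p⁺} {q} {q⁺} {w} mp mp⁺ mq mq⁺ mw d2 vp vq eqF = fin (offset {C = E} {κ} {p} {q} {w} mw d2 (eqF w) (λ {z} _ → eq-dep F eqF z)) where
    fin : (∃ λ τ → Vary E κ p q τ × ∣ τ ∣ ≡ ∣ D E (q ∷ p ∷ w) ∣) → _
    fin (σ , v , eqσ) = go (small σ (≤-trans (≤-reflexive eqσ) (bdd E (mq ∷ mp ∷ mw)))) v (trans (cong odd eqσ) (ev (mq ∷ mp ∷ mw))) where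
     go : ∀ {σ} → Small σ → Vary E κ p q σ → odd ∣ σ ∣ ≡ false → ∃ λ τ → Vary C e p q τ × ∣ τ ∣ ≤ 2
     go sp1 v ()
     go sm1 v ()
     -- An offset ±2 along `κ` would put `q⁺` or `p⁺` at offset 4. With offset 0 the two vectors
     -- agree modulo `e`, and their difference is a multiple of e/2.
     go sp2 v _ = ⊥-elim (four≰2 (vary-bound {C = E} {κ} {p} {q⁺} {+ 4} {w} mp mq⁺ mw (vary-2 v vq) d2))
     go sm2 v _ = ⊥-elim (four≰2 (vary-bound {C = E} {κ} {q} {p⁺} {+ 4} {w} mq mp⁺ mw (vary-comp v vp) (trans (cong ∣_∣ (eqF w)) d2)))
     go sz0 v _ = fin2 (offset {C = C} {e} {p} {q} {κ ∷ w} (mκ ∷ mw) d2' (eqE (κ ∷ w)) (λ {z} _ → eq-dep E eqE z)) where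
      eqE : ∀ z → D E (q ∷ z) ≡ D E (p ∷ z)
      eqE = vary-0 {C = E} {κ} v
      d2' : ∣ D C (e ∷ p ∷ κ ∷ w) ∣ ≡ 2
      d2' = trans (perm-abs C (↭-prep e (↭-swap p κ ↭-refl))) d2
      fin2 : (∃ λ τ → Vary C e p q τ × ∣ τ ∣ ≡ ∣ D C (q ∷ p ∷ κ ∷ w) ∣) → _
      fin2 (τ , v , eqτ) = τ , v , ≤-trans (≤-reflexive eqτ) (bdd C (mq ∷ mp ∷ mκ ∷ mw))

   -- If the two pairs were equal, x̃ would be `x` or `ρ` up to sign, against independence. So their
   -- distance along `e` is nonzero, and its sign decides which pair comes first.
   finish-bad : ∀ {x ρ x̃ w} (P : NPair x ρ) → Ind2 C x x̃ → Ind2 C ρ x̃ → Ms w → ∣ D F (NPair.p P ∷ w) ∣ ≡ 2 →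
       ∀ {q q⁺} → q ∈ A → q⁺ ∈ A → Vary C κ q q⁺ (+ 2) → (∀ z → D F (q ∷ z) ≡ D F (NPair.p P ∷ z)) → Pm C q x̃ ⊎ Pm C q⁺ x̃ → Bad κ
   finish-bad {x} {ρ} {x̃} {w} P i1 i2 mw d2 {q} {q⁺} mq mq⁺ vq eqF cv = fin (collide p∈ p⁺∈ mq mq⁺ mw d2 (vary-con C me pp) (vary-con C me vq) eqF) where
    open NPair P
    d2' : ∀ {y} → (∀ z → D F (y ∷ z) ≡ D F (p ∷ z)) → ∣ D C (e ∷ y ∷ κ ∷ w) ∣ ≡ 2
    d2' {y} h = trans (perm-abs C (↭-prep e (↭-swap y κ ↭-refl))) (trans (cong ∣_∣ (h w)) d2)
    equal : (∀ z → D C (q ∷ z) ≡ D C (p ∷ z)) → ⊥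
    equal h = no-x (one cv) where
     h⁺ : ∀ z → D C (q⁺ ∷ z) ≡ D C (p⁺ ∷ z)
     h⁺ z = cancel-≡ {+ 2} _ _ (λ ()) (trans (at vq z) (trans (cong (λ t → + 2 * t + + 2 * D C (κ ∷ z)) (h z)) (sym (at pp z))))
     one : Pm C q x̃ ⊎ Pm C q⁺ x̃ → Pm C p x̃ ⊎ Pm C p⁺ x̃
     one (inl a) = inl (Pm-trans C {p} {q} {x̃} (inl h) a)
     one (inr a) = inr (Pm-trans C {p⁺} {q⁺} {x̃} (inl h⁺) a)
     both : ∀ {y u} → Pm C y u → Pm C y x̃ → Ind2 C u x̃ → ⊥
     both {y} {u} a b i = Pm-dep C {u} {x̃} (Pm-trans C {u} {y} {x̃} (Pm-sym C {y} {u} a) b) i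
     no-x : Pm C p x̃ ⊎ Pm C p⁺ x̃ → ⊥
     no-x (inl a) = oneof cov where
      oneof : (Pm C p x × Pm C p⁺ ρ) ⊎ (Pm C p ρ × Pm C p⁺ x) → ⊥
      oneof (inl (b , _)) = both {p} {x} b a i1
      oneof (inr (b , _)) = both {p} {ρ} b a i2
     no-x (inr a) = oneof cov where
      oneof : (Pm C p x × Pm C p⁺ ρ) ⊎ (Pm C p ρ × Pm C p⁺ x) → ⊥
      oneof (inl (_ , b)) = both {p⁺} {ρ} b a i2
      oneof (inr (_ , b)) = both {p⁺} {x} b a i1
    fin : (∃ λ t → Vary C e p q t × ∣ t ∣ ≤ 2) → Bad κ
    fin (t , v , b) = go (small t b) v where
     ahead : ∀ {t} → Vary C e p q t → t ≡ + 1 ⊎ t ≡ + 2 → Bad κ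
     ahead v po = record { p∈ = p∈ ; q∈ = mq ; p'∈ = p⁺∈ ; q'∈ = mq⁺ ; pq = v ; pos = po ; pp' = pp ; qq' = vq ; w = w ; mw = mw ; d2 = d2' (λ _ → refl) }
     behind : ∀ {t} → Vary C e q p t → t ≡ + 1 ⊎ t ≡ + 2 → Bad κ
     behind v po = record { p∈ = mq ; q∈ = p∈ ; p'∈ = mq⁺ ; q'∈ = p⁺∈ ; pq = v ; pos = po ; pp' = vq ; qq' = pp ; w = w ; mw = mw ; d2 = d2' eqF }
     go : ∀ {t} → Small t → Vary C e p q t → Bad κ
     go sz0 v = ⊥-elim (equal (vary-0 {C = C} {e} v))
     go sp1 v = ahead v (inl refl)
     go sp2 v = ahead v (inr refl)
     go sm1 v = behind (vary-sym v) (inl refl)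
     go sm2 v = behind (vary-sym v) (inr refl)

   -- Vectors of one class agree up to sign. If the signs differ, the second pair is negated, which
   -- also exchanges its ends.
   bad-from : ∀ {x ρ x̃ ρ̃} → x ∈ A → x̃ ∈ A → Nz F x → Nz F x̃ → NPair x ρ → NPair x̃ ρ̃ → ¬ Ind2 F x x̃ → Ind2 C x x̃ → Ind2 C ρ x̃ → Bad κ
   bad-from {x} {ρ} {x̃} {ρ̃} mx mx̃ nx@(w , mw , dw) nx̃ P Q h i1 i2 = go (even-parallel {C = F} evF mx mx̃ nx nx̃ h) where
    module P = NPair P
    module Q = NPair Q
    d2 : ∣ D F (P.p ∷ w) ∣ ≡ 2
    d2 = trans (cong ∣_∣ (P.same w)) (even-abs {C = F} evF (mx ∷ mw) dw)
    pick : ∀ {X Y Z W : Set} → (X × Y) ⊎ (Z × W) → X ⊎ W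
    pick (inl (a , _)) = inl a
    pick (inr (_ , b)) = inr b
    flipn : Pm C Q.p x̃ ⊎ Pm C Q.p⁺ x̃ → Pm C (neg Q.p⁺) x̃ ⊎ Pm C (neg Q.p) x̃
    flipn (inl a) = inr (Pm-trans C {neg Q.p} {Q.p} {x̃} (Pm-sym C {Q.p} {neg Q.p} (Pm-neg C Q.p)) a)
    flipn (inr a) = inl (Pm-trans C {neg Q.p⁺} {Q.p⁺} {x̃} (Pm-sym C {Q.p⁺} {neg Q.p⁺} (Pm-neg C Q.p⁺)) a)
    go : _ → Bad κ
    go (inl pos) = finish-bad P i1 i2 mw d2 Q.p∈ Q.p⁺∈ Q.pp (λ z → trans (Q.same z) (trans (pos z) (sym (P.same z)))) (pick Q.cov)
    go (inr opp) = finish-bad P i1 i2 mw d2 (neg∈ Q.p⁺∈) (neg∈ Q.p∈) (vary-sym (vary-neg Q.pp))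
     (λ z → trans (D-neg F Q.p⁺ z) (trans (cong -_ (trans (vary-F Q.pp z) (trans (Q.same z) (opp z)))) (trans (neg-involutive _) (sym (P.same z)))))
     (flipn (pick Q.cov))

 length≤2 : ∀ {X : Set} {R : X → X → Set} (zs : List X) → AllPairs R zs →
       (∀ {x y z} → x ∈ zs → y ∈ zs → z ∈ zs → R x y → R x z → R y z → ⊥) → length zs ≤ 2
 length≤2 [] _ _ = z≤n
 length≤2 (_ ∷ []) _ _ = s≤s z≤n
 length≤2 (_ ∷ _ ∷ []) _ _ = s≤s (s≤s z≤n)
 length≤2 (x ∷ y ∷ z ∷ zs) ((a ∷ b ∷ _) ∷ (c ∷ _) ∷ _) h = ⊥-elim (h (here refl) (there (here refl)) (there (there (here refl))) a b c)

 Shifted : ∀ {n} → Config n → V → V → V → Set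
 Shifted C e κ q = ∃₂ λ q' τ → q' ∈ A × Pm C q q' × Vary C e κ q' τ × 0≢ τ × ∣ τ ∣ ≤ 2

 -- Vectors parallel in the even contraction agree there up to sign, so they differ by a multiple of
 -- e/2, which is nonzero by independence.
 shifted : ∀ {n} (C : Config (suc n)) {e} (me : e ∈ A) → Even (C ⟋ me) → ∀ {κ q} → κ ∈ A → q ∈ A → Nz (C ⟋ me) κ → Nz (C ⟋ me) q →
      ¬ Ind2 (C ⟋ me) κ q → Ind2 C κ q → Shifted C e κ q
 shifted C {e} me ev {κ} {q} mκ mq nκ@(w , mw , dw) nq hE ic = fin (align C {C ⟋ me} ev mκ mq nκ nq hE) where
  E = C ⟋ me
  fin : (∃ λ q' → q' ∈ A × Pm C q q' × (∀ z → D E (q' ∷ z) ≡ D E (κ ∷ z)) × (q' ≡ q ⊎ q' ≡ neg q)) → Shifted C e κ q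
  fin (q' , mq' , pm , eqE , _) = fin2 (offset {C = C} {e} {κ} {q'} mw (even-abs {C = E} ev (mκ ∷ mw) dw) (eqE w) (λ {z} _ → eq-dep E eqE z)) where
   fin2 : (∃ λ τ → Vary C e κ q' τ × ∣ τ ∣ ≡ ∣ D C (q' ∷ κ ∷ w) ∣) → Shifted C e κ q
   fin2 (τ , v , eqτ) = q' , τ , mq' , pm , v , offset-≢0 {C = C} (Pm-ind C {κ} {q} {q'} pm ic) v ,
    ≤-trans (≤-reflexive eqτ) (bdd C (mq' ∷ mκ ∷ mw))

 shifted-clash : ∀ {n} (C : Config (suc n)) {e} (me : e ∈ A) {κ w} → Ms w → ∣ D C (e ∷ κ ∷ w) ∣ ≡ 2 →
  ∀ {u u' v v' s t} → u' ∈ A → v' ∈ A → Pm C u u' → Pm C v v' → Vary C e κ u' s → Vary C e κ v' t → Ind2 C u v → ¬ So (clash s t)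
 shifted-clash C {e} me {κ} {w} mw d2 {u} {u'} {v} {v'} {s} {t} mu mv pu pv vu vv ind =
   clash-⊥ s t ne' (vary-bound {C = C} {e} {u'} {v'} {t - s} {w} mu mv mw (vary-comp vu vv) (trans (cong ∣_∣ (vary-same C me vu w)) d2)) where
  ne' : s ≢ t
  ne' refl = Pm-dep C {u} {v} (Pm-trans C {u} {u'} {v} pu (Pm-trans C {u'} {v'} {v} (inl (λ z → cancel-≡ {+ 2} _ _ (λ ()) (trans (at vv z) (sym (at vu z))))) (Pm-sym C {v} {v'} pv))) ind

 -- Together with `κ` these would be four points of one line through `e`, with no room for their
 -- offsets.
 three-shifted : ∀ {n} (C : Config (suc n)) {e} (me : e ∈ A) {κ w} → Ms w → ∣ D C (e ∷ κ ∷ w) ∣ ≡ 2 →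
  ∀ {x y z} → Shifted C e κ x → Shifted C e κ y → Shifted C e κ z → Ind2 C x y → Ind2 C x z → Ind2 C y z → ⊥
 three-shifted C {e} me {κ} {w} mw d2 {x} {y} {z} (x' , a , mx , px , vx , a0 , a2) (y' , b , my , py , vy , b0 , b2) (z' , c , mz , pz , vz , c0 , c2) i j k
  = fin3 (T-∨ {clash a b} (All-∈ (All-∈ (All-∈ three-offsets (small-∈ (small a a2) a0)) (small-∈ (small b b2) b0)) (small-∈ (small c c2) c0))) where
  fin3 : So (clash a b) ⊎ So (clash a c ∨ clash b c) → ⊥
  fin3 (inl h) = shifted-clash C me {κ} {w} mw d2 {x} {x'} {y} {y'} mx my px py vx vy i h
  fin3 (inr h) with T-∨ {clash a c} h
  ... | inl h' = shifted-clash C me {κ} {w} mw d2 {x} {x'} {z} {z'} mx mz px pz vx vz j h'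
  ... | inr h' = shifted-clash C me {κ} {w} mw d2 {y} {y'} {z} {z'} my mz py pz vy vz k h'

 -- Counting by contraction of a second vector

 module _ {N} (C : Config (suc (suc N))) {e} (me : e ∈ A) (ev : Even (C ⟋ me)) (ne : Nz C e) where

  private
   E = C ⟋ me

  module _ {κ} (mκ : κ ∈ A) (nκ : Nz E κ) where

   private
    F = E ⟋ mκ
    evF : Even F
    evF mz = ev (mκ ∷ mz)
    nκC : Nz C κ
    nκC = let (z , mz , d) = nκ in e ∷ z , me ∷ mz , perm-≢ C (↭-swap e κ ↭-refl) d

   -- In the plane of `e` and `κ` there is at most one multiple of `e`, and at most two vectors are
   -- displaced from `κ` along `e`. The last hypothesis excludes multiples of `κ`.
   plane≤3 : ∀ {P} → Simple C P → All (λ x → ¬ Nz F x) P → All (Nz (C ⟋ mκ)) P → length P ≤ 3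
   plane≤3 {P} s hF hc = fin (divide (λ x → Nz? E x) P) where
    fin : (∃₂ λ as bs → P ↭ as ++ bs × All (Nz E) as × All (λ x → ¬ Nz E x) bs) → length P ≤ 3
    fin (as , bs , pm , na , nb) = ≤-trans (≤-reflexive (trans (↭-length pm) (length-++ as)))
      (+-mono-≤ {x = length as} {y = 2} as≤2 bs≤1) where
     sp = simple-++ C as (simple-resp C pm s)
     hF' = All-resp-↭ pm hF
     hc' = All-resp-↭ pm hc
     bs≤1 : length bs ≤ 1
     bs≤1 = length≤1 (ap (snd sp)) (λ a b → parallel-e C me ne (All-∈ nb a) (All-∈ nb b))
     get : ∀ {q} → q ∈ as → Shifted C e κ q
     get m = shifted C me ev mκ (All-∈ (mem (fst sp)) m) nκ (All-∈ na m) (All-∈ hF' (∈-++⁺ˡ m)) (All-∈ hc' (∈-++⁺ˡ m))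
     w = fst nκ
     mw = fst (snd nκ)
     d2 : ∣ D C (e ∷ κ ∷ w) ∣ ≡ 2
     d2 = even-abs {C = E} ev (mκ ∷ mw) (snd (snd nκ))
     as≤2 : length as ≤ 2
     as≤2 = length≤2 as (ap (fst sp)) λ mx my mz i j k → three-shifted C me {κ} {w} mw d2 (get mx) (get my) (get mz) i j k

   F⇒κ : ∀ {x} → Nz F x → Nz (C ⟋ mκ) x
   F⇒κ {x} (z , mz , d) = e ∷ z , me ∷ mz , λ e0 → d (trans (sym (cyc C κ x e z)) e0)

   -- Each surplus point gives a pair at distance `κ`. If the classes modulo `e` and `κ` are
   -- pairwise independent, the rank bounds their number; otherwise two pairs share a class and form
   -- a parallelogram.
   extras-out : ∀ {R} (S : Split C mκ R) → All (Nz F) R → Bad C me ev κ ⊎ length (Split.exs S) ≤ N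
   extras-out {R} S nR = fin (classify (λ p q → Ind2? F (fst p) (fst q)) exs) where
    open Split S
    nR' = All-resp-↭ perm nR
    sre = snd (simple-++ C zs simp)
    sr = fst (simple-++ C reps sre)
    se = snd (simple-++ C reps sre)
    cross = snd (snd (AP-++⁻ reps (ap sre)))
    nre = snd (AllP.++⁻ zs nR')
    nF-r : ∀ {ρ} → ρ ∈ reps → Nz F ρ
    nF-r m = All-∈ nre (∈-++⁺ˡ m)
    nF-x : ∀ {p} → p ∈ exs → Nz F (fst p)
    nF-x m = All-∈ nre (∈-++⁺ʳ reps (∈-map⁺ fst m))
    m-x : ∀ {p} → p ∈ exs → fst p ∈ A
    m-x m = All-∈ (mem se) (∈-map⁺ fst m)
    ind-ρ : ∀ {p ρ} → p ∈ exs → ρ ∈ reps → Ind2 C ρ (fst p)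
    ind-ρ mp mρ = All-∈ (All-∈ cross mρ) (∈-map⁺ fst mp)
    np : ∀ {p} → p ∈ exs → NPair C me ev mκ (fst p) (snd p)
    np m = let (mρ , h) = All-∈ exs-par m in
     npair C me ev mκ (m-x m) (All-∈ (mem sr) mρ) (nF-x m) (nF-r mρ) h (Ind2-sym C (ind-ρ m mρ))
    apx : AllPairs (λ p q → Ind2 C (fst p) (fst q)) exs
    apx = AllPairsP.map⁻ (ap se)
    fin : (∃₂ λ vs rs → exs ↭ vs ++ map fst rs × AllPairs (λ p q → Ind2 F (fst p) (fst q)) vs ×
        All (λ p → snd p ∈ vs × ¬ Ind2 F (fst (fst p)) (fst (snd p))) rs) → Bad C me ev κ ⊎ length exs ≤ N
    fin (vs , [] , pm , apv , _) = inr (≤-trans (≤-reflexive (trans (↭-length pm') (sym (length-map fst vs))))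
      (full-independent E mκ evF (map fst vs) (AllP.map⁺ (All.tabulate (λ m → m-x (back m)))) (AllP.map⁺ (All.tabulate (λ m → nF-x (back m))))
       (AllP.map⁺ (All.tabulate (λ m → NPair.fl (np (back m))))) (AllPairsP.map⁺ apv))) where
     pm' : exs ↭ vs
     pm' = subst (exs ↭_) (++-identityʳ vs) pm
     back : ∀ {p} → p ∈ vs → p ∈ exs
     back m = ∈-resp-↭ (↭-sym pm') m
    fin (vs , (q , p) ∷ rs , pm , apv , (mp , h) ∷ _) = inl (bad-from C me ev mκ (m-x pe) (m-x qe) (nF-x pe) (nF-x qe) (np pe) (np qe)
      (λ i → h (Ind2-sym F i)) (All-∈ (All-∈ cr mp) (here refl)) (ind-ρ qe (fst (All-∈ exs-par pe)))) where
     pe : p ∈ exs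
     pe = ∈-resp-↭ (↭-sym pm) (∈-++⁺ˡ mp)
     qe : q ∈ exs
     qe = ∈-resp-↭ (↭-sym pm) (∈-++⁺ʳ vs (here refl))
     cr = snd (snd (AP-++⁻ vs (AP-resp (λ {x} {y} → Ind2-sym C) pm apx)))

   module _ (IH : ∀ {ys} → Simple (C ⟋ mκ) ys → length ys ≤ f1 N) where

    -- The plane may contain four points although the increment has room for three. But if it
    -- contains a point other than `κ`, this point survives the contraction in a class of its own,
    -- which keeps `r` one below its bound.
    count : ∀ a1 a0 r x → a1 ≤ 3 → a0 ≤ 1 → x ≤ N → (a1 ≡ 0 × r ≤ f1 N) ⊎ (suc r ≤ f1 N) → (r ℕ.+ x) ℕ.+ (a1 ℕ.+ a0) ≤ f1 (suc N)
    count a1 a0 r x h1 h0 hx c = ≤-trans (go c) (≤-reflexive (sym (f1-suc N))) where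
     open ℕP.≤-Reasoning
     go : _ → (r ℕ.+ x) ℕ.+ (a1 ℕ.+ a0) ≤ f1 N ℕ.+ (3 ℕ.+ N)
     go (inl (refl , hr)) = begin
      (r ℕ.+ x) ℕ.+ a0 ≡⟨ +-assoc r x a0 ⟩
      r ℕ.+ (x ℕ.+ a0) ≤⟨ +-mono-≤ hr (+-mono-≤ hx (≤-trans h0 (s≤s z≤n))) ⟩
      f1 N ℕ.+ (N ℕ.+ 3) ≡⟨ cong (f1 N ℕ.+_) (ℕP.+-comm N 3) ⟩
      f1 N ℕ.+ (3 ℕ.+ N) ∎
     go (inr hr) = begin
      (r ℕ.+ x) ℕ.+ (a1 ℕ.+ a0) ≤⟨ +-mono-≤ (+-monoʳ-≤ r hx) (+-mono-≤ h1 h0) ⟩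
      (r ℕ.+ N) ℕ.+ 4 ≡⟨ +-suc (r ℕ.+ N) 3 ⟩
      suc r ℕ.+ N ℕ.+ 3 ≤⟨ +-monoˡ-≤ 3 (+-monoˡ-≤ N hr) ⟩
      f1 N ℕ.+ N ℕ.+ 3 ≡⟨ trans (+-assoc (f1 N) N 3) (cong (f1 N ℕ.+_) (ℕP.+-comm N 3)) ⟩
      f1 N ℕ.+ (3 ℕ.+ N) ∎

    -- Contracting `κ` makes a vector of the plane parallel to `e`, while `ρ` is independent of `e`
    -- and `κ` together.
    plane-ind : ∀ {p ρ} → p ∈ A → ¬ Nz F p → Nz (C ⟋ mκ) p → Nz F ρ → Ind2 (C ⟋ mκ) p ρ
    plane-ind {p} {ρ} mp hp (u , mu , du) (w , mw , dw) = w , mw , λ e0 → *≢0 du dρ (trans (spanned K e (p ∷ []) u mu dep (ρ ∷ w))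
      (trans (cong (λ t → D C (κ ∷ e ∷ u) * t + + 0) e0) (l (D C (κ ∷ e ∷ u))))) where
     K = C ⟋ mκ
     l = ring-53
     dρ : 0≢ (D C (κ ∷ e ∷ ρ ∷ w))
     dρ = perm-≢ C (↭-swap e κ ↭-refl) dw
     dep : ∀ {z} → Ms z → D C (κ ∷ e ∷ p ∷ z) ≡ + 0
     dep mz = perm-0 C (↭-swap e κ ↭-refl) (¬NzL F hp mz)

    bound-κ : ∀ {xs} → Simple C xs → Bad C me ev κ ⊎ length xs ≤ f1 (suc N)
    bound-κ {xs} s = fin (divide (λ x → Nz? F x) xs) where
     fin : (∃₂ λ R P → xs ↭ R ++ P × All (Nz F) R × All (λ x → ¬ Nz F x) P) → Bad C me ev κ ⊎ length xs ≤ f1 (suc N)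
     fin (R , P , pm , nR , hP) = fin2 (divide (λ x → Nz? (C ⟋ mκ) x) P) where
      sRP = simple-resp C pm s
      sR = fst (simple-++ C R sRP)
      sP = snd (simple-++ C R sRP)
      fin2 : (∃₂ λ P1 P0 → P ↭ P1 ++ P0 × All (Nz (C ⟋ mκ)) P1 × All (λ x → ¬ Nz (C ⟋ mκ) x) P0) → _
      fin2 (P1 , P0 , qm , n1 , n0) = fin3 (split C mκ nκC sR) where
       sPP = simple-resp C qm sP
       s1 = fst (simple-++ C P1 sPP)
       s0 = snd (simple-++ C P1 sPP)
       hP1 = fst (AllP.++⁻ P1 (All-resp-↭ qm hP))
       P1≤3 = plane≤3 s1 hP1 n1
       P0≤1 : length P0 ≤ 1
       P0≤1 = length≤1 (ap s0) (λ a b → parallel-e C mκ nκC (All-∈ n0 a) (All-∈ n0 b))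
       fin3 : Split C mκ R → _
       fin3 S = fin4 (extras-out S nR) where
        open Split S
        nR' = All-resp-↭ perm nR
        zs-empty : ∀ zs → All (λ x → ¬ Nz (C ⟋ mκ) x) zs → All (Nz F) zs → length zs ≡ 0
        zs-empty [] _ _ = refl
        zs-empty (_ ∷ _) (h ∷ _) (n ∷ _) = ⊥-elim (h (F⇒κ n))
        nre = snd (AllP.++⁻ zs nR')
        lenR : length R ≡ length reps ℕ.+ length exs
        lenR = trans (↭-length perm) (trans (length-++ zs) (trans (cong (ℕ._+ length (reps ++ map fst exs)) (zs-empty zs zs0 (fst (AllP.++⁻ zs nR'))))
         (trans (length-++ reps) (cong (length reps ℕ.+_) (length-map fst exs)))))
        len : length xs ≡ (length reps ℕ.+ length exs) ℕ.+ (length P1 ℕ.+ length P0)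
        len = trans (↭-length pm) (trans (length-++ R) (cong₂ ℕ._+_ lenR (trans (↭-length qm) (length-++ P1))))
        cases : ∀ P1 → Ms P1 → All (Nz (C ⟋ mκ)) P1 → All (λ x → ¬ Nz F x) P1 → (length P1 ≡ 0 × length reps ≤ f1 N) ⊎ (suc (length reps) ≤ f1 N)
        cases [] _ _ _ = inl (refl , IH simp')
        cases (p ∷ _) (mp ∷ _) (n ∷ _) (h ∷ _) = inr (IH {p ∷ reps} (simple (mp ∷ mem simp') (n ∷ nz simp')
         (All.tabulate (λ m → plane-ind mp h n (All-∈ nre (∈-++⁺ˡ m))) ∷ ap simp')))
        fin4 : Bad C me ev κ ⊎ length exs ≤ N → _
        fin4 (inl b) = inl b
        fin4 (inr x≤) = inr (≤-trans (≤-reflexive len) (count (length P1) (length P0) (length reps) (length exs) P1≤3 P0≤1 x≤ (cases P1 (mem s1) n1 hP1)))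

 FullPair : ∀ {n} → Config (suc n) → ∀ {e} → e ∈ A → Set
 FullPair C {e} me = ∃₂ λ a b → a ∈ A × b ∈ A × Vary C e a b (+ 2) × Nz (C ⟋ me) a

 module _ {N} (C : Config (suc (suc N))) {e} (me : e ∈ A) (ev : Even (C ⟋ me)) where

  private
   E = C ⟋ me

  nzE : ∀ {p κ w} → κ ∈ A → Ms w → ∣ D C (e ∷ p ∷ κ ∷ w) ∣ ≡ 2 → Nz E p
  nzE {κ = κ} {w} mκ mw d = κ ∷ w , mκ ∷ mw , abs2-≢ d

  -- the four points P, P + e/2, P + κ₁, P + κ₁ + e/2
  record Quad (κ₁ : V) : Set where
   field
    {P Q P' Q'} : V
    P∈  : P ∈ A
    Q∈  : Q ∈ A
    P'∈ : P' ∈ A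
    Q'∈ : Q' ∈ A
    PQ  : Vary C e P Q (+ 1)
    PP' : Vary C κ₁ P P' (+ 2)
    QQ' : Vary C κ₁ Q Q' (+ 2)

  P'Q' : ∀ {κ₁} (S : Quad κ₁) → Vary C e (Quad.P' S) (Quad.Q' S) (+ 1)
  P'Q' {κ₁} S = mkV λ z → l (D C (P ∷ z)) (D C (Q ∷ z)) (D C (P' ∷ z)) (D C (Q' ∷ z)) (D C (κ₁ ∷ z)) (D C (e ∷ z)) (at PQ z) (at PP' z) (at QQ' z) where
   open Quad S
   l : ∀ P Q P' Q' k e → + 2 * Q ≡ + 2 * P + + 1 * e → + 2 * P' ≡ + 2 * P + + 2 * k → + 2 * Q' ≡ + 2 * Q + + 2 * k → + 2 * Q' ≡ + 2 * P' + + 1 * e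
   l P Q P' Q' k e a b c = trans c (trans (cong (_+ + 2 * k) a) (trans (r P k e) (cong (_+ + 1 * e) (sym b)))) where
    r = ring-54

  neg-quad : ∀ {κ₁} → Quad κ₁ → Quad κ₁
  neg-quad S = record { P∈ = neg∈ Q'∈ ; Q∈ = neg∈ P'∈ ; P'∈ = neg∈ Q∈ ; Q'∈ = neg∈ P∈
   ; PQ = vary-sym (vary-neg (P'Q' S)) ; PP' = vary-sym (vary-neg QQ') ; QQ' = vary-sym (vary-neg PP') }
   where open Quad S

  module _ {κ₀ κ₁} (m₀ : κ₀ ∈ A) (m₁ : κ₁ ∈ A) (v₀₁ : Vary C e κ₀ κ₁ (+ 1)) where

   private
    F = E ⟋ m₀
    evF : Even F
    evF mz = ev (m₀ ∷ mz)

   -- The fourth point is P + e/2 + κ₁, and κ₁ = κ₀ + e/2.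
   Q'-eq : (S : Quad κ₁) → ∀ z → + 2 * D C (Quad.Q' S ∷ z) ≡ + 2 * D C (Quad.P S ∷ z) + + 2 * D C (e ∷ z) + + 2 * D C (κ₀ ∷ z)
   Q'-eq S z = l (D C (P ∷ z)) (D C (Q ∷ z)) (D C (Q' ∷ z)) (D C (κ₀ ∷ z)) (D C (κ₁ ∷ z)) (D C (e ∷ z)) (at PQ z) (at v₀₁ z) (at QQ' z) where
    open Quad S
    l : ∀ P Q Q' k k1 e → + 2 * Q ≡ + 2 * P + + 1 * e → + 2 * k1 ≡ + 2 * k + + 1 * e → + 2 * Q' ≡ + 2 * Q + + 2 * k1 → + 2 * Q' ≡ + 2 * P + + 2 * e + + 2 * k
    l P Q Q' k k1 e a b c = trans c (trans (cong₂ _+_ a b) (r P k e)) where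
     r = ring-55

   e-κ₁ : ∀ z → D C (e ∷ κ₁ ∷ z) ≡ D C (e ∷ κ₀ ∷ z)
   e-κ₁ = vary-same C me v₀₁

   PP'E : (S : Quad κ₁) → Vary E κ₀ (Quad.P S) (Quad.P' S) (+ 2)
   PP'E S = mkV λ z → trans (at (vary-con C me PP') z) (cong (λ t → + 2 * D C (e ∷ P ∷ z) + + 2 * t) (e-κ₁ z))
    where open Quad S

   F-Q' : (S : Quad κ₁) → ∀ z → D F (Quad.Q' S ∷ z) ≡ D F (Quad.P S ∷ z)
   F-Q' S z = trans eqe (vary-same E m₀ (PP'E S) z) where
    open Quad S
    eqe : D C (e ∷ κ₀ ∷ Q' ∷ z) ≡ D C (e ∷ κ₀ ∷ P' ∷ z)
    eqe = trans (alt C (e ∷ []) κ₀ Q' z) (trans (cong -_ (vary-same C me (P'Q' S) (κ₀ ∷ z))) (sym (alt C (e ∷ []) κ₀ P' z)))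

   module _ {p q p' : V} (mp : p ∈ A) (mq : q ∈ A) (mp' : p' ∈ A) (pq : Vary C e p q (+ 1)) (pp' : Vary C κ₀ p p' (+ 2))
        {w : List V} (mw : Ms w) (d2 : ∣ D F (p ∷ w) ∣ ≡ 2) where

    private
     nzp : ∀ {y} → (∀ z → D F (y ∷ z) ≡ D F (p ∷ z)) → Nz E y
     nzp {y} h = κ₀ ∷ w , m₀ ∷ mw , perm-≢ C (↭-prep e (↭-swap κ₀ y ↭-refl)) (abs2-≢ (trans (cong ∣_∣ (h w)) d2))

    -- With respect to e, p, P, κ₀ the vectors p + κ₀, p + e/2, P + e + κ₀ and P have a doubled
    -- determinant of absolute value 24, beyond the limit 16.
    quad-apart : (S : Quad κ₁) → ¬ Ind2 F p (Quad.P S)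
    quad-apart S (u , mu , du) = ≤⇒≤ᵇ (det-bound C (p' ∷ q ∷ Q' ∷ P ∷ []) cols {u} refl
      ((λ z → r1 (D C (p' ∷ z)) (D C (e ∷ z)) (D C (p ∷ z)) (D C (P ∷ z)) (D C (κ₀ ∷ z)) (at pp' z)) ,
       (λ z → r2 (D C (q ∷ z)) (D C (e ∷ z)) (D C (p ∷ z)) (D C (P ∷ z)) (D C (κ₀ ∷ z)) (at pq z)) ,
       (λ z → r3 (D C (Q' ∷ z)) (D C (e ∷ z)) (D C (p ∷ z)) (D C (P ∷ z)) (D C (κ₀ ∷ z)) (Q'-eq S z)) ,
       (λ z → r4 (D C (e ∷ z)) (D C (p ∷ z)) (D C (P ∷ z)) (D C (κ₀ ∷ z))) , tt)
      (mp' ∷ mq ∷ Q'∈ ∷ P∈ ∷ []) mu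
      (trans (perm-abs C (↭-prep e (↭-trans (↭-prep p (↭-swap P κ₀ ↭-refl)) (↭-swap p κ₀ ↭-refl)))) (even-abs {C = F} evF (mp ∷ P∈ ∷ mu) du))) where
     open Quad S
     cols : Cols
     cols = (e , + 0 ∷ + 1 ∷ + 2 ∷ + 0 ∷ []) ∷ (p , + 2 ∷ + 2 ∷ + 0 ∷ + 0 ∷ []) ∷ (P , + 0 ∷ + 0 ∷ + 2 ∷ + 2 ∷ []) ∷ (κ₀ , + 2 ∷ + 0 ∷ + 2 ∷ + 0 ∷ []) ∷ []
     r1 : ∀ y e p P k → + 2 * y ≡ + 2 * p + + 2 * k → + 2 * y ≡ + 0 * e + (+ 2 * p + (+ 0 * P + (+ 2 * k + + 0)))
     r1 y e p P k h = trans h (l e p P k) where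
      l = ring-56
     r2 : ∀ y e p P k → + 2 * y ≡ + 2 * p + + 1 * e → + 2 * y ≡ + 1 * e + (+ 2 * p + (+ 0 * P + (+ 0 * k + + 0)))
     r2 y e p P k h = trans h (l e p P k) where
      l = ring-57
     r3 : ∀ y e p P k → + 2 * y ≡ + 2 * P + + 2 * e + + 2 * k → + 2 * y ≡ + 2 * e + (+ 0 * p + (+ 2 * P + (+ 2 * k + + 0)))
     r3 y e p P k h = trans h (l e p P k) where
      l = ring-58
     r4 = ring-59

    -- Both parallelograms lie in one class, so P - p is a multiple of e/2. For each multiple, two
    -- of the available points differ by exactly `e`.
    meet : (S : Quad κ₁) → (∀ z → D F (Quad.P S ∷ z) ≡ D F (p ∷ z)) → FullPair C me
    meet S eqF = fin (collide C me ev m₀ mp mp' P∈ P'∈ mw d2 (vary-con C me pp') (PP'E S) eqF) where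
     open Quad S
     fin : (∃ λ ν → Vary C e p P ν × ∣ ν ∣ ≤ 2) → FullPair C me
     fin (ν , v , b) = go (small ν b) v where
      go : ∀ {ν} → Small ν → Vary C e p P ν → FullPair C me
      go sp1 v = p , Q , mp , Q∈ , vary-2 v PQ , nzp (λ _ → refl)
      go sm1 v = P , q , P∈ , mq , vary-comp v pq , nzp eqF
      go sp2 v = p , P , mp , P∈ , v , nzp (λ _ → refl)
      go sm2 v = P , p , P∈ , mp , vary-sym v , nzp eqF
      go sz0 v = p' , Q' , mp' , Q'∈ , mkV (λ z → l (D C (p ∷ z)) (D C (p' ∷ z)) (D C (P ∷ z)) (D C (Q' ∷ z)) (D C (κ₀ ∷ z)) (D C (e ∷ z)) (at v z) (at pp' z) (Q'-eq S z)) ,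
        nzp (vary-F C me ev m₀ pp') where
       l : ∀ p p' P Q' k e → + 2 * P ≡ + 2 * p + + 0 * e → + 2 * p' ≡ + 2 * p + + 2 * k → + 2 * Q' ≡ + 2 * P + + 2 * e + + 2 * k → + 2 * Q' ≡ + 2 * p' + + 2 * e
       l p p' P Q' k e a b c = trans c (trans (cong (λ t → t + + 2 * e + + 2 * k) a) (trans (r p k e) (cong (_+ + 2 * e) (sym b)))) where
        r = ring-60

    half-quad : (S : Quad κ₁) → Nz F (Quad.P S) → FullPair C me
    half-quad S nP = go (even-parallel {C = F} evF mp P∈ (w , mw , abs2-≢ d2) nP (quad-apart S)) where
     open Quad S
     go : _ → FullPair C me
     go (inl same) = meet S same
     go (inr opp) = meet (neg-quad S) (λ z → trans (D-neg F Q' z) (trans (cong -_ (trans (F-Q' S z) (opp z))) (neg-involutive _)))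

 -- A pair a, a + e is the good case: `full-bad` removes the obstruction to counting through `a`. If
 -- only half steps are known and the counts through κ₀ and κ₀ + e/2 both fail, their two
 -- parallelograms produce a pair at distance `e`. Without surplus points, Heller's bound suffices.
 thm1 : ∀ N (C : Config (suc N)) {e} (me : e ∈ A) → Even (C ⟋ me) → Nz C e → ∀ {xs} → Simple C xs → length xs ≤ f1 N
 -- In rank 1 no two vectors are independent, and `f1 0` is 1.
 thm1 zero C me ev ne s = length≤1 (ap s) (λ { _ _ (z , mz , d) → absurd z (rank C _ d) }) where
  absurd : ∀ (z : List V) → suc (suc (length z)) ≡ 1 → ⊥
  absurd _ ()
 thm1 (suc N) C {e} me ev ne {xs} s = start (split C me ne s) where
  E = C ⟋ me
  bound : ∀ {κ} (mκ : κ ∈ A) → Nz E κ → Bad C me ev κ ⊎ length xs ≤ f1 (suc N)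
  bound {κ} mκ nκ@(z , mz , d) = bound-κ C me ev ne mκ nκ (thm1 N (C ⟋ mκ) me
   (λ mz → trans (perm-par C (↭-swap κ e ↭-refl)) (ev (mκ ∷ mz))) (z , mz , perm-≢ C (↭-swap e κ ↭-refl) d)) s
  full : FullPair C me → length xs ≤ f1 (suc N)
  full (a , b , ma , mb , v , na) = go (bound ma na) where
   go : _ → _
   go (inr h) = h
   go (inl B) = ⊥-elim (full-bad C me ev ma mb v B)
  half : ∀ {κ₀ κ₁} → κ₀ ∈ A → κ₁ ∈ A → Vary C e κ₀ κ₁ (+ 1) → Nz E κ₀ → length xs ≤ f1 (suc N)
  half {κ₀} {κ₁} m₀ m₁ v n₀@(z₀ , mz₀ , d₀) = go (bound m₀ n₀) where
   n₁ : Nz E κ₁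
   n₁ = z₀ , mz₀ , λ e0 → d₀ (trans (sym (vary-same C me v z₀)) e0)
   go : _ → _
   go (inr h) = h
   go (inl B) = go2 B.pos B.pq where
    module B = Bad B
    nB : Nz E B.p
    nB = nzE C me ev m₀ B.mw B.d2
    dB : ∣ D C (e ∷ κ₀ ∷ B.p ∷ B.w) ∣ ≡ 2
    dB = trans (perm-abs C (↭-prep e (↭-swap κ₀ B.p ↭-refl))) B.d2
    go2 : ∀ {t} → t ≡ + 1 ⊎ t ≡ + 2 → Vary C e B.p B.q t → length xs ≤ f1 (suc N)
    go2 (inr refl) pq = full (B.p , B.q , B.p∈ , B.q∈ , pq , nB)
    go2 (inl refl) pq = go3 (bound m₁ n₁) where
     go3 : _ → _
     go3 (inr h) = h
     go3 (inl B') = go4 B'.pos B'.pq where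
      module B' = Bad B'
      nB' : Nz E B'.p
      nB' = nzE C me ev m₁ B'.mw B'.d2
      go4 : ∀ {t} → t ≡ + 1 ⊎ t ≡ + 2 → Vary C e B'.p B'.q t → length xs ≤ f1 (suc N)
      go4 (inr refl) pq' = full (B'.p , B'.q , B'.p∈ , B'.q∈ , pq' , nB')
      go4 (inl refl) pq' = full (half-quad C me ev m₀ m₁ v B.p∈ B.q∈ B.p'∈ pq B.pp' B.mw dB
       (record { P∈ = B'.p∈ ; Q∈ = B'.q∈ ; P'∈ = B'.p'∈ ; Q'∈ = B'.q'∈ ; PQ = pq' ; PP' = B'.pp' ; QQ' = B'.qq' })
       (B'.w , B'.mw , λ e0 → abs2-≢ B'.d2 (trans (alt C (e ∷ []) B'.p κ₁ B'.w) (cong -_ (trans (e-κ₁ C me ev m₀ m₁ v (B'.p ∷ B'.w)) e0)))))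
  start : Split C me xs → length xs ≤ f1 (suc N)
  start S = go exs refl where
   open Split S
   sre = snd (simple-++ C zs simp)
   sr = fst (simple-++ C reps sre)
   se = snd (simple-++ C reps sre)
   cross = snd (snd (AP-++⁻ reps (ap sre)))
   pair : ∀ {x ρ} → x ∈ A → ρ ∈ A → Nz E x → Nz E ρ → ¬ Ind2 E x ρ → Ind2 C x ρ → length xs ≤ f1 (suc N)
   pair {x} {ρ} mx mρ nx@(w , mw , dw) nρ h ind = fin (align C {E} ev mx mρ nx nρ h) where
    fin : (∃ λ ρ' → ρ' ∈ A × Pm C ρ ρ' × (∀ z → D E (ρ' ∷ z) ≡ D E (x ∷ z)) × (ρ' ≡ ρ ⊎ ρ' ≡ neg ρ)) → _
    fin (ρ' , mρ' , pm , eqE , _) = fin2 (offset {C = C} {e} {x} {ρ'} mw (even-abs {C = E} ev (mx ∷ mw) dw) (eqE w) (λ {z} _ → eq-dep E eqE z)) where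
     nρ' : Nz E ρ'
     nρ' = w , mw , λ e0 → dw (trans (sym (eqE w)) e0)
     fin2 : (∃ λ τ → Vary C e x ρ' τ × ∣ τ ∣ ≡ ∣ D C (ρ' ∷ x ∷ w) ∣) → _
     fin2 (τ , v , eqτ) = fin3 (small τ (≤-trans (≤-reflexive eqτ) (bdd C (mρ' ∷ mx ∷ mw)))) v (offset-≢0 {C = C} (Pm-ind C {x} {ρ} {ρ'} pm ind) v) where
      fin3 : ∀ {τ} → Small τ → Vary C e x ρ' τ → 0≢ τ → length xs ≤ f1 (suc N)
      fin3 sz0 v h = ⊥-elim (h refl)
      fin3 sp2 v _ = full (x , ρ' , mx , mρ' , v , nx)
      fin3 sm2 v _ = full (ρ' , x , mρ' , mx , vary-sym v , nρ')
      fin3 sp1 v _ = half mx mρ' v nx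
      fin3 sm1 v _ = half mρ' mx (vary-sym v) nρ'
   go : ∀ ys → ys ≡ exs → length xs ≤ f1 (suc N)
   go [] eq = ≤-trans (split-length S) (≤-trans (s≤s (≤-trans (≤-reflexive (trans (cong (length reps ℕ.+_) (sym (cong length eq))) (ℕP.+-identityʳ _)))
     (heller (suc N) E ev simp'))) (≤-trans (≤-reflexive (ℕP.+-comm 1 (tri (suc N)))) (+-monoˡ-≤ 1 (ℕP.m≤m+n (tri (suc N)) _))))
   go ((x , ρ) ∷ ys) eq = pair (All-∈ (mem se) mx) (All-∈ (mem sr) mρ) (All-∈ exs-nz me') (All-∈ (nz simp') mρ) h (Ind2-sym C (All-∈ (All-∈ cross mρ) mx)) where
    me' : (x , ρ) ∈ exs
    me' = subst ((x , ρ) ∈_) eq (here refl)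
    mx = ∈-map⁺ fst me'
    mρ = fst (All-∈ exs-par me')
    h = snd (All-∈ exs-par me')

 -- Circuits modulo 2 and pairs at distance `e`

 module _ {r} (C : Config r) where

  psum : List V → List V → Bool
  psum S u = xsum (λ s → par (D C (s ∷ u))) S

  -- S is a circuit modulo 2
  parity-sum : ∀ S → Ms S → (∀ {z} → Ms z → par (D C (S ++ z)) ≡ false) →
         (∀ l s t → S ≡ l ++ s ∷ t → ∃ λ w → Ms w × par (D C (l ++ t ++ w)) ≡ true) →
         ∀ u → psum S u ≡ false
  parity-sum [] _ _ _ u = refl
  parity-sum (e ∷ T) (me ∷ mT) evS wit u with wit [] e T refl
  ... | w , mw , odd1 = trans (cong (_xor psum T u) (trans (rel u) (pt-all (λ x → par (D C (x ∷ u))) G T w allp))) (xor-same (psum T u)) where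
   xor-same : ∀ a → a xor a ≡ false
   xor-same true = refl
   xor-same false = refl
   G : List V → Bool
   G ys = par (D C (e ∷ ys))
   -- Cramer's rule modulo 2 for the list `T ++ w`: the coefficients at entries of `w` are minors
   -- through all of `S`, hence even.
   rel : ∀ u → par (D C (e ∷ u)) ≡ pt (λ x → par (D C (x ∷ u))) G T w
   rel u = trans (sym (∧-identityʳ _)) (trans (cong (par (D C (e ∷ u)) ∧_) (sym odd1)) (trans (sym (par-* (D C (e ∷ u)) (D C (T ++ w))))
    (trans (cong par (cramer C e u (T ++ w))) (trans (par-W (λ x → D C (x ∷ u)) (λ ys → D C (e ∷ ys)) (T ++ w))
    (pw-app (λ x → par (D C (x ∷ u))) G T w (pw-vanish _ (λ ys → G (T ++ ys)) w v0)))))) where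
    v0 : ∀ l x r → w ≡ l ++ x ∷ r → G (T ++ (l ++ r)) ≡ false
    v0 l x r refl = evS (All-mid l mw)
   -- On the odd minor that omits `t`, all terms but that of `t` contain a repeated vector; so the
   -- coefficient of `t` is odd.
   allp : ∀ l t r → T ≡ l ++ t ∷ r → G (l ++ r ++ w) ≡ true
   allp l t r refl with wit (e ∷ l) t r refl
   ... | w' , mw' , odd2 = true∧ {par (D C (t ∷ l ++ r ++ w'))} (trans (sym odd2) (trans (rel (l ++ r ++ w'))
      (pt-one (λ x → par (D C (x ∷ l ++ r ++ w'))) G l t r w
       (All.tabulate (λ m → cong par (D-mem C (∈-++⁺ˡ m)))) (All.tabulate (λ m → cong par (D-mem C (∈-++⁺ʳ l (∈-++⁺ˡ m))))))))

  shift2 : ∀ T a b w → D C (T ++ a ∷ b ∷ w) ≡ D C (a ∷ b ∷ T ++ w)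
  shift2 T a b w = trans (alt-shift (D C) (alt C) T a (b ∷ w)) (trans (cong (sgn T *_) (alt-shift (λ ys → D C (a ∷ ys)) (λ us → alt C (a ∷ us)) T b w))
   (trans (sym (ℤP.*-assoc (sgn T) (sgn T) _)) (trans (cong (_* D C (a ∷ b ∷ T ++ w)) (sgn² T)) (ℤP.*-identityˡ _))))

  Off : List V → V → List ℤ → V → Set
  Off T x λs y = ∀ z → + 2 * D C (y ∷ z) ≡ + 2 * D C (x ∷ z) + dot λs (map (λ t → D C (t ∷ z)) T)

 coefs-All : ∀ (P : ℤ → Set) → (∀ {x} → P x → P (- x)) → ∀ G T w → (∀ l t r → T ≡ l ++ t ∷ r → P (G (l ++ r ++ w))) → All P (coefs G T w)
 coefs-All P ng G [] w h = []
 coefs-All P ng G (t ∷ T) w h = h [] t T refl ∷ AllP.map⁺ (All.map ng (coefs-All P ng (λ ys → G (t ∷ ys)) T w (λ l s r e → h (t ∷ l) s r (cong (t ∷_) e))))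

 coefs-length : ∀ G T w → length (coefs G T w) ≡ length T
 coefs-length G [] w = refl
 coefs-length G (t ∷ T) w = cong suc (trans (length-map -_ (coefs (λ ys → G (t ∷ ys)) T w)) (coefs-length (λ ys → G (t ∷ ys)) T w))

 -- `C₀` is the contraction of `T`, specified by its values, so that one module serves heavy sets of
 -- every size. `F` contracts the whole heavy set.
 module Frame {N r} (C : Config r) (C₀ : Config (suc N)) {e} (me : e ∈ A) (t : V) (T' : List V) (mT : Ms (t ∷ T'))
  (eq₀ : ∀ z → D C₀ z ≡ D C (t ∷ T' ++ z)) (evS : ∀ {z} → Ms z → par (D C (e ∷ t ∷ T' ++ z)) ≡ false)
  (sumE : ∀ u → psum C (e ∷ t ∷ T') u ≡ false) where

  T = t ∷ T'

  F : Config N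
  F = C₀ ⟋ me

  eqF : ∀ z → D F z ≡ D C (T ++ e ∷ z)
  eqF z = eq₀ (e ∷ z)

  evF : Even F
  evF {z} mz = trans (cong par (eqF z)) (trans (perm-par C (PermP.shift e T z)) (evS mz))

  F-front : ∀ x z → D F (x ∷ z) ≡ D C (e ∷ x ∷ T ++ z)
  F-front x z = trans (eqF (x ∷ z)) (shift2 C T e x z)

  conT : ∀ {x y τ} → Vary C e x y τ → Vary C₀ e x y τ
  conT {x} {y} {τ} v = mkV λ z → begin
   + 2 * D C₀ (y ∷ z) ≡⟨ cong (+ 2 *_) (sh y z) ⟩
   + 2 * (s * D C (y ∷ T ++ z)) ≡⟨ l1 s (D C (y ∷ T ++ z)) ⟩
   s * (+ 2 * D C (y ∷ T ++ z)) ≡⟨ cong (s *_) (at v (T ++ z)) ⟩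
   s * (+ 2 * D C (x ∷ T ++ z) + τ * D C (e ∷ T ++ z)) ≡⟨ l2 s (D C (x ∷ T ++ z)) τ (D C (e ∷ T ++ z)) ⟩
   + 2 * (s * D C (x ∷ T ++ z)) + τ * (s * D C (e ∷ T ++ z)) ≡⟨ cong₂ (λ a b → + 2 * a + τ * b) (sym (sh x z)) (sym (sh e z)) ⟩
   + 2 * D C₀ (x ∷ z) + τ * D C₀ (e ∷ z) ∎ where
   open ≡-Reasoning
   s = sgn T
   sh : ∀ x z → D C₀ (x ∷ z) ≡ s * D C (x ∷ T ++ z)
   sh x z = trans (eq₀ (x ∷ z)) (alt-shift (D C) (alt C) T x z)
   l1 = ring-22
   l2 = ring-23

  record EPair (x ρ : V) : Set where
   field
    {κ κ⁺} : V
    κ∈   : κ ∈ A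
    κ⁺∈  : κ⁺ ∈ A
    ep   : Vary C e κ κ⁺ (+ 2)
    same : ∀ z → D F (κ ∷ z) ≡ D F (x ∷ z)
    cov  : (Pm C κ x × Pm C κ⁺ ρ) ⊎ (Pm C κ ρ × Pm C κ⁺ x)
    fl   : Full C₀ e x

  -- In the parity sum over the heavy set only the term of `t` survives: the term of `e` vanishes by
  -- dependence, the others by repetition. So the offset along `e` is even, and being nonzero it is
  -- full.
  epair : ∀ {x ρ} → x ∈ A → ρ ∈ A → Nz F x → Nz F ρ → (∀ {z} → Ms z → D C (e ∷ x ∷ ρ ∷ z) ≡ + 0) → Ind2 C x ρ → EPair x ρ
  epair {x} {ρ} mx mρ nx@(w , mw , dw) nρ dep ind = fin (align C {F} evF mx mρ nx nρ hF) where
   hF : ¬ Ind2 F x ρ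
   hF (z , mz , d) = d (trans (F-front x (ρ ∷ z)) (perm-0 C (↭-prep e (↭-prep x (↭-sym (PermP.shift ρ T z)))) (dep (AllP.++⁺ mT mz))))
   fin : (∃ λ ρ' → ρ' ∈ A × Pm C ρ ρ' × (∀ z → D F (ρ' ∷ z) ≡ D F (x ∷ z)) × (ρ' ≡ ρ ⊎ ρ' ≡ neg ρ)) → EPair x ρ
   fin (ρ' , mρ' , pm , eqρ , or) = fin2 (offset {C = C} {e} {x} {ρ'} {T ++ w} (AllP.++⁺ mT mw) d2 eqd dep') where
    d2 : ∣ D C (e ∷ x ∷ T ++ w) ∣ ≡ 2
    d2 = trans (cong ∣_∣ (sym (F-front x w))) (even-abs {C = F} evF (mx ∷ mw) dw)
    eqd : D C (e ∷ ρ' ∷ T ++ w) ≡ D C (e ∷ x ∷ T ++ w)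
    eqd = trans (sym (F-front ρ' w)) (trans (eqρ w) (F-front x w))
    dep' : ∀ {z} → Ms z → D C (e ∷ x ∷ ρ' ∷ z) ≡ + 0
    dep' {z} mz = neg0 or where
     neg0 : (ρ' ≡ ρ ⊎ ρ' ≡ neg ρ) → D C (e ∷ x ∷ ρ' ∷ z) ≡ + 0
     neg0 (inl refl) = dep mz
     neg0 (inr refl) = trans (sym (trans (cyc C (neg ρ) e x z) (cyc C x (neg ρ) e z))) (trans (D-neg C ρ (e ∷ x ∷ z)) (cong -_ (trans (trans (cyc C ρ e x z) (cyc C x ρ e z)) (dep mz))))
    fin2 : (∃ λ τ → Vary C e x ρ' τ × ∣ τ ∣ ≡ ∣ D C (ρ' ∷ x ∷ T ++ w) ∣) → EPair x ρ
    fin2 (τ , va , eqτ) = fin3 (abs2 {τ} (trans eqτ (even-val par0 (bdd C (mρ' ∷ mx ∷ AllP.++⁺ mT mw)) ne0))) va where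
     u : List V
     u = ρ' ∷ x ∷ T' ++ w
     par0 : par (D C (ρ' ∷ x ∷ T ++ w)) ≡ false
     par0 = trans (perm-par C (↭-trans (↭-prep ρ' (↭-swap x t ↭-refl)) (↭-swap ρ' t ↭-refl)))
      (xl (par (D C (e ∷ u))) (par (D C (t ∷ u))) (psum C T' u)
       (cong par (trans (alt C (e ∷ []) ρ' x (T' ++ w)) (cong -_ (dep' (AllP.++⁺ (All.tail mT) mw)))))
       (xsum-0 _ T' (All.tabulate (λ m → cong par (D-mem C (there (there (∈-++⁺ˡ m))))))) (sumE u)) where
      xl : ∀ a b c → a ≡ false → c ≡ false → a xor (b xor c) ≡ false → b ≡ false
      xl a false c _ _ _ = refl
      xl .false true .false refl refl ()
     ne0 : 0≢ (D C (ρ' ∷ x ∷ T ++ w))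
     ne0 e0' = offset-≢0 {C = C} (Pm-ind C {x} {ρ} {ρ'} pm ind) va (∣i∣≡0⇒i≡0 (trans eqτ (cong ∣_∣ e0')))
     fin3 : (τ ≡ + 2) ⊎ (τ ≡ - + 2) → Vary C e x ρ' τ → EPair x ρ
     fin3 (inl refl) v = record { κ∈ = mx ; κ⁺∈ = mρ' ; ep = v ; cov = inl (Pm-refl C , Pm-sym C {ρ} {ρ'} pm) ; same = λ _ → refl ; fl = ρ' , + 2 , mρ' , conT v , refl }
     fin3 (inr refl) v = record { κ∈ = mρ' ; κ⁺∈ = mx ; ep = vary-sym v ; cov = inr (Pm-sym C {ρ} {ρ'} pm , Pm-refl C) ; same = eqρ ; fl = ρ' , - + 2 , mρ' , conT v , refl }

  -- two e-pairs in the same class differ by an integral combination of T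
  compare : ∀ {κ κ⁺ μ μ⁺ w} → κ ∈ A → κ⁺ ∈ A → μ ∈ A → μ⁺ ∈ A → Ms w → ∣ D F (κ ∷ w) ∣ ≡ 2 →
       Vary C e κ κ⁺ (+ 2) → Vary C e μ μ⁺ (+ 2) → (∀ z → D F (μ ∷ z) ≡ D F (κ ∷ z)) →
       ∃ λ λs → Off C T κ λs μ × All Ev λs × length λs ≡ length T
  compare {κ} {κ⁺} {μ} {μ⁺} {w} mκ mκ⁺ mμ mμ⁺ mw d2 vκ vμ eq = fin (offset {C = C₀} {e} {κ} {μ} {w} mw d2 (eq w) (λ {z} _ → eq-dep F eq z)) where
   fin : (∃ λ σ → Vary C₀ e κ μ σ × ∣ σ ∣ ≡ ∣ D C₀ (μ ∷ κ ∷ w) ∣) → _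
   fin (σ , v , eqσ) = go (small σ (≤-trans (≤-reflexive eqσ) (bdd C₀ (mμ ∷ mκ ∷ mw)))) v where
    three≰2 : ¬ (3 ≤ 2)
    three≰2 (s≤s (s≤s ()))
    up : ∀ {σ} → Vary C₀ e κ μ σ → ∣ + 2 - - σ ∣ ≤ 2
    up {σ} v = vary-bound {C = C₀} {e} {κ} {μ⁺} {+ 2 - - σ} {w} mκ mμ⁺ mw (vary-2 v (conT vμ)) d2
    down : ∀ {σ} → Vary C₀ e κ μ σ → ∣ σ - + 2 ∣ ≤ 2
    down {σ} v = vary-bound {C = C₀} {e} {κ⁺} {μ} {σ - + 2} {w} mκ⁺ mμ mw (vary-comp (conT vκ) v) (trans (cong ∣_∣ (vary-same C₀ me (conT vκ) w)) d2)
    go : ∀ {σ} → Small σ → Vary C₀ e κ μ σ → ∃ λ λs → Off C T κ λs μ × All Ev λs × length λs ≡ length T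
    -- Modulo `T` the offset along `e` must be 0, since otherwise an end of one pair lies at offset
    -- 3 or 4 from an end of the other.
    go sp1 v = ⊥-elim (three≰2 (up v))
    go sp2 v = ⊥-elim (four≰2 (up v))
    go sm1 v = ⊥-elim (three≰2 (down v))
    go sm2 v = ⊥-elim (four≰2 (down v))
    go sz0 v = result (abs2 {d} dd) where
     eq0 : ∀ z → D C₀ (μ ∷ z) ≡ D C₀ (κ ∷ z)
     eq0 = vary-0 {C = C₀} {e} v
     eqT : ∀ z → D C (μ ∷ T ++ z) ≡ D C (κ ∷ T ++ z)
     eqT z = unsg (trans (sym (alt-shift (D C) (alt C) T μ z)) (trans (sym (eq₀ (μ ∷ z))) (trans (eq0 z) (trans (eq₀ (κ ∷ z)) (alt-shift (D C) (alt C) T κ z))))) where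
      unsg : sgn T * D C (μ ∷ T ++ z) ≡ sgn T * D C (κ ∷ T ++ z) → D C (μ ∷ T ++ z) ≡ D C (κ ∷ T ++ z)
      unsg h = trans (l (D C (μ ∷ T ++ z))) (trans (cong (sgn T *_) h) (sym (l (D C (κ ∷ T ++ z))))) where
       l : ∀ a → a ≡ sgn T * (sgn T * a)
       l a = trans (sym (ℤP.*-identityˡ a)) (trans (cong (_* a) (sym (sgn² T))) (ℤP.*-assoc (sgn T) (sgn T) a))
     dep : ∀ {z} → Ms z → D C (μ ∷ κ ∷ T ++ z) ≡ + 0
     dep {z} _ = perm-0 C (↭-prep μ (PermP.shift κ T z)) (trans (eqT (κ ∷ z)) (D-mem C (∈-++⁺ʳ T (here refl))))
     d = D C (κ ∷ T ++ e ∷ w)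
     dd : ∣ d ∣ ≡ 2
     dd = trans (perm-abs C (↭-trans (↭-prep κ (PermP.shift e T w)) (↭-swap κ e ↭-refl))) (trans (cong ∣_∣ (sym (F-front κ w))) d2)
     cs = coefs (λ ys → D C (μ ∷ κ ∷ ys)) T (e ∷ w)
     rel : ∀ z → d * D C (μ ∷ z) ≡ d * D C (κ ∷ z) + - dot cs (map (λ x → D C (x ∷ z)) T)
     rel z = trans (spanned C μ (κ ∷ T) (e ∷ w) (me ∷ mw) dep z) (cong₂ (λ a b → a * D C (κ ∷ z) + b) (eqT (e ∷ w)) (dot-neg cs (map (λ x → D C (x ∷ z)) T)))
     -- In the parity sum only the term of `e` survives: the omitted member of `T` contributes 0 by
     -- dependence, the other members repeat. So the coefficient is even.
     evs : All Ev cs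
     evs = coefs-All Ev Ev-neg (λ ys → D C (μ ∷ κ ∷ ys)) T (e ∷ w) one where
      one : ∀ l s r → T ≡ l ++ s ∷ r → Ev (D C (μ ∷ κ ∷ l ++ r ++ e ∷ w))
      one l s r eqs = ev-small (trans (perm-par C pm) par0) (bdd C (mμ ∷ mκ ∷ AllP.++⁺ (fst ml) (AllP.++⁺ (All.tail (snd ml)) (me ∷ mw)))) where
       ml = AllP.++⁻ l (subst Ms eqs mT)
       u : List V
       u = μ ∷ κ ∷ l ++ r ++ w
       pm : μ ∷ κ ∷ l ++ r ++ e ∷ w ↭ e ∷ u
       pm = ↭-trans (↭-prep μ (↭-prep κ (↭-trans (++⁺ˡ l (PermP.shift e r w)) (PermP.shift e l (r ++ w)))))
           (↭-trans (↭-prep μ (↭-swap κ e ↭-refl)) (↭-swap μ e ↭-refl))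
       rest : psum C T u ≡ false
       rest = trans (cong (λ S → psum C S u) eqs) (xsum-0 _ (l ++ s ∷ r) (AllP.++⁺
        (All.tabulate (λ m → cong par (D-mem C (there (there (∈-++⁺ˡ m))))))
        (cong par (perm-0 C pm2 (dep mw)) ∷ All.tabulate (λ m → cong par (D-mem C (there (there (∈-++⁺ʳ l (∈-++⁺ˡ m))))))))) where
        pm2 : μ ∷ κ ∷ T ++ w ↭ s ∷ u
        pm2 = subst (λ S → μ ∷ κ ∷ S ++ w ↭ s ∷ u) (sym eqs) (subst (λ S → μ ∷ κ ∷ S ↭ s ∷ u) (sym (++-assoc l (s ∷ r) w))
         (↭-trans (↭-prep μ (↭-prep κ (PermP.shift s l (r ++ w)))) (↭-trans (↭-prep μ (↭-swap κ s ↭-refl)) (↭-swap μ s ↭-refl))))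
       par0 : par (D C (e ∷ u)) ≡ false
       par0 = trans (sym (xor-identityʳ _)) (trans (cong (par (D C (e ∷ u)) xor_) (sym rest)) (sumE u))
     result : (d ≡ + 2) ⊎ (d ≡ - + 2) → ∃ λ λs → Off C T κ λs μ × All Ev λs × length λs ≡ length T
     result (inl p) = map -_ cs , (λ z → trans (cong (_* D C (μ ∷ z)) (sym p)) (trans (rel z) (cong₂ _+_ (cong (_* D C (κ ∷ z)) p) (sym (dot-neg cs (map (λ x → D C (x ∷ z)) T)))))) ,
      AllP.map⁺ (All.map Ev-neg evs) , trans (length-map -_ cs) (coefs-length (λ ys → D C (μ ∷ κ ∷ ys)) T (e ∷ w))
     result (inr p) = cs , (λ z → l (D C (μ ∷ z)) (D C (κ ∷ z)) (dot cs (map (λ x → D C (x ∷ z)) T)) (trans (cong (_* D C (μ ∷ z)) (sym p)) (trans (rel z) (cong (λ t → t * D C (κ ∷ z) + - dot cs (map (λ x → D C (x ∷ z)) T)) p)))) ,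
      evs , coefs-length (λ ys → D C (μ ∷ κ ∷ ys)) T (e ∷ w) where
      l : ∀ m k c → - + 2 * m ≡ - + 2 * k + - c → + 2 * m ≡ + 2 * k + c
      l m k c h = trans (q1 m) (trans (cong -_ h) (q2 k c)) where
       q1 = ring-61
       q2 = ring-62

 par-nz : ∀ {n} (G : Config n) {x ρ u} → Ms u → ¬ Ind2 G x ρ → Nz G ρ → 0≢ (D G (x ∷ u)) → 0≢ (D G (ρ ∷ u))
 par-nz G {x} {ρ} {u} mu h (z , mz , dz) dx e0 = *≢0 dx dz (trans (spanned G ρ (x ∷ []) u mu (λ mz → trans (alt G [] ρ x _) (cong -_ (¬NzL G h mz))) z)
  (trans (cong (λ t → t * D G (x ∷ z) + + 0) e0) refl))

 -- Classes of pairs at distance `e`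

 module FSplit {N n} (C : Config (suc n)) (C₀ : Config (suc N)) {e} (me : e ∈ A) (t : V) (T' : List V) (mT : Ms (t ∷ T'))
  (eq₀ : ∀ z → D C₀ z ≡ D C (t ∷ T' ++ z)) (evS : ∀ {z} → Ms z → par (D C (e ∷ t ∷ T' ++ z)) ≡ false)
  (sumE : ∀ u → psum C (e ∷ t ∷ T') u ≡ false) where

  open Frame C C₀ me t T' mT eq₀ evS sumE public

  -- a pair of vectors of A differing by e, up to sign the pair x , ρ
  record Pair± (x ρ : V) : Set where
   field
    {κ κ⁺} : V
    κ∈   : κ ∈ A
    κ⁺∈  : κ⁺ ∈ A
    ep   : Vary C e κ κ⁺ (+ 2)
    cov  : (Pm C κ x × Pm C κ⁺ ρ) ⊎ (Pm C κ ρ × Pm C κ⁺ x)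

  record EP : Set where
   field
    {x ρ} : V
    x∈   : x ∈ A
    ρ∈   : ρ ∈ A
    nx   : Nz F x
    pair : EPair x ρ
   pm : Pair± x ρ
   pm = record { κ∈ = EPair.κ∈ pair ; κ⁺∈ = EPair.κ⁺∈ pair ; ep = EPair.ep pair ; cov = EPair.cov pair }
   open Pair± pm public
   w = fst nx
   mw = fst (snd nx)
   d2 : ∣ D F (κ ∷ w) ∣ ≡ 2
   d2 = trans (cong ∣_∣ (EPair.same pair w)) (even-abs {C = F} evF (x∈ ∷ mw) (snd (snd nx)))

  -- What a simple list guarantees for two surplus points: they are independent of each other and of
  -- both representatives. The two representatives may coincide.
  Distinct : EP → EP → Set
  Distinct p q = Ind2 C (EP.x p) (EP.x q) × Ind2 C (EP.ρ p) (EP.x q) × Ind2 C (EP.ρ q) (EP.x p)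

  Distinct-sym : ∀ {p q} → Distinct p q → Distinct q p
  Distinct-sym (a , b , c) = Ind2-sym C a , c , b

  Ind2F : EP → EP → Set
  Ind2F p q = Ind2 F (EP.x p) (EP.x q)

  pair-neg : ∀ {x ρ} → Pair± x ρ → Pair± x ρ
  pair-neg P = record { κ∈ = neg∈ κ⁺∈ ; κ⁺∈ = neg∈ κ∈ ; ep = vary-sym (vary-neg ep) ; cov = fl' cov } where
   open Pair± P
   ng : ∀ {a b} → Pm C a b → Pm C (neg a) b
   ng {a} {b} h = Pm-trans C {neg a} {a} {b} (Pm-sym C {a} {neg a} (Pm-neg C a)) h
   fl' : ∀ {x ρ} → (Pm C κ x × Pm C κ⁺ ρ) ⊎ (Pm C κ ρ × Pm C κ⁺ x) → (Pm C (neg κ⁺) x × Pm C (neg κ) ρ) ⊎ (Pm C (neg κ⁺) ρ × Pm C (neg κ) x)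
   fl' {x} {ρ} (inl (a , b)) = inr (ng {κ⁺} {ρ} b , ng {κ} {x} a)
   fl' {x} {ρ} (inr (a , b)) = inl (ng {κ⁺} {x} b , ng {κ} {ρ} a)

  -- equal pairs come from the same line through e
  pairs-equal : ∀ {p q} (P : Pair± (EP.x p) (EP.ρ p)) (Q : Pair± (EP.x q) (EP.ρ q)) → Distinct p q →
         (∀ z → D C (Pair±.κ Q ∷ z) ≡ D C (Pair±.κ P ∷ z)) → ⊥
  pairs-equal {p} {q} P Q (i , j , _) h = no-x (pick Q.cov) where
   module P = Pair± P
   module Q = Pair± Q
   h⁺ : ∀ z → D C (Q.κ⁺ ∷ z) ≡ D C (P.κ⁺ ∷ z)
   h⁺ z = cancel-≡ {+ 2} _ _ (λ ()) (trans (at Q.ep z) (trans (cong (λ t → + 2 * t + + 2 * D C (e ∷ z)) (h z)) (sym (at P.ep z))))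
   pick : ∀ {x ρ} → (Pm C Q.κ x × Pm C Q.κ⁺ ρ) ⊎ (Pm C Q.κ ρ × Pm C Q.κ⁺ x) → Pm C P.κ x ⊎ Pm C P.κ⁺ x
   pick {x} (inl (a , _)) = inl (Pm-trans C {P.κ} {Q.κ} {x} (inl h) a)
   pick {x} (inr (_ , b)) = inr (Pm-trans C {P.κ⁺} {Q.κ⁺} {x} (inl h⁺) b)
   both : ∀ {y u x} → Pm C y u → Pm C y x → Ind2 C u x → ⊥
   both {y} {u} {x} a b i = Pm-dep C {u} {x} (Pm-trans C {u} {y} {x} (Pm-sym C {y} {u} a) b) i
   no-x : Pm C P.κ (EP.x q) ⊎ Pm C P.κ⁺ (EP.x q) → ⊥
   no-x (inl a) = oneof P.cov where
    oneof : (Pm C P.κ (EP.x p) × Pm C P.κ⁺ (EP.ρ p)) ⊎ (Pm C P.κ (EP.ρ p) × Pm C P.κ⁺ (EP.x p)) → ⊥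
    oneof (inl (b , _)) = both {P.κ} b a i
    oneof (inr (b , _)) = both {P.κ} b a j
   no-x (inr a) = oneof P.cov where
    oneof : (Pm C P.κ (EP.x p) × Pm C P.κ⁺ (EP.ρ p)) ⊎ (Pm C P.κ (EP.ρ p) × Pm C P.κ⁺ (EP.x p)) → ⊥
    oneof (inl (_ , b)) = both {P.κ⁺} b a j
    oneof (inr (_ , b)) = both {P.κ⁺} b a i

  -- the pair of q, with sign adjusted to the class of p, differs from the pair of p by an integral vector
  record Rep (q p : EP) : Set where
   field
    Q    : Pair± (EP.x q) (EP.ρ q)
   open Pair± Q renaming (κ to μ; κ⁺ to μ⁺; κ∈ to μ∈; κ⁺∈ to μ⁺∈; ep to eμ; cov to covμ) public
   field
    cls  : ∀ z → D F (μ ∷ z) ≡ D F (EP.κ p ∷ z)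
    λs   : List ℤ
    off  : Off C T (EP.κ p) λs μ
    evs  : All Ev λs
    len  : length λs ≡ length T
    nonz : ¬ AllZero λs

  dot-zero : ∀ {as} bs → AllZero as → dot as bs ≡ + 0
  dot-zero bs [] = refl
  dot-zero [] (refl ∷ h) = refl
  dot-zero (b ∷ bs) (refl ∷ h) = trans (cong (λ t → + 0 * b + t) (dot-zero bs h)) (l b) where
   l = ring-9

  rep : ∀ {q p} → ¬ Ind2F q p → Distinct p q → Rep q p
  rep {q} {p} h dist = go (even-parallel {C = F} evF p.x∈ q.x∈ p.nx q.nx (λ i → h (Ind2-sym F i))) where
   module p = EP p
   module q = EP q
   fin : (Q : Pair± q.x q.ρ) → (∀ z → D F (Pair±.κ Q ∷ z) ≡ D F (p.κ ∷ z)) → Rep q p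
   fin Q cl = mk (compare p.κ∈ p.κ⁺∈ (Pair±.κ∈ Q) (Pair±.κ⁺∈ Q) p.mw p.d2 p.ep (Pair±.ep Q) cl) where
    mk : (∃ λ λs → Off C T p.κ λs (Pair±.κ Q) × All Ev λs × length λs ≡ length T) → Rep q p
    mk (ls , of , es , ln) = record { Q = Q ; cls = cl ; λs = ls ; off = of ; evs = es ; len = ln
     ; nonz = λ az → pairs-equal {p} {q} p.pm Q dist (λ z → cancel-≡ {+ 2} _ _ (λ ()) (trans (of z) (trans (cong (λ t → + 2 * D C (p.κ ∷ z) + t) (dot-zero _ az)) (ℤP.+-identityʳ _)))) }
   go : _ → Rep q p
   go (inl s) = fin q.pm (λ z → trans (EPair.same q.pair z) (trans (s z) (sym (EPair.same p.pair z))))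
   go (inr o) = fin (pair-neg q.pm) (λ z → trans (D-neg F q.κ⁺ z) (trans (cong -_ (trans (vary-same C₀ me (conT q.ep) z) (trans (EPair.same q.pair z) (o z)))) (trans (neg-involutive _) (sym (EPair.same p.pair z)))))

  -- The surplus points of the contraction of `e`: `vs` holds one pair for each class outside the
  -- span of the heavy set, `rs` the repetitions together with the pairs they repeat, and `ins` the
  -- points within the span.
  record Outer {xs} (S : Split C me xs) : Set where
   field
    vs    : List EP
    rs    : List (EP × EP)
    ins   : List (V × V)
    total : length (Split.exs S) ≡ length vs ℕ.+ length rs ℕ.+ length ins
    ins∈  : ∀ {p} → p ∈ ins → p ∈ Split.exs S
    insF  : All (λ p → ¬ Nz F (fst p)) ins
    insAP : AllPairs (λ p q → Ind2 C (fst p) (fst q)) ins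
    vsAP  : AllPairs Ind2F vs
    rsP   : All (λ r → snd r ∈ vs × ¬ Ind2F (fst r) (snd r) × Distinct (snd r) (fst r)) rs
    rsAP  : AllPairs (λ r s → Distinct (fst r) (fst s)) rs

  outer : ∀ {xs} (S : Split C me xs) → Outer S
  outer {xs} S = fin (divide (λ p → Nz? F (fst p)) exs) where
   open Split S
   sre = snd (simple-++ C zs simp)
   sr = fst (simple-++ C reps sre)
   se = snd (simple-++ C reps sre)
   cross = snd (snd (AP-++⁻ reps (ap sre)))
   ind-ρ : ∀ {p ρ} → p ∈ exs → ρ ∈ reps → Ind2 C ρ (fst p)
   ind-ρ mp mρ = All-∈ (All-∈ cross mρ) (∈-map⁺ fst mp)
   apx : AllPairs (λ p q → Ind2 C (fst p) (fst q)) exs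
   apx = AllPairsP.map⁻ (ap se)
   toEP : ∀ {p} → p ∈ exs → Nz F (fst p) → EP
   toEP {x , ρ} m nx = record { x∈ = mx ; ρ∈ = mρ ; nx = nx ; pair = epair mx mρ nx nρ (λ mz → ¬NzL (C ⟋ me) h mz) (Ind2-sym C (ind-ρ m ρ∈)) } where
    mx = All-∈ (mem se) (∈-map⁺ fst m)
    ρ∈ = fst (All-∈ exs-par m)
    h = snd (All-∈ exs-par m)
    mρ = All-∈ (mem sr) ρ∈
    nρ : Nz F ρ
    nρ = let (w , mw , d) = nx in w , mw , λ e0 → par-nz (C ⟋ me) (AllP.++⁺ mT mw) h (All-∈ (nz simp') ρ∈) (λ e1 → d (trans (F-front x w) e1)) (trans (sym (F-front ρ w)) e0)
   fin : (∃₂ λ outs ins → exs ↭ outs ++ ins × All (λ p → Nz F (fst p)) outs × All (λ p → ¬ Nz F (fst p)) ins) → Outer S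
   fin (outs , ins , pm , nos , ni) = fin2 (classify (λ p q → Ind2? F (EP.x p) (EP.x q)) eps) where
    ap2 = AP-++⁻ outs (AP-resp (Ind2-sym C) pm apx)
    out∈ : ∀ {p} → p ∈ outs → p ∈ exs
    out∈ m = ∈-resp-↭ (↭-sym pm) (∈-++⁺ˡ m)
    mkEPs : ∀ os → (∀ {p} → p ∈ os → p ∈ exs) → All (λ p → Nz F (fst p)) os → List EP
    mkEPs [] _ _ = []
    mkEPs (o ∷ os) sub (n ∷ ns) = toEP (sub (here refl)) n ∷ mkEPs os (λ m → sub (there m)) ns
    len-eps : ∀ os (sub : ∀ {p} → p ∈ os → p ∈ exs) ns → length (mkEPs os sub ns) ≡ length os
    len-eps [] _ [] = refl
    len-eps (o ∷ os) sub (n ∷ ns) = cong suc (len-eps os (λ m → sub (there m)) ns)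
    ρ-eps : ∀ os (sub : ∀ {p} → p ∈ os → p ∈ exs) ns {x} → (∀ {ρ} → ρ ∈ reps → Ind2 C ρ x) → All (λ p → Ind2 C (EP.ρ p) x) (mkEPs os sub ns)
    ρ-eps [] _ [] f = []
    ρ-eps ((x , ρ) ∷ os) sub (n ∷ ns) f = f (fst (All-∈ exs-par (sub (here refl)))) ∷ ρ-eps os (λ m → sub (there m)) ns f
    x-eps : ∀ os (sub : ∀ {p} → p ∈ os → p ∈ exs) ns {o} → o ∈ exs → All (λ p → Ind2 C (fst o) (fst p)) os →
        All (λ p → Ind2 C (fst o) (EP.x p) × (∀ {ρ} → ρ ∈ reps → Ind2 C ρ (EP.x p))) (mkEPs os sub ns)
    x-eps [] _ [] mo _ = []
    x-eps (o' ∷ os) sub (n ∷ ns) mo (i ∷ is) = (i , λ mρ → ind-ρ (sub (here refl)) mρ) ∷ x-eps os (λ m → sub (there m)) ns mo is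
    ap-eps : ∀ os (sub : ∀ {p} → p ∈ os → p ∈ exs) ns → AllPairs (λ p q → Ind2 C (fst p) (fst q)) os → AllPairs Distinct (mkEPs os sub ns)
    ap-eps [] _ [] [] = []
    ap-eps (o ∷ os) sub (n ∷ ns) (a ∷ aps) = All.zipWith (λ { ((i , j) , k) → i , j (fst (All-∈ exs-par (sub (here refl)))) , k })
     (x-eps os (λ m → sub (there m)) ns (sub (here refl)) a , ρ-eps os (λ m → sub (there m)) ns (λ mρ → ind-ρ (sub (here refl)) mρ)) ∷ ap-eps os (λ m → sub (there m)) ns aps
    eps = mkEPs outs out∈ nos
    fin2 : (∃₂ λ vs rs → eps ↭ vs ++ map fst rs × AllPairs Ind2F vs × All (λ p → snd p ∈ vs × ¬ Ind2F (fst p) (snd p)) rs) → Outer S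
    fin2 (vs , rs , qm , apv , rp) = record
     { vs = vs ; rs = rs ; ins = ins
     ; total = trans (↭-length pm) (trans (length-++ outs) (cong (ℕ._+ length ins) (trans (sym (len-eps outs out∈ nos)) (trans (↭-length qm) (trans (length-++ vs) (cong (length vs ℕ.+_) (length-map fst rs)))))))
     ; ins∈ = λ m → ∈-resp-↭ (↭-sym pm) (∈-++⁺ʳ outs m)
     ; insF = ni ; insAP = fst (snd ap2) ; vsAP = apv
     ; rsP = All.tabulate (λ {r} m → let (mp , h) = All-∈ rp m in mp , h , All-∈ (All-∈ (snd (snd aps)) mp) (∈-map⁺ fst m))
     ; rsAP = AllPairsP.map⁻ (fst (snd aps)) } where
     aps = AP-++⁻ vs (AP-resp (λ {p} {q} → Distinct-sym {p} {q}) qm (ap-eps outs out∈ nos (fst ap2)))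

  vsV : List EP → List V
  vsV = map EP.x

  vs≤N : ∀ vs → AllPairs Ind2F vs → length vs ≤ N
  vs≤N vs apv = ≤-trans (≤-reflexive (sym (length-map EP.x vs)))
   (full-independent C₀ me evF (vsV vs) (AllP.map⁺ (All.tabulate (λ {p} _ → EP.x∈ p))) (AllP.map⁺ (All.tabulate (λ {p} _ → EP.nx p)))
    (AllP.map⁺ (All.tabulate (λ {p} _ → EPair.fl (EP.pair p)))) (AllPairsP.map⁺ apv))

  -- if vs is a basis, a class in which e varies at all is one of the classes of vs
  in-basis : ∀ vs → AllPairs Ind2F vs → N ≤ length vs → ∀ {y} → y ∈ A → Nz F y → Varies C₀ e y → ∃ λ p → p ∈ vs × ¬ Ind2 F y (EP.x p)
  in-basis vs apv len {y} my ny vy = fin (findP (λ y p → Ind2? F y (EP.x p)) y vs) where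
   findP : (R? : ∀ y p → Dec (Ind2 F y (EP.x p))) → ∀ y vs → (∃ λ p → p ∈ vs × ¬ Ind2 F y (EP.x p)) ⊎ All (λ p → Ind2 F y (EP.x p)) vs
   findP R? y [] = inr []
   findP R? y (v ∷ vs) with R? y v
   ... | no h = inl (v , here refl , h)
   ... | yes h with findP R? y vs
   ...   | inl (p , m , h') = inl (p , there m , h')
   ...   | inr a = inr (h ∷ a)
   getEP : ∀ {vs v} → v ∈ vsV vs → ∃ λ p → p ∈ vs × EP.x p ≡ v
   getEP {p ∷ vs} (here refl) = p , here refl , refl
   getEP {p ∷ vs} (there m) = let (q , mq , e') = getEP m in q , there mq , e'
   ms : Ms (vsV vs)
   ms = AllP.map⁺ (All.tabulate (λ {p} _ → EP.x∈ p))
   full : ∀ {v} → v ∈ vsV vs → Full C₀ e v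
   full m with getEP m
   ... | p , _ , refl = EPair.fl (EP.pair p)
   fin : (∃ λ p → p ∈ vs × ¬ Ind2 F y (EP.x p)) ⊎ All (λ p → Ind2 F y (EP.x p)) vs → ∃ λ p → p ∈ vs × ¬ Ind2 F y (EP.x p)
   fin (inl r) = r
   fin (inr a) = ⊥-elim (tri! (spanning F {y} {vsV vs} my ny ms (AllP.map⁺ (All.tabulate (λ {p} _ → EP.nx p))) (AllPairsP.map⁺ apv)
     (λ sm1 sm2 m3 → no-tri C₀ me evF (All-∈ ms sm1) (All-∈ ms sm2) (All-∈ ms m3) (full-varies {C = C₀} (full sm1)) (full sm2) (full m3))
     (≤-trans len (≤-reflexive (sym (length-map EP.x vs)))) (AllP.map⁺ a))) where
    tri! : Triple F y (vsV vs) → ⊥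
    tri! (p , q , mp , mq , t) = no-tri C₀ me evF my (All-∈ ms mp) (All-∈ ms mq) vy (full mp) (full mq) t

 -- coordinates of y - x with respect to S, in half units
 record Offset {r} (C : Config r) (S : List V) (x y : V) : Set where
  field
   λs  : List ℤ
   off : Off C S x λs y
   len : length λs ≡ length S
   bnd : All (λ a → ∣ a ∣ ≤ 2) λs
   bit : Bool
   prt : All (λ a → par a ≡ bit) λs

 -- The parity sum of the circuit shows that omitting another member leaves the parity of the minor
 -- unchanged. So all coefficients agree modulo 2.
 coef-parity : ∀ {r} (C : Config r) s S → (∀ u → psum C (s ∷ S) u ≡ false) → ∀ p w l t r → s ∷ S ≡ l ++ t ∷ r →
        par (D C (p ++ l ++ r ++ w)) ≡ par (D C (p ++ S ++ w))
 coef-parity C s S sumE p w [] t r refl = refl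
 coef-parity C s _ sumE p w (.s ∷ l) t r refl = trans (perm-par C (PermP.shift s p (l ++ r ++ w)))
   (trans (xor-eq (trans (cong (par (D C (s ∷ u)) xor_) (sym (sum1 l (λ m → ∈-++⁺ʳ p (∈-++⁺ˡ m))))) (sumE u))) (perm-par C pm)) where
  u : List V
  u = p ++ l ++ r ++ w
  pm : t ∷ u ↭ p ++ (l ++ t ∷ r) ++ w
  pm = ↭-trans (↭-sym (PermP.shift t p (l ++ r ++ w))) (++⁺ˡ p (subst (t ∷ l ++ r ++ w ↭_) (sym (++-assoc l (t ∷ r) w)) (↭-sym (PermP.shift t l (r ++ w)))))
  sum1 : ∀ l' → (∀ {v} → v ∈ l' → v ∈ u) → psum C (l' ++ t ∷ r) u ≡ par (D C (t ∷ u))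
  sum1 [] _ = trans (cong (par (D C (t ∷ u)) xor_) (xsum-0 _ r (All.tabulate (λ m → cong par (D-mem C (∈-++⁺ʳ p (∈-++⁺ʳ l (∈-++⁺ˡ m)))))))) (xor-identityʳ _)
  sum1 (v ∷ l') sub = trans (cong (_xor psum C (l' ++ t ∷ r) u) (cong par (D-mem C (sub (here refl))))) (sum1 l' (λ m → sub (there m)))

 -- Cramer's rule with a pivot ±2; agreement modulo `S` makes the coefficient of `x` equal to 1, as
 -- in `offset`.
 off-exist : ∀ {r} (C : Config r) s S → Ms (s ∷ S) → (∀ u → psum C (s ∷ S) u ≡ false) → ∀ {x y w} → x ∈ A → y ∈ A → Ms w →
       ∣ D C (x ∷ s ∷ S ++ w) ∣ ≡ 2 → (∀ z → D C (y ∷ s ∷ S ++ z) ≡ D C (x ∷ s ∷ S ++ z)) → Offset C (s ∷ S) x y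
 off-exist C s S' mS sumE {x} {y} {w} mx my mw dd eqS = result (abs2 {d} dd) where
  S = s ∷ S'
  d = D C (x ∷ S ++ w)
  dep : ∀ {z} → Ms z → D C (y ∷ x ∷ S ++ z) ≡ + 0
  dep {z} _ = perm-0 C (↭-prep y (PermP.shift x S z)) (trans (eqS (x ∷ z)) (D-mem C (∈-++⁺ʳ S (here refl))))
  G : List V → ℤ
  G ys = D C (y ∷ x ∷ ys)
  cs = coefs G S w
  rel : ∀ z → d * D C (y ∷ z) ≡ d * D C (x ∷ z) + - dot cs (map (λ v → D C (v ∷ z)) S)
  rel z = trans (spanned C y (x ∷ S) w mw dep z) (cong₂ (λ a b → a * D C (x ∷ z) + b) (eqS w) (dot-neg cs (map (λ v → D C (v ∷ z)) S)))
  bit₀ = par (G (S' ++ w))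
  P : ℤ → Set
  P a = ∣ a ∣ ≤ 2 × par a ≡ bit₀
  P-neg : ∀ {a} → P a → P (- a)
  P-neg {a} (b , p) = subst (_≤ 2) (sym (∣-i∣≡∣i∣ a)) b , trans (par-neg a) p
  Ps : All P cs
  Ps = coefs-All P (λ {a} → P-neg {a}) G S w one where
   one : ∀ l t r → S ≡ l ++ t ∷ r → P (G (l ++ r ++ w))
   one l t r eqs = bdd C (my ∷ mx ∷ AllP.++⁺ (fst ml) (AllP.++⁺ (All.tail (snd ml)) mw)) , coef-parity C s S' sumE (y ∷ x ∷ []) w l t r eqs where
    ml = AllP.++⁻ l (subst Ms eqs mS)
  result : (d ≡ + 2) ⊎ (d ≡ - + 2) → Offset C S x y
  result (inl p) = record { λs = map -_ cs ; off = λ z → trans (cong (_* D C (y ∷ z)) (sym p)) (trans (rel z) (cong₂ _+_ (cong (_* D C (x ∷ z)) p) (sym (dot-neg cs (map (λ v → D C (v ∷ z)) S)))))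
   ; len = trans (length-map -_ cs) (coefs-length G S w)
   ; bnd = AllP.map⁺ (All.map (λ {a} h → fst (P-neg {a} h)) Ps) ; bit = bit₀ ; prt = AllP.map⁺ (All.map (λ {a} h → snd (P-neg {a} h)) Ps) }
  result (inr p) = record { λs = cs ; off = λ z → l (D C (y ∷ z)) (D C (x ∷ z)) (dot cs (map (λ v → D C (v ∷ z)) S)) (trans (cong (_* D C (y ∷ z)) (sym p)) (trans (rel z) (cong (λ t → t * D C (x ∷ z) + - dot cs (map (λ v → D C (v ∷ z)) S)) p)))
   ; len = coefs-length G S w ; bnd = All.map fst Ps ; bit = bit₀ ; prt = All.map snd Ps } where
   l : ∀ m k c → - + 2 * m ≡ - + 2 * k + - c → + 2 * m ≡ + 2 * k + c
   l m k c h = trans (q1 m) (trans (cong -_ h) (q2 k c)) where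
    q1 = ring-61
    q2 = ring-62

 -- Squares and their diagonals

 record Square {r} (C : Config r) (e s : V) : Set where
  field
   {b bₑ bₛ bₑₛ} : V
   b∈   : b ∈ A
   bₑ∈  : bₑ ∈ A
   bₛ∈  : bₛ ∈ A
   bₑₛ∈ : bₑₛ ∈ A
   v₁   : Vary C e b bₑ (+ 2)
   v₂   : Vary C s b bₛ (+ 2)
   v₃   : Vary C e bₛ bₑₛ (+ 2)

 -- a pair differing by e + s or e - s
 Diag : ∀ {r} → Config r → V → V → ℤ → V → V → Set
 Diag C e s c y y' = ∀ z → + 2 * D C (y' ∷ z) ≡ + 2 * D C (e ∷ z) + (c * D C (s ∷ z) + + 2 * D C (y ∷ z))

 module _ {r} (C : Config r) {e s : V} where

  diag : (B : Square C e s) → Diag C e s (+ 2) (Square.b B) (Square.bₑₛ B)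
  diag B z = l (D C (b ∷ z)) (D C (bₛ ∷ z)) (D C (bₑₛ ∷ z)) (D C (e ∷ z)) (D C (s ∷ z)) (at v₂ z) (at v₃ z) where
   open Square B
   l : ∀ b bs bes e s → + 2 * bs ≡ + 2 * b + + 2 * s → + 2 * bes ≡ + 2 * bs + + 2 * e → + 2 * bes ≡ + 2 * e + (+ 2 * s + + 2 * b)
   l b bs bes e s p q = trans q (trans (cong (_+ + 2 * e) p) (r1 b e s)) where
    r1 = ring-63

  antidiag : (B : Square C e s) → Diag C e s (- + 2) (Square.bₛ B) (Square.bₑ B)
  antidiag B z = l (D C (b ∷ z)) (D C (bₑ ∷ z)) (D C (bₛ ∷ z)) (D C (e ∷ z)) (D C (s ∷ z)) (at v₁ z) (at v₂ z) where
   open Square B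
   l : ∀ b be bs e s → + 2 * be ≡ + 2 * b + + 2 * e → + 2 * bs ≡ + 2 * b + + 2 * s → + 2 * be ≡ + 2 * e + (- + 2 * s + + 2 * bs)
   l b be bs e s p q = trans p (trans (r1 b e s) (cong (λ t → + 2 * e + (- + 2 * s + t)) (sym q))) where
    r1 = ring-64

  -- The vectors e + s and e - s span a sublattice of index 2, so the four given vectors would have
  -- a minor ±4.
  diag-clash : ∀ {y y' u u' w} → y ∈ A → y' ∈ A → u ∈ A → u' ∈ A → Ms w → Diag C e s (+ 2) y y' → Diag C e s (- + 2) u u' →
         ∣ D C (e ∷ s ∷ y ∷ u ∷ w) ∣ ≡ 2 → ⊥
  diag-clash {y} {y'} {u} {u'} {w} my my' mu mu' mw dg ad d2 = ≤⇒≤ᵇ (det-bound C (y ∷ y' ∷ u ∷ u' ∷ []) cols {w} refl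
    ((λ z → r1 (D C (e ∷ z)) (D C (s ∷ z)) (D C (y ∷ z)) (D C (u ∷ z))) ,
     (λ z → r2 (D C (y' ∷ z)) (D C (e ∷ z)) (D C (s ∷ z)) (D C (y ∷ z)) (D C (u ∷ z)) (dg z)) ,
     (λ z → r3 (D C (e ∷ z)) (D C (s ∷ z)) (D C (y ∷ z)) (D C (u ∷ z))) ,
     (λ z → r4 (D C (u' ∷ z)) (D C (e ∷ z)) (D C (s ∷ z)) (D C (y ∷ z)) (D C (u ∷ z)) (ad z)) , tt)
    (my ∷ my' ∷ mu ∷ mu' ∷ []) mw d2) where
   cols : Cols
   cols = (e , + 0 ∷ + 2 ∷ + 0 ∷ + 2 ∷ []) ∷ (s , + 0 ∷ + 2 ∷ + 0 ∷ - + 2 ∷ []) ∷ (y , + 2 ∷ + 2 ∷ + 0 ∷ + 0 ∷ []) ∷ (u , + 0 ∷ + 0 ∷ + 2 ∷ + 2 ∷ []) ∷ []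
   r1 = ring-65
   r2 : ∀ y' e s y u → + 2 * y' ≡ + 2 * e + (+ 2 * s + + 2 * y) → + 2 * y' ≡ + 2 * e + (+ 2 * s + (+ 2 * y + (+ 0 * u + + 0)))
   r2 y' e s y u h = trans h (l e s y u) where
    l = ring-66
   r3 = ring-67
   r4 : ∀ u' e s y u → + 2 * u' ≡ + 2 * e + (- + 2 * s + + 2 * u) → + 2 * u' ≡ + 2 * e + (- + 2 * s + (+ 0 * y + (+ 2 * u + + 0)))
   r4 u' e s y u h = trans h (l e s y u) where
    l = ring-68

 module FSquare {N n} (C : Config (suc n)) (C₀ : Config (suc N)) {e} (me : e ∈ A) (t : V) (T' : List V) (mT : Ms (t ∷ T'))
  (eq₀ : ∀ z → D C₀ z ≡ D C (t ∷ T' ++ z)) (evS : ∀ {z} → Ms z → par (D C (e ∷ t ∷ T' ++ z)) ≡ false)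
  (sumE : ∀ u → psum C (e ∷ t ∷ T') u ≡ false) where

  open FSplit C C₀ me t T' mT eq₀ evS sumE public

  square : ∀ {q p s} (R : Rep q p) {c} → c ≡ + 2 ⊎ c ≡ - + 2 → Vary C s (EP.κ p) (Rep.μ R) c →
       Σ (Square C e s) λ B → ∀ z → D F (Square.b B ∷ z) ≡ D F (EP.κ p ∷ z)
  square {q} {p} R (inl refl) v = record { b∈ = EP.κ∈ p ; bₑ∈ = EP.κ⁺∈ p ; bₛ∈ = Rep.μ∈ R ; bₑₛ∈ = Rep.μ⁺∈ R ; v₁ = EP.ep p ; v₂ = v ; v₃ = Rep.eμ R } , (λ _ → refl)
  square {q} {p} R (inr refl) v = record { b∈ = Rep.μ∈ R ; bₑ∈ = Rep.μ⁺∈ R ; bₛ∈ = EP.κ∈ p ; bₑₛ∈ = EP.κ⁺∈ p ; v₁ = Rep.eμ R ; v₂ = vary-sym v ; v₃ = EP.ep p } , Rep.cls R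

  F-2 : ∀ {x x' y y'} → (∀ z → D F (x' ∷ z) ≡ D F (x ∷ z)) → (∀ z → D F (y' ∷ z) ≡ D F (y ∷ z)) → ∀ z → D F (x' ∷ y' ∷ z) ≡ D F (x ∷ y ∷ z)
  F-2 {x} {x'} {y} {y'} hx hy z = trans (hx (y' ∷ z)) (trans (alt F [] x y' z) (trans (cong -_ (hy (x ∷ z))) (sym (alt F [] x y z))))

  -- members of a square keep the class
  sq-class : ∀ {s} → s ∈ T → (B : Square C e s) → ∀ z → D F (Square.bₛ B ∷ z) ≡ D F (Square.b B ∷ z)
  sq-class {s} ms B z = cancel-≡ {+ 2} _ _ (λ ()) (trans (cong (+ 2 *_) (F-front bₛ z)) (trans (cong (+ 2 *_) (alt C [] e bₛ (T ++ z)))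
    (trans (l1 (D C (bₛ ∷ e ∷ T ++ z))) (trans (cong -_ (at v₂ (e ∷ T ++ z))) (trans (cong (λ t → - (+ 2 * D C (b ∷ e ∷ T ++ z) + + 2 * t)) (D-mem C (there (∈-++⁺ˡ ms))))
    (trans (l2 (D C (b ∷ e ∷ T ++ z))) (cong (+ 2 *_) (trans (sym (alt C [] e b (T ++ z))) (sym (F-front b z)))))))))) where
   open Square B
   l1 = ring-33
   l2 = ring-69

  -- A square has diagonals in both directions, so the diagonal of one and the antidiagonal of the
  -- other clash.
  two-squares : ∀ {s l r} → T ≡ l ++ s ∷ r → (B B' : Square C e s) → ¬ Ind2 F (Square.b B) (Square.b B')
  two-squares {s} {l} {r} eqT B B' (w , mw , d) = diag-clash C {e} {s} {w = l ++ r ++ w} B.b∈ B.bₑₛ∈ B'.bₛ∈ B'.bₑ∈ (AllP.++⁺ (fst ml) (AllP.++⁺ (All.tail (snd ml)) mw))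
    (diag C B) (antidiag C B') d2 where
   module B = Square B
   module B' = Square B'
   ml = AllP.++⁻ l (subst Ms eqT mT)
   s∈T : s ∈ T
   s∈T = subst (s ∈_) (sym eqT) (∈-mid l s r)
   pm : e ∷ s ∷ B.b ∷ B'.bₛ ∷ l ++ r ++ w ↭ T ++ e ∷ B.b ∷ B'.bₛ ∷ w
   pm = ↭-sym (subst (λ S → S ++ e ∷ B.b ∷ B'.bₛ ∷ w ↭ e ∷ s ∷ B.b ∷ B'.bₛ ∷ l ++ r ++ w) (sym eqT)
      (subst (_↭ e ∷ s ∷ B.b ∷ B'.bₛ ∷ l ++ r ++ w) (sym (++-assoc l (s ∷ r) (e ∷ B.b ∷ B'.bₛ ∷ w)))
      (↭-trans (PermP.shift s l (r ++ e ∷ B.b ∷ B'.bₛ ∷ w)) (↭-trans (↭-prep s (mv l r)) (↭-swap s e ↭-refl))))) where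
    mv : ∀ l r → l ++ r ++ e ∷ B.b ∷ B'.bₛ ∷ w ↭ e ∷ B.b ∷ B'.bₛ ∷ l ++ r ++ w
    mv l r = subst₂ (λ a b → a ↭ e ∷ B.b ∷ B'.bₛ ∷ b) (++-assoc l r (e ∷ B.b ∷ B'.bₛ ∷ w)) (++-assoc l r w)
      (↭-trans (PermP.shift e (l ++ r) (B.b ∷ B'.bₛ ∷ w)) (↭-prep e (↭-trans (PermP.shift B.b (l ++ r) (B'.bₛ ∷ w)) (↭-prep B.b (PermP.shift B'.bₛ (l ++ r) w)))))
   d2 : ∣ D C (e ∷ s ∷ B.b ∷ B'.bₛ ∷ l ++ r ++ w) ∣ ≡ 2
   d2 = trans (perm-abs C pm) (trans (cong ∣_∣ (trans (sym (eqF (B.b ∷ B'.bₛ ∷ w))) (F-2 {B.b} {B.b} {B'.b} {B'.bₛ} (λ _ → refl) (sq-class s∈T B') w)))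
       (even-abs {C = F} evF (B.b∈ ∷ B'.b∈ ∷ mw) d))

 -- Minimal heavy sets and the points in their span

 Heavy : ∀ {r} → Config r → List V → Set
 Heavy C S = (∀ {z} → Ms z → par (D C (S ++ z)) ≡ false) × NzL C S

 -- The pattern `y ∷ S` restricts the condition to nonempty sets.
 NoHeavy : ∀ {r} → Config r → ℕ → Set
 NoHeavy C k = ∀ y S → Ms (y ∷ S) → suc (length S) ≤ k → ¬ Heavy C (y ∷ S)

 module _ {r} (C : Config r) where

  NzL-perm : ∀ {S S'} → S ↭ S' → NzL C S → NzL C S'
  NzL-perm p (z , mz , d) = z , mz , perm-≢ C (++⁺ʳ z p) d

  heavy-perm : ∀ {S S'} → S ↭ S' → Heavy C S → Heavy C S'
  heavy-perm p (ev , nz) = (λ {z} mz → trans (perm-par C (++⁺ʳ z (↭-sym p))) (ev mz)) , NzL-perm p nz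

  odd-wit : ∀ {k} → NoHeavy C k → ∀ y S → Ms (y ∷ S) → suc (length S) ≤ k → NzL C (y ∷ S) → ∃ λ w → Ms w × par (D C (y ∷ S ++ w)) ≡ true
  odd-wit nh y S ms le nz with Odd? C (y ∷ S)
  ... | yes h = h
  ... | no h = ⊥-elim (nh y S ms le ((λ {z} mz → false≢ (λ p → h (z , mz , p))) , nz))

  -- Omitting a member leaves an independent set that is too small to be heavy; this supplies the
  -- odd minors of a circuit.
  min-sum : ∀ {j} S → Ms S → Heavy C S → length S ≡ suc (suc j) → NoHeavy C (suc j) → ∀ u → psum C S u ≡ false
  min-sum {j} S ms (ev , nz) len nh = parity-sum C S ms ev wit where
   wit : ∀ l s t → S ≡ l ++ s ∷ t → ∃ λ w → Ms w × par (D C (l ++ t ++ w)) ≡ true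
   wit l s t refl = go (l ++ t) refl where
    pm : l ++ s ∷ t ↭ s ∷ l ++ t
    pm = PermP.shift s l t
    lt : suc (length (l ++ t)) ≡ suc (suc j)
    lt = trans (sym (↭-length pm)) len
    go : ∀ lt' → lt' ≡ l ++ t → ∃ λ w → Ms w × par (D C (l ++ t ++ w)) ≡ true
    go [] e = ⊥-elim (bad (trans (cong (λ x → suc (length x)) e) lt)) where
     bad : ∀ {j} → 1 ≢ suc (suc j)
     bad ()
    go (y ∷ S') e with odd-wit nh y S' (subst Ms (sym e) (All-mid l ms)) (≤-reflexive (suc-injective (trans (cong (λ x → suc (length x)) e) lt)))
             (drop-s (NzL-perm pm nz)) where
     drop-s : NzL C (s ∷ l ++ t) → NzL C (y ∷ S')
     drop-s (z , mz , d) = s ∷ z , All-∈ ms (∈-mid l s t) ∷ mz , subst (λ x → 0≢ (D C (x ++ s ∷ z))) (sym e) (perm-≢ C (↭-sym (PermP.shift s (l ++ t) z)) d)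
    ... | w , mw , o = w , mw , trans (cong (λ x → par (D C x)) (trans (sym (++-assoc l t w)) (cong (_++ w) (sym e)))) o

 record Coord {r} (C : Config r) (S : List V) (x : V) : Set where
  field
   λs  : List ℤ
   rel : ∀ z → + 2 * D C (x ∷ z) ≡ dot λs (map (λ s → D C (s ∷ z)) S)
   len : length λs ≡ length S
   bnd : All (λ a → ∣ a ∣ ≤ 2) λs
   bit : Bool
   prt : All (λ a → par a ≡ bit) λs

 coord : ∀ {r} (C : Config r) s S → Ms (s ∷ S) → (∀ u → psum C (s ∷ S) u ≡ false) → ∀ {x w} → x ∈ A → Ms w →
     ∣ D C (s ∷ S ++ w) ∣ ≡ 2 → (∀ {z} → Ms z → D C (x ∷ s ∷ S ++ z) ≡ + 0) → Coord C (s ∷ S) x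
 coord C s S' mS sumE {x} {w} mx mw dd dep = result (abs2 {d} dd) where
  S = s ∷ S'
  d = D C (S ++ w)
  G : List V → ℤ
  G ys = D C (x ∷ ys)
  cs = coefs G S w
  rel : ∀ z → d * D C (x ∷ z) ≡ dot cs (map (λ v → D C (v ∷ z)) S)
  rel = spanned C x S w mw dep
  P : ℤ → Set
  P a = ∣ a ∣ ≤ 2 × par a ≡ par (G (S' ++ w))
  P-neg : ∀ {a} → P a → P (- a)
  P-neg {a} (b , p) = subst (_≤ 2) (sym (∣-i∣≡∣i∣ a)) b , trans (par-neg a) p
  Ps : All P cs
  Ps = coefs-All P (λ {a} → P-neg {a}) G S w λ l t r eqs → let ml = AllP.++⁻ l (subst Ms eqs mS) in
   bdd C (mx ∷ AllP.++⁺ (fst ml) (AllP.++⁺ (All.tail (snd ml)) mw)) , coef-parity C s S' sumE (x ∷ []) w l t r eqs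
  result : (d ≡ + 2) ⊎ (d ≡ - + 2) → Coord C S x
  result (inl p) = record { λs = cs ; rel = λ z → trans (cong (_* D C (x ∷ z)) (sym p)) (rel z) ; len = coefs-length G S w
   ; bnd = All.map fst Ps ; bit = par (G (S' ++ w)) ; prt = All.map snd Ps }
  result (inr p) = record { λs = map -_ cs ; len = trans (length-map -_ cs) (coefs-length G S w)
   ; rel = λ z → trans (l (D C (x ∷ z)) _ (trans (cong (_* D C (x ∷ z)) (sym p)) (rel z))) (sym (dot-neg cs (map (λ v → D C (v ∷ z)) S)))
   ; bnd = AllP.map⁺ (All.map (λ {a} h → fst (P-neg {a} h)) Ps) ; bit = par (G (S' ++ w)) ; prt = AllP.map⁺ (All.map (λ {a} h → snd (P-neg {a} h)) Ps) } where
   l : ∀ m c → - + 2 * m ≡ c → + 2 * m ≡ - c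
   l m c h = trans (q m) (cong -_ h) where
    q = ring-61

 all-ev : ∀ {as} → All (λ a → ∣ a ∣ ≤ 2) as → All (λ a → par a ≡ false) as → All Ev as
 all-ev [] [] = []
 all-ev (b ∷ bs) (p ∷ ps) = ev-small p b ∷ all-ev bs ps

 all-odd : ∀ {as} → All (λ a → ∣ a ∣ ≤ 2) as → All (λ a → par a ≡ true) as → All PM1 as
 all-odd [] [] = []
 all-odd (b ∷ bs) (p ∷ ps) = odd-small p b ∷ all-odd bs ps

 -- The points in the span of a minimal heavy set, up to sign: its members, and the half sums with
 -- all coefficients ±1/2.
 data Inner {r} (C : Config r) (S : List V) (x : V) : Set where
  member : ∀ {s} → s ∈ S → Pm C s x → Inner C S x
  signs  : ∀ as → (∀ z → + 2 * D C (x ∷ z) ≡ dot as (map (λ s → D C (s ∷ z)) S)) → All PM1 as → length as ≡ length S → Inner C S x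

 mult-pm : ∀ {r} (C : Config r) {a s x} → PM2 a → (∀ z → + 2 * D C (x ∷ z) ≡ a * D C (s ∷ z)) → Pm C s x
 mult-pm C {s = s} {x} pm+ h = inl (λ z → cancel-≡ {+ 2} _ _ (λ ()) (h z))
 mult-pm C {s = s} {x} pm- h = inr (λ z → cancel-≡ {+ 2} _ _ (λ ()) (trans (h z) (l (D C (s ∷ z))))) where
  l = ring-70

 -- The doubled coordinates share one parity. If they are even and more than one is nonzero, `x` and
 -- the members with coordinate 0 form a smaller heavy set, by the parity sum.
 inner : ∀ {r} (C : Config r) e T → Ms (e ∷ T) → Heavy C (e ∷ T) → NoHeavy C (length T) → (∀ u → psum C (e ∷ T) u ≡ false) →
     ∀ {x} → x ∈ A → Nz C x → ¬ NzL C (x ∷ e ∷ T) → Inner C (e ∷ T) x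
 inner C e T mS hv@(ev , (w , mw , dw)) nh sumE {x} mx (z₀ , mz₀ , d₀) h = go (coord C e T mS sumE mx mw (even-val (ev mw) (bdd C (AllP.++⁺ mS mw)) dw) (¬NzL C h)) where
  S = e ∷ T
  go : Coord C S x → Inner C S x
  go K = go1 bit refl where
   open Coord K
   go1 : ∀ b → bit ≡ b → Inner C S x
   go1 true e1 = signs λs rel (all-odd bnd (subst (λ b → All (λ a → par a ≡ b) λs) e1 prt)) len
   go1 false e1 = go2 (part S (all-ev bnd (subst (λ b → All (λ a → par a ≡ b) λs) e1 prt)) len) where
    go2 : AllZero λs ⊎ Part λs S → Inner C S x
    go2 (inl az) = ⊥-elim (d₀ (cancel-≡ {+ 2} _ (+ 0) (λ ()) (trans (rel z₀) (dot-0 {V} az (map (λ s → D C (s ∷ z₀)) S)))))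
    go2 (inr P) = go3 Is refl where
     open Part P
     go3 : ∀ I' → I' ≡ Is → Inner C S x
     go3 [] e2 = member (∈-resp-↭ (↭-sym perm) (here refl)) (mult-pm C a2 (λ z → trans (rel z) (only _ (subst (All _) e2 []))))
     go3 (i ∷ I') e2 = ⊥-elim (nh x Zs (mx ∷ mZ) le (hev , hnz)) where
      mP : Ms (s ∷ Is ++ Zs)
      mP = All-resp-↭ perm mS
      mZ : Ms Zs
      mZ = ++⁻ʳ (s ∷ Is) mP
      le : suc (length Zs) ≤ length T
      le = ≤-trans (≤-trans (s≤s (ℕP.m≤n+m (length Zs) (length I'))) (≤-reflexive (trans (cong suc (sym (length-++ I'))) (trans (cong (λ t → length (t ++ Zs)) e2) refl))))
          (≤-reflexive (suc-injective (sym (↭-length perm))))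
      hev : ∀ {z} → Ms z → par (D C (x ∷ Zs ++ z)) ≡ false
      hev {z} mz = let (g , e3 , p3) = half (λ s → D C (s ∷ Zs ++ z)) (All.tabulate (λ m → D-mem C (∈-++⁺ˡ m)))
             in trans (cong par (cancel-≡ {+ 2} _ g (λ ()) (trans (rel (Zs ++ z)) e3))) (trans p3 (sumE (Zs ++ z)))
      hnz : NzL C (x ∷ Zs)
      hnz = Is ++ w , AllP.++⁺ (++⁻ˡ Is (All.tail mP)) mw , λ e0 → *≢0 (PM2-≢ a2) ds (trans (sym (only _ (All.tabulate (λ m → D-mem C (∈-++⁺ʳ Zs (∈-++⁺ˡ m))))))
           (trans (sym (rel (Zs ++ Is ++ w))) (cong (+ 2 *_) e0))) where
       ds : 0≢ (D C (s ∷ Zs ++ Is ++ w))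
       ds = perm-≢ C (↭-trans (++⁺ʳ w perm) (↭-prep s (subst₂ _↭_ refl (++-assoc Zs Is w) (++⁺ʳ w (++-comm Is Zs))))) dw

 -- Repetitions of classes and their directions

 module Gen {N n} (C : Config (suc n)) (C₀ : Config (suc N)) {e} (me : e ∈ A) (t : V) (T' : List V) (mT : Ms (t ∷ T'))
  (eq₀ : ∀ z → D C₀ z ≡ D C (t ∷ T' ++ z)) (hv : Heavy C (e ∷ t ∷ T')) (nh : NoHeavy C (suc (length T'))) where

  psumS : ∀ u → psum C (e ∷ t ∷ T') u ≡ false
  psumS = min-sum C (e ∷ t ∷ T') (me ∷ mT) hv refl nh

  open FSquare C C₀ me t T' mT eq₀ (fst hv) psumS public

  -- If more than one coordinate of μ - κ were nonzero, then κ, μ + e and the members with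
  -- coordinate 0 would be heavy: modulo 2, and with those members present, adding `e` completes the
  -- displacement to the full circuit sum.
  axial : ∀ {κ μ μ⁺ λs w} → κ ∈ A → μ⁺ ∈ A → Off C T κ λs μ → All Ev λs → length λs ≡ length T → ¬ AllZero λs →
      Vary C e μ μ⁺ (+ 2) → Ms w → ∣ D F (κ ∷ w) ∣ ≡ 2 → ∃ λ s → s ∈ T × (∃ λ c → PM2 c × Vary C s κ μ c)
  axial {κ} {μ} {μ⁺} {λs} {w} mκ mμ⁺ off evs len nz vμ mw d2 = go (part T evs len) where
   go : AllZero λs ⊎ Part λs T → ∃ λ s → s ∈ T × (∃ λ c → PM2 c × Vary C s κ μ c)
   go (inl z) = ⊥-elim (nz z)
   go (inr P) = go2 Is refl where
    open Part P
    go2 : ∀ I' → I' ≡ Is → ∃ λ s → s ∈ T × (∃ λ c → PM2 c × Vary C s κ μ c)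
    go2 [] e2 = s , ∈-resp-↭ (↭-sym perm) (here refl) , a , a2 , mkV λ z → trans (off z) (cong (λ t → + 2 * D C (κ ∷ z) + t) (only _ (subst (All _) e2 [])))
    go2 (i ∷ I') e2 = ⊥-elim (nh κ (μ⁺ ∷ Zs) (mκ ∷ mμ⁺ ∷ mZ) le (hev , hnz)) where
     mP : Ms (s ∷ Is ++ Zs)
     mP = All-resp-↭ perm mT
     mZ : Ms Zs
     mZ = ++⁻ʳ (s ∷ Is) mP
     le : suc (suc (length Zs)) ≤ suc (length T')
     le = ≤-trans (s≤s (≤-trans (s≤s (ℕP.m≤n+m (length Zs) (length I'))) (≤-reflexive (trans (cong suc (sym (length-++ I'))) (cong (λ t → length (t ++ Zs)) e2)))))
         (≤-reflexive (sym (↭-length perm)))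
     sumd : ∀ u h → κ ∈ u → dot λs (map (λ s → D C (s ∷ u)) T) ≡ + 2 * h → D C (μ⁺ ∷ u) ≡ D C (e ∷ u) + h
     sumd u h m eqh = cancel-≡ {+ 2} _ _ (λ ()) (trans (at vμ u) (trans (cong (_+ + 2 * D C (e ∷ u)) (trans (off u) (cong₂ (λ a b → + 2 * a + b) (D-mem C m) eqh))) (l (D C (e ∷ u)) h))) where
      l = ring-71
     hev : ∀ {z} → Ms z → par (D C (κ ∷ μ⁺ ∷ Zs ++ z)) ≡ false
     hev {z} mz = let u = κ ∷ Zs ++ z
                      (g , e3 , p3) = half (λ s → D C (s ∷ u)) (All.tabulate (λ m → D-mem C (there (∈-++⁺ˡ m))))
            in trans (perm-par C (↭-swap κ μ⁺ ↭-refl)) (trans (cong par (sumd u g (here refl) e3)) (trans (par-+ (D C (e ∷ u)) g) (trans (cong (par (D C (e ∷ u)) xor_) p3) (psumS u))))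
     hnz : NzL C (κ ∷ μ⁺ ∷ Zs)
     hnz = s ∷ Is ++ w , All.head mP ∷ AllP.++⁺ (++⁻ˡ Is (All.tail mP)) mw , λ e0 → abs2-≢ d2 (trans (F-front κ w) (fz e0)) where
      u : List V
      u = κ ∷ Zs ++ s ∷ Is ++ w
      d0 : dot λs (map (λ s → D C (s ∷ u)) T) ≡ + 2 * + 0
      d0 = trans (only _ (All.tabulate (λ m → D-mem C (there (∈-++⁺ʳ Zs (there (∈-++⁺ˡ m)))))))
          (trans (cong (a *_) (D-mem C (there (∈-++⁺ʳ Zs (here refl))))) (*-zeroʳ a))
      pm : u ↭ κ ∷ T ++ w
      pm = ↭-prep κ (↭-trans (subst (_↭ (s ∷ Is ++ Zs) ++ w) (++-assoc Zs (s ∷ Is) w) (++⁺ʳ w (++-comm Zs (s ∷ Is)))) (++⁺ʳ w (↭-sym perm)))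
      fz : D C (κ ∷ μ⁺ ∷ Zs ++ s ∷ Is ++ w) ≡ + 0 → D C (e ∷ κ ∷ T ++ w) ≡ + 0
      fz e0 = perm-0 C (↭-prep e pm) (trans (sym (trans (sumd u (+ 0) (here refl) d0) (ℤP.+-identityʳ _))) (perm-0 C (↭-swap κ μ⁺ ↭-refl) e0))

  -- Fill the remaining places of the frame minor ±2 with everything but `s`: each other member of
  -- `T` is then repeated.
  dual : ∀ {s κ w} → s ∈ T → ∣ D F (κ ∷ w) ∣ ≡ 2 → ∃ λ z → 0≢ (D C (s ∷ z)) × (∀ {s'} → s' ∈ T → s' ≡ s ⊎ D C (s' ∷ z) ≡ + 0)
  dual {s} {κ} {w} ms d2 = start (∈-split ms) where
   start : (∃₂ λ l r → T ≡ l ++ s ∷ r) → ∃ λ z → 0≢ (D C (s ∷ z)) × (∀ {s'} → s' ∈ T → s' ≡ s ⊎ D C (s' ∷ z) ≡ + 0)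
   start (l , r , eqT) = e ∷ κ ∷ l ++ r ++ w , dnz , λ m → off (∈-≡ l (subst (_ ∈_) eqT m)) where
    off : ∀ {s'} → s' ≡ s ⊎ s' ∈ l ++ r → s' ≡ s ⊎ D C (s' ∷ e ∷ κ ∷ l ++ r ++ w) ≡ + 0
    off (inl p) = inl p
    off (inr m) = inr (D-mem C (there (there (subst (_ ∈_) (++-assoc l r w) (∈-++⁺ˡ m)))))
    pm : e ∷ κ ∷ T ++ w ↭ s ∷ e ∷ κ ∷ l ++ r ++ w
    pm = subst (λ S → e ∷ κ ∷ S ++ w ↭ s ∷ e ∷ κ ∷ l ++ r ++ w) (sym eqT) (subst (λ S → e ∷ κ ∷ S ↭ s ∷ e ∷ κ ∷ l ++ r ++ w) (sym (++-assoc l (s ∷ r) w))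
        (PermP.shift s (e ∷ κ ∷ l) (r ++ w)))
    dnz : 0≢ (D C (s ∷ e ∷ κ ∷ l ++ r ++ w))
    dnz = perm-≢ C pm (λ e0 → abs2-≢ d2 (trans (F-front κ w) e0))

  record RS (vs : List EP) : Set where
   field
    {q p} : EP
    p∈    : p ∈ vs
    Rp     : Rep q p
    {s}   : V
    s∈    : s ∈ T
    {c}   : ℤ
    c2    : PM2 c
    al    : Vary C s (EP.κ p) (Rep.μ Rp) c
   sqr = square {q} {p} {s} Rp (pm-or c2) al
   B = fst sqr

  -- Two displacements c₁ s₁, c₂ s₂ along members of T never differ by a third such displacement.
  three-shifts : ∀ {κ μ₁ μ₂ s₁ s₂ s₃ c₁ c₂ c₃ w} → ∣ D F (κ ∷ w) ∣ ≡ 2 → s₁ ∈ T → s₂ ∈ T → s₃ ∈ T → PM2 c₁ → PM2 c₂ → PM2 c₃ →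
          Vary C s₁ κ μ₁ c₁ → Vary C s₂ κ μ₂ c₂ → Vary C s₃ μ₁ μ₂ c₃ → ⊥
  three-shifts {κ} {μ₁} {μ₂} {s₁} {s₂} {s₃} {c₁} {c₂} {c₃} {w} d2 ms₁ ms₂ ms₃ pc₁ pc₂ pc₃ v₁ v₂ v₃ = fin (dual {s₁} {κ} {w} ms₁ d2) where
   rel : ∀ z → c₂ * D C (s₂ ∷ z) ≡ c₁ * D C (s₁ ∷ z) + c₃ * D C (s₃ ∷ z)
   rel z = l (D C (κ ∷ z)) (+ 2 * D C (μ₁ ∷ z)) (+ 2 * D C (μ₂ ∷ z)) (c₂ * D C (s₂ ∷ z)) (c₁ * D C (s₁ ∷ z)) (c₃ * D C (s₃ ∷ z)) (at v₁ z) (at v₂ z) (at v₃ z) where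
    l : ∀ k m1' m2' x y w → m1' ≡ + 2 * k + y → m2' ≡ + 2 * k + x → m2' ≡ m1' + w → x ≡ y + w
    l k m1' m2' x y w refl refl h = trans (q1 k x) (trans (cong (λ t → t - + 2 * k) h) (q2 k y w)) where
     q1 = ring-72
     q2 = ring-73
   vanish : ∀ {c} x → PM2 c → c * x ≡ + 0 → x ≡ + 0
   vanish {c} x pc h = cancel-≡ {c} x (+ 0) (PM2-≢ pc) (trans h (sym (*-zeroʳ c)))
   times-0 : ∀ c {x} → x ≡ + 0 → c * x ≡ + 0
   times-0 c refl = *-zeroʳ c
   add-0 : ∀ x {y} → y ≡ + 0 → x + y ≡ x
   add-0 x refl = ℤP.+-identityʳ x
   fin : (∃ λ z → 0≢ (D C (s₁ ∷ z)) × (∀ {s'} → s' ∈ T → s' ≡ s₁ ⊎ D C (s' ∷ z) ≡ + 0)) → ⊥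
   fin (z , ne , oth) = cases (oth ms₂) (oth ms₃) where
    second : s₃ ≡ s₁ → (∃ λ z' → 0≢ (D C (s₂ ∷ z')) × (∀ {s'} → s' ∈ T → s' ≡ s₂ ⊎ D C (s' ∷ z') ≡ + 0)) → D C (s₂ ∷ z) ≡ + 0 → ⊥
    second eq₃ (z' , ne' , oth') hb = last (oth' ms₁) where
     last : s₁ ≡ s₂ ⊎ D C (s₁ ∷ z') ≡ + 0 → ⊥
     last (inl eq) = ne (trans (cong (λ t → D C (t ∷ z)) eq) hb)
     last (inr h) = ne' (vanish (D C (s₂ ∷ z')) pc₂ (trans (rel z') (trans (add-0 _ (times-0 c₃ (trans (cong (λ t → D C (t ∷ z')) eq₃) h))) (times-0 c₁ h))))
    third : c₂ ≡ c₁ → s₂ ≡ s₁ → (∃ λ z' → 0≢ (D C (s₃ ∷ z')) × (∀ {s'} → s' ∈ T → s' ≡ s₃ ⊎ D C (s' ∷ z') ≡ + 0)) → ⊥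
    third ceq seq (z' , ne' , _) = ne' (vanish (D C (s₃ ∷ z')) pc₃ (l (c₁ * D C (s₁ ∷ z')) (c₃ * D C (s₃ ∷ z')) (trans (cong₂ (λ c s → c * D C (s ∷ z')) (sym ceq) (sym seq)) (rel z')))) where
     l : ∀ x y → x ≡ x + y → y ≡ + 0
     l x y h = trans (q x y) (trans (cong (_- x) (sym h)) (+-inverseʳ x)) where
      q = ring-74
    cases : s₂ ≡ s₁ ⊎ D C (s₂ ∷ z) ≡ + 0 → s₃ ≡ s₁ ⊎ D C (s₃ ∷ z) ≡ + 0 → ⊥
    cases (inr hb) (inr h₃) = ne (vanish (D C (s₁ ∷ z)) pc₁ (trans (sym (add-0 _ (times-0 c₃ h₃))) (trans (sym (rel z)) (times-0 c₂ hb))))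
    cases (inr hb) (inl eq₃) = second eq₃ (dual {s₂} {κ} {w} ms₂ d2) hb
    cases (inl eq₂) (inl eq₃) = PM2-sum pc₁ pc₂ pc₃ (cancel-≡ {D C (s₁ ∷ z)} _ _ ne (trans (*-comm _ c₂) (trans (cong (λ s → c₂ * D C (s ∷ z)) (sym eq₂)) (trans (rel z)
      (trans (cong (λ s → c₁ * D C (s₁ ∷ z) + c₃ * D C (s ∷ z)) eq₃) (l c₁ c₃ (D C (s₁ ∷ z)))))))) where
     l = ring-75
    cases (inl eq₂) (inr h₃) = third (cancel-≡ {D C (s₁ ∷ z)} _ _ ne (trans (*-comm _ c₂) (trans (cong (λ s → c₂ * D C (s ∷ z)) (sym eq₂)) (trans (rel z) (trans (add-0 _ (times-0 c₃ h₃)) (*-comm c₁ _)))))) eq₂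
      (dual {s₃} {κ} {w} ms₃ d2)

  -- Two repetitions of one pair are also displaced from each other along a member of `T`, and three
  -- such displacements cannot close up.
  one-rep : ∀ {q₁ q₂ p₁ p₂ s₁ s₂ c₁ c₂} → p₁ ≡ p₂ → (R₁ : Rep q₁ p₁) (R₂ : Rep q₂ p₂) → s₁ ∈ T → s₂ ∈ T → PM2 c₁ → PM2 c₂ →
       Vary C s₁ (EP.κ p₁) (Rep.μ R₁) c₁ → Vary C s₂ (EP.κ p₂) (Rep.μ R₂) c₂ → Distinct q₁ q₂ → ⊥
  one-rep {q₁} {q₂} {p} {s₁ = s₁} {s₂} refl R₁ R₂ ms₁ ms₂ pc₁ pc₂ v₁ v₂ dist =
    fin (compare {μ₁} {Rep.μ⁺ R₁} {μ₂} {Rep.μ⁺ R₂} {EP.w p} (Rep.μ∈ R₁) (Rep.μ⁺∈ R₁) (Rep.μ∈ R₂) (Rep.μ⁺∈ R₂) (EP.mw p) d2 (Rep.eμ R₁) (Rep.eμ R₂) (λ z → trans (Rep.cls R₂ z) (sym (Rep.cls R₁ z)))) where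
   μ₁ = Rep.μ R₁
   μ₂ = Rep.μ R₂
   d2 : ∣ D F (μ₁ ∷ EP.w p) ∣ ≡ 2
   d2 = trans (cong ∣_∣ (Rep.cls R₁ (EP.w p))) (EP.d2 p)
   fin : (∃ λ λs → Off C T μ₁ λs μ₂ × All Ev λs × length λs ≡ length T) → ⊥
   fin (λs , off , evs , len) = fin2 (axial {μ₁} {μ₂} {Rep.μ⁺ R₂} {λs} {EP.w p} (Rep.μ∈ R₁) (Rep.μ⁺∈ R₂) off evs len
      (λ az → pairs-equal {q₁} {q₂} (Rep.Q R₁) (Rep.Q R₂) dist (λ z → cancel-≡ {+ 2} _ _ (λ ()) (trans (off z) (trans (cong (λ t → + 2 * D C (μ₁ ∷ z) + t) (dot-zero _ az)) (ℤP.+-identityʳ _)))))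
      (Rep.eμ R₂) (EP.mw p) d2) where
    fin2 : (∃ λ s → s ∈ T × (∃ λ c → PM2 c × Vary C s μ₁ μ₂ c)) → ⊥
    fin2 (s₃ , m₃ , c₃ , pc₃ , v₃) = three-shifts {EP.κ p} {μ₁} {μ₂} {s₁} {s₂} {s₃} {w = EP.w p} (EP.d2 p) ms₁ ms₂ m₃ pc₁ pc₂ pc₃ v₁ v₂ v₃

  Apart : ∀ {vs} → RS vs → RS vs → Set
  Apart a b = RS.s a ≢ RS.s b × Ind2 F (Square.b (RS.B a)) (Square.b (RS.B b))

  -- Distinct repetitions repeat distinct pairs, so their classes are independent; there
  -- `two-squares` forces different directions.
  reps-apart : ∀ {vs} → AllPairs Ind2F vs → ∀ (a b : RS vs) → Distinct (RS.q a) (RS.q b) → Apart a b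
  reps-apart apv a b dist = go (AP-lookup (Ind2-sym F) apv a.p∈ b.p∈) where
   module a = RS a
   module b = RS b
   go : a.p ≡ b.p ⊎ Ind2F a.p b.p → Apart a b
   go (inl h) = ⊥-elim (one-rep h a.Rp b.Rp a.s∈ b.s∈ a.c2 b.c2 a.al b.al dist)
   go (inr (z , mz , d)) = (λ h → diff h ind) , ind where
    ind : Ind2 F (Square.b a.B) (Square.b b.B)
    ind = z , mz , λ e0 → d (trans (sym (F-2 (λ z → trans (snd a.sqr z) (EPair.same (EP.pair a.p) z)) (λ z → trans (snd b.sqr z) (EPair.same (EP.pair b.p) z)) z)) e0)
    diff : a.s ≡ b.s → ¬ Ind2 F (Square.b a.B) (Square.b b.B)
    diff h i = let (l , r , eqT) = ∈-split b.s∈ in two-squares {b.s} {l} {r} eqT (subst (Square C e) h a.B) b.B (transp h a.B i) where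
     transp : ∀ {s s'} (h : s ≡ s') (B : Square C e s) {y} → Ind2 F (Square.b B) y → Ind2 F (Square.b (subst (Square C e) h B)) y
     transp refl B i = i

  record SquareList {xs} {S : Split C me xs} (o : Outer S) : Set where
   field
    sqs : List (RS (Outer.vs o))
    len : length sqs ≡ length (Outer.rs o)
    apt : AllPairs Apart sqs
    le  : length sqs ≤ length T

  -- Each repetition closes a square with the pair it repeats. The second directions are distinct
  -- members of `T`, which bounds the number of repetitions.
  squares : ∀ {xs} {S : Split C me xs} (o : Outer S) → SquareList o
  squares {S = S} o = record { sqs = mk rs rsP ; len = ln rs rsP ; apt = aps
    ; le = ≤-trans (≤-reflexive (sym (length-map RS.s (mk rs rsP)))) (distinct-length (AllPairsP.map⁺ (AllPairs.map fst aps)) (AllP.map⁺ (All.tabulate (λ {a} _ → RS.s∈ a)))) } where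
   open Outer o
   P : EP × EP → Set
   P r = snd r ∈ vs × ¬ Ind2F (fst r) (snd r) × Distinct (snd r) (fst r)
   one : ∀ {r} → P r → Σ (RS vs) λ a → RS.q a ≡ fst r
   one {q , p} (m , h , dist) = fin (axial p.κ∈ (Rep.μ⁺∈ Rp) (Rep.off Rp) (Rep.evs Rp) (Rep.len Rp) (Rep.nonz Rp) (Rep.eμ Rp) p.mw p.d2) where
    module p = EP p
    Rp = rep {q} {p} h dist
    fin : (∃ λ s → s ∈ T × (∃ λ c → PM2 c × Vary C s p.κ (Rep.μ Rp) c)) → Σ (RS vs) λ a → RS.q a ≡ q
    fin (s , ms , c , pc , v) = record { p∈ = m ; Rp = Rp ; s∈ = ms ; c2 = pc ; al = v } , refl
   mk : ∀ rs → All P rs → List (RS vs)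
   mk [] [] = []
   mk (r ∷ rs) (p ∷ ps) = fst (one {r} p) ∷ mk rs ps
   ln : ∀ rs ps → length (mk rs ps) ≡ length rs
   ln [] [] = refl
   ln (r ∷ rs) (p ∷ ps) = cong suc (ln rs ps)
   ds : ∀ (a : RS vs) rs ps → All (λ r → Distinct (RS.q a) (fst r)) rs → All (Apart a) (mk rs ps)
   ds a [] [] [] = []
   ds a (r ∷ rs) (p ∷ ps) (d ∷ dss) = reps-apart vsAP a (fst (one {r} p)) (subst (Distinct (RS.q a)) (sym (snd (one {r} p))) d) ∷ ds a rs ps dss
   ap' : ∀ rs ps → AllPairs (λ r s → Distinct (fst r) (fst s)) rs → AllPairs Apart (mk rs ps)
   ap' [] [] [] = []
   ap' (r ∷ rs) (p ∷ ps) (d ∷ dss) = ds (fst (one {r} p)) rs ps (All.map (λ {x} h → subst (λ t → Distinct t (fst x)) (sym (snd (one {r} p))) h) d) ∷ ap' rs ps dss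
   aps = ap' rs rsP rsAP

  record InnerPair {xs} {S : Split C me xs} (o : Outer S) (x ρ : V) : Set where
   field
    x∈  : x ∈ A
    ρ∈  : ρ ∈ A
    ix  : Inner C (e ∷ T) x
    iρ  : Inner C (e ∷ T) ρ
    nx  : Nz (C ⟋ me) x
    nρ  : Nz (C ⟋ me) ρ
    dep : ¬ Ind2 (C ⟋ me) x ρ
    ind : ∀ {p} → p ∈ Outer.ins o → Ind2 C ρ (fst p)

  inner-pair : ∀ {xs} {S : Split C me xs} (o : Outer S) {x ρ} → (x , ρ) ∈ Outer.ins o → InnerPair o x ρ
  inner-pair {S = S} o {x} {ρ} m = record { x∈ = X.x∈A m' ; ρ∈ = X.ρ∈A m' ; ix = inn (X.x∈A m') (X.x-nz m') hx ; iρ = inn (X.ρ∈A m') (X.ρ-nz m') hρ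
    ; nx = X.x-nz m' ; nρ = X.ρ-nz m' ; dep = X.x∥ρ m' ; ind = λ mp → X.ρ-ind (Outer.ins∈ o mp) (X.ρ∈ m') } where
   module X = SplitFacts S
   m' = Outer.ins∈ o m
   hx : ∀ {z} → Ms z → D C (e ∷ x ∷ T ++ z) ≡ + 0
   hx mz = trans (sym (F-front x _)) (¬NzL F (All-∈ (Outer.insF o) m) mz)
   hρ : ∀ {z} → Ms z → D C (e ∷ ρ ∷ T ++ z) ≡ + 0
   hρ {z} mz = go (D C (e ∷ ρ ∷ T ++ z) ℤ.≟ + 0) where
    go : Dec (D C (e ∷ ρ ∷ T ++ z) ≡ + 0) → D C (e ∷ ρ ∷ T ++ z) ≡ + 0
    go (yes e0) = e0
    go (no ne) = ⊥-elim (par-nz (C ⟋ me) (AllP.++⁺ mT mz) (λ i → X.x∥ρ m' (Ind2-sym (C ⟋ me) i)) (X.x-nz m') ne (hx mz))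
   inn : ∀ {y} → y ∈ A → Nz (C ⟋ me) y → (∀ {z} → Ms z → D C (e ∷ y ∷ T ++ z) ≡ + 0) → Inner C (e ∷ T) y
   inn {y} my (z₀ , mz₀ , d₀) h = inner C e T (me ∷ mT) hv nh psumS my (e ∷ z₀ , me ∷ mz₀ , perm-≢ C (↭-swap e y ↭-refl) d₀)
    (λ { (z , mz , d) → d (perm-0 C (↭-swap e y ↭-refl) (h mz)) })

  -- A class that varies along `e` must be one of the `N` classes in `vs`; negating the pair there
  -- adjusts the sign.
  pair-in-class : ∀ vs → AllPairs Ind2F vs → N ≤ length vs → ∀ {κ} → κ ∈ A → Nz F κ → Varies C₀ e κ →
          ∃₂ λ P P⁺ → P ∈ A × P⁺ ∈ A × Vary C e P P⁺ (+ 2) × (∀ z → D F (P ∷ z) ≡ D F (κ ∷ z))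
  pair-in-class vs apv full {κ} mκ nκ vκ = fin (in-basis vs apv full mκ nκ vκ) where
   fin : (∃ λ p → p ∈ vs × ¬ Ind2 F κ (EP.x p)) → ∃₂ λ P P⁺ → P ∈ A × P⁺ ∈ A × Vary C e P P⁺ (+ 2) × (∀ z → D F (P ∷ z) ≡ D F (κ ∷ z))
   fin (p , _ , h) = go (even-parallel {C = F} evF mκ (EP.x∈ p) nκ (EP.nx p) h) where
    same = EPair.same (EP.pair p)
    go : Pm F κ (EP.x p) → ∃₂ λ P P⁺ → P ∈ A × P⁺ ∈ A × Vary C e P P⁺ (+ 2) × (∀ z → D F (P ∷ z) ≡ D F (κ ∷ z))
    go (inl g) = EP.κ p , EP.κ⁺ p , EP.κ∈ p , EP.κ⁺∈ p , EP.ep p , λ z → trans (same z) (g z)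
    go (inr g) = neg (EP.κ⁺ p) , neg (EP.κ p) , neg∈ (EP.κ⁺∈ p) , neg∈ (EP.κ∈ p) , vary-sym (vary-neg (EP.ep p)) ,
     λ z → trans (D-neg F (EP.κ⁺ p) z) (trans (cong -_ (trans (vary-same C₀ me (conT (EP.ep p)) z) (trans (same z) (g z)))) (neg-involutive _))

 -- Points on the lines through a heavy vector

 parallel-trans : ∀ {n} (E : Config n) → Even E → ∀ {x y z} → x ∈ A → y ∈ A → z ∈ A → Nz E x → Nz E y → Nz E z → ¬ Ind2 E x y → ¬ Ind2 E y z → ¬ Ind2 E x z
 parallel-trans E ev {x} {y} {z} mx my mz nx ny nz' h g = Pm-dep E {x} {z} (Pm-trans E {x} {y} {z} (even-parallel {C = E} ev mx my nx ny h) (even-parallel {C = E} ev my mz ny nz' g))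

 vary-unique : ∀ {n} (C : Config n) {e x y τ σ} w → 0≢ (D C (e ∷ w)) → Vary C e x y τ → Vary C e x y σ → τ ≡ σ
 vary-unique C {e} {x} {y} {τ} {σ} w ne v v' = cancel-≡ {D C (e ∷ w)} τ σ ne (l (+ 2 * D C (x ∷ w)) (D C (e ∷ w)) τ σ (trans (sym (at v w)) (at v' w))) where
  l : ∀ k e t s → k + t * e ≡ k + s * e → e * t ≡ e * s
  l k e t s h = trans (q1 k e t) (trans (cong (_- k) h) (sym (q1 k e s))) where
   q1 = ring-76

 -- points q₀, q₀ + e/2, q₀ + e
 record Triad {n} (C : Config n) (e : V) : Set where
  field
   {q₀ q₁ q₂} : V
   q₀∈ : q₀ ∈ A
   q₁∈ : q₁ ∈ A
   q₂∈ : q₂ ∈ A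
   v₁  : Vary C e q₀ q₁ (+ 1)
   v₂  : Vary C e q₀ q₂ (+ 2)

 module Extras {n} (C : Config (suc n)) {e} (me : e ∈ A) (ev : Even (C ⟋ me)) {ys} (S : Split C me ys) where

  private
   E = C ⟋ me
  open Split S
  open SplitFacts S

  shift : ∀ {p} → p ∈ exs → Shifted C e (snd p) (fst p)
  shift m = shifted C me ev (ρ∈A m) (x∈A m) (ρ-nz m) (x-nz m) (λ i → x∥ρ m (Ind2-sym E i)) (ρ-ind m (ρ∈ m))

  same-ρ : ∀ {p q} → p ∈ exs → q ∈ exs → ¬ Ind2 E (fst p) (fst q) → snd p ≡ snd q
  same-ρ {p} {q} mp mq h = go (AP-lookup (Ind2-sym E) (ap simp') (ρ∈ mp) (ρ∈ mq)) where
   go : snd p ≡ snd q ⊎ Ind2 E (snd p) (snd q) → snd p ≡ snd q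
   go (inl e) = e
   go (inr i) = ⊥-elim (parallel-trans E ev (ρ∈A mp) (x∈A mp) (ρ∈A mq) (ρ-nz mp) (x-nz mp) (ρ-nz mq) (λ i → x∥ρ mp (Ind2-sym E i))
           (parallel-trans E ev (x∈A mp) (x∈A mq) (ρ∈A mq) (x-nz mp) (x-nz mq) (ρ-nz mq) h (x∥ρ mq)) i)

  shift' : ∀ {p q} → p ∈ exs → q ∈ exs → ¬ Ind2 E (fst p) (fst q) → Shifted C e (snd p) (fst q)
  shift' mp mq h = subst (λ ρ → Shifted C e ρ _) (sym (same-ρ mp mq h)) (shift mq)

  ρ-2 : ∀ {p} (m : p ∈ exs) → ∣ D C (e ∷ snd p ∷ fst (ρ-nz m)) ∣ ≡ 2
  ρ-2 m = let (w , mw , d) = ρ-nz m in even-abs {C = E} ev (ρ∈A m ∷ mw) d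

  class≤2 : ∀ {p q r} → p ∈ exs → q ∈ exs → r ∈ exs → Ind2 C (fst p) (fst q) → Ind2 C (fst p) (fst r) → Ind2 C (fst q) (fst r) →
       ¬ Ind2 E (fst p) (fst q) → ¬ Ind2 E (fst p) (fst r) → ⊥
  class≤2 mp mq mr i j k h g = three-shifted C me (fst (snd (ρ-nz mp))) (ρ-2 mp) (shift mp) (shift' mp mq h) (shift' mp mr g) i j k

  -- Two surplus points and their representative have three distinct offsets within distance 2, so
  -- these are consecutive half steps.
  triad : ∀ {p q} → p ∈ exs → q ∈ exs → Ind2 C (fst p) (fst q) → ¬ Ind2 E (fst p) (fst q) →
      Σ (Triad C e) λ t → ∀ z → D E (Triad.q₀ t ∷ z) ≡ D E (snd p ∷ z)
  triad {p} {q} mp mq ind h = go (shift mp) (shift' mp mq h) where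
   ρ = snd p
   w = fst (ρ-nz mp)
   go : Shifted C e ρ (fst p) → Shifted C e ρ (fst q) → Σ (Triad C e) λ t → ∀ z → D E (Triad.q₀ t ∷ z) ≡ D E (ρ ∷ z)
   go (x , σ , mx , px , vx , s0 , s2) (y , τ , my , py , vy , t0 , t2) =
     pick (small σ s2) (small τ t2) s0 t0 vx vy (λ c → shifted-clash C me {ρ} {w} (fst (snd (ρ-nz mp))) (ρ-2 mp) mx my px py vx vy ind c) where
    pick : ∀ {σ τ} → Small σ → Small τ → 0≢ σ → 0≢ τ → Vary C e ρ x σ → Vary C e ρ y τ → ¬ So (clash σ τ) → Σ (Triad C e) λ t → ∀ z → D E (Triad.q₀ t ∷ z) ≡ D E (ρ ∷ z)
    pick sz0 _ s0 _ _ _ _ = ⊥-elim (s0 refl)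
    pick _ sz0 _ t0 _ _ _ = ⊥-elim (t0 refl)
    pick sp1 sp2 _ _ vx vy _ = record { q₀∈ = ρ∈A mp ; q₁∈ = mx ; q₂∈ = my ; v₁ = vx ; v₂ = vy } , (λ _ → refl)
    pick sp2 sp1 _ _ vx vy _ = record { q₀∈ = ρ∈A mp ; q₁∈ = my ; q₂∈ = mx ; v₁ = vy ; v₂ = vx } , (λ _ → refl)
    pick sp1 sm1 _ _ vx vy _ = record { q₀∈ = my ; q₁∈ = ρ∈A mp ; q₂∈ = mx ; v₁ = vary-sym vy ; v₂ = vary-comp vy vx } , vary-same C me vy
    pick sm1 sp1 _ _ vx vy _ = record { q₀∈ = mx ; q₁∈ = ρ∈A mp ; q₂∈ = my ; v₁ = vary-sym vx ; v₂ = vary-comp vx vy } , vary-same C me vx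
    pick sm1 sm2 _ _ vx vy _ = record { q₀∈ = my ; q₁∈ = mx ; q₂∈ = ρ∈A mp ; v₁ = vary-comp vy vx ; v₂ = vary-sym vy } , vary-same C me vy
    pick sm2 sm1 _ _ vx vy _ = record { q₀∈ = mx ; q₁∈ = my ; q₂∈ = ρ∈A mp ; v₁ = vary-comp vx vy ; v₂ = vary-sym vx } , vary-same C me vx
    pick sp1 sp1 _ _ _ _ c = ⊥-elim (c tt)
    pick sp2 sp2 _ _ _ _ c = ⊥-elim (c tt)
    pick sm1 sm1 _ _ _ _ c = ⊥-elim (c tt)
    pick sm2 sm2 _ _ _ _ c = ⊥-elim (c tt)
    pick sp1 sm2 _ _ _ _ c = ⊥-elim (c tt)
    pick sp2 sm1 _ _ _ _ c = ⊥-elim (c tt)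
    pick sp2 sm2 _ _ _ _ c = ⊥-elim (c tt)
    pick sm1 sp2 _ _ _ _ c = ⊥-elim (c tt)
    pick sm2 sp1 _ _ _ _ c = ⊥-elim (c tt)
    pick sm2 sp2 _ _ _ _ c = ⊥-elim (c tt)

  varies : ∀ {p} → p ∈ exs → Varies C e (fst p)
  varies {x , ρ} m = go (shifted C me ev (x∈A m) (ρ∈A m) (x-nz m) (ρ-nz m) (x∥ρ m) (Ind2-sym C (ρ-ind m (ρ∈ m)))) where
   go : Shifted C e x ρ → Varies C e x
   go (y , τ , my , _ , v , t0 , _) = y , τ , my , v , t0

  module _ (L : List V) (mL : Ms L) (nL : All (Nz E) L) (cover : ∀ {y} → y ∈ A → Nz E y → Varies C e y → ∃ λ p → p ∈ L × ¬ Ind2 E y p) where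

   Code : V → V → Set
   Code x p = x ∈ A × Nz E x × ¬ Ind2 E x p × p ∈ L

   code : ∀ {y} → y ∈ A → Nz E y → Varies C e y → ∃ λ p → p ∈ L × Code y p
   code my ny vy = let (p , mp , h) = cover my ny vy in p , mp , my , ny , h , mp

   same-code : ∀ {x y p} → Code x p → Code y p → ¬ Ind2 E x y
   same-code (mx , nx , h , ml) (my , ny , g , _) = parallel-trans E ev mx (All-∈ mL ml) my nx (All-∈ nL ml) ny h (λ i → g (Ind2-sym E i))

   covered : ∀ ps → (∀ {p} → p ∈ ps → p ∈ exs) → AllPairs (λ p q → Ind2 E (fst p) (fst q)) ps → length ps ≤ length L
   covered ps sub ap' = coded {R = λ p q → Ind2 E (fst p) (fst q)} {Code = λ q → Code (fst q)} L ps ap' (All.tabulate (λ m → code (x∈A (sub m)) (x-nz (sub m)) (varies (sub m)))) (λ _ _ → same-code)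

   -- A class has at most three points, hence at most two surplus points besides its representative.
   exs≤ : length exs ≤ length L ℕ.+ length L
   exs≤ = fin (classify (λ p q → Ind2? E (fst p) (fst q)) exs) where
    fin : (∃₂ λ rs ds → exs ↭ rs ++ map fst ds × AllPairs (λ p q → Ind2 E (fst p) (fst q)) rs × All (λ d → snd d ∈ rs × ¬ Ind2 E (fst (fst d)) (fst (snd d))) ds) → length exs ≤ length L ℕ.+ length L
    fin (rs , ds , pm , apr , hd') = ≤-trans (≤-reflexive (trans (↭-length pm) (length-++ rs)))
      (+-mono-≤ (covered rs (λ m → ∈-resp-↭ (↭-sym pm) (∈-++⁺ˡ m)) apr) (covered (map fst ds) d∈ (AllPairsP.map⁺ (AP-tab (AllPairsP.map⁻ (fst (snd aps))) apart')))) where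
     d∈ : ∀ {p} → p ∈ map fst ds → p ∈ exs
     d∈ m = ∈-resp-↭ (↭-sym pm) (∈-++⁺ʳ rs m)
     r∈ : ∀ {p} → p ∈ rs → p ∈ exs
     r∈ m = ∈-resp-↭ (↭-sym pm) (∈-++⁺ˡ m)
     aps = AP-++⁻ rs (AP-resp (Ind2-sym C) pm exs-ap)
     apart' : ∀ {d d'} → d ∈ ds → d' ∈ ds → Ind2 C (fst (fst d)) (fst (fst d')) → Ind2 E (fst (fst d)) (fst (fst d'))
     apart' {d} {d'} md md' i = go (Ind2? E (fst (fst d)) (fst (fst d'))) where
      m1' = ∈-map⁺ fst md
      m2' = ∈-map⁺ fst md'
      mr = fst (All-∈ hd' md)
      cr = All-∈ (snd (snd aps)) mr
      go : Dec (Ind2 E (fst (fst d)) (fst (fst d'))) → Ind2 E (fst (fst d)) (fst (fst d'))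
      go (yes j) = j
      go (no h) = ⊥-elim (class≤2 (d∈ m1') (d∈ m2') (r∈ mr) i (Ind2-sym C (All-∈ cr m1')) (Ind2-sym C (All-∈ cr m2')) h (snd (All-∈ hd' md)))

   -- If the classes in which e varies are covered by m of them, there are few extra points unless some class other than that of b has three points.
   far-triad : ∀ {b} → b ∈ A → Nz E b → Varies C e b → suc (length exs) ≤ 2 ℕ.+ length L ⊎ (Σ (Triad C e) λ t → Ind2 E (Triad.q₀ t) b)
   far-triad {b} mb nb vb = fin (divide (λ p → Ind2? E (fst p) b) exs) where
    Goal = suc (length exs) ≤ 2 ℕ.+ length L ⊎ (Σ (Triad C e) λ t → Ind2 E (Triad.q₀ t) b)
    fin : (∃₂ λ far near → exs ↭ far ++ near × All (λ p → Ind2 E (fst p) b) far × All (λ p → ¬ Ind2 E (fst p) b) near) → Goal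
    fin (far , near , pm , hf , hn) = fin2 (classify (λ p q → Ind2? E (fst p) (fst q)) far) where
     aps = AP-++⁻ far (AP-resp (Ind2-sym C) pm exs-ap)
     f∈ : ∀ {p} → p ∈ far → p ∈ exs
     f∈ m = ∈-resp-↭ (↭-sym pm) (∈-++⁺ˡ m)
     n∈ : ∀ {p} → p ∈ near → p ∈ exs
     n∈ m = ∈-resp-↭ (↭-sym pm) (∈-++⁺ʳ far m)
     near∥ : ∀ {p q} → p ∈ near → q ∈ near → ¬ Ind2 E (fst p) (fst q)
     near∥ mp mq = parallel-trans E ev (x∈A (n∈ mp)) mb (x∈A (n∈ mq)) (x-nz (n∈ mp)) nb (x-nz (n∈ mq)) (All-∈ hn mp) (λ i → All-∈ hn mq (Ind2-sym E i))
     near≤2 : length near ≤ 2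
     near≤2 = length≤2 near (fst (snd aps)) λ mx my mz i j k → class≤2 (n∈ mx) (n∈ my) (n∈ mz) i j k (near∥ mx my) (near∥ mx mz)
     fin2 : (∃₂ λ rs ds → far ↭ rs ++ map fst ds × AllPairs (λ p q → Ind2 E (fst p) (fst q)) rs × All (λ d → snd d ∈ rs × ¬ Ind2 E (fst (fst d)) (fst (snd d))) ds) → Goal
     fin2 (rs , (q , p) ∷ ds , pm2 , apr , (mp , h) ∷ _) = inr (fst T3 , away (Ind2? E (Triad.q₀ (fst T3)) b)) where
      q∈ : q ∈ far
      q∈ = ∈-resp-↭ (↭-sym pm2) (∈-++⁺ʳ rs (here refl))
      p∈ : p ∈ far
      p∈ = ∈-resp-↭ (↭-sym pm2) (∈-++⁺ˡ mp)
      ind : Ind2 C (fst p) (fst q)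
      ind = All-∈ (All-∈ (snd (snd (AP-++⁻ rs (AP-resp (Ind2-sym C) pm2 (fst aps))))) mp) (here refl)
      T3 = triad (f∈ p∈) (f∈ q∈) ind (λ i → h (Ind2-sym E i))
      q₀ = Triad.q₀ (fst T3)
      nq₀ : Nz E q₀
      nq₀ = let (w , mw , d) = ρ-nz (f∈ p∈) in w , mw , λ e0 → d (trans (sym (snd T3 w)) e0)
      away : Dec (Ind2 E q₀ b) → Ind2 E q₀ b
      away (yes i) = i
      away (no g) = ⊥-elim (parallel-trans E ev (x∈A (f∈ p∈)) (Triad.q₀∈ (fst T3)) mb (x-nz (f∈ p∈)) nq₀ nb
        (parallel-trans E ev (x∈A (f∈ p∈)) (ρ∈A (f∈ p∈)) (Triad.q₀∈ (fst T3)) (x-nz (f∈ p∈)) (ρ-nz (f∈ p∈)) nq₀ (x∥ρ (f∈ p∈)) (Pm-dep E {snd p} {q₀} (inl (snd T3)))) g (All-∈ hf p∈))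
     fin2 (rs , [] , pm2 , apr , _) = inl (≤-trans (≤-reflexive (cong suc (trans (↭-length pm) (trans (length-++ far) (ℕP.+-comm (length far) (length near))))))
       (≤-trans (≤-reflexive (sym (+-suc (length near) (length far)))) (+-mono-≤ near≤2 far≤))) where
      pm3 : far ↭ rs
      pm3 = subst (far ↭_) (++-identityʳ rs) pm2
      r∈ : ∀ {p} → p ∈ rs → p ∈ exs
      r∈ m = f∈ (∈-resp-↭ (↭-sym pm3) m)
      far≤ : suc (length far) ≤ length L
      far≤ = ≤-trans (≤-reflexive (cong suc (trans (↭-length pm3) (sym (length-map fst rs)))))
       (coded {R = Ind2 E} {Code = Code} L (b ∷ map fst rs)
        (AllP.map⁺ (All.tabulate (λ m → Ind2-sym E (All-∈ hf (∈-resp-↭ (↭-sym pm3) m)))) ∷ AllPairsP.map⁺ apr)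
        (code mb nb vb ∷ AllP.map⁺ (All.tabulate (λ m → code (x∈A (r∈ m)) (x-nz (r∈ m)) (varies (r∈ m)))))
        (λ _ _ → same-code))

 -- In a maximal even configuration all lines through b are present, which links b to every other point.
 linked : ∀ {n} (E : Config (suc n)) → Even E → ∀ {b} → b ∈ A → Nz E b → ∀ {P} → P ∈ A → Ind2 E P b → ∀ {zs} → Simple E zs →
      suc (length zs) ≤ tri (suc n) ⊎ (∃ λ t → Ms t × 0≢ (D E (b ∷ t)) × 0≢ (D E (P ∷ t)))
 linked {n} E ev {b} mb nb {P} mP ind {zs} s = go (n ℕ.≤? length (Split.exs S)) where
  S = split E mb nb s
  open Lines E ev mb S
  F = E ⟋ mb
  evF : Even F
  evF mz = ev (mb ∷ mz)
  nP : Nz F P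
  nP = let (z , mz , d) = ind in z , mz , perm-≢ E (↭-swap P b ↭-refl) d
  notri : ∀ {y p q} → y ∈ lines → p ∈ lines → q ∈ lines → ¬ Tri F y p q
  notri my mp mq = no-tri E mb evF (All-∈ lines-mem my) (All-∈ lines-mem mp) (All-∈ lines-mem mq) (full-varies {C = E} (All-∈ fulls my)) (All-∈ fulls mp) (All-∈ fulls mq)
  go : Dec (n ≤ length (Split.exs S)) → suc (length zs) ≤ tri (suc n) ⊎ (∃ λ t → Ms t × 0≢ (D E (b ∷ t)) × 0≢ (D E (P ∷ t)))
  go (no h) = inl (≤-trans (s≤s (split-length S)) (s≤s (≤-trans (≤-reflexive (sym (+-suc (length (Split.reps S)) (length (Split.exs S)))))
    (≤-trans (+-mono-≤ (heller n F evF (Split.simp' S)) (≰⇒> h)) (≤-reflexive (ℕP.+-comm (tri n) n))))))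
  go (yes h) = inr (fin (basis F lines mP nP lines-mem lines-nz lines-ap notri) nP) where
   fin : Basis F lines → Nz F P → ∃ λ t → Ms t × 0≢ (D E (b ∷ t)) × 0≢ (D E (P ∷ t))
   fin (bb , mbb , db , sub) (z , mz , dz) = fin2 (W-find (λ x → D F (x ∷ z)) (λ us → D F (P ∷ us)) bb (λ e0 → *≢0 dz db (trans (cramer F P z bb) e0))) where
    fin2 : (∃ λ l → ∃₂ λ x r → bb ≡ l ++ x ∷ r × 0≢ (D F (x ∷ z)) × 0≢ (D F (P ∷ l ++ r))) → _
    fin2 (l , x , r , refl , _ , dP) = fin3 (keep l x r sub) where
     mlr : Ms (l ++ r)
     mlr = All-mid l mbb
     dx : 0≢ (D E (b ∷ x ∷ l ++ r))
     dx = perm-≢ F (PermP.shift x l r) db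
     fin3 : x ∈ lines ⊎ All (_∈ (l ++ r)) lines → ∃ λ t → Ms t × 0≢ (D E (b ∷ t)) × 0≢ (D E (P ∷ t))
     -- At least `n` lines cannot fit into the n - 1 other vectors of the basis.
     fin3 (inr sub') = ⊥-elim (<-irrefl refl (≤-trans (s≤s (≤-trans h (≤-trans (≤-reflexive (sym (length-map fst (Split.exs S)))) (distinct-length (AllPairs.map (Ind2-≢ F) lines-ap) sub'))))
       (≤-reflexive (trans (sym (↭-length (PermP.shift x l r))) (rank F _ db)))))
     fin3 (inl x∈) = fin4 (All-∈ fulls x∈) (D E (P ∷ x ∷ l ++ r) ℤ.≟ + 0) where
      mx = All-∈ lines-mem x∈
      fin4 : Full E b x → Dec (D E (P ∷ x ∷ l ++ r) ≡ + 0) → ∃ λ t → Ms t × 0≢ (D E (b ∷ t)) × 0≢ (D E (P ∷ t))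
      fin4 _ (no ne) = x ∷ l ++ r , mx ∷ mlr , dx , ne
      -- Where `x` fails for `P`, its displacement by ±b succeeds: the two minors differ by the
      -- nonzero minor of `P` and `b`, up to sign.
      fin4 (y , τ , my , v , t2) (yes e0) = y ∷ l ++ r , my ∷ mlr , (λ e1 → dx (trans (sym (vary-same E mb v (l ++ r))) e1)) ,
       λ e1 → *≢0 {τ} {D F (P ∷ l ++ r)} (abs2-≢ {τ} t2) dP (trans (cong (τ *_) (alt E [] b P (l ++ r))) (l1 τ (D E (P ∷ b ∷ l ++ r)) (D E (P ∷ y ∷ l ++ r)) (D E (P ∷ x ∷ l ++ r)) (at (vary-con E mP v) (l ++ r)) e1 e0)) where
       l1 : ∀ t d y x → + 2 * y ≡ + 2 * x + t * d → y ≡ + 0 → x ≡ + 0 → t * - d ≡ + 0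
       l1 t d _ _ h refl refl = trans (q t d) (cong -_ (sym h)) where
        q = ring-77

 plus : ∀ {n} (G : Config n) {e u u⁺} → Vary G e u u⁺ (+ 2) → ∀ z → D G (u⁺ ∷ z) ≡ D G (u ∷ z) + D G (e ∷ z)
 plus G {e} {u} v z = cancel-≡ {+ 2} _ _ (λ ()) (trans (at v z) (l (D G (u ∷ z)) (D G (e ∷ z)))) where
  l = ring-78

 -- Shifting either or both vectors by `e` adds ±2 to the minor in independent ways; from an odd
 -- value, one of the results leaves the interval from -2 to 2.
 even-pair : ∀ {n} (G : Config (suc n)) {e u u⁺ v v⁺ y} → e ∈ A → u ∈ A → u⁺ ∈ A → v ∈ A → v⁺ ∈ A → Ms y → Vary G e u u⁺ (+ 2) → Vary G e v v⁺ (+ 2) →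
       ∣ D G (e ∷ v ∷ y) ∣ ≡ 2 → ∣ D G (e ∷ u ∷ y) ∣ ≡ 2 → par (D G (u ∷ v ∷ y)) ≡ false
 even-pair G {e} {u} {u⁺} {v} {v⁺} {y} me mu mu⁺ mv mv⁺ my vu vv s2 s2' = go (small a (bdd G (mu ∷ mv ∷ my))) (abs2 {s} s2) (abs2 {s'} s2')
   (subst (λ t → ∣ t ∣ ≤ 2) e1 (bdd G (mu⁺ ∷ mv ∷ my))) (subst (λ t → ∣ t ∣ ≤ 2) e2 (bdd G (mu ∷ mv⁺ ∷ my))) (subst (λ t → ∣ t ∣ ≤ 2) e3 (bdd G (mu⁺ ∷ mv⁺ ∷ my))) where
  a = D G (u ∷ v ∷ y)
  s = D G (e ∷ v ∷ y)
  s' = D G (e ∷ u ∷ y)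
  e1 : D G (u⁺ ∷ v ∷ y) ≡ a + s
  e1 = plus G vu (v ∷ y)
  e2 : D G (u ∷ v⁺ ∷ y) ≡ a - s'
  e2 = trans (alt G [] u v⁺ y) (trans (cong -_ (trans (plus G vv (u ∷ y)) (cong (_+ s') (alt G [] v u y)))) (l a s')) where
   l = ring-79
  e3 : D G (u⁺ ∷ v⁺ ∷ y) ≡ a - s' + s
  e3 = trans (plus G vu (v⁺ ∷ y)) (cong₂ _+_ e2 (vary-same G me vv y))
  go : ∀ {a s s'} → Small a → s ≡ + 2 ⊎ s ≡ - + 2 → s' ≡ + 2 ⊎ s' ≡ - + 2 → ∣ a + s ∣ ≤ 2 → ∣ a - s' ∣ ≤ 2 → ∣ a - s' + s ∣ ≤ 2 → par a ≡ false
  go sz0 _ _ _ _ _ = refl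
  go sp2 _ _ _ _ _ = refl
  go sm2 _ _ _ _ _ = refl
  go sp1 (inl refl) _ h _ _ = ⊥-elim (≤⇒≤ᵇ h)
  go sp1 (inr refl) (inl refl) _ _ h = ⊥-elim (≤⇒≤ᵇ h)
  go sp1 (inr refl) (inr refl) _ h _ = ⊥-elim (≤⇒≤ᵇ h)
  go sm1 (inr refl) _ h _ _ = ⊥-elim (≤⇒≤ᵇ h)
  go sm1 (inl refl) (inr refl) _ _ h = ⊥-elim (≤⇒≤ᵇ h)
  go sm1 (inl refl) (inl refl) _ h _ = ⊥-elim (≤⇒≤ᵇ h)

 Scaled : ∀ {r} → Config r → (List V → ℤ) → V → Set
 Scaled C f x = ∃ λ σ → PM1 σ × (∀ z → + 2 * D C (x ∷ z) ≡ σ * f z)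

 scaled-pm : ∀ {r} (C : Config r) {f x y} → Scaled C f x → Scaled C f y → Pm C x y
 scaled-pm C (_ , o+ , h) (_ , o+ , g) = inl (λ z → cancel-≡ {+ 2} _ _ (λ ()) (trans (g z) (sym (h z))))
 scaled-pm C (_ , o- , h) (_ , o- , g) = inl (λ z → cancel-≡ {+ 2} _ _ (λ ()) (trans (g z) (sym (h z))))
 scaled-pm C {f} {x} {y} (_ , o+ , h) (_ , o- , g) = inr (λ z → cancel-≡ {+ 2} _ _ (λ ()) (trans (g z) (l (f z) (D C (x ∷ z)) (h z)))) where
  l : ∀ f x → + 2 * x ≡ + 1 * f → - + 1 * f ≡ + 2 * - x
  l f x h = trans (q f) (trans (cong -_ (sym h)) (q2 x)) where
   q = ring-80
   q2 = ring-81
 scaled-pm C {f} {x} {y} (_ , o- , h) (_ , o+ , g) = inr (λ z → cancel-≡ {+ 2} _ _ (λ ()) (trans (g z) (l (f z) (D C (x ∷ z)) (h z)))) where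
  l : ∀ f x → + 2 * x ≡ - + 1 * f → + 1 * f ≡ + 2 * - x
  l f x h = trans (q f) (trans (cong -_ (sym h)) (q2 x)) where
   q = ring-82
   q2 = ring-81

 -- y = P + (a e + b s)/2
 record At2 {r} (C : Config r) (e s P y : V) (a b : ℤ) : Set where
  constructor mkAt
  field
   val : ∀ z → + 2 * D C (y ∷ z) ≡ + 2 * D C (P ∷ z) + (a * D C (e ∷ z) + b * D C (s ∷ z))
 open At2 public

 diag-at : ∀ {r} (C : Config r) {e s P y y' a b a' b'} c → At2 C e s P y a b → At2 C e s P y' a' b' → a' ≡ a + + 2 → b' ≡ b + c → Diag C e s c y y'
 diag-at C {e} {s} {P} {y} {y'} {a} {b} c h h' refl refl z = sum-diff (cong₂ _-_ (val h' z) (val h z)) (l (D C (y' ∷ z)) (D C (y ∷ z)) (D C (P ∷ z)) (D C (e ∷ z)) (D C (s ∷ z)) a b c) where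
  l = ring-83

 Edge : ∀ {r} → Config r → V → V → V → Set
 Edge C e s P = ∃ λ c → PM2 c × (∃₂ λ y y' → y ∈ A × y' ∈ A × Diag C e s c y y' × (∃₂ λ a b → At2 C e s P y a b))

 -- Two pairs in direction e and one in direction s, displaced by integral vectors, contain a diagonal.
 find-edge : ∀ {r} (C : Config r) {e s P P⁺ q q⁺ α β γ} → P ∈ A → P⁺ ∈ A → q ∈ A → q⁺ ∈ A → At2 C e s P P⁺ (+ 2) (+ 0) → Ev α → Ev β → Ev γ →
       At2 C e s P q α β → At2 C e s P q⁺ (α + γ) (β + + 2) → Edge C e s P
 find-edge C {e} {s} {P} {P⁺} {q} {q⁺} mP mP⁺ mq mq⁺ hP⁺ = go where
  h0 : At2 C e s P P (+ 0) (+ 0)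
  h0 = mkAt λ z → l (D C (P ∷ z)) (D C (e ∷ z)) (D C (s ∷ z)) where
   l = ring-84
  mk : ∀ {y y' a b a' b'} c → PM2 c → y ∈ A → y' ∈ A → At2 C e s P y a b → At2 C e s P y' a' b' → a' ≡ a + + 2 → b' ≡ b + c → Edge C e s P
  mk {a = a} {b} c pc my my' h h' p q' = c , pc , _ , _ , my , my' , diag-at C c h h' p q' , a , b , h
  go : ∀ {α β γ} → Ev α → Ev β → Ev γ → At2 C e s P q α β → At2 C e s P q⁺ (α + γ) (β + + 2) → Edge C e s P
  go {α} {β} _ _ ev+ h h' = mk (+ 2) pm+ mq mq⁺ h h' refl refl
  go {α} {β} _ _ ev- h h' = mk (- + 2) pm- mq⁺ mq h' h (l α) (l' β) where
   l = ring-85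
   l' = ring-86
  go ev0 ev0 ev0 h h' = mk (- + 2) pm- mq⁺ mP⁺ h' hP⁺ refl refl
  go ev+ ev0 ev0 h h' = mk (+ 2) pm+ mP mq⁺ h0 h' refl refl
  go ev- ev0 ev0 h h' = mk (- + 2) pm- mq⁺ mP h' h0 refl refl
  go ev0 ev+ ev0 h h' = mk (- + 2) pm- mq mP⁺ h hP⁺ refl refl
  go ev0 ev- ev0 h h' = mk (+ 2) pm+ mq mP⁺ h hP⁺ refl refl
  go ev+ ev+ ev0 h h' = mk (+ 2) pm+ mP mq h0 h refl refl
  go ev+ ev- ev0 h h' = mk (- + 2) pm- mP mq h0 h refl refl
  go ev- ev+ ev0 h h' = mk (- + 2) pm- mq mP h h0 refl refl
  go ev- ev- ev0 h h' = mk (+ 2) pm+ mq mP h h0 refl refl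

 -- Heavy pairs

 module K2 {N} (C : Config (suc (suc N))) {e t} (me : e ∈ A) (mt : t ∈ A) (hv : Heavy C (e ∷ t ∷ [])) (nh : NoHeavy C 1) where

  open Gen C (C ⟋ mt) me t [] (mt ∷ []) (λ _ → refl) hv nh public

  -- Twice the possible points of the plane of `e` and `t` other than `e`, up to sign: t, (e + t)/2
  -- and (t - e)/2.
  form : Fin 3 → List V → ℤ
  form zero z = + 2 * D C (t ∷ z)
  form (suc zero) z = D C (e ∷ z) + D C (t ∷ z)
  form (suc (suc zero)) z = - D C (e ∷ z) + D C (t ∷ z)

  form-of : ∀ {x} → Inner C (e ∷ t ∷ []) x → Nz (C ⟋ me) x → ∃ λ k → Scaled C (form k) x
  form-of {x} (member (here refl) pm) (z , mz , d) = ⊥-elim (Pm-dep C {e} {x} pm (z , mz , d))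
  form-of {x} (member (there (here refl)) (inl h)) _ = zero , + 1 , o+ , λ z → trans (cong (+ 2 *_) (h z)) (sym (ℤP.*-identityˡ _))
  form-of {x} (member (there (here refl)) (inr h)) _ = zero , - + 1 , o- , λ z → trans (cong (+ 2 *_) (h z)) (l (D C (t ∷ z))) where
   l = ring-87
  form-of {x} (signs (_ ∷ _ ∷ []) rel (pa ∷ pb ∷ []) _) _ = go pa pb rel where
   go : ∀ {a b} → PM1 a → PM1 b → (∀ z → + 2 * D C (x ∷ z) ≡ a * D C (e ∷ z) + (b * D C (t ∷ z) + + 0)) → ∃ λ k → Scaled C (form k) x
   go o+ o+ r = suc zero , + 1 , o+ , λ z → trans (r z) (l (D C (e ∷ z)) (D C (t ∷ z))) where
    l = ring-88
   go o- o- r = suc zero , - + 1 , o- , λ z → trans (r z) (l (D C (e ∷ z)) (D C (t ∷ z))) where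
    l = ring-89
   go o+ o- r = suc (suc zero) , - + 1 , o- , λ z → trans (r z) (l (D C (e ∷ z)) (D C (t ∷ z))) where
    l = ring-90
   go o- o+ r = suc (suc zero) , + 1 , o+ , λ z → trans (r z) (l (D C (e ∷ z)) (D C (t ∷ z))) where
    l = ring-91

  -- Three points are possible, and the representative of a surplus point occupies one of them.
  ins≤2 : ∀ {xs} {S : Split C me xs} (o : Outer S) → length (Outer.ins o) ≤ 2
  ins≤2 o = go (Outer.ins o) refl where
   go : ∀ ps → ps ≡ Outer.ins o → length (Outer.ins o) ≤ 2
   go [] eq = subst (λ l → length l ≤ 2) eq z≤n
   go ((x , ρ) ∷ _) eq = ℕ.s≤s⁻¹ (subst (_≤ 3) (cong suc (length-map fst (Outer.ins o)))
     (coded {R = Ind2 C} {Code = λ y k → Scaled C (form k) y} (zero ∷ suc zero ∷ suc (suc zero) ∷ []) (ρ ∷ map fst (Outer.ins o))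
      (AllP.map⁺ (All.tabulate (λ m → InnerPair.ind I m)) ∷ AllPairsP.map⁺ (Outer.insAP o))
      (cd (form-of (InnerPair.iρ I) (InnerPair.nρ I)) ∷ AllP.map⁺ (All.tabulate (λ { {y , _} m → let J' = inner-pair o m in cd (form-of (InnerPair.ix J') (InnerPair.nx J')) })))
      (λ {y} {y'} _ _ c c' → Pm-dep C {y} {y'} (scaled-pm C c c')))) where
    I : InnerPair o x ρ
    I = inner-pair o (subst ((x , ρ) ∈_) eq (here refl))
    cd : ∀ {y} → (∃ λ k → Scaled C (form k) y) → ∃ λ k → k ∈ zero ∷ suc zero ∷ suc (suc zero) ∷ [] × Scaled C (form k) y
    cd (zero , s) = zero , here refl , s
    cd (suc zero , s) = suc zero , there (here refl) , s
    cd (suc (suc zero) , s) = suc (suc zero) , there (there (here refl)) , s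

  -- The case in which the budget may be exceeded by one: all `N` classes contain a pair, and one of
  -- these is repeated, which gives the square.
  record Critical (xs : List V) : Set where
   field
    S    : Split C me xs
    o    : Outer S
    full : N ≤ length (Outer.vs o)
    B    : Square C e t
    nb   : Nz F (Square.b B)
    le   : length (Split.exs S) ≤ 3 ℕ.+ N

  bound-or-critical : ∀ {xs} → Simple C xs → length xs ≤ f1 (suc N) ⊎ Critical xs
  bound-or-critical {xs} s = start (split C me (t ∷ w , mt ∷ mw , dw) s) where
   w = fst (snd hv)
   mw = fst (snd (snd hv))
   dw = snd (snd (snd hv))
   start : Split C me xs → length xs ≤ f1 (suc N) ⊎ Critical xs
   start S = begin' (outer S) where
    reps≤ : length (Split.reps S) ≤ f1 N
    reps≤ = thm1 N (C ⟋ me) mt (fst hv) (w , mw , dw) (Split.simp' S)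
    begin' : Outer S → length xs ≤ f1 (suc N) ⊎ Critical xs
    begin' o = go' (squares o) where
     exs≡ : ∀ {a b} → length (Outer.vs o) ℕ.+ length (Outer.rs o) ≤ a → a ℕ.+ 2 ≡ b → length (Split.exs S) ≤ b
     exs≡ h refl = ≤-trans (≤-reflexive (Outer.total o)) (+-mono-≤ h (ins≤2 o))
     vs≤ = vs≤N (Outer.vs o) (Outer.vsAP o)
     go : ∀ (sqs : List (RS (Outer.vs o))) → length sqs ≡ length (Outer.rs o) → length sqs ≤ 1 → length xs ≤ f1 (suc N) ⊎ Critical xs
     go' : SquareList o → length xs ≤ f1 (suc N) ⊎ Critical xs
     go' q = go (SquareList.sqs q) (SquareList.len q) (SquareList.le q)
     go [] len _ = inl (fit N (split-length S) reps≤ (exs≡ (≤-trans (≤-reflexive (trans (cong (length (Outer.vs o) ℕ.+_) (sym len)) (ℕP.+-identityʳ _))) vs≤) (ℕP.+-comm N 2)))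
     go (_ ∷ _ ∷ _) len (s≤s ())
     go (a ∷ []) len _ = go2 (N ℕ.≤? length (Outer.vs o)) where
      eq1 : length (Outer.vs o) ℕ.+ length (Outer.rs o) ≡ suc (length (Outer.vs o))
      eq1 = trans (cong (length (Outer.vs o) ℕ.+_) (sym len)) (ℕP.+-comm _ 1)
      go2 : Dec (N ≤ length (Outer.vs o)) → length xs ≤ f1 (suc N) ⊎ Critical xs
      go2 (no h) = inl (fit N (split-length S) reps≤ (exs≡ (≤-trans (≤-reflexive eq1) (≰⇒> h)) (ℕP.+-comm N 2)))
      go2 (yes h) = inr (mk (RS.s∈ a) (RS.B a) (nzF (snd (RS.sqr a)))) where
       p = RS.p a
       nzF : (∀ z → D F (Square.b (RS.B a) ∷ z) ≡ D F (EP.κ p ∷ z)) → Nz F (Square.b (RS.B a))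
       nzF h = EP.w p , EP.mw p , λ e0 → abs2-≢ (EP.d2 p) (trans (sym (h (EP.w p))) e0)
       mk : ∀ {s} → s ∈ t ∷ [] → (B : Square C e s) → Nz F (Square.b B) → Critical xs
       mk (here refl) B nb = record { S = S ; o = o ; full = h ; B = B ; nb = nb
        ; le = exs≡ (≤-trans (≤-reflexive eq1) (s≤s vs≤)) (cong suc (ℕP.+-comm N 2)) }

 -- Two critical directions of a heavy pair

 module PairClash {N} (C : Config (suc (suc N))) {e s} (me : e ∈ A) (ms : s ∈ A) (hv : Heavy C (e ∷ s ∷ [])) (sumE : ∀ u → psum C (e ∷ s ∷ []) u ≡ false) where

  E : Config N
  E = C ⟋ me ⟋ ms

  evE : Even E
  evE = fst hv

  record Off2 (x y : V) : Set where
   field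
    {α β} : ℤ
    rel   : At2 C e s x y α β
    α≤2   : ∣ α ∣ ≤ 2
    β≤2   : ∣ β ∣ ≤ 2
    same  : par α ≡ par β

  off2 : ∀ {x y} → x ∈ A → y ∈ A → Nz E x → (∀ z → D E (y ∷ z) ≡ D E (x ∷ z)) → Off2 x y
  off2 {x} {y} mx my (w , mw , dw) cls = go (off-exist C e (s ∷ []) (me ∷ ms ∷ []) sumE mx my mw (trans (cong ∣_∣ (sym (cyc C e s x w))) (even-abs {C = E} evE (mx ∷ mw) dw))
    (λ z → trans (sym (cyc C e s y z)) (trans (cls z) (cyc C e s x z)))) where
   go : Offset C (e ∷ s ∷ []) x y → Off2 x y
   go O = fin (Offset.λs O) (Offset.off O) (Offset.len O) (Offset.bnd O) (Offset.prt O) where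
    fin : ∀ λs → Off C (e ∷ s ∷ []) x λs y → length λs ≡ 2 → All (λ a → ∣ a ∣ ≤ 2) λs → All (λ a → par a ≡ Offset.bit O) λs → Off2 x y
    fin (a ∷ b ∷ []) off _ (ba ∷ bb ∷ []) (pa ∷ pb ∷ []) = record
     { α = a ; β = b ; rel = mkAt λ z → trans (off z) (cong (λ t → + 2 * D C (x ∷ z) + (a * D C (e ∷ z) + t)) (ℤP.+-identityʳ (b * D C (s ∷ z)))) ; α≤2 = ba ; β≤2 = bb ; same = trans pa (sym pb) }

  vary-e : ∀ {x y a b} → At2 C e s x y a b → Vary (C ⟋ ms) e x y a
  vary-e {x} {y} {a} {b} h = mkV λ z → trans (cong (+ 2 *_) (alt C [] s y z)) (trans (l (D C (y ∷ s ∷ z)) _ (val h (s ∷ z)))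
    (trans (cong (λ t → - (+ 2 * D C (x ∷ s ∷ z) + (a * D C (e ∷ s ∷ z) + b * t))) (D-twice C s z))
    (trans (l2 (D C (x ∷ s ∷ z)) a (D C (e ∷ s ∷ z)) b) (sym (cong₂ (λ p q → + 2 * p + a * q) (alt C [] s x z) (alt C [] s e z)))))) where
   l : ∀ y r → + 2 * y ≡ r → + 2 * - y ≡ - r
   l y r refl = q y where
    q = ring-92
   l2 = ring-93

  vary-s : ∀ {x y a b} → At2 C e s x y a b → Vary (C ⟋ me) s x y b
  vary-s {x} {y} {a} {b} h = mkV λ z → trans (cong (+ 2 *_) (alt C [] e y z)) (trans (l (D C (y ∷ e ∷ z)) _ (val h (e ∷ z)))
    (trans (cong (λ t → - (+ 2 * D C (x ∷ e ∷ z) + (a * t + b * D C (s ∷ e ∷ z)))) (D-twice C e z))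
    (trans (l2 (D C (x ∷ e ∷ z)) a (D C (s ∷ e ∷ z)) b) (sym (cong₂ (λ p q → + 2 * p + b * q) (alt C [] e x z) (alt C [] e s z)))))) where
   l : ∀ y r → + 2 * y ≡ r → + 2 * - y ≡ - r
   l y r refl = q y where
    q = ring-92
   l2 = ring-94

  at-class : ∀ {x y a b} → At2 C e s x y a b → ∀ z → D E (y ∷ z) ≡ D E (x ∷ z)
  at-class h = vary-same (C ⟋ me) ms (vary-s h)

  -- The square offers both diagonals, and any diagonal in an independent class clashes with one of
  -- them.
  edge-clash : (B : Square C e s) → ∀ {q} → Ind2 E q (Square.b B) → q ∈ A → ∀ {P} → (∀ z → D E (P ∷ z) ≡ D E (q ∷ z)) → Edge C e s P → ⊥
  edge-clash B {q} (w , mw , d) mq {P} cls (_ , pc , y , y' , my , my' , dg , _ , _ , h) = go pc dg where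
   open Square B renaming (b∈ to sb∈)
   d2 : ∀ {b'} → (∀ z → D E (b' ∷ z) ≡ D E (b ∷ z)) → ∣ D C (e ∷ s ∷ y ∷ b' ∷ w) ∣ ≡ 2
   d2 {b'} hb = trans (cong ∣_∣ (trans (trans (at-class h (b' ∷ w)) (cls (b' ∷ w))) (trans (alt E [] q b' w) (trans (cong -_ (hb (q ∷ w))) (sym (alt E [] q b w))))))
       (even-abs {C = E} evE (mq ∷ sb∈ ∷ mw) d)
   hs : ∀ z → D E (bₛ ∷ z) ≡ D E (b ∷ z)
   hs = vary-same (C ⟋ me) ms (vary-con C me v₂)
   go : ∀ {c} → PM2 c → Diag C e s c y y' → ⊥
   go pm+ dg = diag-clash C {e} {s} my my' bₛ∈ bₑ∈ mw dg (antidiag C B) (d2 hs)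
   go pm- dg = diag-clash C {e} {s} sb∈ bₑₛ∈ my my' mw (diag C B) dg (trans (perm-abs C (↭-prep e (↭-prep s (↭-swap b y ↭-refl)))) (d2 (λ _ → refl)))

  -- The three e-, s-displaced pairs at b, P and q force P and q to have the same parity.
  triad-clash : (B : Square C e s) (Q : Triad (C ⟋ me) s) → ∀ {t} → Ms t → 0≢ (D E (Square.b B ∷ t)) → 0≢ (D E (Triad.q₀ Q ∷ t)) → Ind2 E (Triad.q₀ Q) (Square.b B) →
         ∀ {P P⁺} → P ∈ A → P⁺ ∈ A → Vary C e P P⁺ (+ 2) → (∀ z → D E (P ∷ z) ≡ D E (Triad.q₀ Q ∷ z)) → ⊥
  triad-clash B Q {t} mt dbt dqt ind {P} {P⁺} mP mP⁺ vP cls = fin (off2 mP q₀∈ nP (λ z → sym (cls z))) (off2 q₀∈ q₂∈ nq (vary-same (C ⟋ me) ms v₂')) where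
   open Square B renaming (b∈ to sb∈)
   open Triad Q renaming (v₁ to v₁'; v₂ to v₂')
   nq : Nz E q₀
   nq = t , mt , dqt
   nP : Nz E P
   nP = t , mt , λ e0 → dqt (trans (sym (cls t)) e0)
   db2 = even-abs {C = E} evE (sb∈ ∷ mt) dbt
   dq2 = even-abs {C = E} evE (q₀∈ ∷ mt) dqt
   dP2 : ∣ D E (P ∷ t) ∣ ≡ 2
   dP2 = trans (cong ∣_∣ (cls t)) dq2
   sw : ∀ {x} → ∣ D E (x ∷ t) ∣ ≡ 2 → ∣ D C (s ∷ e ∷ x ∷ t) ∣ ≡ 2
   sw {x} h = trans (perm-abs C (↭-swap s e ↭-refl)) h
   -- Shifts of q₀ and b along `s` give this parity, shifts of `P` and b along `e` the analogous one
   -- for `P`; the circuit relation then replaces `s` by `e` in the latter.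
   Q-even : par (D C (e ∷ q₀ ∷ b ∷ t)) ≡ false
   Q-even = even-pair (C ⟋ me) ms q₀∈ q₂∈ sb∈ bₛ∈ mt v₂' (vary-con C me v₂) db2 dq2
   P-even' : par (D C (s ∷ P ∷ b ∷ t)) ≡ false
   P-even' = even-pair (C ⟋ ms) me mP mP⁺ sb∈ bₑ∈ mt (vary-con C ms vP) (vary-con C ms v₁) (sw {b} db2) (sw {P} dP2)
   P-even : par (D C (e ∷ P ∷ b ∷ t)) ≡ false
   P-even = trans (xor-eq (trans (cong (par (D C (e ∷ P ∷ b ∷ t)) xor_) (sym (xor-identityʳ _))) (sumE (P ∷ b ∷ t)))) P-even'
   fin : Off2 P q₀ → Off2 q₀ q₂ → ⊥
   fin O O' = edge-clash B ind q₀∈ cls (find-edge C mP mP⁺ q₀∈ q₂∈ hP⁺ (ev-small (trans O.same β-even) O.α≤2) (ev-small β-even O.β≤2) (ev-small γ-even O'.α≤2) O.rel hq₂) where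
    module O = Off2 O
    module O' = Off2 O'
    δ2 : O'.β ≡ + 2
    δ2 = vary-unique (C ⟋ me) (b ∷ t) (abs2-≢ db2) (vary-s O'.rel) v₂'
    γ-even : par O'.α ≡ false
    γ-even = trans O'.same (cong par δ2)
    hP⁺ : At2 C e s P P⁺ (+ 2) (+ 0)
    hP⁺ = mkAt λ z → trans (at vP z) (l (D C (P ∷ z)) (D C (e ∷ z)) (D C (s ∷ z))) where
     l = ring-95
    hq₂ : At2 C e s P q₂ (O.α + O'.α) (O.β + + 2)
    hq₂ = mkAt λ z → trans (val O'.rel z) (trans (cong₂ (λ p d → p + (O'.α * D C (e ∷ z) + d * D C (s ∷ z))) (val O.rel z) δ2) (l (D C (P ∷ z)) (D C (e ∷ z)) (D C (s ∷ z)) O.α O.β O'.α)) where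
     l = ring-96
    -- The offset β is, up to sign, the difference of the two even minors.
    β-even : par O.β ≡ false
    β-even = trans (sym (par-neg O.β)) (go (abs2 {D E (b ∷ t)} db2) (at (vary-s O.rel) (b ∷ t))) where
     x = D C (e ∷ q₀ ∷ b ∷ t)
     y = D C (e ∷ P ∷ b ∷ t)
     xy : ∀ {g} → g ≡ x - y ⊎ g ≡ y - x → par g ≡ false
     xy (inl refl) = trans (par-+ x (- y)) (cong₂ _xor_ Q-even (trans (par-neg y) P-even))
     xy (inr refl) = trans (par-+ y (- x)) (cong₂ _xor_ P-even (trans (par-neg x) Q-even))
     go : D E (b ∷ t) ≡ + 2 ⊎ D E (b ∷ t) ≡ - + 2 → + 2 * x ≡ + 2 * y + O.β * D E (b ∷ t) → par (- O.β) ≡ false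
     go (inl p) h = xy (inr (cancel-≡ {+ 2} _ _ (λ ()) (l x y O.β (trans h (cong (λ d → + 2 * y + O.β * d) p))))) where
      l : ∀ x y b → + 2 * x ≡ + 2 * y + b * + 2 → + 2 * - b ≡ + 2 * (y - x)
      l x y b h = sum-diff h (q x y b) where
       q = ring-97
     go (inr p) h = xy (inl (cancel-≡ {+ 2} _ _ (λ ()) (l x y O.β (trans h (cong (λ d → + 2 * y + O.β * d) p))))) where
      l : ∀ x y b → + 2 * x ≡ + 2 * y + b * - + 2 → + 2 * - b ≡ + 2 * (x - y)
      l x y b h = sum-diff (sym h) (q x y b) where
       q = ring-98

 -- Unless one direction gives the bound, both are critical. Then the contraction of `e` stays one
 -- below its own bound: otherwise it contains a triad away from the square, linked to it by a
 -- maximal even configuration, and `triad-clash` applies.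
 thm2-min : ∀ N → 2 ≤ N → (C : Config (suc (suc N))) → ∀ {e s} → e ∈ A → s ∈ A → Heavy C (e ∷ s ∷ []) → NoHeavy C 1 → ∀ {xs} → Simple C xs → length xs ≤ f1 (suc N)
 thm2-min (suc N') N≥2 C {e} {s} me ms hv nh {xs} sx = go (K.bound-or-critical sx) (L.bound-or-critical sx) where
  N = suc N'
  hv' : Heavy C (s ∷ e ∷ [])
  hv' = heavy-perm C (↭-swap e s ↭-refl) hv
  module K = K2 C me ms hv nh
  module L = K2 C ms me hv' nh
  open PairClash C me ms hv K.psumS
  C1 = C ⟋ me
  go : length xs ≤ f1 (suc N) ⊎ K.Critical xs → length xs ≤ f1 (suc N) ⊎ L.Critical xs → length xs ≤ f1 (suc N)
  go (inl h) _ = h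
  go _ (inl h) = h
  go (inr k) (inr l) = fit' N (split-length k.S) (main (split C1 ms (w , mw , dw) (Split.simp' k.S))) k.le where
   module k = K.Critical k
   module l = L.Critical l
   w = fst (snd hv)
   mw = fst (snd (snd hv))
   dw = snd (snd (snd hv))
   b = Square.b k.B
   mb = Square.b∈ k.B
   nb : Nz E b
   nb = let (z , mz , d) = k.nb in z , mz , perm-≢ C (↭-swap s e ↭-refl) d
   ps = L.Outer.vs l.o
   Ls : List V
   Ls = L.vsV ps
   mL : Ms Ls
   mL = AllP.map⁺ (All.tabulate (λ {p} _ → L.EP.x∈ p))
   nL : All (Nz E) Ls
   nL = AllP.map⁺ (All.tabulate (λ {p} _ → L.EP.nx p))
   Ls≤ : length Ls ≤ N
   Ls≤ = ≤-trans (≤-reflexive (length-map L.EP.x ps)) (L.vs≤N ps (L.Outer.vsAP l.o))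
   cover : ∀ {y} → y ∈ A → Nz E y → Varies C1 s y → ∃ λ p → p ∈ Ls × ¬ Ind2 E y p
   cover my ny vy = let (p , mp , h) = L.in-basis ps (L.Outer.vsAP l.o) l.full my ny vy in L.EP.x p , ∈-map⁺ L.EP.x mp , h
   vb : Varies C1 s b
   vb = Square.bₛ k.B , + 2 , Square.bₛ∈ k.B , vary-con C me (Square.v₂ k.B) , λ ()
   no-link : (Q : Triad C1 s) → Ind2 E (Triad.q₀ Q) b → ¬ (∃ λ t → Ms t × 0≢ (D E (b ∷ t)) × 0≢ (D E (Triad.q₀ Q ∷ t)))
   no-link Q ind (t , mt , dbt , dqt) = fin (K.pair-in-class (K.Outer.vs k.o) (K.Outer.vsAP k.o) k.full q₀∈ nqF (q₁ , Off2.α O1 , q₁∈ , vary-e (Off2.rel O1) , α≢0)) where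
    open Triad Q
    nqF : Nz K.F q₀
    nqF = t , mt , perm-≢ C (↭-swap e s ↭-refl) dqt
    O1 : Off2 q₀ q₁
    O1 = off2 q₀∈ q₁∈ (t , mt , dqt) (vary-same C1 ms v₁)
    α≢0 : 0≢ (Off2.α O1)
    α≢0 e0 = bad (trans (sym (cong par e0)) (trans (Off2.same O1) (cong par (vary-unique C1 (b ∷ t) dbt (vary-s (Off2.rel O1)) v₁)))) where
     bad : false ≢ true
     bad ()
    F→E : ∀ {x y} → (∀ z → D K.F (x ∷ z) ≡ D K.F (y ∷ z)) → ∀ z → D E (x ∷ z) ≡ D E (y ∷ z)
    F→E h z = trans (alt C [] e s _) (trans (cong -_ (h z)) (sym (alt C [] e s _)))
    fin : (∃₂ λ P P⁺ → P ∈ A × P⁺ ∈ A × Vary C e P P⁺ (+ 2) × (∀ z → D K.F (P ∷ z) ≡ D K.F (q₀ ∷ z))) → ⊥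
    fin (P , P⁺ , mP , mP⁺ , vP , h) = triad-clash k.B Q mt dbt dqt ind mP mP⁺ vP (F→E h)
   -- Without such a triad x ≤ N + 1, and N + 2 ≤ 2N holds from N = 2 on.
   arith1 : ∀ {r x} → suc x ≤ 2 ℕ.+ N → 2 ℕ.+ (r ℕ.+ x) ≤ r ℕ.+ (N ℕ.+ N) ℕ.+ 1
   arith1 {r} {x} h = ≤-trans (≤-reflexive (solve 2 (λ r x → con 2 :+ (r :+ x) := r :+ (con 1 :+ x) :+ con 1) refl r x))
     (+-monoˡ-≤ 1 (+-monoʳ-≤ r (≤-trans h (+-monoˡ-≤ N N≥2))))
    where open +-*-Solver
   arith2 : ∀ {r x} → suc r ≤ tri N → x ≤ N ℕ.+ N → 2 ℕ.+ (r ℕ.+ x) ≤ f1 N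
   arith2 {r} {x} h g = ≤-trans (≤-reflexive (solve 2 (λ r x → con 2 :+ (r :+ x) := con 1 :+ r :+ x :+ con 1) refl r x)) (+-monoˡ-≤ 1 (+-mono-≤ h g))
    where open +-*-Solver
   main : Split C1 ms (Split.reps k.S) → suc (length (Split.reps k.S)) ≤ f1 N
   main S' = reps< where
    module X = Extras C1 ms evE S'
    r' = length (Split.reps S')
    x' = length (Split.exs S')
    via : ∀ {r x} → r' ≤ r → x' ≤ x → 2 ℕ.+ (r ℕ.+ x) ≤ f1 N → suc (length (Split.reps k.S)) ≤ f1 N
    via hr hx h = ≤-trans (s≤s (split-length S')) (≤-trans (s≤s (s≤s (+-mono-≤ hr hx))) h)
    reps< : suc (length (Split.reps k.S)) ≤ f1 N
    reps< = fin (X.far-triad Ls mL nL cover mb nb vb) where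
     fin : suc x' ≤ 2 ℕ.+ length Ls ⊎ (Σ (Triad C1 s) λ Q → Ind2 E (Triad.q₀ Q) b) → suc (length (Split.reps k.S)) ≤ f1 N
     fin (inl h) = via {tri N} {x'} (heller N E evE (Split.simp' S')) ≤-refl (arith1 {tri N} {x'} (≤-trans h (+-monoʳ-≤ 2 Ls≤)))
     fin (inr (Q , ind)) = fin2 (linked E evE mb nb (Triad.q₀∈ Q) ind (Split.simp' S')) where
      fin2 : suc r' ≤ tri N ⊎ (∃ λ t → Ms t × 0≢ (D E (b ∷ t)) × 0≢ (D E (Triad.q₀ Q ∷ t))) → suc (length (Split.reps k.S)) ≤ f1 N
      fin2 (inl h) = via {r'} {x'} ≤-refl ≤-refl (arith2 h (≤-trans (X.exs≤ Ls mL nL cover) (+-mono-≤ Ls≤ Ls≤)))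
      fin2 (inr l) = ⊥-elim (no-link Q ind l)

 heavy-dec : ∀ {r} (C : Config r) S → Dec (Heavy C S)
 heavy-dec C S with Odd? C S | NzL? C S
 ... | yes (z , mz , o) | _ = no (λ { (ev , _) → bad (trans (sym (ev mz)) o) }) where
  bad : false ≢ true
  bad ()
 ... | no h | no n = no (λ p → n (snd p))
 ... | no h | yes n = yes ((λ {z} mz → false≢ (λ o → h (z , mz , o))) , n)

 heavy? : ∀ {r} (C : Config r) k → Dec (∃ λ S → Ms S × length S ≡ k × Heavy C S)
 heavy? C k with Any.any? (heavy-dec C) (tuples k)
 ... | yes a = let (S , mS , h) = find∈ a in yes (S , tuples-Ms k mS , tuples-len k mS , h) where
  tuples-len : ∀ k {S} → S ∈ tuples k → length S ≡ k
  tuples-len zero (here refl) = refl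
  tuples-len (suc k) p with ∈-concat⁻′ (map (λ v → map (v ∷_) (tuples k)) A) p
  ... | xs , q , r with ∈-map⁻ (λ v → map (v ∷_) (tuples k)) r
  ...   | v , _ , refl with ∈-map⁻ (v ∷_) q
  ...     | z' , mz , refl = cong suc (tuples-len k mz)
 ... | no na = no λ { (S , mS , refl , h) → na (lose∈ (tuples-∈ mS) h) }

 no-heavy₀ : ∀ {r} (C : Config r) → NoHeavy C 0
 no-heavy₀ C y S _ ()

 no-heavy-suc : ∀ {r} (C : Config r) {k} → NoHeavy C k → ¬ (∃ λ S → Ms S × length S ≡ suc k × Heavy C S) → NoHeavy C (suc k)
 no-heavy-suc C {k} nh h y S mS le hv = go (m≤n⇒m<n∨m≡n le) where
  go : suc (length S) < suc k ⊎ suc (length S) ≡ suc k → ⊥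
  go (inl lt) = nh y S mS (ℕ.s≤s⁻¹ lt) hv
  go (inr eq) = h (y ∷ S , mS , eq , hv)

 thm2 : ∀ N → 2 ≤ N → (C : Config (suc (suc N))) → ∀ {e s} → e ∈ A → s ∈ A → Heavy C (e ∷ s ∷ []) → ∀ {xs} → Simple C xs → length xs ≤ f1 (suc N)
 thm2 N N≥2 C {e} {s} me ms hv {xs} sx = go (heavy? C 1) where
  go : Dec (∃ λ S → Ms S × length S ≡ 1 × Heavy C S) → length xs ≤ f1 (suc N)
  go (yes (v ∷ [] , mv ∷ [] , _ , (ev , nv))) = thm1 (suc N) C mv ev nv sx
  go (no h) = thm2-min N N≥2 C me ms hv (no-heavy-suc C (no-heavy₀ C) h) sx

 -- Coordinates in the span of a heavy set

 record Comb {r} (C : Config r) (S : List V) (x : V) (as : List ℤ) : Set where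
  constructor mkC
  field
   eqn : ∀ z → + 2 * D C (x ∷ z) ≡ dot as (map (λ s → D C (s ∷ z)) S)
 open Comb public

 comb-con : ∀ {n} (C : Config (suc n)) {a} (ma : a ∈ A) {S x as} → Comb C S x as → Comb (C ⟋ ma) S x as
 comb-con C {a} ma {S} {x} {as} h = mkC λ z → trans (cong (+ 2 *_) (alt C [] a x z)) (trans (l (D C (x ∷ a ∷ z)) _ (eqn h (a ∷ z)))
   (trans (sym (dot-negʳ as (λ s → D C (s ∷ a ∷ z)) S)) (dot-congʳ as (λ s → sym (alt C [] a s z)) S))) where
  l : ∀ y r → + 2 * y ≡ r → + 2 * - y ≡ - r
  l y r refl = q y where
   q = ring-92

 -- coordinates of a vector of the span of S
 record Coords {r} (C : Config r) (S : List V) (x : V) : Set where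
  constructor coords
  field
   as   : List ℤ
   len  : length as ≡ length S
   comb : Comb C S x as
   kind : All PM1 as ⊎ Axis as

 inner-coords : ∀ {r} (C : Config r) {S x} → Inner C S x → Coords C S x
 inner-coords C (signs as rel ps len) = coords as len (mkC rel) (inl ps)
 inner-coords C (member m (inl h)) = let (as , ax , l , f) = axis-at pm+ m in coords as l (mkC λ z → trans (cong (+ 2 *_) (h z)) (sym (f _))) (inr ax)
 inner-coords C {S} {x} (member {s} m (inr h)) = let (as , ax , l , f) = axis-at pm- m in coords as l (mkC λ z → trans (cong (+ 2 *_) (h z)) (trans (q (D C (s ∷ z))) (sym (f _)))) (inr ax) where
  q = ring-99

 -- The minor of two parallel vectors vanishes, and it expands to a multiple of this 2 × 2
 -- determinant of their coordinates.
 minor : ∀ {n} (G : Config n) {t s x ρ b c b' c' w} → (∀ z → + 2 * D G (x ∷ z) ≡ b * D G (t ∷ z) + c * D G (s ∷ z)) →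
     (∀ z → + 2 * D G (ρ ∷ z) ≡ b' * D G (t ∷ z) + c' * D G (s ∷ z)) → Ms w → ¬ Ind2 G x ρ → 0≢ (D G (t ∷ s ∷ w)) → b * c' ≡ c * b'
 minor G {t} {s} {x} {ρ} {b} {c} {b'} {c'} {w} hx hρ mw dep ne = cancel-≡ {D G (t ∷ s ∷ w)} _ _ ne
   (fin (D G (t ∷ s ∷ w)) (D G (x ∷ ρ ∷ w)) (D G (t ∷ ρ ∷ w)) (D G (s ∷ ρ ∷ w)) (hx (ρ ∷ w)) (¬NzL G dep mw) ht hs) where
  ht : + 2 * D G (t ∷ ρ ∷ w) ≡ c' * D G (t ∷ s ∷ w)
  ht = trans (cong (+ 2 *_) (alt G [] t ρ w)) (trans (neg2 (D G (ρ ∷ t ∷ w)) _ (hρ (t ∷ w))) (trans (cong₂ (λ p q → - (b' * p + c' * q)) (D-twice G t w) (alt G [] s t w)) (q b' c' (D G (t ∷ s ∷ w))))) where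
   neg2 : ∀ y r → + 2 * y ≡ r → + 2 * - y ≡ - r
   neg2 y r refl = p y where
    p = ring-92
   q = ring-100
  hs : + 2 * D G (s ∷ ρ ∷ w) ≡ - b' * D G (t ∷ s ∷ w)
  hs = trans (cong (+ 2 *_) (alt G [] s ρ w)) (trans (neg2 (D G (ρ ∷ s ∷ w)) _ (hρ (s ∷ w))) (trans (cong (λ q → - (b' * D G (t ∷ s ∷ w) + c' * q)) (D-twice G s w)) (q b' c' (D G (t ∷ s ∷ w))))) where
   neg2 : ∀ y r → + 2 * y ≡ r → + 2 * - y ≡ - r
   neg2 y r refl = p y where
    p = ring-92
   q = ring-101
  fin : ∀ d x t s → + 2 * x ≡ b * t + c * s → x ≡ + 0 → + 2 * t ≡ c' * d → + 2 * s ≡ - b' * d → d * (b * c') ≡ d * (c * b')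
  fin d x t s h refl h1 h2 = sum-diff {x = b * (c' * d) + c * (- b' * d)} {y = + 0} (trans (cong₂ (λ p q → b * p + c * q) (sym h1) (sym h2)) (trans (q1 b c t s) (cong (+ 2 *_) (sym h)))) (q2 d b c b' c') where
   q1 = ring-102
   q2 = ring-103

 -- Up to sign, a code stands for two vectors, one for each value of σ. A pair uses up both, so
 -- another pair with this code would repeat one of them.
 lines-coded : ∀ {r} (C : Config r) {K : Set} (univ : List K) (form : ℤ → K → List V → ℤ) ins → AllPairs (λ p q → Ind2 C (fst p) (fst q)) ins →
        (∀ {p q} → p ∈ ins → q ∈ ins → Ind2 C (snd p) (fst q)) →
        (∀ {p} → p ∈ ins → ∃ λ k → k ∈ univ × (∃ λ σ → PM1 σ × Scaled C (form σ k) (fst p)) × (∃ λ σ → PM1 σ × Scaled C (form σ k) (snd p))) →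
        length ins ≤ length univ
 lines-coded C {K} univ form ins apx ind cd = coded {R = λ p q → Ind2 C (fst p) (fst q)} {Code = Cd} univ ins apx (All.tabulate cd) clash3 where
  Cd : V × V → K → Set
  Cd p k = (∃ λ σ → PM1 σ × Scaled C (form σ k) (fst p)) × (∃ λ σ → PM1 σ × Scaled C (form σ k) (snd p))
  clash3 : ∀ {p q k} → p ∈ ins → q ∈ ins → Cd p k → Cd q k → Ind2 C (fst p) (fst q) → ⊥
  clash3 {x , ρ} {y , _} {k} mp mq ((σ , pσ , sx) , (τ , pτ , sρ)) ((υ , pυ , sy) , _) i = go (PM1-pigeon pσ pυ pτ) where
   go : σ ≡ υ ⊎ σ ≡ τ ⊎ υ ≡ τ → ⊥
   go (inl refl) = Pm-dep C {x} {y} (scaled-pm C sx sy) i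
   go (inr (inl refl)) = Pm-dep C {ρ} {x} (scaled-pm C sρ sx) (ind mp mp)
   go (inr (inr refl)) = Pm-dep C {ρ} {y} (scaled-pm C sρ sy) (ind mp mq)

 -- the two diagonals of a square
 record Ends {r} (C : Config r) {e s} (B : Square C e s) (c c' : ℤ) : Set where
  field
   {y y'} : V
   y∈  : y ∈ A
   y'∈ : y' ∈ A
   hy  : ∀ z → + 2 * D C (y ∷ z) ≡ c * D C (s ∷ z) + + 2 * D C (Square.b B ∷ z)
   hy' : ∀ z → + 2 * D C (y' ∷ z) ≡ + 2 * D C (e ∷ z) + (c' * D C (s ∷ z) + + 2 * D C (Square.b B ∷ z))

 ends+ : ∀ {r} (C : Config r) {e s} (B : Square C e s) → Ends C B (+ 0) (+ 2)
 ends+ C {e} {s} B = record { y∈ = Square.b∈ B ; y'∈ = Square.bₑₛ∈ B ; hy = λ z → l (D C (s ∷ z)) (D C (Square.b B ∷ z)) ; hy' = diag C B } where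
  l = ring-104

 ends- : ∀ {r} (C : Config r) {e s} (B : Square C e s) → Ends C B (+ 2) (+ 0)
 ends- C {e} {s} B = record { y∈ = Square.bₛ∈ B ; y'∈ = Square.bₑ∈ B ; hy = λ z → trans (at (Square.v₂ B) z) (ℤP.+-comm (+ 2 * D C (Square.b B ∷ z)) _)
   ; hy' = λ z → trans (at (Square.v₁ B) z) (l (D C (Square.b B ∷ z)) (D C (e ∷ z)) (D C (s ∷ z))) } where
  l = ring-105

 -- Two squares in independent classes with different second directions are incompatible with a sign vector: the determinant is 3.
 squares-sign : ∀ {r} (C : Config r) {e s s'} (B : Square C e s) (B' : Square C e s') → ∀ {x a b c w} → x ∈ A → PM1 a → PM1 b → PM1 c →
         Comb C (e ∷ s ∷ s' ∷ []) x (a ∷ b ∷ c ∷ []) → Ms w → ∣ D C (e ∷ s ∷ s' ∷ Square.b B ∷ Square.b B' ∷ w) ∣ ≡ 2 → ⊥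
 squares-sign C {e} {s} {s'} B B' {x} {w = w} mx = go where
  β = Square.b B
  β' = Square.b B'
  cols : ℤ → ℤ → ℤ → ℤ → ℤ → ℤ → ℤ → Cols
  cols a b c p p' q q' = (e , a ∷ + 0 ∷ + 2 ∷ + 0 ∷ + 2 ∷ []) ∷ (s , b ∷ p ∷ p' ∷ + 0 ∷ + 0 ∷ []) ∷ (s' , c ∷ + 0 ∷ + 0 ∷ q ∷ q' ∷ []) ∷
              (β , + 0 ∷ + 2 ∷ + 2 ∷ + 0 ∷ + 0 ∷ []) ∷ (β' , + 0 ∷ + 0 ∷ + 0 ∷ + 2 ∷ + 2 ∷ []) ∷ []
  bd : ∀ {a b c p p' q q'} → Comb C (e ∷ s ∷ s' ∷ []) x (a ∷ b ∷ c ∷ []) → Ends C B p p' → Ends C B' q q' → Ms w → ∣ D C (e ∷ s ∷ s' ∷ β ∷ β' ∷ w) ∣ ≡ 2 →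
     ∣ detP 5 (cols a b c p p' q q') ∣ ≤ 32
  bd {a} {b} {c} {p} {p'} {q} {q'} h P Q mw d2 = det-bound C (x ∷ P.y ∷ P.y' ∷ Q.y ∷ Q.y' ∷ []) (cols a b c p p' q q') {w} refl
    ((λ z → trans (eqn h z) (r1 a b c (D C (e ∷ z)) (D C (s ∷ z)) (D C (s' ∷ z)) (D C (β ∷ z)) (D C (β' ∷ z)))) ,
     (λ z → trans (P.hy z) (r2 p (D C (e ∷ z)) (D C (s ∷ z)) (D C (s' ∷ z)) (D C (β ∷ z)) (D C (β' ∷ z)))) ,
     (λ z → trans (P.hy' z) (r3 p' (D C (e ∷ z)) (D C (s ∷ z)) (D C (s' ∷ z)) (D C (β ∷ z)) (D C (β' ∷ z)))) ,
     (λ z → trans (Q.hy z) (r4 q (D C (e ∷ z)) (D C (s ∷ z)) (D C (s' ∷ z)) (D C (β ∷ z)) (D C (β' ∷ z)))) ,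
     (λ z → trans (Q.hy' z) (r5 q' (D C (e ∷ z)) (D C (s ∷ z)) (D C (s' ∷ z)) (D C (β ∷ z)) (D C (β' ∷ z)))) , tt)
    (mx ∷ P.y∈ ∷ P.y'∈ ∷ Q.y∈ ∷ Q.y'∈ ∷ []) mw d2 where
   module P = Ends P
   module Q = Ends Q
   r1 = ring-106
   r2 = ring-107
   r3 = ring-108
   r4 = ring-109
   r5 = ring-110
  E+ = ends+ C B
  E- = ends- C B
  E'+ = ends+ C B'
  E'- = ends- C B'
  go : ∀ {a b c} → PM1 a → PM1 b → PM1 c → Comb C (e ∷ s ∷ s' ∷ []) x (a ∷ b ∷ c ∷ []) → Ms w → ∣ D C (e ∷ s ∷ s' ∷ β ∷ β' ∷ w) ∣ ≡ 2 → ⊥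
  -- For each sign pattern the diagonals are chosen such that the three terms of the determinant
  -- have equal signs.
  go o+ o+ o+ h mw d = ≤⇒≤ᵇ (bd {+ 1} {+ 1} {+ 1} h E- E'- mw d)
  go o+ o+ o- h mw d = ≤⇒≤ᵇ (bd {+ 1} {+ 1} { - + 1} h E- E'+ mw d)
  go o+ o- o+ h mw d = ≤⇒≤ᵇ (bd {+ 1} { - + 1} {+ 1} h E+ E'- mw d)
  go o+ o- o- h mw d = ≤⇒≤ᵇ (bd {+ 1} { - + 1} { - + 1} h E+ E'+ mw d)
  go o- o+ o+ h mw d = ≤⇒≤ᵇ (bd { - + 1} {+ 1} {+ 1} h E+ E'+ mw d)
  go o- o+ o- h mw d = ≤⇒≤ᵇ (bd { - + 1} {+ 1} { - + 1} h E+ E'- mw d)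
  go o- o- o+ h mw d = ≤⇒≤ᵇ (bd { - + 1} { - + 1} {+ 1} h E- E'+ mw d)
  go o- o- o- h mw d = ≤⇒≤ᵇ (bd { - + 1} { - + 1} { - + 1} h E- E'- mw d)

 -- Heavy triples

 module K3 {N} (C : Config (suc (suc (suc N)))) {e t s} (me : e ∈ A) (mt : t ∈ A) (ms : s ∈ A) (hv : Heavy C (e ∷ t ∷ s ∷ [])) (nh : NoHeavy C 2) where

  open Gen C (C ⟋ mt ⟋ ms) me t (s ∷ []) (mt ∷ ms ∷ []) (λ _ → refl) hv nh public

  G = C ⟋ me

  drop-e : ∀ {x a b c} → Comb C (e ∷ t ∷ s ∷ []) x (a ∷ b ∷ c ∷ []) → ∀ z → + 2 * D G (x ∷ z) ≡ b * D G (t ∷ z) + c * D G (s ∷ z)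
  drop-e {x} {a} {b} {c} h z = trans (eqn (comb-con C me h) z) (trans (cong (λ u → a * u + (b * D G (t ∷ z) + (c * D G (s ∷ z) + + 0))) (D-twice C e z)) (l a (b * D G (t ∷ z)) (c * D G (s ∷ z)))) where
   l = ring-111

  -- A half sign vector up to scaling: σ is the product of the signs at e and t, `q` the product of
  -- those at t and s.
  form : ℤ → ℤ → List V → ℤ
  form σ q z = σ * D C (e ∷ z) + (D C (t ∷ z) + q * D C (s ∷ z))

  Sg : V → ℤ → Set
  Sg x q = ∃ λ a → ∃₂ λ b c → PM1 a × PM1 b × PM1 c × Comb C (e ∷ t ∷ s ∷ []) x (a ∷ b ∷ c ∷ []) × b * c ≡ q

  sg-scaled : ∀ {x q} → Sg x q → ∃ λ σ → PM1 σ × Scaled C (form σ q) x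
  sg-scaled {x} (a , b , c , pa , pb , pc , h , refl) = a * b , PM1-* pa pb , b , pb , λ z → trans (eqn h z) (sym (trans (l (D C (e ∷ z)) (D C (t ∷ z)) (D C (s ∷ z)) a b c)
    (trans (cong (λ u → u * (a * D C (e ∷ z)) + (b * D C (t ∷ z) + u * (c * D C (s ∷ z)))) (PM1-sq pb)) (l2 (a * D C (e ∷ z)) (b * D C (t ∷ z)) (c * D C (s ∷ z)))))) where
   l = ring-112
   l2 = ring-113

  -- After contracting `e`, the coordinates at t and s are proportional. This excludes a member
  -- against a sign vector or against another member; the same member twice contradicts
  -- independence.
  both-signs : ∀ {x ρ} → Coords C (e ∷ t ∷ s ∷ []) x → Coords C (e ∷ t ∷ s ∷ []) ρ → Nz G x → Nz G ρ → ¬ Ind2 G x ρ → Ind2 C ρ x → ∃ λ q → PM1 q × Sg x q × Sg ρ q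
  both-signs {x} {ρ} (coords (a ∷ b ∷ c ∷ []) _ hx kx) (coords (a' ∷ b' ∷ c' ∷ []) _ hρ kρ) nx nρ dep ind = go kx kρ where
   w = fst (snd hv)
   min : b * c' ≡ c * b'
   min = minor G {t} {s} {x} {ρ} {b} {c} {b'} {c'} (drop-e hx) (drop-e hρ) (fst (snd (snd hv))) dep (snd (snd (snd hv)))
   zero-e : ∀ {y a} → Comb C (e ∷ t ∷ s ∷ []) y (a ∷ + 0 ∷ + 0 ∷ []) → ¬ Nz G y
   zero-e {y} h (z , _ , d) = d (cancel-≡ {+ 2} _ (+ 0) (λ ()) (trans (drop-e h z) (l (D G (t ∷ z)) (D G (s ∷ z))))) where
    l = ring-114
   pm-t : ∀ {y b} → PM2 b → Comb C (e ∷ t ∷ s ∷ []) y (+ 0 ∷ b ∷ + 0 ∷ []) → Pm C t y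
   pm-t {y} {b} pb h = mult-pm C pb (λ z → trans (eqn h z) (l (D C (e ∷ z)) (b * D C (t ∷ z)) (D C (s ∷ z)))) where
    l = ring-115
   pm-s : ∀ {y c} → PM2 c → Comb C (e ∷ t ∷ s ∷ []) y (+ 0 ∷ + 0 ∷ c ∷ []) → Pm C s y
   pm-s {y} {c} pc h = mult-pm C pc (λ z → trans (eqn h z) (l (D C (e ∷ z)) (D C (t ∷ z)) (c * D C (s ∷ z)))) where
    l = ring-116
   go : All PM1 (a ∷ b ∷ c ∷ []) ⊎ Axis (a ∷ b ∷ c ∷ []) → All PM1 (a' ∷ b' ∷ c' ∷ []) ⊎ Axis (a' ∷ b' ∷ c' ∷ []) → ∃ λ q → PM1 q × Sg x q × Sg ρ q
   go (inl (pa ∷ pb ∷ pc ∷ [])) (inl (pa' ∷ pb' ∷ pc' ∷ [])) = b * c , PM1-* pb pc , (a , b , c , pa , pb , pc , hx , refl) ,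
    (a' , b' , c' , pa' , pb' , pc' , hρ , sym (PM1-ratio pb pc pb' pc' min))
   go (inr (hereA _ (refl ∷ refl ∷ []))) _ = ⊥-elim (zero-e hx nx)
   go _ (inr (hereA _ (refl ∷ refl ∷ []))) = ⊥-elim (zero-e hρ nρ)
   go (inl (_ ∷ _ ∷ pc ∷ [])) (inr (thereA (hereA pb' (refl ∷ [])))) = ⊥-elim (*≢0 (PM1-≢ pc) (PM2-≢ pb') (trans (sym min) (*-zeroʳ b)))
   go (inl (_ ∷ pb ∷ _ ∷ [])) (inr (thereA (thereA (hereA pc' [])))) = ⊥-elim (*≢0 (PM1-≢ pb) (PM2-≢ pc') (trans min (*-zeroʳ c)))
   go (inr (thereA (hereA pb (refl ∷ [])))) (inl (_ ∷ _ ∷ pc' ∷ [])) = ⊥-elim (*≢0 (PM2-≢ pb) (PM1-≢ pc') min)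
   go (inr (thereA (thereA (hereA pc [])))) (inl (_ ∷ pb' ∷ _ ∷ [])) = ⊥-elim (*≢0 (PM2-≢ pc) (PM1-≢ pb') (sym min))
   go (inr (thereA (hereA pb (refl ∷ [])))) (inr (thereA (hereA pb' (refl ∷ [])))) = ⊥-elim (Pm-dep C {ρ} {x} (Pm-trans C {ρ} {t} {x} (Pm-sym C {t} {ρ} (pm-t pb' hρ)) (pm-t pb hx)) ind)
   go (inr (thereA (thereA (hereA pc [])))) (inr (thereA (thereA (hereA pc' [])))) = ⊥-elim (Pm-dep C {ρ} {x} (Pm-trans C {ρ} {s} {x} (Pm-sym C {s} {ρ} (pm-s pc' hρ)) (pm-s pc hx)) ind)
   go (inr (thereA (hereA pb (refl ∷ [])))) (inr (thereA (thereA (hereA pc' [])))) = ⊥-elim (*≢0 (PM2-≢ pb) (PM2-≢ pc') min)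
   go (inr (thereA (thereA (hereA pc [])))) (inr (thereA (hereA pb' (refl ∷ [])))) = ⊥-elim (*≢0 (PM2-≢ pc) (PM2-≢ pb') (sym min))

  pair-signs : ∀ {xs} {S : Split C me xs} (o : Outer S) {p} → p ∈ Outer.ins o → ∃ λ q → PM1 q × Sg (fst p) q × Sg (snd p) q
  pair-signs o {x , ρ} m = both-signs (inner-coords C ix) (inner-coords C iρ) nx nρ dep (ind m)
   where open InnerPair (inner-pair o m)

  ins≤2 : ∀ {xs} {S : Split C me xs} (o : Outer S) → length (Outer.ins o) ≤ 2
  ins≤2 o = lines-coded C signs₂ form (Outer.ins o) (Outer.insAP o) (λ mp mq → InnerPair.ind (inner-pair o mp) mq)
   λ m → let (q , pq , sx , sρ) = pair-signs o m in q , PM1-∈ pq , sg-scaled sx , sg-scaled sρ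

  two-squares-sign : ∀ {vs x q} (a b : RS vs) → Apart a b → x ∈ A → Sg x q → ⊥
  two-squares-sign {x = x} a b (ne , (w , mw , d)) mx (α , β , γ , pα , pβ , pγ , h , _) = go (RS.s∈ a) (RS.s∈ b) ne (RS.B a) (RS.B b) d where
   go : ∀ {s₁ s₂} → s₁ ∈ t ∷ s ∷ [] → s₂ ∈ t ∷ s ∷ [] → s₁ ≢ s₂ → (B : Square C e s₁) (B' : Square C e s₂) → 0≢ (D F (Square.b B ∷ Square.b B' ∷ w)) → ⊥
   go (here refl) (here refl) ne _ _ _ = ne refl
   go (there (here refl)) (there (here refl)) ne _ _ _ = ne refl
   go (here refl) (there (here refl)) _ B B' d = squares-sign C B B' mx pα pβ pγ h mw
    (trans (perm-abs C (↭-trans (↭-swap e t ↭-refl) (↭-prep t (↭-swap e s ↭-refl)))) (even-abs {C = F} evF (Square.b∈ B ∷ Square.b∈ B' ∷ mw) d))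
   go (there (here refl)) (here refl) _ B B' d = squares-sign C B B' mx pα pγ pβ h' mw
    (trans (perm-abs C (↭-trans (↭-prep e (↭-swap s t ↭-refl)) (↭-trans (↭-swap e t ↭-refl) (↭-prep t (↭-swap e s ↭-refl))))) (even-abs {C = F} evF (Square.b∈ B ∷ Square.b∈ B' ∷ mw) d)) where
    h' : Comb C (e ∷ s ∷ t ∷ []) x (α ∷ γ ∷ β ∷ [])
    h' = mkC λ z → trans (eqn h z) (l (α * D C (e ∷ z)) (β * D C (t ∷ z)) (γ * D C (s ∷ z))) where
     l = ring-117

  -- Inner points admit at most one square, which leaves N + 1 + 2 surplus points; without inner
  -- points there are at most N + 2. The budget is N + 3.
  bound : 2 ≤ N → ∀ {xs} → Simple C xs → length xs ≤ f1 (suc (suc N))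
  bound N≥2 {xs} sx = start (split C me (t ∷ s ∷ w , mt ∷ ms ∷ mw , dw) sx) where
   w = fst (snd hv)
   mw = fst (snd (snd hv))
   dw = snd (snd (snd hv))
   start : Split C me xs → length xs ≤ f1 (suc (suc N))
   start S = step2 (outer S) where
    step2 : Outer S → length xs ≤ f1 (suc (suc N))
    step2 o = step3 (squares o) where
     finish : ∀ {m i} → length (Outer.rs o) ≤ m → length (Outer.ins o) ≤ i → m ℕ.+ i ≤ 3 → length xs ≤ f1 (suc (suc N))
     finish {m} {i} hm hi h = fit (suc N) (split-length S) (thm2 N N≥2 (C ⟋ me) mt ms hv (Split.simp' S))
      (≤-trans (≤-reflexive (Outer.total o)) (≤-trans (+-mono-≤ (+-mono-≤ (vs≤N (Outer.vs o) (Outer.vsAP o)) hm) hi)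
       (≤-trans (≤-reflexive (+-assoc N m i)) (≤-trans (+-monoʳ-≤ N h) (≤-reflexive (ℕP.+-comm N 3))))))
     step3 : SquareList o → length xs ≤ f1 (suc (suc N))
     step3 q = go (Outer.ins o) refl (SquareList.sqs q) (SquareList.len q) (SquareList.apt q) (SquareList.le q) where
      go : ∀ is → is ≡ Outer.ins o → ∀ (sqs : List (RS (Outer.vs o))) → length sqs ≡ length (Outer.rs o) → AllPairs Apart sqs → length sqs ≤ 2 → length xs ≤ f1 (suc (suc N))
      go [] eq sqs len _ le = finish {2} {0} (subst (_≤ 2) len le) (≤-reflexive (sym (cong length eq))) (s≤s (s≤s z≤n))
      go (_ ∷ _) _ [] len _ _ = finish {1} {2} (subst (_≤ 1) len z≤n) (ins≤2 o) ≤-refl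
      go (_ ∷ _) _ (_ ∷ []) len _ _ = finish {1} {2} (subst (_≤ 1) len ≤-refl) (ins≤2 o) ≤-refl
      go (p ∷ _) eq (a ∷ b ∷ _) _ ((ab ∷ _) ∷ _) _ = ⊥-elim (two-squares-sign a b ab (InnerPair.x∈ (inner-pair o mp)) (fst (snd (snd (pair-signs o mp))))) where
       mp : p ∈ Outer.ins o
       mp = subst (p ∈_) eq (here refl)

 thm3 : ∀ N → 2 ≤ N → (C : Config (suc (suc (suc N)))) → ∀ {e t s} → e ∈ A → t ∈ A → s ∈ A → Heavy C (e ∷ t ∷ s ∷ []) → ∀ {xs} → Simple C xs → length xs ≤ f1 (suc (suc N))
 thm3 N N≥2 C me mt ms hv {xs} sx = go (heavy? C 1) (heavy? C 2) where
  go : Dec (∃ λ S → Ms S × length S ≡ 1 × Heavy C S) → Dec (∃ λ S → Ms S × length S ≡ 2 × Heavy C S) → length xs ≤ f1 (suc (suc N))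
  go (yes (_ ∷ [] , mv ∷ [] , _ , (ev , nv))) _ = thm1 (suc (suc N)) C mv ev nv sx
  go (no _) (yes (_ ∷ _ ∷ [] , m ∷ m' ∷ [] , _ , h)) = thm2 (suc N) (m≤n⇒m≤1+n N≥2) C m m' h sx
  go (no h1) (no h2) = K3.bound C me mt ms hv (no-heavy-suc C (no-heavy-suc C (no-heavy₀ C) h1) h2) N≥2 sx

 -- Heavy quadruples

 -- `perm±` might give different signs for `x` and `y`; applied to the single vector x - y, it
 -- transports the equality.
 perm-eq : ∀ {r} (C : Config r) {x y} us vs us' vs' → (∀ v → us ++ v ∷ vs ↭ us' ++ v ∷ vs') → D C (us ++ x ∷ vs) ≡ D C (us ++ y ∷ vs) → D C (us' ++ x ∷ vs') ≡ D C (us' ++ y ∷ vs')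
 perm-eq C {x} {y} us vs us' vs' p h = i-j≡0⇒i≡j _ _ (trans (sym (diff us' vs')) (perm-0 C (p v) (trans (diff us vs) (trans (cong (_- D C (us ++ y ∷ vs)) h) (+-inverseʳ (D C (us ++ y ∷ vs))))))) where
  v : V
  v = lc (+ 1) x (- + 1) y
  diff : ∀ us vs → D C (us ++ v ∷ vs) ≡ D C (us ++ x ∷ vs) - D C (us ++ y ∷ vs)
  diff us vs = trans (lin C us (+ 1) x (- + 1) y vs) (l (D C (us ++ x ∷ vs)) (D C (us ++ y ∷ vs))) where
   l = ring-118

 -- A displacement with many nonzero coordinates yields a small heavy tuple.
 off-few : ∀ {r} (C : Config r) {S} → Ms S → (∀ u → psum C S u ≡ false) → ∀ {k} → NoHeavy C k → ∀ {x y λs w} → x ∈ A → y ∈ A → Off C S x λs y →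
      (P : Part λs S) → suc (suc (length (Part.Zs P))) ≤ k → Ms w → 0≢ (D C (x ∷ S ++ w)) → ⊥
 off-few C {S} mS sumE nh {x} {y} {λs} {w} mx my off P le mw dw = nh x (y ∷ Zs) (mx ∷ my ∷ mZ) le (hev , hnz) where
  open Part P
  mP : Ms (s ∷ Is ++ Zs)
  mP = All-resp-↭ perm mS
  mZ : Ms Zs
  mZ = ++⁻ʳ (s ∷ Is) mP
  rel : ∀ u → x ∈ u → + 2 * D C (y ∷ u) ≡ dot λs (map (λ s → D C (s ∷ u)) S)
  rel u m = trans (off u) (trans (cong (λ t → + 2 * t + dot λs (map (λ s → D C (s ∷ u)) S)) (D-mem C m)) (+-identityˡ _))
  hev : ∀ {z} → Ms z → par (D C (x ∷ y ∷ Zs ++ z)) ≡ false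
  hev {z} mz = let u = x ∷ Zs ++ z
                   (g , e3 , p3) = half (λ s → D C (s ∷ u)) (All.tabulate (λ m → D-mem C (there (∈-++⁺ˡ m))))
         in trans (perm-par C (↭-swap x y ↭-refl)) (trans (cong par (cancel-≡ {+ 2} _ g (λ ()) (trans (rel u (here refl)) e3))) (trans p3 (sumE u)))
  hnz : NzL C (x ∷ y ∷ Zs)
  hnz = Is ++ w , AllP.++⁺ (++⁻ˡ Is (All.tail mP)) mw , λ e0 → *≢0 (PM2-≢ a2) ds (trans (sym (only _ (All.tabulate (λ m → D-mem C (there (∈-++⁺ʳ Zs (∈-++⁺ˡ m)))))))
       (trans (sym (rel (x ∷ Zs ++ Is ++ w) (here refl))) (cong (+ 2 *_) (perm-0 C (↭-swap x y ↭-refl) e0)))) where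
   ds : 0≢ (D C (s ∷ x ∷ Zs ++ Is ++ w))
   ds = perm-≢ C (↭-trans (↭-prep x (↭-trans (++⁺ʳ w perm) (↭-prep s (subst₂ _↭_ refl (++-assoc Zs Is w) (++⁺ʳ w (++-comm Is Zs)))))) (↭-swap x s ↭-refl)) dw

 -- A pair in the class of `P` modulo `S` whose difference is the sum of two signed members of `S`.
 record EdgeL {r} (C : Config r) (S : List V) (P : V) : Set where
  field
   {y y'} : V
   y∈  : y ∈ A
   y'∈ : y' ∈ A
   as  : List ℤ
   len : length as ≡ length S
   tw  : TwoL as
   rel : ∀ z → + 2 * D C (y' ∷ z) ≡ + 2 * D C (y ∷ z) + dot as (map (λ s → D C (s ∷ z)) S)
   cls : ∀ z → D C (y ∷ S ++ z) ≡ D C (P ∷ S ++ z)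

 edge-swap : ∀ {r} (C : Config r) {a b S P} → EdgeL C (a ∷ b ∷ S) P → EdgeL C (b ∷ a ∷ S) P
 edge-swap C {a} {b} {S} {P} E = go (EdgeL.as E) (EdgeL.len E) (EdgeL.tw E) (EdgeL.rel E) where
  y = EdgeL.y E
  y' = EdgeL.y' E
  go : ∀ as → length as ≡ suc (suc (length S)) → TwoL as → (∀ z → + 2 * D C (y' ∷ z) ≡ + 2 * D C (y ∷ z) + dot as (map (λ s → D C (s ∷ z)) (a ∷ b ∷ S))) → EdgeL C (b ∷ a ∷ S) P
  go (α ∷ β ∷ as) len tw rel = record { y∈ = EdgeL.y∈ E ; y'∈ = EdgeL.y'∈ E ; as = β ∷ α ∷ as ; len = len ; tw = twoL-swap tw
   ; rel = λ z → trans (rel z) (cong (λ t → + 2 * D C (y ∷ z) + t) (l (α * D C (a ∷ z)) (β * D C (b ∷ z)) (dot as (map (λ s → D C (s ∷ z)) S))))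
   ; cls = λ z → perm-eq C [] (a ∷ b ∷ S ++ z) [] (b ∷ a ∷ S ++ z) (λ v → ↭-prep v (↭-swap a b ↭-refl)) (EdgeL.cls E z) } where
   l = ring-119

 edge-swap₂ : ∀ {r} (C : Config r) {o a b S P} → EdgeL C (o ∷ a ∷ b ∷ S) P → EdgeL C (o ∷ b ∷ a ∷ S) P
 edge-swap₂ C {o} {a} {b} {S} {P} E = go (EdgeL.as E) (EdgeL.len E) (EdgeL.tw E) (EdgeL.rel E) where
  y = EdgeL.y E
  y' = EdgeL.y' E
  go : ∀ as → length as ≡ suc (suc (suc (length S))) → TwoL as → (∀ z → + 2 * D C (y' ∷ z) ≡ + 2 * D C (y ∷ z) + dot as (map (λ s → D C (s ∷ z)) (o ∷ a ∷ b ∷ S))) → EdgeL C (o ∷ b ∷ a ∷ S) P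
  go (ω ∷ α ∷ β ∷ as) len tw rel = record { y∈ = EdgeL.y∈ E ; y'∈ = EdgeL.y'∈ E ; as = ω ∷ β ∷ α ∷ as ; len = len ; tw = twoL-swap₂ tw
   ; rel = λ z → trans (rel z) (cong (λ t → + 2 * D C (y ∷ z) + t) (l (ω * D C (o ∷ z)) (α * D C (a ∷ z)) (β * D C (b ∷ z)) (dot as (map (λ s → D C (s ∷ z)) S))))
   ; cls = λ z → perm-eq C [] (o ∷ a ∷ b ∷ S ++ z) [] (o ∷ b ∷ a ∷ S ++ z) (λ v → ↭-prep v (↭-prep o (↭-swap a b ↭-refl))) (EdgeL.cls E z) } where
   l = ring-120

 record At4 {r} (C : Config r) (h g k l P y : V) (a b c d : ℤ) : Set where
  constructor mkAt4
  field
   val4 : ∀ z → + 2 * D C (y ∷ z) ≡ + 2 * D C (P ∷ z) + (a * D C (h ∷ z) + (b * D C (g ∷ z) + (c * D C (k ∷ z) + (d * D C (l ∷ z) + + 0))))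
 open At4 public

 -- A pair in direction h and a pair in direction g, displaced by an integral vector, contain a diagonal.
 pair-edge : ∀ {r} (C : Config r) {h g k l} → Ms (h ∷ g ∷ k ∷ l ∷ []) → (∀ u → psum C (h ∷ g ∷ k ∷ l ∷ []) u ≡ false) → NoHeavy C 3 →
       ∀ {P P⁺ q q⁺ w} → P ∈ A → P⁺ ∈ A → q ∈ A → q⁺ ∈ A → Vary C h P P⁺ (+ 2) → Vary C g q q⁺ (+ 2) →
       ∀ {λs} → Off C (h ∷ g ∷ k ∷ l ∷ []) P λs q → length λs ≡ 4 → All Ev λs → Ms w → 0≢ (D C (P ∷ h ∷ g ∷ k ∷ l ∷ w)) → EdgeL C (h ∷ g ∷ k ∷ l ∷ []) P
 pair-edge C {h} {g} {k} {l} mS sumE nh {P} {P⁺} {q} {q⁺} {w} mP mP⁺ mq mq⁺ vP vq {a ∷ b ∷ c ∷ d ∷ []} off len evs mw dw = go (tally evs) where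
  S = h ∷ g ∷ k ∷ l ∷ []
  atP : At4 C h g k l P P (+ 0) (+ 0) (+ 0) (+ 0)
  atP = mkAt4 λ z → r (D C (P ∷ z)) (D C (h ∷ z)) (D C (g ∷ z)) (D C (k ∷ z)) (D C (l ∷ z)) where
   r = ring-121
  atP⁺ : At4 C h g k l P P⁺ (+ 2) (+ 0) (+ 0) (+ 0)
  atP⁺ = mkAt4 λ z → trans (at vP z) (r (D C (P ∷ z)) (D C (h ∷ z)) (D C (g ∷ z)) (D C (k ∷ z)) (D C (l ∷ z))) where
   r = ring-122
  atq : At4 C h g k l P q a b c d
  atq = mkAt4 off
  atq⁺ : At4 C h g k l P q⁺ a (b + + 2) c d
  atq⁺ = mkAt4 λ z → trans (at vq z) (trans (cong (_+ + 2 * D C (g ∷ z)) (off z)) (r (+ 2 * D C (P ∷ z)) (a * D C (h ∷ z)) b (D C (g ∷ z)) (c * D C (k ∷ z)) (d * D C (l ∷ z)))) where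
   r = ring-123
  clsP : ∀ z → D C (P ∷ S ++ z) ≡ D C (P ∷ S ++ z)
  clsP _ = refl
  clsP⁺ : ∀ z → D C (P⁺ ∷ S ++ z) ≡ D C (P ∷ S ++ z)
  clsP⁺ z = trans (plus C vP (S ++ z)) (trans (cong (λ t → D C (P ∷ S ++ z) + t) (D-twice C h _)) (ℤP.+-identityʳ _))
  mk : ∀ {y y' a b c d a' b' c' d'} α β γ δ → y ∈ A → y' ∈ A → At4 C h g k l P y a b c d → At4 C h g k l P y' a' b' c' d' → (∀ z → D C (y ∷ S ++ z) ≡ D C (P ∷ S ++ z)) →
     a' ≡ a + α → b' ≡ b + β → c' ≡ c + γ → d' ≡ d + δ → TwoL (α ∷ β ∷ γ ∷ δ ∷ []) → EdgeL C S P
  mk {y} {y'} {a} {b} {c} {d} α β γ δ my my' hy hy' cl refl refl refl refl t = record { y∈ = my ; y'∈ = my' ; as = α ∷ β ∷ γ ∷ δ ∷ [] ; len = refl ; tw = t ; cls = cl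
   ; rel = λ z → sum-diff (cong₂ _-_ (val4 hy' z) (val4 hy z)) (r (D C (y' ∷ z)) (D C (y ∷ z)) (D C (P ∷ z)) (D C (h ∷ z)) (D C (g ∷ z)) (D C (k ∷ z)) (D C (l ∷ z)) a b c d α β γ δ) } where
   r = ring-124
  0+ : ∀ x → x ≡ + 0 + x
  0+ x = sym (+-identityˡ x)
  go : Count (a ∷ b ∷ c ∷ d ∷ []) → EdgeL C S P
  -- With fewer than two nonzero coordinates from `P` to `q`, starting at `P⁺` or ending at `q⁺`
  -- supplies the missing ones; more than two would make a small heavy set.
  go (cnt0 (refl ∷ refl ∷ refl ∷ refl ∷ [])) = mk (- + 2) (+ 2) (+ 0) (+ 0) mP⁺ mq⁺ atP⁺ atq⁺ clsP⁺ refl refl refl refl (hereT pm- (hereA pm+ (refl ∷ refl ∷ [])))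
  go (cnt1 (hereA pa (refl ∷ refl ∷ refl ∷ []))) = mk a (+ 2) (+ 0) (+ 0) mP mq⁺ atP atq⁺ clsP (0+ a) refl refl refl (hereT pa (hereA pm+ (refl ∷ refl ∷ [])))
  go (cnt1 (thereA (hereA pb (refl ∷ refl ∷ [])))) = mk (- + 2) b (+ 0) (+ 0) mP⁺ mq atP⁺ atq clsP⁺ refl (0+ b) refl refl (hereT pm- (hereA pb (refl ∷ refl ∷ [])))
  go (cnt1 (thereA (thereA (hereA pc (refl ∷ []))))) = mk (- + 2) (+ 0) c (+ 0) mP⁺ mq atP⁺ atq clsP⁺ refl refl (0+ c) refl (hereT pm- (thereA (hereA pc (refl ∷ []))))
  go (cnt1 (thereA (thereA (thereA (hereA pd []))))) = mk (- + 2) (+ 0) (+ 0) d mP⁺ mq atP⁺ atq clsP⁺ refl refl refl (0+ d) (hereT pm- (thereA (thereA (hereA pd []))))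
  go (cnt2 t) = mk a b c d mP mq atP atq clsP (0+ a) (0+ b) (0+ c) (0+ d) t
  go (cnt3 t) = ⊥-elim (off-few C mS sumE nh mP mq off (fst pt3) le mw dw) where
   pt3 = part-three t S len
   zs≤ : ∀ {i z} → 4 ≡ suc (i ℕ.+ z) → 2 ≤ i → suc (suc z) ≤ 3
   zs≤ {i} {z} e h = ≤-trans (+-monoˡ-≤ z h) (≤-reflexive (suc-injective (sym e)))
   le : suc (suc (length (Part.Zs (fst pt3)))) ≤ 3
   le = zs≤ (trans (↭-length (Part.perm (fst pt3))) (cong suc (length-++ (Part.Is (fst pt3))))) (snd pt3)

 -- The Hadamard frame: h₁, …, h₄ are half of the rows of a 4×4 Hadamard matrix in the coordinates e, t, s, u.
 record Hadamard {r} (C : Config r) (e t s u h₁ h₂ h₃ h₄ : V) : Set where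
  field
   n₁ : h₁ ∈ A
   n₂ : h₂ ∈ A
   n₃ : h₃ ∈ A
   n₄ : h₄ ∈ A
   c₁ : Comb C (e ∷ t ∷ s ∷ u ∷ []) h₁ (+ 1 ∷ + 1 ∷ + 1 ∷ + 1 ∷ [])
   c₂ : Comb C (e ∷ t ∷ s ∷ u ∷ []) h₂ (+ 1 ∷ + 1 ∷ - + 1 ∷ - + 1 ∷ [])
   c₃ : Comb C (e ∷ t ∷ s ∷ u ∷ []) h₃ (+ 1 ∷ - + 1 ∷ + 1 ∷ - + 1 ∷ [])
   c₄ : Comb C (e ∷ t ∷ s ∷ u ∷ []) h₄ (+ 1 ∷ - + 1 ∷ - + 1 ∷ + 1 ∷ [])

 module _ {r} (C : Config r) {e t s u h₁ h₂ h₃ h₄} (Hd : Hadamard C e t s u h₁ h₂ h₃ h₄) where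
  open Hadamard Hd

  -- The sign matrix has determinant -16, and halving its four rows leaves -1. So the new frame is
  -- heavy together with the old one.
  hadamard-det : ∀ z → D C (h₁ ∷ h₂ ∷ h₃ ∷ h₄ ∷ z) ≡ - D C (e ∷ t ∷ s ∷ u ∷ z)
  hadamard-det z = cancel-≡ {+ 16} _ _ (λ ()) (trans (expand (D C) (alt C) (h₁ ∷ h₂ ∷ h₃ ∷ h₄ ∷ [])
    ((e , + 1 ∷ + 1 ∷ + 1 ∷ + 1 ∷ []) ∷ (t , + 1 ∷ + 1 ∷ - + 1 ∷ - + 1 ∷ []) ∷ (s , + 1 ∷ - + 1 ∷ + 1 ∷ - + 1 ∷ []) ∷ (u , + 1 ∷ - + 1 ∷ - + 1 ∷ + 1 ∷ []) ∷ [])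
    refl (eqn c₁ , eqn c₂ , eqn c₃ , eqn c₄ , tt) z) (l (D C (e ∷ t ∷ s ∷ u ∷ z)))) where
   l = ring-125

  -- The rows of the sign matrix add up to (4, 0, 0, 0).
  hadamard-sum : ∀ z → + 2 * D C (e ∷ z) ≡ + 1 * D C (h₁ ∷ z) + (+ 1 * D C (h₂ ∷ z) + (+ 1 * D C (h₃ ∷ z) + (+ 1 * D C (h₄ ∷ z) + + 0)))
  hadamard-sum z = cancel-≡ {+ 2} _ _ (λ ()) (sym (trans (q1 (D C (h₁ ∷ z)) (D C (h₂ ∷ z)) (D C (h₃ ∷ z)) (D C (h₄ ∷ z)))
    (trans (cong₂ _+_ (cong₂ _+_ (eqn c₁ z) (eqn c₂ z)) (cong₂ _+_ (eqn c₃ z) (eqn c₄ z))) (q2 (D C (e ∷ z)) (D C (t ∷ z)) (D C (s ∷ z)) (D C (u ∷ z)))))) where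
   q1 = ring-126
   q2 = ring-127

 SignRow : ∀ {r} → Config r → V → V → V → V → ℤ → ℤ → ℤ → ℤ → Set
 SignRow C e t s u a b c d = ∃ λ h → h ∈ A × Comb C (e ∷ t ∷ s ∷ u ∷ []) h (a ∷ b ∷ c ∷ d ∷ [])

 -- Any difference ±hᵢ±hⱼ found in a class independent of that of the square B gives a determinant larger than 2.
 hadamard-clash : ∀ {r} (C : Config r) {e t s u} → s ∈ A → u ∈ A → (B : Square C e t) → (∀ {a b c d} → PM1 a → PM1 b → PM1 c → PM1 d → SignRow C e t s u a b c d) →
          ∀ {h₁ h₂ h₃ h₄} → Hadamard C e t s u h₁ h₂ h₃ h₄ → ∀ {P} (E : EdgeL C (h₁ ∷ h₂ ∷ h₃ ∷ h₄ ∷ []) P) → ∀ {w} → Ms w →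
          ∣ D C (e ∷ t ∷ s ∷ u ∷ Square.b B ∷ EdgeL.y E ∷ w) ∣ ≡ 2 → ⊥
 hadamard-clash C {e} {t} {s} {u} ms mu B sign {h₁} {h₂} {h₃} {h₄} Hd E {w} mw d2 = start (EdgeL.as E) (EdgeL.len E) (EdgeL.tw E) (EdgeL.rel E) where
  open Hadamard Hd
  β₀ = Square.b B
  y = EdgeL.y E
  y' = EdgeL.y' E
  Rel : ℤ → ℤ → ℤ → ℤ → Set
  Rel a b c d = ∀ z → + 2 * D C (y' ∷ z) ≡ + 2 * D C (y ∷ z) + (a * D C (h₁ ∷ z) + (b * D C (h₂ ∷ z) + (c * D C (h₃ ∷ z) + (d * D C (h₄ ∷ z) + + 0))))
  record RelS (α β γ δ : ℤ) : Set where
   constructor mkR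
   field
    valS : ∀ z → + 2 * D C (y' ∷ z) ≡ + 2 * D C (y ∷ z) + (α * D C (e ∷ z) + (β * D C (t ∷ z) + (γ * D C (s ∷ z) + δ * D C (u ∷ z))))
  toS : ∀ a b c d α β γ δ → Rel a b c d → a + b + c + d ≡ + 2 * α → a + b - c - d ≡ + 2 * β → a - b + c - d ≡ + 2 * γ → a - b - c + d ≡ + 2 * δ → RelS α β γ δ
  toS a b c d α β γ δ h p q p' q' = mkR λ z → cancel-≡ {+ 2} _ _ (λ ()) (trans (cong (+ 2 *_) (h z)) (trans (l1 (D C (y ∷ z)) a b c d (D C (h₁ ∷ z)) (D C (h₂ ∷ z)) (D C (h₃ ∷ z)) (D C (h₄ ∷ z)))
    (trans (cong₂ (λ m n → + 4 * D C (y ∷ z) + (m + n)) (cong₂ (λ m n → a * m + b * n) (eqn c₁ z) (eqn c₂ z)) (cong₂ (λ m n → c * m + d * n) (eqn c₃ z) (eqn c₄ z)))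
    (trans (l2 (D C (y ∷ z)) a b c d (D C (e ∷ z)) (D C (t ∷ z)) (D C (s ∷ z)) (D C (u ∷ z)))
    (trans (cong₂ (λ m n → + 4 * D C (y ∷ z) + (m + n)) (cong₂ (λ m n → m * D C (e ∷ z) + n * D C (t ∷ z)) p q) (cong₂ (λ m n → m * D C (s ∷ z) + n * D C (u ∷ z)) p' q'))
    (l3 (D C (y ∷ z)) α β γ δ (D C (e ∷ z)) (D C (t ∷ z)) (D C (s ∷ z)) (D C (u ∷ z)))))))) where
   l1 = ring-128
   l2 = ring-129
   l3 = ring-130
  cols : (α β γ δ p p' a b c d a' b' c' d' : ℤ) → Cols
  cols α β γ δ p p' a b c d a' b' c' d' = (e , + 0 ∷ α ∷ + 0 ∷ + 2 ∷ a ∷ a' ∷ []) ∷ (t , + 0 ∷ β ∷ p ∷ p' ∷ b ∷ b' ∷ []) ∷ (s , + 0 ∷ γ ∷ + 0 ∷ + 0 ∷ c ∷ c' ∷ []) ∷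
   (u , + 0 ∷ δ ∷ + 0 ∷ + 0 ∷ d ∷ d' ∷ []) ∷ (β₀ , + 0 ∷ + 0 ∷ + 2 ∷ + 2 ∷ + 0 ∷ + 0 ∷ []) ∷ (y , + 2 ∷ + 2 ∷ + 0 ∷ + 0 ∷ + 0 ∷ + 0 ∷ []) ∷ []
  bd : ∀ {α β γ δ p p' a b c d a' b' c' d'} → Ends C B p p' → RelS α β γ δ → SignRow C e t s u a b c d → SignRow C e t s u a' b' c' d' → ∣ detP 6 (cols α β γ δ p p' a b c d a' b' c' d') ∣ ≤ 64
  bd {α} {β} {γ} {δ} {p} {p'} {a} {b} {c} {d} {a'} {b'} {c'} {d'} Q rs (x , mx , hx) (x' , mx' , hx') = det-bound C (y ∷ y' ∷ Q.y ∷ Q.y' ∷ x ∷ x' ∷ []) (cols α β γ δ p p' a b c d a' b' c' d') {w} refl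
    ((λ z → r1 (D C (e ∷ z)) (D C (t ∷ z)) (D C (s ∷ z)) (D C (u ∷ z)) (D C (β₀ ∷ z)) (D C (y ∷ z))) ,
     (λ z → trans (RelS.valS rs z) (r2 α β γ δ (D C (e ∷ z)) (D C (t ∷ z)) (D C (s ∷ z)) (D C (u ∷ z)) (D C (β₀ ∷ z)) (D C (y ∷ z)))) ,
     (λ z → trans (Q.hy z) (r3 p (D C (e ∷ z)) (D C (t ∷ z)) (D C (s ∷ z)) (D C (u ∷ z)) (D C (β₀ ∷ z)) (D C (y ∷ z)))) ,
     (λ z → trans (Q.hy' z) (r4 p' (D C (e ∷ z)) (D C (t ∷ z)) (D C (s ∷ z)) (D C (u ∷ z)) (D C (β₀ ∷ z)) (D C (y ∷ z)))) ,
     (λ z → trans (eqn hx z) (r5 a b c d (D C (e ∷ z)) (D C (t ∷ z)) (D C (s ∷ z)) (D C (u ∷ z)) (D C (β₀ ∷ z)) (D C (y ∷ z)))) ,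
     (λ z → trans (eqn hx' z) (r5 a' b' c' d' (D C (e ∷ z)) (D C (t ∷ z)) (D C (s ∷ z)) (D C (u ∷ z)) (D C (β₀ ∷ z)) (D C (y ∷ z)))) , tt)
    (EdgeL.y∈ E ∷ EdgeL.y'∈ E ∷ Q.y∈ ∷ Q.y'∈ ∷ mx ∷ mx' ∷ []) mw d2 where
   module Q = Ends Q
   r1 = ring-131
   r2 = ring-132
   r3 = ring-133
   r4 = ring-134
   r5 = ring-135
  row-s : SignRow C e t s u (+ 0) (+ 0) (+ 2) (+ 0)
  row-s = s , ms , mkC λ z → l (D C (e ∷ z)) (D C (t ∷ z)) (D C (s ∷ z)) (D C (u ∷ z)) where
   l = ring-136
  row-u : SignRow C e t s u (+ 0) (+ 0) (+ 0) (+ 2)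
  row-u = u , mu , mkC λ z → l (D C (e ∷ z)) (D C (t ∷ z)) (D C (s ∷ z)) (D C (u ∷ z)) where
   l = ring-137
  go : ∀ {a b c d} → TwoL (a ∷ b ∷ c ∷ d ∷ []) → Rel a b c d → ⊥
  -- In the old frame each difference again has exactly two coordinates ±1. A diagonal of the square
  -- and two points of the span are chosen such that the doubled determinant exceeds 64.
  go (hereT pm+ (hereA pm+ (refl ∷ refl ∷ []))) h = ≤⇒≤ᵇ (bd (ends- C B) (toS (+ 2) (+ 2) (+ 0) (+ 0) (+ 2) (+ 2) (+ 0) (+ 0) h refl refl refl refl) row-s row-u)
  go (hereT pm+ (hereA pm- (refl ∷ refl ∷ []))) h = ≤⇒≤ᵇ (bd (ends+ C B) (toS (+ 2) (- + 2) (+ 0) (+ 0) (+ 0) (+ 0) (+ 2) (+ 2) h refl refl refl refl) (sign o+ o- o+ o-) (sign o+ o- o- o+))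
  go (hereT pm- (hereA pm+ (refl ∷ refl ∷ []))) h = ≤⇒≤ᵇ (bd (ends+ C B) (toS (- + 2) (+ 2) (+ 0) (+ 0) (+ 0) (+ 0) (- + 2) (- + 2) h refl refl refl refl) (sign o+ o- o+ o-) (sign o+ o- o- o+))
  go (hereT pm- (hereA pm- (refl ∷ refl ∷ []))) h = ≤⇒≤ᵇ (bd (ends- C B) (toS (- + 2) (- + 2) (+ 0) (+ 0) (- + 2) (- + 2) (+ 0) (+ 0) h refl refl refl refl) row-s row-u)
  go (hereT pm+ (thereA (hereA pm+ (refl ∷ [])))) h = ≤⇒≤ᵇ (bd (ends+ C B) (toS (+ 2) (+ 0) (+ 2) (+ 0) (+ 2) (+ 0) (+ 2) (+ 0) h refl refl refl refl) row-u (sign o+ o- o- o+))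
  go (hereT pm+ (thereA (hereA pm- (refl ∷ [])))) h = ≤⇒≤ᵇ (bd (ends+ C B) (toS (+ 2) (+ 0) (- + 2) (+ 0) (+ 0) (+ 2) (+ 0) (+ 2) h refl refl refl refl) row-s (sign o+ o- o+ o+))
  go (hereT pm- (thereA (hereA pm+ (refl ∷ [])))) h = ≤⇒≤ᵇ (bd (ends+ C B) (toS (- + 2) (+ 0) (+ 2) (+ 0) (+ 0) (- + 2) (+ 0) (- + 2) h refl refl refl refl) row-s (sign o+ o- o+ o+))
  go (hereT pm- (thereA (hereA pm- (refl ∷ [])))) h = ≤⇒≤ᵇ (bd (ends+ C B) (toS (- + 2) (+ 0) (- + 2) (+ 0) (- + 2) (+ 0) (- + 2) (+ 0) h refl refl refl refl) row-u (sign o+ o- o- o+))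
  go (hereT pm+ (thereA (thereA (hereA pm+ [])))) h = ≤⇒≤ᵇ (bd (ends+ C B) (toS (+ 2) (+ 0) (+ 0) (+ 2) (+ 2) (+ 0) (+ 0) (+ 2) h refl refl refl refl) row-s (sign o+ o- o+ o-))
  go (hereT pm+ (thereA (thereA (hereA pm- [])))) h = ≤⇒≤ᵇ (bd (ends+ C B) (toS (+ 2) (+ 0) (+ 0) (- + 2) (+ 0) (+ 2) (+ 2) (+ 0) h refl refl refl refl) row-u (sign o+ o- o+ o+))
  go (hereT pm- (thereA (thereA (hereA pm+ [])))) h = ≤⇒≤ᵇ (bd (ends+ C B) (toS (- + 2) (+ 0) (+ 0) (+ 2) (+ 0) (- + 2) (- + 2) (+ 0) h refl refl refl refl) row-u (sign o+ o- o+ o+))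
  go (hereT pm- (thereA (thereA (hereA pm- [])))) h = ≤⇒≤ᵇ (bd (ends+ C B) (toS (- + 2) (+ 0) (+ 0) (- + 2) (- + 2) (+ 0) (+ 0) (- + 2) h refl refl refl refl) row-s (sign o+ o- o+ o-))
  go (thereT (hereT pm+ (hereA pm+ (refl ∷ [])))) h = ≤⇒≤ᵇ (bd (ends+ C B) (toS (+ 0) (+ 2) (+ 2) (+ 0) (+ 2) (+ 0) (+ 0) (- + 2) h refl refl refl refl) row-s (sign o+ o- o+ o+))
  go (thereT (hereT pm+ (hereA pm- (refl ∷ [])))) h = ≤⇒≤ᵇ (bd (ends+ C B) (toS (+ 0) (+ 2) (- + 2) (+ 0) (+ 0) (+ 2) (- + 2) (+ 0) h refl refl refl refl) row-u (sign o+ o- o- o+))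
  go (thereT (hereT pm- (hereA pm+ (refl ∷ [])))) h = ≤⇒≤ᵇ (bd (ends+ C B) (toS (+ 0) (- + 2) (+ 2) (+ 0) (+ 0) (- + 2) (+ 2) (+ 0) h refl refl refl refl) row-u (sign o+ o- o- o+))
  go (thereT (hereT pm- (hereA pm- (refl ∷ [])))) h = ≤⇒≤ᵇ (bd (ends+ C B) (toS (+ 0) (- + 2) (- + 2) (+ 0) (- + 2) (+ 0) (+ 0) (+ 2) h refl refl refl refl) row-s (sign o+ o- o+ o+))
  go (thereT (hereT pm+ (thereA (hereA pm+ [])))) h = ≤⇒≤ᵇ (bd (ends+ C B) (toS (+ 0) (+ 2) (+ 0) (+ 2) (+ 2) (+ 0) (- + 2) (+ 0) h refl refl refl refl) row-u (sign o+ o- o+ o+))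
  go (thereT (hereT pm+ (thereA (hereA pm- [])))) h = ≤⇒≤ᵇ (bd (ends+ C B) (toS (+ 0) (+ 2) (+ 0) (- + 2) (+ 0) (+ 2) (+ 0) (- + 2) h refl refl refl refl) row-s (sign o+ o- o+ o-))
  go (thereT (hereT pm- (thereA (hereA pm+ [])))) h = ≤⇒≤ᵇ (bd (ends+ C B) (toS (+ 0) (- + 2) (+ 0) (+ 2) (+ 0) (- + 2) (+ 0) (+ 2) h refl refl refl refl) row-s (sign o+ o- o+ o-))
  go (thereT (hereT pm- (thereA (hereA pm- [])))) h = ≤⇒≤ᵇ (bd (ends+ C B) (toS (+ 0) (- + 2) (+ 0) (- + 2) (- + 2) (+ 0) (+ 2) (+ 0) h refl refl refl refl) row-u (sign o+ o- o+ o+))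
  go (thereT (thereT (hereT pm+ (hereA pm+ [])))) h = ≤⇒≤ᵇ (bd (ends+ C B) (toS (+ 0) (+ 0) (+ 2) (+ 2) (+ 2) (- + 2) (+ 0) (+ 0) h refl refl refl refl) row-s row-u)
  go (thereT (thereT (hereT pm+ (hereA pm- [])))) h = ≤⇒≤ᵇ (bd (ends+ C B) (toS (+ 0) (+ 0) (+ 2) (- + 2) (+ 0) (+ 0) (+ 2) (- + 2) h refl refl refl refl) (sign o+ o- o+ o+) (sign o+ o- o- o-))
  go (thereT (thereT (hereT pm- (hereA pm+ [])))) h = ≤⇒≤ᵇ (bd (ends+ C B) (toS (+ 0) (+ 0) (- + 2) (+ 2) (+ 0) (+ 0) (- + 2) (+ 2) h refl refl refl refl) (sign o+ o- o+ o+) (sign o+ o- o- o-))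
  go (thereT (thereT (hereT pm- (hereA pm- [])))) h = ≤⇒≤ᵇ (bd (ends+ C B) (toS (+ 0) (+ 0) (- + 2) (- + 2) (- + 2) (+ 2) (+ 0) (+ 0) h refl refl refl refl) row-s row-u)
  go (thereT (thereT (thereT (hereT _ ())))) _
  go (thereT (thereT (thereT (thereT ())))) _
  start : ∀ as → length as ≡ 4 → TwoL as → (∀ z → + 2 * D C (y' ∷ z) ≡ + 2 * D C (y ∷ z) + dot as (map (λ v → D C (v ∷ z)) (h₁ ∷ h₂ ∷ h₃ ∷ h₄ ∷ []))) → ⊥
  start (_ ∷ _ ∷ _ ∷ _ ∷ []) _ t r = go t r

 comb-swap₂ : ∀ {r} (C : Config r) {e p q l x a b c ds} → Comb C (e ∷ p ∷ q ∷ l) x (a ∷ b ∷ c ∷ ds) → Comb C (e ∷ q ∷ p ∷ l) x (a ∷ c ∷ b ∷ ds)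
 comb-swap₂ C {e} {p} {q} {l} {x} {a} {b} {c} {ds} h = mkC λ z → trans (eqn h z) (r (a * D C (e ∷ z)) (b * D C (p ∷ z)) (c * D C (q ∷ z)) (dot ds (map (λ s → D C (s ∷ z)) l))) where
  r = ring-138

 comb-swap₃ : ∀ {r} (C : Config r) {e o p q l x a a' b c ds} → Comb C (e ∷ o ∷ p ∷ q ∷ l) x (a ∷ a' ∷ b ∷ c ∷ ds) → Comb C (e ∷ o ∷ q ∷ p ∷ l) x (a ∷ a' ∷ c ∷ b ∷ ds)
 comb-swap₃ C {e} {o} {p} {q} {l} {x} {a} {a'} {b} {c} {ds} h = mkC λ z → trans (eqn h z) (r (a * D C (e ∷ z)) (a' * D C (o ∷ z)) (b * D C (p ∷ z)) (c * D C (q ∷ z)) (dot ds (map (λ s → D C (s ∷ z)) l))) where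
  r = ring-139

 minor₄ : ∀ {n} (C : Config (suc (suc n))) {e t s u x ρ a b c d a' b' c' d' w} (me : e ∈ A) (mu : u ∈ A) → Comb C (e ∷ t ∷ s ∷ u ∷ []) x (a ∷ b ∷ c ∷ d ∷ []) →
      Comb C (e ∷ t ∷ s ∷ u ∷ []) ρ (a' ∷ b' ∷ c' ∷ d' ∷ []) → ¬ Ind2 (C ⟋ me) x ρ → Ms w → 0≢ (D C (e ∷ t ∷ s ∷ u ∷ w)) → b * c' ≡ c * b'
 minor₄ C {e} {t} {s} {u} {x} {ρ} {a} {b} {c} {d} {a'} {b'} {c'} {d'} {w} me mu hx hρ dep mw ne =
   minor H {t} {s} {x} {ρ} {b} {c} {b'} {c'} (drop hx) (drop hρ) mw (λ i → dep (Ind2-con (C ⟋ me) mu i)) (perm-≢ C (↭-prep e (PermP.shift u (t ∷ s ∷ []) w)) ne) where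
  H = C ⟋ me ⟋ mu
  drop : ∀ {y a b c d} → Comb C (e ∷ t ∷ s ∷ u ∷ []) y (a ∷ b ∷ c ∷ d ∷ []) → ∀ z → + 2 * D H (y ∷ z) ≡ b * D H (t ∷ z) + c * D H (s ∷ z)
  drop {y} {a} {b} {c} {d} h z = trans (eqn (comb-con (C ⟋ me) mu (comb-con C me h)) z)
    (trans (cong₂ (λ p q → a * p + (b * D H (t ∷ z) + (c * D H (s ∷ z) + (d * q + + 0)))) (D-mem C (there (here refl))) (D-twice (C ⟋ me) u z)) (l a (b * D H (t ∷ z)) (c * D H (s ∷ z)) d)) where
   l = ring-140

 square-con : ∀ {n} (C : Config (suc n)) {a e s} (ma : a ∈ A) → Square C e s → Square (C ⟋ ma) e s
 square-con C ma B = record { b∈ = Square.b∈ B ; bₑ∈ = Square.bₑ∈ B ; bₛ∈ = Square.bₛ∈ B ; bₑₛ∈ = Square.bₑₛ∈ B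
  ; v₁ = vary-con C ma (Square.v₁ B) ; v₂ = vary-con C ma (Square.v₂ B) ; v₃ = vary-con C ma (Square.v₃ B) }

 -- What is left if contracting `e` exceeds the budget: all half sign vectors, a square, a pair in a
 -- class independent of it, and a pair in every class that varies along `e`.
 record QuadCritical {N} (C : Config (suc (suc (suc (suc N))))) {e t s u} (me : e ∈ A) (mt : t ∈ A) (ms : s ∈ A) (mu : u ∈ A) : Set where
  field
   sign  : ∀ {a b c d} → PM1 a → PM1 b → PM1 c → PM1 d → SignRow C e t s u a b c d
   {s'}  : V
   s'∈   : s' ∈ t ∷ s ∷ u ∷ []
   B     : Square C e s'
   other : ∃₂ λ κ κ⁺ → κ ∈ A × κ⁺ ∈ A × Vary C e κ κ⁺ (+ 2) × Ind2 (C ⟋ mt ⟋ ms ⟋ mu ⟋ me) (Square.b B) κ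
   pairs : ∀ {κ} → κ ∈ A → Nz (C ⟋ mt ⟋ ms ⟋ mu ⟋ me) κ → Varies (C ⟋ mt ⟋ ms ⟋ mu) e κ →
       ∃₂ λ P P⁺ → P ∈ A × P⁺ ∈ A × Vary C e P P⁺ (+ 2) × (∀ z → D C (t ∷ s ∷ u ∷ e ∷ P ∷ z) ≡ D C (t ∷ s ∷ u ∷ e ∷ κ ∷ z))

 -- Inner points and squares of a heavy quadruple

 module K4 {N} (C : Config (suc (suc (suc (suc N))))) {e t s u} (me : e ∈ A) (mt : t ∈ A) (ms : s ∈ A) (mu : u ∈ A)
  (hv : Heavy C (e ∷ t ∷ s ∷ u ∷ [])) (nh : NoHeavy C 3) where

  open Gen C (C ⟋ mt ⟋ ms ⟋ mu) me t (s ∷ u ∷ []) (mt ∷ ms ∷ mu ∷ []) (λ _ → refl) hv nh public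

  S₄ : List V
  S₄ = e ∷ t ∷ s ∷ u ∷ []

  form : ℤ → ℤ × ℤ → List V → ℤ
  form σ (q , r) z = σ * D C (e ∷ z) + (D C (t ∷ z) + (q * D C (s ∷ z) + r * D C (u ∷ z)))

  Sg : V → ℤ × ℤ → Set
  Sg x k = ∃ λ a → ∃ λ b → ∃₂ λ c d → PM1 a × PM1 b × PM1 c × PM1 d × Comb C S₄ x (a ∷ b ∷ c ∷ d ∷ []) × (b * c , b * d) ≡ k

  sg-scaled : ∀ {x k} → Sg x k → ∃ λ σ → PM1 σ × Scaled C (form σ k) x
  sg-scaled {x} (a , b , c , d , pa , pb , pc , pd , h , refl) = a * b , PM1-* pa pb , b , pb , λ z → trans (eqn h z)
    (sym (trans (l (D C (e ∷ z)) (D C (t ∷ z)) (D C (s ∷ z)) (D C (u ∷ z)) a b c d)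
    (trans (cong (λ v → v * (a * D C (e ∷ z)) + (b * D C (t ∷ z) + (v * (c * D C (s ∷ z)) + v * (d * D C (u ∷ z))))) (PM1-sq pb)) (l2 (a * D C (e ∷ z)) (b * D C (t ∷ z)) (c * D C (s ∷ z)) (d * D C (u ∷ z)))))) where
   l = ring-141
   l2 = ring-142

  both-signs : ∀ {x ρ} → Coords C S₄ x → Coords C S₄ ρ → Nz (C ⟋ me) x → Nz (C ⟋ me) ρ → ¬ Ind2 (C ⟋ me) x ρ → Ind2 C ρ x → ∃ λ k → k ∈ univ₄ × Sg x k × Sg ρ k
  both-signs {x} {ρ} (coords (a ∷ b ∷ c ∷ d ∷ []) _ hx kx) (coords (a' ∷ b' ∷ c' ∷ d' ∷ []) _ hρ kρ) nx nρ dep ind = go kx kρ where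
   w = fst (snd hv)
   mw = fst (snd (snd hv))
   dw = snd (snd (snd hv))
   m-ts : b * c' ≡ c * b'
   m-ts = minor₄ C me mu hx hρ dep mw dw
   m-tu : b * d' ≡ d * b'
   m-tu = minor₄ C me ms (comb-swap₃ C hx) (comb-swap₃ C hρ) dep mw (perm-≢ C (↭-prep e (↭-prep t (↭-swap s u ↭-refl))) dw)
   m-su : c * d' ≡ d * c'
   m-su = minor₄ C me mt (comb-swap₃ C (comb-swap₂ C hx)) (comb-swap₃ C (comb-swap₂ C hρ)) dep mw (perm-≢ C (↭-prep e (↭-trans (↭-swap t s ↭-refl) (↭-prep s (↭-swap t u ↭-refl)))) dw)
   zero-e : ∀ {y a} → Comb C S₄ y (a ∷ + 0 ∷ + 0 ∷ + 0 ∷ []) → ¬ Nz (C ⟋ me) y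
   zero-e {y} {a} h (z , _ , d) = d (cancel-≡ {+ 2} _ (+ 0) (λ ()) (trans (eqn (comb-con C me h) z) (trans (cong (λ v → a * v + (+ 0 * D C (e ∷ t ∷ z) + (+ 0 * D C (e ∷ s ∷ z) + (+ 0 * D C (e ∷ u ∷ z) + + 0)))) (D-twice C e z))
     (l a (D C (e ∷ t ∷ z)) (D C (e ∷ s ∷ z)) (D C (e ∷ u ∷ z)))))) where
    l = ring-143
   par-axis : ∀ {v α α'} → PM2 α → PM2 α' → (∀ z → + 2 * D C (x ∷ z) ≡ α * D C (v ∷ z)) → (∀ z → + 2 * D C (ρ ∷ z) ≡ α' * D C (v ∷ z)) → ⊥
   par-axis {v} p p' h h' = Pm-dep C {ρ} {x} (Pm-trans C {ρ} {v} {x} (Pm-sym C {v} {ρ} (mult-pm C p' h')) (mult-pm C p h)) ind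
   at-t : ∀ {y b} → Comb C S₄ y (+ 0 ∷ b ∷ + 0 ∷ + 0 ∷ []) → ∀ z → + 2 * D C (y ∷ z) ≡ b * D C (t ∷ z)
   at-t {y} {b} h z = trans (eqn h z) (l (D C (e ∷ z)) (b * D C (t ∷ z)) (D C (s ∷ z)) (D C (u ∷ z))) where
    l = ring-144
   at-s : ∀ {y b} → Comb C S₄ y (+ 0 ∷ + 0 ∷ b ∷ + 0 ∷ []) → ∀ z → + 2 * D C (y ∷ z) ≡ b * D C (s ∷ z)
   at-s {y} {b} h z = trans (eqn h z) (l (D C (e ∷ z)) (D C (t ∷ z)) (b * D C (s ∷ z)) (D C (u ∷ z))) where
    l = ring-145
   at-u : ∀ {y b} → Comb C S₄ y (+ 0 ∷ + 0 ∷ + 0 ∷ b ∷ []) → ∀ z → + 2 * D C (y ∷ z) ≡ b * D C (u ∷ z)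
   at-u {y} {b} h z = trans (eqn h z) (l (D C (e ∷ z)) (D C (t ∷ z)) (D C (s ∷ z)) (b * D C (u ∷ z))) where
    l = ring-146
   go : All PM1 (a ∷ b ∷ c ∷ d ∷ []) ⊎ Axis (a ∷ b ∷ c ∷ d ∷ []) → All PM1 (a' ∷ b' ∷ c' ∷ d' ∷ []) ⊎ Axis (a' ∷ b' ∷ c' ∷ d' ∷ []) → ∃ λ k → k ∈ univ₄ × Sg x k × Sg ρ k
   go (inl (pa ∷ pb ∷ pc ∷ pd ∷ [])) (inl (pa' ∷ pb' ∷ pc' ∷ pd' ∷ [])) = (b * c , b * d) , univ₄-∈ (PM1-* pb pc) (PM1-* pb pd) , (a , b , c , d , pa , pb , pc , pd , hx , refl) ,
    (a' , b' , c' , d' , pa' , pb' , pc' , pd' , hρ , cong₂ _,_ (sym (PM1-ratio pb pc pb' pc' m-ts)) (sym (PM1-ratio pb pd pb' pd' m-tu)))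
   go (inr (hereA _ (refl ∷ refl ∷ refl ∷ []))) _ = ⊥-elim (zero-e hx nx)
   go _ (inr (hereA _ (refl ∷ refl ∷ refl ∷ []))) = ⊥-elim (zero-e hρ nρ)
   go (inl (_ ∷ pb ∷ pc ∷ pd ∷ [])) (inr (thereA (hereA q (refl ∷ refl ∷ [])))) = ⊥-elim (*≢0 (PM1-≢ pc) (PM2-≢ q) (trans (sym m-ts) (*-zeroʳ b)))
   go (inr (thereA (hereA q (refl ∷ refl ∷ [])))) (inl (_ ∷ pb' ∷ pc' ∷ pd' ∷ [])) = ⊥-elim (*≢0 (PM2-≢ q) (PM1-≢ pc') m-ts)
   go (inr (thereA (hereA q (refl ∷ refl ∷ [])))) (inr (thereA (hereA q' (refl ∷ refl ∷ [])))) = ⊥-elim (par-axis q q' (at-t hx) (at-t hρ))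
   go (inr (thereA (hereA q (refl ∷ refl ∷ [])))) (inr (thereA (thereA (hereA q' (refl ∷ []))))) = ⊥-elim (*≢0 (PM2-≢ q) (PM2-≢ q') m-ts)
   go (inr (thereA (hereA q (refl ∷ refl ∷ [])))) (inr (thereA (thereA (thereA (hereA q' []))))) = ⊥-elim (*≢0 (PM2-≢ q) (PM2-≢ q') m-tu)
   go (inl (_ ∷ pb ∷ pc ∷ pd ∷ [])) (inr (thereA (thereA (hereA q (refl ∷ []))))) = ⊥-elim (*≢0 (PM1-≢ pb) (PM2-≢ q) (trans m-ts (*-zeroʳ c)))
   go (inr (thereA (thereA (hereA q (refl ∷ []))))) (inl (_ ∷ pb' ∷ pc' ∷ pd' ∷ [])) = ⊥-elim (*≢0 (PM2-≢ q) (PM1-≢ pb') (sym m-ts))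
   go (inr (thereA (thereA (hereA q (refl ∷ []))))) (inr (thereA (hereA q' (refl ∷ refl ∷ [])))) = ⊥-elim (*≢0 (PM2-≢ q) (PM2-≢ q') (sym m-ts))
   go (inr (thereA (thereA (hereA q (refl ∷ []))))) (inr (thereA (thereA (hereA q' (refl ∷ []))))) = ⊥-elim (par-axis q q' (at-s hx) (at-s hρ))
   go (inr (thereA (thereA (hereA q (refl ∷ []))))) (inr (thereA (thereA (thereA (hereA q' []))))) = ⊥-elim (*≢0 (PM2-≢ q) (PM2-≢ q') m-su)
   go (inl (_ ∷ pb ∷ pc ∷ pd ∷ [])) (inr (thereA (thereA (thereA (hereA q []))))) = ⊥-elim (*≢0 (PM1-≢ pb) (PM2-≢ q) (trans m-tu (*-zeroʳ d)))
   go (inr (thereA (thereA (thereA (hereA q []))))) (inl (_ ∷ pb' ∷ pc' ∷ pd' ∷ [])) = ⊥-elim (*≢0 (PM2-≢ q) (PM1-≢ pb') (sym m-tu))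
   go (inr (thereA (thereA (thereA (hereA q []))))) (inr (thereA (hereA q' (refl ∷ refl ∷ [])))) = ⊥-elim (*≢0 (PM2-≢ q) (PM2-≢ q') (sym m-tu))
   go (inr (thereA (thereA (thereA (hereA q []))))) (inr (thereA (thereA (hereA q' (refl ∷ []))))) = ⊥-elim (*≢0 (PM2-≢ q) (PM2-≢ q') (sym m-su))
   go (inr (thereA (thereA (thereA (hereA q []))))) (inr (thereA (thereA (thereA (hereA q' []))))) = ⊥-elim (par-axis q q' (at-u hx) (at-u hρ))

  abstract
   pair-signs : ∀ {xs} {S : Split C me xs} (o : Outer S) {p} → p ∈ Outer.ins o → ∃ λ k → k ∈ univ₄ × Sg (fst p) k × Sg (snd p) k
   pair-signs o {x , ρ} m = both-signs (inner-coords C ix) (inner-coords C iρ) nx nρ dep (ind m)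
    where open InnerPair (inner-pair o m)

  ins≤ : ∀ {xs} {S : Split C me xs} (o : Outer S) univ → (∀ {p} (m : p ∈ Outer.ins o) → fst (pair-signs o m) ∈ univ) → length (Outer.ins o) ≤ length univ
  ins≤ o univ h = lines-coded C univ form (Outer.ins o) (Outer.insAP o) (λ mp mq → InnerPair.ind (inner-pair o mp) mq)
   λ m → fst (pair-signs o m) , h m , sg-scaled (fst (snd (snd (pair-signs o m)))) , sg-scaled (snd (snd (snd (pair-signs o m))))

  ins≤4 : ∀ {xs} {S : Split C me xs} (o : Outer S) → length (Outer.ins o) ≤ 4
  ins≤4 o = ins≤ o univ₄ (λ m → fst (snd (pair-signs o m)))

  -- If a code were missing, the other three would bound the number of inner pairs by 3.
  present : ∀ {xs} {S : Split C me xs} (o : Outer S) → 4 ≤ length (Outer.ins o) → ∀ {k} → k ∈ univ₄ → ∃ λ p → p ∈ Outer.ins o × Sg (fst p) k × Sg (snd p) k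
  present {xs} {S} o le {k} mk = start (∈-split mk) where
   P : V × V → Set
   P p = p ∈ Outer.ins o × Sg (fst p) k × Sg (snd p) k
   start : (∃₂ λ l r → univ₄ ≡ l ++ k ∷ r) → ∃ λ p → P p
   start (l , r , eq) = fin (∃⊎∀ (Outer.ins o) {λ m → fst (pair-signs o m) ∈ l ++ r} one) where
    one : ∀ {p} (m : p ∈ Outer.ins o) → (∃ λ p → P p) ⊎ fst (pair-signs o m) ∈ l ++ r
    one {p} m = go (∈-≡ l (subst (fst (pair-signs o m) ∈_) eq (fst (snd (pair-signs o m))))) where
     go : fst (pair-signs o m) ≡ k ⊎ fst (pair-signs o m) ∈ l ++ r → (∃ λ p → P p) ⊎ fst (pair-signs o m) ∈ l ++ r
     go (inr h) = inr h
     go (inl e) = inl (p , m , subst (Sg (fst p)) e (fst (snd (snd (pair-signs o m)))) , subst (Sg (snd p)) e (snd (snd (snd (pair-signs o m)))))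
    fin : (∃ λ p → P p) ⊎ (∀ {p} (m : p ∈ Outer.ins o) → fst (pair-signs o m) ∈ l ++ r) → ∃ λ p → P p
    fin (inl h) = h
    fin (inr h) = ⊥-elim (<-irrefl refl (≤-trans (s≤s (ins≤ o (l ++ r) h)) (≤-trans (≤-reflexive (trans (sym (↭-length (PermP.shift k l r))) (sym (cong length eq)))) le)))

  record Arrangement (x s₁ s₂ : V) : Set where
   field
    {s₃} : V
    m₃   : s₃ ∈ A
    perm : t ∷ s ∷ u ∷ [] ↭ s₁ ∷ s₂ ∷ s₃ ∷ []
    {a b c d} : ℤ
    pa   : PM1 a
    pb   : PM1 b
    pc   : PM1 c
    pd   : PM1 d
    comb : Comb C (e ∷ s₁ ∷ s₂ ∷ s₃ ∷ []) x (a ∷ b ∷ c ∷ d ∷ [])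

  arrange : ∀ {x k s₁ s₂} → Sg x k → s₁ ∈ t ∷ s ∷ u ∷ [] → s₂ ∈ t ∷ s ∷ u ∷ [] → s₁ ≢ s₂ → Arrangement x s₁ s₂
  arrange (a , b , c , d , pa , pb , pc , pd , h , _) = go where
   go : ∀ {s₁ s₂} → s₁ ∈ t ∷ s ∷ u ∷ [] → s₂ ∈ t ∷ s ∷ u ∷ [] → s₁ ≢ s₂ → Arrangement _ s₁ s₂
   go (here refl) (here refl) ne = ⊥-elim (ne refl)
   go (there (here refl)) (there (here refl)) ne = ⊥-elim (ne refl)
   go (there (there (here refl))) (there (there (here refl))) ne = ⊥-elim (ne refl)
   go (here refl) (there (here refl)) _ = record { m₃ = mu ; perm = ↭-refl ; pa = pa ; pb = pb ; pc = pc ; pd = pd ; comb = h }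
   go (here refl) (there (there (here refl))) _ = record { m₃ = ms ; perm = ↭-prep t (↭-swap s u ↭-refl) ; pa = pa ; pb = pb ; pc = pd ; pd = pc ; comb = comb-swap₃ C h }
   go (there (here refl)) (here refl) _ = record { m₃ = mu ; perm = ↭-swap t s ↭-refl ; pa = pa ; pb = pc ; pc = pb ; pd = pd ; comb = comb-swap₂ C h }
   go (there (here refl)) (there (there (here refl))) _ = record { m₃ = mt ; perm = ↭-trans (↭-swap t s ↭-refl) (↭-prep s (↭-swap t u ↭-refl)) ; pa = pa ; pb = pc ; pc = pd ; pd = pb ; comb = comb-swap₃ C (comb-swap₂ C h) }
   go (there (there (here refl))) (here refl) _ = record { m₃ = ms ; perm = ↭-trans (↭-prep t (↭-swap s u ↭-refl)) (↭-swap t u ↭-refl) ; pa = pa ; pb = pd ; pc = pb ; pd = pc ; comb = comb-swap₂ C (comb-swap₃ C h) }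
   go (there (there (here refl))) (there (here refl)) _ = record { m₃ = mt ; perm = ↭-trans (↭-trans (↭-swap t s ↭-refl) (↭-prep s (↭-swap t u ↭-refl))) (↭-swap s u ↭-refl) ; pa = pa ; pb = pd ; pc = pc ; pd = pb ; comb = comb-swap₂ C (comb-swap₃ C (comb-swap₂ C h)) }

  -- Contracting the direction that neither square uses leads to the determinant of `squares-sign`.
  two-squares-sign : ∀ {vs x k} (a b : RS vs) → Apart a b → x ∈ A → Sg x k → ⊥
  two-squares-sign {x = x} a b (ne , (w , mw , d)) mx sg = squares-sign H (square-con C m₃ B) (square-con C m₃ B') {x} mx pa pb pc comb' mw
    (trans (perm-abs C pm) (even-abs {C = F} evF (Square.b∈ B ∷ Square.b∈ B' ∷ mw) d)) where
   B = RS.B a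
   B' = RS.B b
   ar = arrange sg (RS.s∈ a) (RS.s∈ b) ne
   open Arrangement ar using (s₃; m₃; perm; pa; pb; pc; comb)
   H = C ⟋ m₃
   comb' : Comb H (e ∷ RS.s a ∷ RS.s b ∷ []) x (Arrangement.a ar ∷ Arrangement.b ar ∷ Arrangement.c ar ∷ [])
   comb' = mkC λ z → trans (eqn (comb-con C m₃ comb) z) (trans (cong (λ v → Arrangement.a ar * D H (e ∷ z) + (Arrangement.b ar * D H (RS.s a ∷ z) + (Arrangement.c ar * D H (RS.s b ∷ z) + (Arrangement.d ar * v + + 0)))) (D-twice C s₃ z))
     (l (Arrangement.a ar * D H (e ∷ z)) (Arrangement.b ar * D H (RS.s a ∷ z)) (Arrangement.c ar * D H (RS.s b ∷ z)) (Arrangement.d ar))) where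
    l = ring-147
   rest = Square.b B ∷ Square.b B' ∷ w
   pm : s₃ ∷ e ∷ RS.s a ∷ RS.s b ∷ rest ↭ t ∷ s ∷ u ∷ e ∷ rest
   pm = ↭-trans (↭-trans (↭-swap s₃ e ↭-refl) (↭-trans (↭-prep e (↭-sym (PermP.shift s₃ (RS.s a ∷ RS.s b ∷ []) rest))) (↭-sym (PermP.shift e (RS.s a ∷ RS.s b ∷ s₃ ∷ []) rest)))) (++⁺ʳ (e ∷ rest) (↭-sym perm))

  -- N pairs, one repetition and four inner points make N + 5 surplus points, one more than the
  -- budget.
  record Critical (xs : List V) : Set where
   field
    S    : Split C me xs
    o    : Outer S
    full : N ≤ length (Outer.vs o)
    sq   : RS (Outer.vs o)
    ins4 : 4 ≤ length (Outer.ins o)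

  bound-or-critical : 2 ≤ N → ∀ {xs} → Simple C xs → length xs ≤ f1 (suc (suc (suc N))) ⊎ Critical xs
  bound-or-critical N≥2 {xs} sx = start (split C me (t ∷ s ∷ u ∷ w , mt ∷ ms ∷ mu ∷ mw , dw) sx) where
   w = fst (snd hv)
   mw = fst (snd (snd hv))
   dw = snd (snd (snd hv))
   Goal = length xs ≤ f1 (suc (suc (suc N))) ⊎ Critical xs
   start : Split C me xs → Goal
   start S = step2 (outer S) where
    step2 : Outer S → Goal
    step2 o = step3 (squares o) where
     finish : ∀ {v m i} → length (Outer.vs o) ≤ v → length (Outer.rs o) ≤ m → length (Outer.ins o) ≤ i → v ℕ.+ m ℕ.+ i ≤ 4 ℕ.+ N → Goal
     finish hv' hm hi h = inl (fit (suc (suc N)) (split-length S) (thm3 N N≥2 (C ⟋ me) mt ms mu hv (Split.simp' S))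
      (≤-trans (≤-reflexive (Outer.total o)) (≤-trans (+-mono-≤ (+-mono-≤ hv' hm) hi) h)))
     vs≤ = vs≤N (Outer.vs o) (Outer.vsAP o)
     to : ∀ v m i {b} → m ℕ.+ i ≤ b → v ℕ.+ m ℕ.+ i ≤ b ℕ.+ v
     to v m i {b} h = ≤-trans (≤-reflexive (+-assoc v m i)) (≤-trans (+-monoʳ-≤ v h) (≤-reflexive (ℕP.+-comm v b)))
     step3 : SquareList o → Goal
     step3 q = go (Outer.ins o) refl (SquareList.sqs q) (SquareList.len q) (SquareList.apt q) (SquareList.le q) where
      go : ∀ is → is ≡ Outer.ins o → ∀ (sqs : List (RS (Outer.vs o))) → length sqs ≡ length (Outer.rs o) → AllPairs Apart sqs → length sqs ≤ 3 → Goal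
      go [] eq sqs len _ le = finish vs≤ (subst (_≤ 3) len le) (≤-reflexive (sym (cong length eq))) (to N 3 0 (s≤s (s≤s (s≤s z≤n))))
      go (_ ∷ _) _ [] len _ _ = finish vs≤ (subst (_≤ 0) len z≤n) (ins≤4 o) (to N 0 4 ≤-refl)
      go (p ∷ _) eq (a ∷ b ∷ _) _ ((ab ∷ _) ∷ _) _ = ⊥-elim (two-squares-sign a b ab (InnerPair.x∈ (inner-pair o mp)) (fst (snd (snd (pair-signs o mp))))) where
       mp : p ∈ Outer.ins o
       mp = subst (p ∈_) eq (here refl)
      go (_ ∷ _) _ (a ∷ []) len _ _ = dec (N ℕ.≤? length (Outer.vs o)) (4 ℕ.≤? length (Outer.ins o)) where
       rs≤ : length (Outer.rs o) ≤ 1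
       rs≤ = ≤-reflexive (sym len)
       dec : Dec (N ≤ length (Outer.vs o)) → Dec (4 ≤ length (Outer.ins o)) → Goal
       dec (yes h) (yes g) = inr (record { S = S ; o = o ; full = h ; sq = a ; ins4 = g })
       dec (no h) _ = finish ≤-refl rs≤ (ins≤4 o) (≤-trans (to (length (Outer.vs o)) 1 4 ≤-refl) (+-monoʳ-≤ 4 (≰⇒> h)))
       dec (yes _) (no g) = finish vs≤ rs≤ (ℕ.s≤s⁻¹ (≰⇒> g)) (to N 1 3 ≤-refl)

  -- Each of the four codes is occupied by a pair, whose two vectors realise both values of σ; a
  -- negation adjusts the common sign.
  sign-row : ∀ {xs} {S : Split C me xs} (o : Outer S) → 4 ≤ length (Outer.ins o) → ∀ {a b c d} → PM1 a → PM1 b → PM1 c → PM1 d → SignRow C e t s u a b c d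
  sign-row o le {a} {b} {c} {d} pa pb pc pd = fin (present o le (univ₄-∈ (PM1-* pb pc) (PM1-* pb pd))) where
   k = (b * c , b * d)
   use : ∀ {h} → h ∈ A → Scaled C (form (a * b) k) h → SignRow C e t s u a b c d
   use {h} mh (σ , pσ , hs) = go pσ pb hs refl where
    f = form (a * b) k
    unf : ∀ z → b * f z ≡ a * D C (e ∷ z) + (b * D C (t ∷ z) + (c * D C (s ∷ z) + (d * D C (u ∷ z) + + 0)))
    unf z = trans (l (D C (e ∷ z)) (D C (t ∷ z)) (D C (s ∷ z)) (D C (u ∷ z)) a b c d)
      (trans (cong (λ v → v * (a * D C (e ∷ z)) + (b * D C (t ∷ z) + (v * (c * D C (s ∷ z)) + v * (d * D C (u ∷ z))))) (PM1-sq pb)) (l2 (a * D C (e ∷ z)) (b * D C (t ∷ z)) (c * D C (s ∷ z)) (d * D C (u ∷ z)))) where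
     l = ring-141
     l2 = ring-142
    same : ∀ {b'} → b' ≡ b → (∀ z → + 2 * D C (h ∷ z) ≡ b' * f z) → SignRow C e t s u a b c d
    same refl g = h , mh , mkC λ z → trans (g z) (unf z)
    opp : ∀ {b'} → - b' ≡ b → (∀ z → + 2 * D C (h ∷ z) ≡ b' * f z) → SignRow C e t s u a b c d
    opp {b'} eq g = neg h , neg∈ mh , mkC λ z → trans (cong (+ 2 *_) (D-neg C h z)) (trans (q (D C (h ∷ z)) b' (f z) (g z)) (trans (cong (_* f z) eq) (unf z))) where
     q : ∀ x b f → + 2 * x ≡ b * f → + 2 * - x ≡ - b * f
     q x b f h = trans (q1 x) (trans (cong -_ h) (q2 b f)) where
      q1 = ring-148
      q2 = ring-149
    go : ∀ {σ b'} → PM1 σ → PM1 b' → (∀ z → + 2 * D C (h ∷ z) ≡ σ * f z) → b' ≡ b → SignRow C e t s u a b c d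
    go o+ o+ g eq = same eq g
    go o- o- g eq = same eq g
    go o+ o- g eq = opp eq g
    go o- o+ g eq = opp eq g
   fin : (∃ λ p → p ∈ Outer.ins o × Sg (fst p) k × Sg (snd p) k) → SignRow C e t s u a b c d
   fin ((x , ρ) , m , sx , sρ) = go (sg-scaled sx) (sg-scaled sρ) where
    I = inner-pair o m
    go : (∃ λ σ → PM1 σ × Scaled C (form σ k) x) → (∃ λ σ → PM1 σ × Scaled C (form σ k) ρ) → SignRow C e t s u a b c d
    go (σ , pσ , hx) (τ , pτ , hρ) = pick (PM1-pigeon (PM1-* pa pb) pσ pτ) where
     pick : a * b ≡ σ ⊎ a * b ≡ τ ⊎ σ ≡ τ → SignRow C e t s u a b c d
     pick (inl refl) = use (InnerPair.x∈ I) hx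
     pick (inr (inl refl)) = use (InnerPair.ρ∈ I) hρ
     pick (inr (inr refl)) = ⊥-elim (Pm-dep C {ρ} {x} (scaled-pm C hρ hx) (InnerPair.ind I m))

  -- Of two different pairs in `vs`, at least one lies outside the class of the square.
  second-class : 2 ≤ N → ∀ {vs} → AllPairs Ind2F vs → N ≤ length vs → (a : RS vs) →
          ∃₂ λ κ κ⁺ → κ ∈ A × κ⁺ ∈ A × Vary C e κ κ⁺ (+ 2) × Ind2 F (Square.b (RS.B a)) κ
  second-class N≥2 {vs} apv full a = go vs apv (≤-trans N≥2 full) (λ m → m) where
   p = RS.p a
   use : ∀ v → Ind2F p v → ∃₂ λ κ κ⁺ → κ ∈ A × κ⁺ ∈ A × Vary C e κ κ⁺ (+ 2) × Ind2 F (Square.b (RS.B a)) κ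
   use v (z , mz , d) = EP.κ v , EP.κ⁺ v , EP.κ∈ v , EP.κ⁺∈ v , EP.ep v , z , mz ,
    λ e0 → d (trans (sym (F-2 (λ z → trans (snd (RS.sqr a) z) (EPair.same (EP.pair p) z)) (EPair.same (EP.pair v)) z)) e0)
   go : ∀ ws → AllPairs Ind2F ws → 2 ≤ length ws → (∀ {v} → v ∈ ws → v ∈ vs) → ∃₂ λ κ κ⁺ → κ ∈ A × κ⁺ ∈ A × Vary C e κ κ⁺ (+ 2) × Ind2 F (Square.b (RS.B a)) κ
   go (v ∷ v' ∷ _) ((i ∷ _) ∷ _) _ sub = pick (AP-lookup (Ind2-sym F) apv (RS.p∈ a) (sub (here refl))) where
    pick : p ≡ v ⊎ Ind2F p v → ∃₂ λ κ κ⁺ → κ ∈ A × κ⁺ ∈ A × Vary C e κ κ⁺ (+ 2) × Ind2 F (Square.b (RS.B a)) κ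
    pick (inl eq) = use v' (subst (λ q → Ind2F q v') (sym eq) i)
    pick (inr j) = use v j
   go (_ ∷ []) _ (s≤s ()) _

  frame : 2 ≤ N → ∀ {xs} → Simple C xs → length xs ≤ f1 (suc (suc (suc N))) ⊎ QuadCritical C me mt ms mu
  frame N≥2 {xs} sx = go (bound-or-critical N≥2 sx) where
   go : length xs ≤ f1 (suc (suc (suc N))) ⊎ Critical xs → length xs ≤ f1 (suc (suc (suc N))) ⊎ QuadCritical C me mt ms mu
   go (inl h) = inl h
   go (inr k) = inr (record { sign = sign-row k.o k.ins4 ; s'∈ = RS.s∈ k.sq ; B = RS.B k.sq
     ; other = second-class N≥2 (Outer.vsAP k.o) k.full k.sq
     ; pairs = pair-in-class (Outer.vs k.o) (Outer.vsAP k.o) k.full })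
    where module k = Critical k

 -- Everything that the exceptional case of a heavy quadruple provides: a square at b, all sign vectors, and an e-pair κ , κ⁺ in a class independent of b.
 record Exceptional {r} (C : Config r) (e t s u : V) : Set where
  field
   B    : Square C e t
   sign : ∀ {a b c d} → PM1 a → PM1 b → PM1 c → PM1 d → SignRow C e t s u a b c d
   {κ κ⁺} : V
   κ∈   : κ ∈ A
   κ⁺∈  : κ⁺ ∈ A
   vκ   : Vary C e κ κ⁺ (+ 2)
   {w}  : List V
   mw   : Ms w
   d2   : ∣ D C (e ∷ t ∷ s ∷ u ∷ Square.b B ∷ κ ∷ w) ∣ ≡ 2

 off-con : ∀ {n} (C : Config (suc (suc (suc n)))) {h g k l} (mg : g ∈ A) (mk : k ∈ A) (ml : l ∈ A) {x y a b c d} → Off C (h ∷ g ∷ k ∷ l ∷ []) x (a ∷ b ∷ c ∷ d ∷ []) y →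
      Vary (C ⟋ mg ⟋ mk ⟋ ml) h x y a
 off-con C {h} {g} {k} {l} mg mk ml {x} {y} {a} {b} {c} {d} off = mkV λ z → trans (cong (+ 2 *_) (sh y z)) (trans (r1 (D C (y ∷ g ∷ k ∷ l ∷ z)))
   (trans (cong -_ (trans (off (g ∷ k ∷ l ∷ z)) (cong₂ (λ p q → + 2 * D C (x ∷ g ∷ k ∷ l ∷ z) + (a * D C (h ∷ g ∷ k ∷ l ∷ z) + (b * p + q))) (D-twice C g _)
    (cong₂ (λ p q → c * p + (d * q + + 0)) (D-mem C (there (here refl))) (D-mem C (there (there (here refl))))))))
   (trans (r2 (D C (x ∷ g ∷ k ∷ l ∷ z)) a (D C (h ∷ g ∷ k ∷ l ∷ z)) b c d) (sym (cong₂ (λ p q → + 2 * p + a * q) (sh x z) (sh h z)))))) where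
  sh : ∀ v z → D C (g ∷ k ∷ l ∷ v ∷ z) ≡ - D C (v ∷ g ∷ k ∷ l ∷ z)
  sh v z = trans (alt-shift (D C) (alt C) (g ∷ k ∷ l ∷ []) v z) (q (D C (v ∷ g ∷ k ∷ l ∷ z))) where
   q = ring-150
  r1 = ring-92
  r2 = ring-151

 -- The exceptional quadruple and its Hadamard frame

 module ExceptionalBound {N} (N≥2 : 2 ≤ N) (C : Config (suc (suc (suc (suc N))))) {e t s u} (ms : s ∈ A) (mu : u ∈ A)
  (hv : Heavy C (e ∷ t ∷ s ∷ u ∷ [])) (nh : NoHeavy C 3) (X : Exceptional C e t s u) {xs} (sx : Simple C xs) where

  open Exceptional X
  b = Square.b B

  module _ {h₁ h₂ h₃ h₄} (Hd : Hadamard C e t s u h₁ h₂ h₃ h₄) where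
   open Hadamard Hd

   Sh : List V
   Sh = h₁ ∷ h₂ ∷ h₃ ∷ h₄ ∷ []

   hv₁ : Heavy C Sh
   hv₁ = (λ {z} mz → trans (cong par (hadamard-det C Hd z)) (trans (par-neg (D C (e ∷ t ∷ s ∷ u ∷ z))) (fst hv mz))) , (z₀ , fst (snd (snd hv)) , ne) where
    z₀ = fst (snd hv)
    ne : 0≢ (D C (h₁ ∷ h₂ ∷ h₃ ∷ h₄ ∷ z₀))
    ne e0 = snd (snd (snd hv)) (neg-0 (D C (e ∷ t ∷ s ∷ u ∷ z₀)) (trans (sym (hadamard-det C Hd z₀)) e0))

   π₂ : Sh ↭ h₂ ∷ h₁ ∷ h₃ ∷ h₄ ∷ []
   π₂ = ↭-swap h₁ h₂ ↭-refl
   π₃ : Sh ↭ h₃ ∷ h₁ ∷ h₂ ∷ h₄ ∷ []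
   π₃ = PermP.shift h₃ (h₁ ∷ h₂ ∷ []) (h₄ ∷ [])
   π₁₃ : Sh ↭ h₁ ∷ h₃ ∷ h₂ ∷ h₄ ∷ []
   π₁₃ = ↭-prep h₁ (↭-swap h₂ h₃ ↭-refl)
   π₂₃ : Sh ↭ h₂ ∷ h₃ ∷ h₁ ∷ h₄ ∷ []
   π₂₃ = ↭-trans π₂ (↭-prep h₂ (↭-swap h₁ h₃ ↭-refl))

   dκ : 0≢ (D C (κ ∷ Sh ++ b ∷ w))
   dκ e0 = abs2-≢ d2 (neg-0 (D C (e ∷ t ∷ s ∷ u ∷ b ∷ κ ∷ w)) (trans (sym (hadamard-det C Hd (b ∷ κ ∷ w))) (perm-0 C pm e0))) where
    pm : κ ∷ Sh ++ b ∷ w ↭ h₁ ∷ h₂ ∷ h₃ ∷ h₄ ∷ b ∷ κ ∷ w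
    pm = ↭-trans (↭-sym (PermP.shift κ Sh (b ∷ w))) (++⁺ˡ Sh (↭-swap κ b ↭-refl))

   Class : V → Set
   Class P = ∀ z → D C (P ∷ Sh ++ z) ≡ D C (κ ∷ Sh ++ z)

   -- an hᵢ-pair in the class of κ
   record HPair (h : V) : Set where
    field
     {P P⁺} : V
     P∈  : P ∈ A
     P⁺∈ : P⁺ ∈ A
     vP  : Vary C h P P⁺ (+ 2)
     cls : Class P
    nP : 0≢ (D C (P ∷ Sh ++ b ∷ w))
    nP e0 = dκ (trans (sym (cls (b ∷ w))) e0)

   -- κ⁺ - κ is `e`, which is half the sum of h₁, ..., h₄. So the class of `κ` varies by a half step
   -- along each of them.
   off₁ : Off C Sh κ (+ 1 ∷ + 1 ∷ + 1 ∷ + 1 ∷ []) κ⁺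
   off₁ z = trans (at vκ z) (cong (λ v → + 2 * D C (κ ∷ z) + v) (hadamard-sum C Hd z))

   nzκ : ∀ {g i j k} → Sh ↭ g ∷ i ∷ j ∷ k ∷ [] → ∃ λ z → Ms z × 0≢ (D C (i ∷ j ∷ k ∷ g ∷ κ ∷ z))
   nzκ {g} {i} {j} {k} π = b ∷ w , Square.b∈ B ∷ mw , perm-≢ C (↭-trans (↭-sym (PermP.shift κ Sh (b ∷ w))) (↭-trans (++⁺ʳ (κ ∷ b ∷ w) π) (↭-sym (PermP.shift g (i ∷ j ∷ k ∷ []) (κ ∷ b ∷ w))))) dκ

   cls-of : ∀ {g i j k P} → Sh ↭ g ∷ i ∷ j ∷ k ∷ [] → (∀ z → D C (i ∷ j ∷ k ∷ g ∷ P ∷ z) ≡ D C (i ∷ j ∷ k ∷ g ∷ κ ∷ z)) → Class P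
   cls-of {g} {i} {j} {k} π h z = perm-eq C (i ∷ j ∷ k ∷ g ∷ []) z [] (Sh ++ z)
    (λ v → ↭-trans (PermP.shift g (i ∷ j ∷ k ∷ []) (v ∷ z)) (↭-trans (++⁺ʳ (v ∷ z) (↭-sym π)) (PermP.shift v Sh z))) (h z)

   -- In a critical frame, a class that varies by half a step already contains a full pair.
   hpair₁ : QuadCritical C n₁ n₂ n₃ n₄ → HPair h₁
   hpair₁ k = go (QuadCritical.pairs k κ∈ (nzκ ↭-refl) (κ⁺ , + 1 , κ⁺∈ , off-con C n₂ n₃ n₄ {a = + 1} {+ 1} {+ 1} {+ 1} off₁ , λ ())) where
    go : _ → HPair h₁
    go (P , P⁺ , mP , mP⁺ , v , h) = record { P∈ = mP ; P⁺∈ = mP⁺ ; vP = v ; cls = cls-of ↭-refl h }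

   hpair₂ : QuadCritical C n₂ n₁ n₃ n₄ → HPair h₂
   hpair₂ k = go (QuadCritical.pairs k κ∈ (nzκ π₂) (κ⁺ , + 1 , κ⁺∈ , off-con C n₁ n₃ n₄ {a = + 1} {+ 1} {+ 1} {+ 1} off₂ , λ ())) where
    off₂ : Off C (h₂ ∷ h₁ ∷ h₃ ∷ h₄ ∷ []) κ (+ 1 ∷ + 1 ∷ + 1 ∷ + 1 ∷ []) κ⁺
    off₂ z = trans (off₁ z) (cong (λ v → + 2 * D C (κ ∷ z) + v) (l (+ 1 * D C (h₁ ∷ z)) (+ 1 * D C (h₂ ∷ z)) _)) where
     l = ring-119
    go : _ → HPair h₂
    go (P , P⁺ , mP , mP⁺ , v , h) = record { P∈ = mP ; P⁺∈ = mP⁺ ; vP = v ; cls = cls-of π₂ h }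

   hpair₃ : QuadCritical C n₃ n₁ n₂ n₄ → HPair h₃
   hpair₃ k = go (QuadCritical.pairs k κ∈ (nzκ π₃) (κ⁺ , + 1 , κ⁺∈ , off-con C n₁ n₂ n₄ {a = + 1} {+ 1} {+ 1} {+ 1} off₃ , λ ())) where
    off₃ : Off C (h₃ ∷ h₁ ∷ h₂ ∷ h₄ ∷ []) κ (+ 1 ∷ + 1 ∷ + 1 ∷ + 1 ∷ []) κ⁺
    off₃ z = trans (off₁ z) (cong (λ v → + 2 * D C (κ ∷ z) + v) (l (+ 1 * D C (h₁ ∷ z)) (+ 1 * D C (h₂ ∷ z)) (+ 1 * D C (h₃ ∷ z)) _)) where
     l = ring-152
    go : _ → HPair h₃
    go (P , P⁺ , mP , mP⁺ , v , h) = record { P∈ = mP ; P⁺∈ = mP⁺ ; vP = v ; cls = cls-of π₃ h }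

   clash-std : ∀ {P} → Class P → EdgeL C Sh P → ⊥
   clash-std {P} cP E = hadamard-clash C ms mu B sign Hd E mw (trans (cong ∣_∣ same) d2) where
    y = EdgeL.y E
    same : D C (e ∷ t ∷ s ∷ u ∷ b ∷ y ∷ w) ≡ D C (e ∷ t ∷ s ∷ u ∷ b ∷ κ ∷ w)
    same = trans (sym (neg-h y)) (trans (cong -_ (perm-eq C [] (Sh ++ b ∷ w) (Sh ++ b ∷ []) w (λ v → ↭-trans (↭-sym (PermP.shift v Sh (b ∷ w))) (++⁺ˡ Sh (↭-swap v b ↭-refl))) (trans (EdgeL.cls E (b ∷ w)) (cP (b ∷ w))))) (neg-h κ)) where
     neg-h : ∀ v → - D C (h₁ ∷ h₂ ∷ h₃ ∷ h₄ ∷ b ∷ v ∷ w) ≡ D C (e ∷ t ∷ s ∷ u ∷ b ∷ v ∷ w)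
     neg-h v = trans (cong -_ (hadamard-det C Hd (b ∷ v ∷ w))) (neg-involutive _)

   module _ {g i j k} (mS : Ms (g ∷ i ∷ j ∷ k ∷ [])) (π : Sh ↭ g ∷ i ∷ j ∷ k ∷ []) where

    S' : List V
    S' = g ∷ i ∷ j ∷ k ∷ []

    psum' : ∀ u → psum C S' u ≡ false
    psum' = min-sum C S' mS (heavy-perm C π hv₁) refl nh

    to' : ∀ {P Q} → Class P → Class Q → ∀ z → D C (Q ∷ S' ++ z) ≡ D C (P ∷ S' ++ z)
    to' cP cQ z = perm-eq C [] (Sh ++ z) [] (S' ++ z) (λ v → ↭-prep v (++⁺ʳ z π)) (trans (cQ z) (sym (cP z)))

    nP' : ∀ {h} (p : HPair h) → 0≢ (D C (HPair.P p ∷ S' ++ b ∷ w))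
    nP' p = perm-≢ C (↭-prep (HPair.P p) (++⁺ʳ (b ∷ w) π)) (HPair.nP p)

    offset' : ∀ {h h'} (p : HPair h) (q : HPair h') → Offset C S' (HPair.P p) (HPair.P q)
    offset' p q = off-exist C g (i ∷ j ∷ k ∷ []) mS psum' (HPair.P∈ p) (HPair.P∈ q) (Square.b∈ B ∷ mw)
     (even-val (trans (perm-par C (↭-sym (PermP.shift (HPair.P p) S' (b ∷ w)))) (fst (heavy-perm C π hv₁) (HPair.P∈ p ∷ Square.b∈ B ∷ mw))) (bdd C (HPair.P∈ p ∷ AllP.++⁺ mS (Square.b∈ B ∷ mw))) (nP' p))
     (to' (HPair.cls p) (HPair.cls q))

    even-edge : (p : HPair g) (q : HPair i) (O : Offset C S' (HPair.P p) (HPair.P q)) → Offset.bit O ≡ false → EdgeL C S' (HPair.P p)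
    even-edge p q O eq = pair-edge C mS psum' nh (HPair.P∈ p) (HPair.P⁺∈ p) (HPair.P∈ q) (HPair.P⁺∈ q) (HPair.vP p) (HPair.vP q) (Offset.off O) (Offset.len O)
     (all-ev (Offset.bnd O) (subst (λ b → All (λ a → par a ≡ b) (Offset.λs O)) eq (Offset.prt O))) (Square.b∈ B ∷ mw) (nP' p)

   -- The three pairs lie in one class, so the doubled coordinates of each offset share a parity.
   -- The coordinates at h₁ add up along the three pairs, hence not all parities are odd, and an
   -- even offset yields an edge that clashes with the square.
   no-pairs : HPair h₁ → HPair h₂ → HPair h₃ → ⊥
   no-pairs p₁ p₂ p₃ = go (Offset.bit O₁₂) refl (Offset.bit O₁₃) refl (Offset.bit O₂₃) refl where
    mS₁₂ : Ms (h₁ ∷ h₂ ∷ h₃ ∷ h₄ ∷ [])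
    mS₁₂ = n₁ ∷ n₂ ∷ n₃ ∷ n₄ ∷ []
    mS₁₃ : Ms (h₁ ∷ h₃ ∷ h₂ ∷ h₄ ∷ [])
    mS₁₃ = n₁ ∷ n₃ ∷ n₂ ∷ n₄ ∷ []
    mS₂₃ : Ms (h₂ ∷ h₃ ∷ h₁ ∷ h₄ ∷ [])
    mS₂₃ = n₂ ∷ n₃ ∷ n₁ ∷ n₄ ∷ []
    O₁₂ = offset' mS₁₂ ↭-refl p₁ p₂
    O₁₃ = offset' mS₁₃ π₁₃ p₁ p₃
    O₂₃ = offset' mS₂₃ π₂₃ p₂ p₃
    z₁ : List V
    z₁ = h₂ ∷ h₃ ∷ h₄ ∷ κ ∷ b ∷ w
    d₁ : 0≢ (D C (h₁ ∷ z₁))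
    d₁ = perm-≢ C (↭-sym (PermP.shift κ Sh (b ∷ w))) dκ
    odd-sum : ∀ λs μs νs → Four λs → Four μs → Four νs → All (λ a → par a ≡ true) λs → All (λ a → par a ≡ true) μs → All (λ a → par a ≡ true) νs →
         Off C (h₁ ∷ h₂ ∷ h₃ ∷ h₄ ∷ []) (HPair.P p₁) λs (HPair.P p₂) → Off C (h₁ ∷ h₃ ∷ h₂ ∷ h₄ ∷ []) (HPair.P p₁) μs (HPair.P p₃) → Off C (h₂ ∷ h₃ ∷ h₁ ∷ h₄ ∷ []) (HPair.P p₂) νs (HPair.P p₃) → ⊥
    odd-sum _ _ _ (quad a₁ a₂ a₃ a₄) (quad b₁ b₃ b₂ b₄) (quad c₂' c₃' c₁' c₄') (pa ∷ _) (pb ∷ _) (_ ∷ _ ∷ pc ∷ _) ha hb hc = bad (trans (sym pb) (trans (cong par beq) (trans (par-+ a₁ c₁') (cong₂ _xor_ pa pc)))) where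
     bad : true ≢ false
     bad ()
     x₁ = D C (HPair.P p₁ ∷ z₁)
     g₂ : D C (h₂ ∷ z₁) ≡ + 0
     g₂ = D-mem C (here refl)
     g₃ : D C (h₃ ∷ z₁) ≡ + 0
     g₃ = D-mem C (there (here refl))
     g₄ : D C (h₄ ∷ z₁) ≡ + 0
     g₄ = D-mem C (there (there (here refl)))
     l : ∀ x₁ x₂ x₃ d₁ d₂ d₃ d₄ → d₂ ≡ + 0 → d₃ ≡ + 0 → d₄ ≡ + 0 → + 2 * x₂ ≡ + 2 * x₁ + (a₁ * d₁ + (a₂ * d₂ + (a₃ * d₃ + (a₄ * d₄ + + 0)))) →
       + 2 * x₃ ≡ + 2 * x₁ + (b₁ * d₁ + (b₃ * d₃ + (b₂ * d₂ + (b₄ * d₄ + + 0)))) → + 2 * x₃ ≡ + 2 * x₂ + (c₂' * d₂ + (c₃' * d₃ + (c₁' * d₁ + (c₄' * d₄ + + 0)))) → d₁ * b₁ ≡ d₁ * (a₁ + c₁')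
     l x₁ x₂ x₃ d₁ _ _ _ refl refl refl h h' h'' = sum-diff (cong₂ _+_ (cong₂ _-_ h'' h') h) (q x₁ x₂ x₃ d₁ a₁ a₂ a₃ a₄ b₁ b₂ b₃ b₄ c₁' c₂' c₃' c₄') where
      q = ring-153
     beq : b₁ ≡ a₁ + c₁'
     beq = cancel-≡ {D C (h₁ ∷ z₁)} _ _ d₁ (l x₁ (D C (HPair.P p₂ ∷ z₁)) (D C (HPair.P p₃ ∷ z₁)) (D C (h₁ ∷ z₁)) (D C (h₂ ∷ z₁)) (D C (h₃ ∷ z₁)) (D C (h₄ ∷ z₁)) g₂ g₃ g₄ (ha z₁) (hb z₁) (hc z₁))
    oddO : ∀ {S x y} (O : Offset C S x y) → Offset.bit O ≡ true → All (λ a → par a ≡ true) (Offset.λs O)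
    oddO O eq = subst (λ b → All (λ a → par a ≡ b) (Offset.λs O)) eq (Offset.prt O)
    go : ∀ b₁₂ → Offset.bit O₁₂ ≡ b₁₂ → ∀ b₁₃ → Offset.bit O₁₃ ≡ b₁₃ → ∀ b₂₃ → Offset.bit O₂₃ ≡ b₂₃ → ⊥
    go false q _ _ _ _ = clash-std (HPair.cls p₁) (even-edge mS₁₂ ↭-refl p₁ p₂ O₁₂ q)
    go true _ false q _ _ = clash-std (HPair.cls p₁) (edge-swap₂ C (even-edge mS₁₃ π₁₃ p₁ p₃ O₁₃ q))
    go true _ true _ false q = clash-std (HPair.cls p₂) (edge-swap C (edge-swap₂ C (even-edge mS₂₃ π₂₃ p₂ p₃ O₂₃ q)))
    go true q₁ true q₂ true q₃ = odd-sum _ _ _ (view₄ _ (Offset.len O₁₂)) (view₄ _ (Offset.len O₁₃)) (view₄ _ (Offset.len O₂₃)) (oddO O₁₂ q₁) (oddO O₁₃ q₂) (oddO O₂₃ q₃) (Offset.off O₁₂) (Offset.off O₁₃) (Offset.off O₂₃)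

   -- Three choices of the distinguished vector suffice, since three pairs are already
   -- contradictory.
   frame-bound : length xs ≤ f1 (suc (suc (suc N)))
   frame-bound = go (K4.frame C n₁ n₂ n₃ n₄ hv₁ nh N≥2 sx) (K4.frame C n₂ n₁ n₃ n₄ (heavy-perm C π₂ hv₁) nh N≥2 sx) (K4.frame C n₃ n₁ n₂ n₄ (heavy-perm C π₃ hv₁) nh N≥2 sx) where
    go : length xs ≤ f1 (suc (suc (suc N))) ⊎ QuadCritical C n₁ n₂ n₃ n₄ → length xs ≤ f1 (suc (suc (suc N))) ⊎ QuadCritical C n₂ n₁ n₃ n₄ →
       length xs ≤ f1 (suc (suc (suc N))) ⊎ QuadCritical C n₃ n₁ n₂ n₄ → length xs ≤ f1 (suc (suc (suc N)))
    go (inl h) _ _ = h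
    go _ (inl h) _ = h
    go _ _ (inl h) = h
    go (inr k₁) (inr k₂) (inr k₃) = ⊥-elim (no-pairs (hpair₁ k₁) (hpair₂ k₂) (hpair₃ k₃))

  bound : length xs ≤ f1 (suc (suc (suc N)))
  bound = go (sign o+ o+ o+ o+) (sign o+ o+ o- o-) (sign o+ o- o+ o-) (sign o+ o- o- o+) where
   go : SignRow C e t s u (+ 1) (+ 1) (+ 1) (+ 1) → SignRow C e t s u (+ 1) (+ 1) (- + 1) (- + 1) → SignRow C e t s u (+ 1) (- + 1) (+ 1) (- + 1) → SignRow C e t s u (+ 1) (- + 1) (- + 1) (+ 1) →
      length xs ≤ f1 (suc (suc (suc N)))
   go (_ , n₁ , c₁) (_ , n₂ , c₂) (_ , n₃ , c₃) (_ , n₄ , c₄) = frame-bound (record { n₁ = n₁ ; n₂ = n₂ ; n₃ = n₃ ; n₄ = n₄ ; c₁ = c₁ ; c₂ = c₂ ; c₃ = c₃ ; c₄ = c₄ })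

 -- The second direction of the square may be any of the three other members; a permutation moves it
 -- to the front of them.
 thm4-min : ∀ N → 2 ≤ N → (C : Config (suc (suc (suc (suc N))))) → ∀ {e t s u} → e ∈ A → t ∈ A → s ∈ A → u ∈ A → Heavy C (e ∷ t ∷ s ∷ u ∷ []) → NoHeavy C 3 →
       ∀ {xs} → Simple C xs → length xs ≤ f1 (suc (suc (suc N)))
 thm4-min N N≥2 C {e} {t} {s} {u} me mt ms mu hv nh {xs} sx = go (K4.frame C me mt ms mu hv nh N≥2 sx) where
  F = C ⟋ mt ⟋ ms ⟋ mu ⟋ me
  evF : Even F
  evF {z} mz = trans (perm-par C (PermP.shift e (t ∷ s ∷ u ∷ []) z)) (fst hv mz)
  go : length xs ≤ f1 (suc (suc (suc N))) ⊎ QuadCritical C me mt ms mu → length xs ≤ f1 (suc (suc (suc N)))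
  go (inl h) = h
  go (inr k) = fin (QuadCritical.s'∈ k) (QuadCritical.B k) (QuadCritical.other k) where
   sign : ∀ {a b c d} → PM1 a → PM1 b → PM1 c → PM1 d → SignRow C e t s u a b c d
   sign = QuadCritical.sign k
   d2 : ∀ {b κ w} → b ∈ A → κ ∈ A → Ms w → 0≢ (D F (b ∷ κ ∷ w)) → ∀ {t' s' u'} → t ∷ s ∷ u ∷ [] ↭ t' ∷ s' ∷ u' ∷ [] → ∣ D C (e ∷ t' ∷ s' ∷ u' ∷ b ∷ κ ∷ w) ∣ ≡ 2
   d2 {b} {κ} {w} mb mκ mw d π = trans (perm-abs C (↭-trans (↭-prep e (++⁺ʳ (b ∷ κ ∷ w) (↭-sym π))) (↭-sym (PermP.shift e (t ∷ s ∷ u ∷ []) (b ∷ κ ∷ w))))) (even-abs {C = F} evF (mb ∷ mκ ∷ mw) d)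
   fin : ∀ {s'} → s' ∈ t ∷ s ∷ u ∷ [] → (B : Square C e s') → (∃₂ λ κ κ⁺ → κ ∈ A × κ⁺ ∈ A × Vary C e κ κ⁺ (+ 2) × Ind2 F (Square.b B) κ) → length xs ≤ f1 (suc (suc (suc N)))
   fin (here refl) B (κ , κ⁺ , mκ , mκ⁺ , v , (w , mw , d)) = ExceptionalBound.bound N≥2 C ms mu hv nh
    (record { B = B ; sign = sign ; κ∈ = mκ ; κ⁺∈ = mκ⁺ ; vκ = v ; mw = mw ; d2 = d2 (Square.b∈ B) mκ mw d ↭-refl }) sx
   fin (there (here refl)) B (κ , κ⁺ , mκ , mκ⁺ , v , (w , mw , d)) = ExceptionalBound.bound N≥2 C mt mu (heavy-perm C (↭-prep e (↭-swap t s ↭-refl)) hv) nh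
    (record { B = B ; sign = λ pa pb pc pd → let (h , mh , c) = sign pa pc pb pd in h , mh , comb-swap₂ C c ; κ∈ = mκ ; κ⁺∈ = mκ⁺ ; vκ = v ; mw = mw
        ; d2 = d2 (Square.b∈ B) mκ mw d (↭-swap t s ↭-refl) }) sx
   fin (there (there (here refl))) B (κ , κ⁺ , mκ , mκ⁺ , v , (w , mw , d)) = ExceptionalBound.bound N≥2 C mt ms (heavy-perm C (↭-prep e π) hv) nh
    (record { B = B ; sign = λ pa pb pc pd → let (h , mh , c) = sign pa pc pd pb in h , mh , comb-swap₂ C (comb-swap₃ C c) ; κ∈ = mκ ; κ⁺∈ = mκ⁺ ; vκ = v ; mw = mw
        ; d2 = d2 (Square.b∈ B) mκ mw d π }) sx where
    π : t ∷ s ∷ u ∷ [] ↭ u ∷ t ∷ s ∷ []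
    π = PermP.shift u (t ∷ s ∷ []) []

 -- No heavy set of at most four vectors: unit displacements

 coefs-dot-0 : ∀ G T w (φ : V → ℤ) → (∀ l t r → T ≡ l ++ t ∷ r → G (l ++ r ++ w) ≡ + 0 ⊎ φ t ≡ + 0) → dot (coefs G T w) (map φ T) ≡ + 0
 coefs-dot-0 G [] w φ h = refl
 coefs-dot-0 G (t ∷ T) w φ h = trans (cong₂ _+_ (first (h [] t T refl))
   (trans (dot-neg (coefs (λ ys → G (t ∷ ys)) T w) (map φ T)) (cong -_ (coefs-dot-0 (λ ys → G (t ∷ ys)) T w φ (λ l s r e → h (t ∷ l) s r (cong (t ∷_) e)))))) refl where
  first : G (T ++ w) ≡ + 0 ⊎ φ t ≡ + 0 → G (T ++ w) * φ t ≡ + 0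
  first (inl e) = cong (_* φ t) e
  first (inr e) = trans (cong (G (T ++ w) *_) e) (*-zeroʳ (G (T ++ w)))

 -- The ratio of the proportional minors is ±2, as read off at `w`; so one family is ±2 times the
 -- other everywhere.
 proportional-even : ∀ {r} (C : Config r) {hs T w δ p} → 0≢ p → (∀ z → p * D C (hs ++ z) ≡ δ * D C (T ++ z)) → ∣ D C (hs ++ w) ∣ ≡ 2 → ∣ D C (T ++ w) ∣ ≡ 1 →
           ∀ z → par (D C (hs ++ z)) ≡ false
 proportional-even C {hs} {T} {w} {δ} {p} p≢0 h h2 h1 z = trans (cong odd abs-eq) (odd-double ∣ D C (T ++ z) ∣) where
  instance
   nzp : ℕ.NonZero ∣ p ∣
   nzp = ℕ.≢-nonZero (λ e → p≢0 (∣i∣≡0⇒i≡0 e))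
  ab : ∀ z → ∣ p ∣ ℕ.* ∣ D C (hs ++ z) ∣ ≡ ∣ δ ∣ ℕ.* ∣ D C (T ++ z) ∣
  ab z = trans (sym (∣i*j∣≡∣i∣*∣j∣ p (D C (hs ++ z)))) (trans (cong ∣_∣ (h z)) (∣i*j∣≡∣i∣*∣j∣ δ (D C (T ++ z))))
  δ2 : ∣ δ ∣ ≡ ∣ p ∣ ℕ.* 2
  δ2 = trans (sym (ℕP.*-identityʳ ∣ δ ∣)) (trans (cong (∣ δ ∣ ℕ.*_) (sym h1)) (trans (sym (ab w)) (cong (∣ p ∣ ℕ.*_) h2)))
  abs-eq : ∣ D C (hs ++ z) ∣ ≡ 2 ℕ.* ∣ D C (T ++ z) ∣
  abs-eq = ℕP.*-cancelˡ-≡ _ _ ∣ p ∣ (trans (ab z) (trans (cong (ℕ._* ∣ D C (T ++ z) ∣) δ2) (ℕP.*-assoc (∣ p ∣) 2 (∣ D C (T ++ z) ∣))))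

 module Sparse {n} (C : Config (suc n)) (nh : NoHeavy C 4) {e} (me : e ∈ A) (ne : Nz C e) where

  private
   F = C ⟋ me

  -- If y = x ± 2e, every minor containing x and y is ±2 times one containing e and x, which makes
  -- x, y a heavy pair.
  double-heavy : ∀ {x y τ} → x ∈ A → y ∈ A → Nz F x → Vary C e x y τ → τ ≡ + 4 ⊎ τ ≡ - + 4 → ⊥
  double-heavy {x} {y} {τ} mx my (w , mw , dw) v t4 = nh x (y ∷ []) (mx ∷ my ∷ []) (s≤s (s≤s z≤n)) ((λ {z} _ → even z) , w , mw , λ e0 → nzD t4 (twice w) (trans (alt C [] y x w) (cong -_ e0))) where
   twice : ∀ z → + 2 * D C (y ∷ x ∷ z) ≡ τ * D C (e ∷ x ∷ z)
   twice z = trans (at v (x ∷ z)) (trans (cong (λ t → + 2 * t + τ * D C (e ∷ x ∷ z)) (D-twice C x z)) (+-identityˡ _))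
   nzD : τ ≡ + 4 ⊎ τ ≡ - + 4 → + 2 * D C (y ∷ x ∷ w) ≡ τ * D C (e ∷ x ∷ w) → D C (y ∷ x ∷ w) ≡ + 0 → ⊥
   nzD (inl refl) h e0 = *≢0 {+ 4} (λ ()) dw (trans (sym h) (cong (+ 2 *_) e0))
   nzD (inr refl) h e0 = *≢0 { - + 4} (λ ()) dw (trans (sym h) (cong (+ 2 *_) e0))
   par-2 : ∀ {t} g x → t ≡ + 4 ⊎ t ≡ - + 4 → + 2 * g ≡ t * x → par g ≡ false
   par-2 g x (inl refl) h = trans (cong par (cancel-≡ {+ 2} g (+ 2 * x) (λ ()) (trans h (l x)))) (par-* (+ 2) x) where
    l = ring-154
   par-2 g x (inr refl) h = trans (cong par (cancel-≡ {+ 2} g (- + 2 * x) (λ ()) (trans h (l x)))) (par-* (- + 2) x) where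
    l = ring-155
   even : ∀ z → par (D C (x ∷ y ∷ z)) ≡ false
   even z = trans (perm-par C (↭-swap x y ↭-refl)) (par-2 (D C (y ∷ x ∷ z)) (D C (e ∷ x ∷ z)) t4 (twice z))

  UnitShift : V → V → Set
  UnitShift x y = ∃₂ λ y' τ → y' ∈ A × PM2 τ × Pm C y y' × Vary C e x y' τ

  -- Some minor containing e and x is odd, hence ±1, and makes the coefficients integral. An odd
  -- minor containing e and y forces the factor modulo `e` to be ±1. The remaining multiple of `e`
  -- is nonzero, and ±2 would give a heavy pair.
  unit-shift : ∀ {x y} → x ∈ A → y ∈ A → Nz F x → Nz F y → ¬ Ind2 F x y → Ind2 C x y → UnitShift x y
  unit-shift {x} {y} mx my nx ny dep ind = start (odd-wit C nh e (x ∷ []) (me ∷ mx ∷ []) (s≤s (s≤s z≤n)) nx) (odd-wit C nh e (y ∷ []) (me ∷ my ∷ []) (s≤s (s≤s z≤n)) ny) where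
   start : (∃ λ w → Ms w × par (D C (e ∷ x ∷ w)) ≡ true) → (∃ λ w → Ms w × par (D C (e ∷ y ∷ w)) ≡ true) → UnitShift x y
   start (w , mw , ow) (w' , mw' , ow') = fin {β} (small β (bdd F (my ∷ mw))) relF where
    d = D F (x ∷ w)
    pd : PM1 d
    pd = odd-small ow (bdd F (mx ∷ mw))
    β = D F (y ∷ w)
    relF : ∀ z → D F (y ∷ z) ≡ d * (β * D F (x ∷ z))
    relF z = PM1-scale {d} pd (trans (spanned F y (x ∷ []) w mw (λ mz → trans (alt F [] y x _) (cong -_ (¬NzL F dep mz))) z) (ℤP.+-identityʳ _))
    evenβ : ∀ {b} → par b ≡ false → (∀ z → D F (y ∷ z) ≡ d * (b * D F (x ∷ z))) → ⊥
    evenβ {b} pb h = bad (trans (sym ow') (trans (cong par (h w')) (trans (par-* d (b * D F (x ∷ w'))) (trans (cong (par d ∧_) (trans (par-* b (D F (x ∷ w'))) (cong (_∧ par (D F (x ∷ w'))) pb))) (∧-zeroʳ (par d)))))) where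
     bad : true ≢ false
     bad ()
    -- y' is y or its negative, chosen to agree with x modulo e
    aligned : ∀ {y'} → y' ∈ A → Pm C y y' → (∀ z → D F (y' ∷ z) ≡ D F (x ∷ z)) → UnitShift x y
    aligned {y'} my' pm eqF = finish {a} {d} (small a (bdd C (my' ∷ mx ∷ mw))) pd relC (λ e0 → nz-a e0) where
     a = D C (y' ∷ x ∷ w)
     relC : ∀ z → D C (y' ∷ z) ≡ d * (a * D C (e ∷ z) + d * D C (x ∷ z))
     relC z = PM1-scale {d} pd (trans (spanned C y' (e ∷ x ∷ []) w mw dep' z) (trans (cong (λ t → a * D C (e ∷ z) + (- t * D C (x ∷ z) + + 0)) (trans (alt C [] y' e w) (cong -_ (eqF w)))) (l a (D C (e ∷ z)) d (D C (x ∷ z))))) where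
      dep' : ∀ {z} → Ms z → D C (y' ∷ e ∷ x ∷ z) ≡ + 0
      dep' {z} mz = trans (alt C [] y' e (x ∷ z)) (cong -_ (trans (eqF (x ∷ z)) (D-twice F x z)))
      l = ring-156
     nz-a : a ≡ + 0 → ⊥
     nz-a e0 = let (z , mz , dz) = Pm-ind C {x} {y} {y'} pm ind in dz (trans (alt C [] x y' z) (cong -_ (trans (relC (x ∷ z))
      (trans (cong₂ (λ p q → d * (p * D C (e ∷ x ∷ z) + d * q)) e0 (D-twice C x z)) (l d (D C (e ∷ x ∷ z))))))) where
      l = ring-157
     var : ∀ {d a} τ → PM1 d → + 2 * (d * a) ≡ τ → (∀ z → D C (y' ∷ z) ≡ d * (a * D C (e ∷ z) + d * D C (x ∷ z))) → Vary C e x y' τ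
     var {d} {a} _ p refl h = mkV λ z → trans (cong (+ 2 *_) (h z)) (trans (l d a (D C (e ∷ z)) (D C (x ∷ z))) (trans (cong (λ t → + 2 * (t * D C (x ∷ z)) + + 2 * (d * a) * D C (e ∷ z)) (PM1-sq p)) (l2 (D C (x ∷ z)) (+ 2 * (d * a) * D C (e ∷ z))))) where
      l = ring-158
      l2 = ring-159
     finish : ∀ {a d} → Small a → PM1 d → (∀ z → D C (y' ∷ z) ≡ d * (a * D C (e ∷ z) + d * D C (x ∷ z))) → 0≢ a → UnitShift x y
     finish sz0 _ _ h0 = ⊥-elim (h0 refl)
     finish sp1 o+ h _ = y' , + 2 , my' , pm+ , pm , var {+ 1} {+ 1} (+ 2) o+ refl h
     finish sp1 o- h _ = y' , - + 2 , my' , pm- , pm , var { - + 1} {+ 1} (- + 2) o- refl h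
     finish sm1 o+ h _ = y' , - + 2 , my' , pm- , pm , var {+ 1} { - + 1} (- + 2) o+ refl h
     finish sm1 o- h _ = y' , + 2 , my' , pm+ , pm , var { - + 1} { - + 1} (+ 2) o- refl h
     finish sp2 o+ h _ = ⊥-elim (double-heavy mx my' nx (var {+ 1} {+ 2} (+ 4) o+ refl h) (inl refl))
     finish sp2 o- h _ = ⊥-elim (double-heavy mx my' nx (var { - + 1} {+ 2} (- + 4) o- refl h) (inr refl))
     finish sm2 o+ h _ = ⊥-elim (double-heavy mx my' nx (var {+ 1} { - + 2} (- + 4) o+ refl h) (inr refl))
     finish sm2 o- h _ = ⊥-elim (double-heavy mx my' nx (var { - + 1} { - + 2} (+ 4) o- refl h) (inl refl))
    pos : (∀ z → D F (y ∷ z) ≡ D F (x ∷ z)) → UnitShift x y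
    pos h = aligned my (Pm-refl C) h
    opp : (∀ z → D F (y ∷ z) ≡ - D F (x ∷ z)) → UnitShift x y
    opp h = aligned (neg∈ my) (Pm-neg C y) (λ z → trans (D-neg F y z) (trans (cong -_ (h z)) (neg-involutive _)))
    l++ = ring-160
    l+- = ring-161
    l-+ = ring-162
    l-- = ring-163
    unit : ∀ {d β} → PM1 d → PM1 β → (∀ z → D F (y ∷ z) ≡ d * (β * D F (x ∷ z))) → UnitShift x y
    unit o+ o+ h = pos (λ z → trans (h z) (l++ (D F (x ∷ z))))
    unit o+ o- h = opp (λ z → trans (h z) (l+- (D F (x ∷ z))))
    unit o- o+ h = opp (λ z → trans (h z) (l-+ (D F (x ∷ z))))
    unit o- o- h = pos (λ z → trans (h z) (l-- (D F (x ∷ z))))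
    fin : ∀ {β} → Small β → (∀ z → D F (y ∷ z) ≡ d * (β * D F (x ∷ z))) → UnitShift x y
    fin sz0 h = ⊥-elim (evenβ {+ 0} refl h)
    fin sp2 h = ⊥-elim (evenβ {+ 2} refl h)
    fin sm2 h = ⊥-elim (evenβ { - + 2} refl h)
    fin sp1 h = unit {d} {+ 1} pd o+ h
    fin sm1 h = unit {d} { - + 1} pd o- h

  module _ {xs} (S : Split C me xs) where
   open Split S
   open SplitFacts S

   line : ∀ {p} → p ∈ exs → UnitShift (fst p) (snd p)
   line m = unit-shift (x∈A m) (ρ∈A m) (x-nz m) (ρ-nz m) (x∥ρ m) (Ind2-sym C (ρ-ind m (ρ∈ m)))

   -- Otherwise `ρ` and `y` are both displaced from `x` by ±e, up to sign. With equal displacements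
   -- they coincide, with opposite ones they differ by 2e.
   exs-ind : ∀ {p q} → p ∈ exs → q ∈ exs → Ind2 C (fst p) (fst q) → Ind2 F (fst p) (fst q)
   exs-ind {x , ρ} {y , _} mp mq i = go (Ind2? F x y) where
    two-shifts : UnitShift x ρ → UnitShift x y → ⊥
    two-shifts (ρ' , _ , mρ , pτ , pmρ , vρ) (y' , _ , my , pσ , pmy , vy) = cmp pτ pσ vρ vy where
     same : ∀ {τ} → Vary C e x ρ' τ → Vary C e x y' τ → ⊥
     same v v' = Pm-dep C {ρ} {y} (Pm-trans C {ρ} {ρ'} {y} pmρ (Pm-trans C {ρ'} {y'} {y} (inl (λ z → cancel-≡ {+ 2} _ _ (λ ()) (trans (at v' z) (sym (at v z))))) (Pm-sym C {y} {y'} pmy))) (ρ-ind mq (ρ∈ mp))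
     nρ' : ∀ {τ} → Vary C e x ρ' τ → Nz F ρ'
     nρ' v = let (w , mw , d) = x-nz mp in w , mw , λ e0 → d (trans (sym (vary-same C me v w)) e0)
     cmp : ∀ {τ σ} → PM2 τ → PM2 σ → Vary C e x ρ' τ → Vary C e x y' σ → ⊥
     cmp pm+ pm+ v v' = same v v'
     cmp pm- pm- v v' = same v v'
     cmp pm+ pm- v v' = double-heavy mρ my (nρ' v) (vary-comp v v') (inr refl)
     cmp pm- pm+ v v' = double-heavy mρ my (nρ' v) (vary-comp v v') (inl refl)
    go : Dec (Ind2 F x y) → Ind2 F x y
    go (yes j) = j
    go (no h) = ⊥-elim (two-shifts (line mp) (unit-shift (x∈A mp) (x∈A mq) (x-nz mp) (x-nz mq) h i))

 -- Circuits of displaced vectors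

 module Circuits {n} (C : Config (suc n)) (nh : NoHeavy C 4) {e} (me : e ∈ A) where

  private
   F = C ⟋ me

  Shift : Set
  Shift = Vr C e

  -- Each vector contributes its offset of absolute value 2 times a nonzero integer.
  R-lower : ∀ G (vs : List Shift) w → All (λ v → ∣ τ v ∣ ≡ 2) vs → (∀ l v r → vs ≡ l ++ v ∷ r → 0≢ (G (bases l ++ e ∷ bases r ++ w))) → 2 ℕ.* length vs ≤ R G vs w
  R-lower G [] w _ _ = z≤n
  R-lower G (v ∷ vs) w (t ∷ ts) h = ≤-trans (≤-reflexive (*-suc 2 (length vs))) (+-mono-≤ (≤-trans (*-monoʳ-≤ 2 (pos (h [] v vs refl))) (≤-reflexive (cong (ℕ._* ∣ G (e ∷ bases vs ++ w) ∣) (sym t))))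
    (R-lower (λ ys → G (base v ∷ ys)) vs w ts (λ l u r eq → h (v ∷ l) u r (cong (v ∷_) eq)))) where
   pos : ∀ {x} → 0≢ x → 1 ≤ ∣ x ∣
   pos {x} ne = n≢0⇒n>0 (λ e0 → ne (∣i∣≡0⇒i≡0 e0))

  NzL-drop : ∀ l {s r} → s ∈ A → NzL F (l ++ s ∷ r) → NzL F (l ++ r)
  NzL-drop l {s} {r} ms (z , mz , d) = s ∷ z , ms ∷ mz , perm-≢ F (subst₂ _↭_ refl refl (↭-trans (++⁺ʳ z (PermP.shift s l r)) (↭-sym (PermP.shift s (l ++ r) z)))) d

  module _ (y : Shift) where

   -- `y` and `U` form a circuit after contracting `e`: `U` is independent, and `y` depends on all
   -- of `U` but on no proper part.
   Minimal : List Shift → Set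
   Minimal U = NzL F (bases U) × ¬ NzL F (base y ∷ bases U) × (∀ l v r → U ≡ l ++ v ∷ r → NzL F (base y ∷ bases (l ++ r)))

   check : ∀ (pre post : List Shift) → (∃ λ l → ∃₂ λ v r → pre ++ post ≡ l ++ v ∷ r × ¬ NzL F (base y ∷ bases (l ++ r))) ⊎ (∀ (l : List Shift) v r → post ≡ l ++ v ∷ r → NzL F (base y ∷ bases ((pre ++ l) ++ r)))
   check pre [] = inr (λ l v r eq → ⊥-elim (no-split l eq))
   check pre (v ∷ post) = go (NzL? F (base y ∷ bases (pre ++ post))) (check (pre ++ v ∷ []) post) where
    go : Dec (NzL F (base y ∷ bases (pre ++ post))) → _ → _
    go (no h) _ = inl (pre , v , post , refl , h)
    go (yes i) (inl (l , u , r , eq , h)) = inl (l , u , r , trans (sym (++-assoc pre (v ∷ []) post)) eq , h)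
    go (yes i) (inr f) = inr all where
     all : ∀ l u r → v ∷ post ≡ l ++ u ∷ r → NzL F (base y ∷ bases ((pre ++ l) ++ r))
     all [] u r refl = subst (λ t → NzL F (base y ∷ bases (t ++ post))) (sym (++-identityʳ pre)) i
     all (_ ∷ l) u r refl = subst (λ t → NzL F (base y ∷ bases (t ++ r))) (++-assoc pre (v ∷ []) l) (f l u r refl)

   minimal : ∀ k U → length U ≤ k → NzL F (bases U) → ¬ NzL F (base y ∷ bases U) → ∃ λ U' → All (_∈ U) U' × Minimal U'
   minimal k U le nzU dep = go k le (check [] U) where
    go : ∀ k → length U ≤ k → (∃ λ l → ∃₂ λ v r → U ≡ l ++ v ∷ r × ¬ NzL F (base y ∷ bases (l ++ r))) ⊎ (∀ l v r → U ≡ l ++ v ∷ r → NzL F (base y ∷ bases (l ++ r))) → ∃ λ U' → All (_∈ U) U' × Minimal U'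
    go _ _ (inr f) = U , All.tabulate (λ m → m) , nzU , dep , f
    go zero le (inl (l , v , r , refl , h)) = ⊥-elim (ℕP.1+n≰n {0} (≤-trans (≤-trans (s≤s z≤n) (≤-reflexive (sym (↭-length (PermP.shift v l r))))) le))
    go (suc k) le (inl (l , v , r , refl , h)) = up (minimal k (l ++ r) (ℕ.s≤s⁻¹ (≤-trans (≤-reflexive (sym (↭-length (PermP.shift v l r)))) le))
      (subst (NzL F) (sym (map-++ base l r)) (NzL-drop (bases l) (b∈ v) (subst (NzL F) (map-++ base l (v ∷ r)) nzU))) h) where
     up : (∃ λ U' → All (_∈ (l ++ r)) U' × Minimal U') → ∃ λ U' → All (_∈ (l ++ v ∷ r)) U' × Minimal U'
     up (U' , sub , m) = U' , All.map (λ mu → ∈-resp-↭ (↭-sym (PermP.shift v l r)) (there mu)) sub , m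

   -- In a circuit each member can be exchanged for `y`. A zero minor would be a zero coefficient in
   -- the expansion of `y`, which would then depend on the other members.
   nonvanishing : ∀ {U w} → Minimal U → Ms w → 0≢ (D F (bases U ++ w)) → ∀ l v r → U ≡ l ++ v ∷ r → 0≢ (D F (base y ∷ bases l ++ bases r ++ w))
   nonvanishing {U} {w} (_ , dep , mn) mw dw l v r eqU e0 = fin (mn l v r eqU) where
    Tl = bases U
    G : List V → ℤ
    G ys = D F (base y ∷ ys)
    eqT : Tl ≡ bases l ++ base v ∷ bases r
    eqT = trans (cong bases eqU) (map-++ base l (v ∷ r))
    fin : NzL F (base y ∷ bases (l ++ r)) → ⊥
    fin (z , mz , d) = *≢0 dw d' (trans (spanned F (base y) Tl w mw (¬NzL F dep) u) (coefs-dot-0 G Tl w (λ x → D F (x ∷ u)) zero-or)) where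
     u : List V
     u = bases (l ++ r) ++ z
     d' : 0≢ (D F (base y ∷ u))
     d' = d
     zero-or : ∀ l' t r' → Tl ≡ l' ++ t ∷ r' → G (l' ++ r' ++ w) ≡ + 0 ⊎ D F (t ∷ u) ≡ + 0
     zero-or l' t r' eq' = go (∈-≡ (bases l) (subst (t ∈_) (trans (sym eq') eqT) (∈-mid l' t r'))) where
      go : t ≡ base v ⊎ t ∈ bases l ++ bases r → G (l' ++ r' ++ w) ≡ + 0 ⊎ D F (t ∷ u) ≡ + 0
      go (inr m) = inr (D-mem F (∈-++⁺ˡ (subst (t ∈_) (sym (map-++ base l r)) m)))
      go (inl refl) = inl (perm-0 F (↭-prep (base y) (subst₂ _↭_ (++-assoc (bases l) (bases r) w) (++-assoc l' r' w)
       (++⁺ʳ w (drop-mid (bases l) l' (subst (_↭ l' ++ base v ∷ r') eqT (subst (Tl ↭_) eq' ↭-refl)))))) e0)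

   range-lower : ∀ {U w} → Minimal U → All (λ v → ∣ τ v ∣ ≡ 2) (y ∷ U) → Ms w → 0≢ (D F (bases U ++ w)) → 2 ℕ.* suc (length U) ≤ R (D C) (y ∷ U) w
   range-lower {U} {w} M ts mw dw = R-lower (D C) (y ∷ U) w ts nv where
    nv : ∀ l v r → y ∷ U ≡ l ++ v ∷ r → 0≢ (D C (bases l ++ e ∷ bases r ++ w))
    nv [] _ _ refl = dw
    nv (_ ∷ l) v r refl = perm-≢ C (↭-sym (PermP.shift e (base y ∷ bases l) (bases r ++ w))) (nonvanishing M mw dw l v r refl)

   Shifts : V → Shift → Set
   Shifts h v = ∃ λ θ → Vary C e (base v) h θ

   uncons : ∀ {v vs hs} → Choice (v ∷ vs) hs → ∃₂ λ h hs' → hs ≡ h ∷ hs' × Shifts h v × Choice vs hs'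
   uncons {v} (keepB c) = _ , _ , refl , (+ 0 , mkV λ z → l (D C (base v ∷ z)) (D C (e ∷ z))) , c where
    l = ring-164
   uncons {v} (flip c) = _ , _ , refl , (τ v , vary v) , c

   choice₃ : ∀ {u v w hs} → Choice (u ∷ v ∷ w ∷ []) hs → ∃ λ h₀ → ∃₂ λ h₁ h₂ → hs ≡ h₀ ∷ h₁ ∷ h₂ ∷ [] × Shifts h₀ u × Shifts h₁ v × Shifts h₂ w
   choice₃ ch with uncons ch
   ... | h₀ , _ , refl , s₀ , ch₁ with uncons ch₁
   ...   | h₁ , _ , refl , s₁ , ch₂ with uncons ch₂
   ...     | h₂ , _ , refl , s₂ , [] = h₀ , h₁ , h₂ , refl , s₀ , s₁ , s₂

   choice₄ : ∀ {u v w x hs} → Choice (u ∷ v ∷ w ∷ x ∷ []) hs → ∃ λ h₀ → ∃ λ h₁ → ∃₂ λ h₂ h₃ → hs ≡ h₀ ∷ h₁ ∷ h₂ ∷ h₃ ∷ [] × Shifts h₀ u × Shifts h₁ v × Shifts h₂ w × Shifts h₃ x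
   choice₄ ch with uncons ch
   ... | h₀ , _ , refl , s₀ , ch₁ with choice₃ ch₁
   ...   | h₁ , h₂ , h₃ , refl , s₁ , s₂ , s₃ = h₀ , h₁ , h₂ , h₃ , refl , s₀ , s₁ , s₂ , s₃

   tuple-heavy : ∀ {h hs T w δ p} → Ms (h ∷ hs) → suc (length hs) ≤ 4 → 0≢ p → (∀ z → p * D C (h ∷ hs ++ z) ≡ δ * D C (T ++ z)) → Ms w → ∣ D C (T ++ w) ∣ ≡ 1 → ∣ D C (h ∷ hs ++ w) ∣ ≡ 2 → ⊥
   tuple-heavy {h} {hs} {T} {w} {δ} mh le p0 prop mw h1 h2 = nh h hs mh le ((λ {z} _ → proportional-even C {h ∷ hs} {T} {w} {δ} p0 prop h2 h1 z) , w , mw , abs2-≢ h2)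

   dep-C : ∀ (U : List Shift) → ¬ NzL F (base y ∷ bases U) → ∀ {z} → Ms z → D C (base y ∷ e ∷ bases U ++ z) ≡ + 0
   dep-C U dep mz = trans (alt C [] (base y) e _) (cong -_ (¬NzL F dep mz))

   row₀ : ∀ {h θ} → Vary C e (base y) h θ → ∀ {d} → PM1 d → ∀ {g} z → d * D C (base y ∷ z) ≡ g → + 2 * D C (h ∷ z) ≡ + 2 * (d * g) + θ * D C (e ∷ z)
   row₀ {h} {θ} v pd z eq = trans (at v z) (cong (λ t → + 2 * t + θ * D C (e ∷ z)) (PM1-scale pd eq))

   -- The chosen vectors lie in the span of `T₃`, so their minors are proportional to those of `T₃`;
   -- a value ±2 against ±1 makes the tuple heavy.
   no-circuit₂ : ∀ {u₁ u₂ w h₀ h₁ h₂} → ¬ NzL F (base y ∷ base u₁ ∷ base u₂ ∷ []) → Ms w → ∣ D F (base u₁ ∷ base u₂ ∷ w) ∣ ≡ 1 → Ms (h₀ ∷ h₁ ∷ h₂ ∷ []) →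
          Shifts h₀ y → Shifts h₁ u₁ → Shifts h₂ u₂ → ∣ D C (h₀ ∷ h₁ ∷ h₂ ∷ w) ∣ ≡ 2 → ⊥
   no-circuit₂ {u₁} {u₂} {w} {h₀} {h₁} {h₂} dep mw d1 mh (θ₀ , v₀) (θ₁ , v₁) (θ₂ , v₂) h2 = fin (coefs (λ ys → D C (base y ∷ ys)) T₃ w) sp (coefs-length (λ ys → D C (base y ∷ ys)) T₃ w) where
    d = D C (e ∷ base u₁ ∷ base u₂ ∷ w)
    T₃ : List V
    T₃ = e ∷ base u₁ ∷ base u₂ ∷ []
    sp : ∀ z → d * D C (base y ∷ z) ≡ dot (coefs (λ ys → D C (base y ∷ ys)) T₃ w) (map (λ x → D C (x ∷ z)) T₃)
    sp = spanned C (base y) T₃ w mw (dep-C (u₁ ∷ u₂ ∷ []) dep)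
    fin : ∀ cs → (∀ z → d * D C (base y ∷ z) ≡ dot cs (map (λ x → D C (x ∷ z)) T₃)) → length cs ≡ 3 → ⊥
    fin (c₀ ∷ c₁ ∷ c₂ ∷ []) sp _ = tuple-heavy {h₀} {h₁ ∷ h₂ ∷ []} {T₃} {w} {detP 3 cols} {pow2 3} mh (s≤s (s≤s (s≤s z≤n))) (λ ())
      (λ z → expand (D C) (alt C) (h₀ ∷ h₁ ∷ h₂ ∷ []) cols refl
       ((λ z → trans (row₀ v₀ {d} (abs1 {d} d1) z (sp z)) (r0 d c₀ c₁ c₂ θ₀ (D C (e ∷ z)) (D C (base u₁ ∷ z)) (D C (base u₂ ∷ z)))) ,
        (λ z → trans (at v₁ z) (r1 θ₁ (D C (e ∷ z)) (D C (base u₁ ∷ z)) (D C (base u₂ ∷ z)))) ,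
        (λ z → trans (at v₂ z) (r2 θ₂ (D C (e ∷ z)) (D C (base u₁ ∷ z)) (D C (base u₂ ∷ z)))) , tt) z) mw d1 h2 where
     cols : Cols
     cols = (e , + 2 * (d * c₀) + θ₀ ∷ θ₁ ∷ θ₂ ∷ []) ∷ (base u₁ , + 2 * (d * c₁) ∷ + 2 ∷ + 0 ∷ []) ∷ (base u₂ , + 2 * (d * c₂) ∷ + 0 ∷ + 2 ∷ []) ∷ []
     r0 = ring-165
     r1 = ring-166
     r2 = ring-167

   no-circuit₃ : ∀ {u₁ u₂ u₃ w h₀ h₁ h₂ h₃} → ¬ NzL F (base y ∷ base u₁ ∷ base u₂ ∷ base u₃ ∷ []) → Ms w → ∣ D F (base u₁ ∷ base u₂ ∷ base u₃ ∷ w) ∣ ≡ 1 → Ms (h₀ ∷ h₁ ∷ h₂ ∷ h₃ ∷ []) →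
          Shifts h₀ y → Shifts h₁ u₁ → Shifts h₂ u₂ → Shifts h₃ u₃ → ∣ D C (h₀ ∷ h₁ ∷ h₂ ∷ h₃ ∷ w) ∣ ≡ 2 → ⊥
   no-circuit₃ {u₁} {u₂} {u₃} {w} {h₀} {h₁} {h₂} {h₃} dep mw d1 mh (θ₀ , v₀) (θ₁ , v₁) (θ₂ , v₂) (θ₃ , v₃) h2 = fin (coefs (λ ys → D C (base y ∷ ys)) T₄ w) sp (coefs-length (λ ys → D C (base y ∷ ys)) T₄ w) where
    d = D C (e ∷ base u₁ ∷ base u₂ ∷ base u₃ ∷ w)
    T₄ : List V
    T₄ = e ∷ base u₁ ∷ base u₂ ∷ base u₃ ∷ []
    sp : ∀ z → d * D C (base y ∷ z) ≡ dot (coefs (λ ys → D C (base y ∷ ys)) T₄ w) (map (λ x → D C (x ∷ z)) T₄)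
    sp = spanned C (base y) T₄ w mw (dep-C (u₁ ∷ u₂ ∷ u₃ ∷ []) dep)
    fin : ∀ cs → (∀ z → d * D C (base y ∷ z) ≡ dot cs (map (λ x → D C (x ∷ z)) T₄)) → length cs ≡ 4 → ⊥
    fin (c₀ ∷ c₁ ∷ c₂ ∷ c₃ ∷ []) sp _ = tuple-heavy {h₀} {h₁ ∷ h₂ ∷ h₃ ∷ []} {T₄} {w} {detP 4 cols} {pow2 4} mh ≤-refl (λ ())
      (λ z → expand (D C) (alt C) (h₀ ∷ h₁ ∷ h₂ ∷ h₃ ∷ []) cols refl
       ((λ z → trans (row₀ v₀ {d} (abs1 {d} d1) z (sp z)) (r0 d c₀ c₁ c₂ c₃ θ₀ (D C (e ∷ z)) (D C (base u₁ ∷ z)) (D C (base u₂ ∷ z)) (D C (base u₃ ∷ z)))) ,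
        (λ z → trans (at v₁ z) (r1 θ₁ (D C (e ∷ z)) (D C (base u₁ ∷ z)) (D C (base u₂ ∷ z)) (D C (base u₃ ∷ z)))) ,
        (λ z → trans (at v₂ z) (r2 θ₂ (D C (e ∷ z)) (D C (base u₁ ∷ z)) (D C (base u₂ ∷ z)) (D C (base u₃ ∷ z)))) ,
        (λ z → trans (at v₃ z) (r3 θ₃ (D C (e ∷ z)) (D C (base u₁ ∷ z)) (D C (base u₂ ∷ z)) (D C (base u₃ ∷ z)))) , tt) z) mw d1 h2 where
     cols : Cols
     cols = (e , + 2 * (d * c₀) + θ₀ ∷ θ₁ ∷ θ₂ ∷ θ₃ ∷ []) ∷ (base u₁ , + 2 * (d * c₁) ∷ + 2 ∷ + 0 ∷ + 0 ∷ []) ∷ (base u₂ , + 2 * (d * c₂) ∷ + 0 ∷ + 2 ∷ + 0 ∷ []) ∷ (base u₃ , + 2 * (d * c₃) ∷ + 0 ∷ + 0 ∷ + 2 ∷ []) ∷ []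
     r0 = ring-168
     r1 = ring-169
     r2 = ring-170
     r3 = ring-171

   bases-Ms : ∀ (U : List Shift) → Ms (bases U)
   bases-Ms [] = []
   bases-Ms (v ∷ U) = b∈ v ∷ bases-Ms U

   -- The range of D over the choices of a minimal dependent set is at least its size, and at most 4.
   no-circuit : Nz F (base y) → ∀ U → All (λ v → ∣ τ v ∣ ≡ 2) (y ∷ U) → All (λ v → Ind2 F (base y) (base v)) U → Minimal U → ⊥
   no-circuit ny [] _ _ (_ , dep , _) = dep ny
   no-circuit ny (u ∷ []) _ (i ∷ _) (_ , dep , _) = dep i
   no-circuit ny U@(_ ∷ _ ∷ _) ts is M@((w , mw , dw) , dep , _) = go U refl where
    le4 : suc (length U) ≤ 4
    le4 = *-cancelˡ-≤ 2 (≤-trans (range-lower M ts mw dw) (range≤8 (y ∷ U) mw))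
    Ends' : List Shift → Set
    Ends' U' = ∃ λ w → Ms w × ∣ D F (bases U' ++ w) ∣ ≡ 1 × (∃ λ hs → Choice (y ∷ U') hs × ∣ D C (hs ++ w) ∣ ≡ 2)
    -- From three members on, the range forces a value ±2, at a completion for which the minor of
    -- `e` and the bases is odd.
    ends : 3 ≤ suc (length U) → Ends' U
    ends ge = fin (odd-wit C nh e (bases U) (me ∷ bases-Ms U) (≤-trans (≤-reflexive (cong suc (length-map base U))) le4) (fst M)) where
     fin : (∃ λ w → Ms w × par (D C (e ∷ bases U ++ w)) ≡ true) → Ends' U
     fin (w' , mw' , o) = fin2 (spread (D C) (alt C) varyD (y ∷ U) w') where
      d1 : ∣ D F (bases U ++ w') ∣ ≡ 1
      d1 = odd-abs {D F (bases U ++ w')} o (bdd C (me ∷ AllP.++⁺ (bases-Ms U) mw'))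
      dw' : 0≢ (D F (bases U ++ w'))
      dw' e0 = PM1-≢ (abs1 d1) e0
      six : 6 ≤ R (D C) (y ∷ U) w'
      six = ≤-trans (*-monoʳ-≤ 2 ge) (range-lower M ts mw' dw')
      fin2 : (∃₂ λ hi lo → Choice (y ∷ U) hi × Choice (y ∷ U) lo × + 2 * (D C (hi ++ w') - D C (lo ++ w')) ≡ + R (D C) (y ∷ U) w') → Ends' U
      fin2 (hi , lo , ch , cl , eq) = pick (sum-two {D C (hi ++ w')} {D C (lo ++ w')} (bdd C (AllP.++⁺ (choice-Ms ch) mw')) (bdd C (AllP.++⁺ (choice-Ms cl) mw')) eq six) where
       pick : ∣ D C (hi ++ w') ∣ ≡ 2 ⊎ ∣ D C (lo ++ w') ∣ ≡ 2 → Ends' U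
       pick (inl h) = w' , mw' , d1 , hi , ch , h
       pick (inr h) = w' , mw' , d1 , lo , cl , h
    go : ∀ U' → U' ≡ U → ⊥
    go (u₁ ∷ u₂ ∷ []) refl = use (ends ≤-refl) where
     use : Ends' (u₁ ∷ u₂ ∷ []) → ⊥
     use (w , mw , d1 , hs , ch , h2) with choice₃ ch
     ... | h₀ , h₁ , h₂ , refl , s₀ , s₁ , s₂ = no-circuit₂ {u₁} {u₂} dep mw d1 (choice-Ms ch) s₀ s₁ s₂ h2
    go (u₁ ∷ u₂ ∷ u₃ ∷ []) refl = use (ends (ℕP.n≤1+n 3)) where
     use : Ends' (u₁ ∷ u₂ ∷ u₃ ∷ []) → ⊥
     use (w , mw , d1 , hs , ch , h2) with choice₄ ch
     ... | h₀ , h₁ , h₂ , h₃ , refl , s₀ , s₁ , s₂ , s₃ = no-circuit₃ {u₁} {u₂} {u₃} dep mw d1 (choice-Ms ch) s₀ s₁ s₂ s₃ h2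
    go (_ ∷ _ ∷ _ ∷ _ ∷ _) refl = absurd le4 where
     absurd : ∀ {k} → ¬ (suc (suc (suc (suc (suc k)))) ≤ 4)
     absurd (s≤s (s≤s (s≤s (s≤s ()))))

  shifts-independent : Nz C e → ∀ U → All (λ v → ∣ τ v ∣ ≡ 2) U → All (λ v → Nz F (base v)) U → AllPairs (λ u v → Ind2 F (base u) (base v)) U → NzL F (bases U)
  shifts-independent ne [] _ _ _ = ne
  shifts-independent ne (y ∷ U) (t ∷ ts) (n₀ ∷ ns) (i ∷ is) = go (NzL? F (base y ∷ bases U)) where
   ih = shifts-independent ne U ts ns is
   go : Dec (NzL F (base y ∷ bases U)) → NzL F (base y ∷ bases U)
   go (yes h) = h
   go (no h) = let (U' , sub , M) = minimal y (length U) U ≤-refl ih h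
         in ⊥-elim (no-circuit y n₀ U' (t ∷ All.map (All-∈ ts) sub) (All.map (All-∈ i) sub) M)

 -- The crude bound and the induction over the rank

 -- The numerators in Cramer's rule for a fixed basis are minors, so they lie between -2 and 2, and
 -- they determine the vector.
 crude : ∀ {n} (C : Config n) {xs} → Simple C xs → length xs ≤ length (boxes n)
 crude C {[]} s = z≤n
 crude {n} C {x ∷ xs} s with nz s
 ... | (w , mw , d) ∷ _ = coded {R = Ind2 C} {Code = λ y k → k ≡ code y} (boxes n) (x ∷ xs) (ap s) (All.tabulate (λ m → code _ , mem-box (All-∈ (mem s) m) , refl)) same where
  b : List V
  b = x ∷ w
  mb : Ms b
  mb = All.head (mem s) ∷ mw
  len : length b ≡ n
  len = rank C b d
  d' : 0≢ (D C (b ++ []))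
  d' = subst (λ t → 0≢ (D C t)) (sym (++-identityʳ b)) d
  G : V → List V → ℤ
  G y ys = D C (y ∷ ys)
  code : V → List ℤ
  code y = coefs (G y) b []
  mem-box : ∀ {y} → y ∈ A → code y ∈ boxes n
  mem-box {y} my = subst (λ k → code y ∈ boxes k) (trans (coefs-length (G y) b []) len)
   (boxes-∈ (coefs-All (λ a → ∣ a ∣ ≤ 2) (λ {a} h → subst (_≤ 2) (sym (∣-i∣≡∣i∣ a)) h) (G y) b [] λ l t r eq →
    let ml = AllP.++⁻ l (subst Ms eq mb) in bdd C (my ∷ AllP.++⁺ (fst ml) (AllP.++⁺ (All.tail (snd ml)) []))))
  dep : ∀ y {z} → Ms z → D C (y ∷ b ++ z) ≡ + 0
  dep y {z} _ = go (D C (y ∷ b ++ z) ℤ.≟ + 0) where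
   go : Dec (D C (y ∷ b ++ z) ≡ + 0) → D C (y ∷ b ++ z) ≡ + 0
   go (yes e) = e
   go (no h) = ⊥-elim (<-irrefl refl (≤-trans (s≤s (≤-trans (≤-reflexive (sym len)) (ℕP.m≤m+n (length b) (length z)))) (≤-reflexive (trans (cong suc (sym (length-++ b))) (rank C _ h)))))
  same : ∀ {y y' k} → y ∈ x ∷ xs → y' ∈ x ∷ xs → k ≡ code y → k ≡ code y' → ¬ Ind2 C y y'
  same {y} {y'} _ _ e e' = Pm-dep C {y} {y'} (inl (λ z → cancel-≡ {D C (b ++ [])} _ _ d' (trans (spanned C y' b [] [] (dep y') z)
   (trans (cong (λ cs → dot cs (map (λ v → D C (v ∷ z)) b)) (trans (sym e') e)) (sym (spanned C y b [] [] (dep y) z))))))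

 -- The surplus points are unit displacements along `e` whose classes are independent, so the rank
 -- of the contraction bounds their number.
 sparse-bound : ∀ {n} (C : Config (suc n)) → NoHeavy C 4 → ∀ {e} (me : e ∈ A) → Nz C e → ∀ {xs} → Simple C xs → ∃ λ rs → Simple (C ⟋ me) rs × length xs ≤ 1 ℕ.+ (length rs ℕ.+ n)
 sparse-bound {n} C nh {e} me ne {xs} sx = go (split C me ne sx) where
  F = C ⟋ me
  go : Split C me xs → ∃ λ rs → Simple F rs × length xs ≤ 1 ℕ.+ (length rs ℕ.+ n)
  go S = Split.reps S , Split.simp' S , ≤-trans (split-length S) (s≤s (+-monoʳ-≤ (length (Split.reps S)) exs≤n)) where
   open Split S using (exs)
   open SplitFacts S
   open Sparse C nh me ne using (UnitShift; line; exs-ind)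
   shiftOf : ∀ {p} → p ∈ exs → Σ (Vr C e) λ v → base v ≡ fst p × ∣ τ v ∣ ≡ 2
   shiftOf {x , ρ} m = mk (line S m) where
    abs-2 : ∀ {t} → PM2 t → ∣ t ∣ ≡ 2
    abs-2 pm+ = refl
    abs-2 pm- = refl
    mk : UnitShift x ρ → Σ (Vr C e) λ v → base v ≡ x × ∣ τ v ∣ ≡ 2
    mk (y , t , my , pt' , _ , v) = vr x y t (x∈A m) my v , refl , abs-2 pt'
   record Built (ps : List (V × V)) : Set where
    field
     U   : List (Vr C e)
     len : length U ≡ length ps
     ts  : All (λ v → ∣ τ v ∣ ≡ 2) U
     ns  : All (λ v → Nz F (base v)) U
     is  : AllPairs (λ u v → Ind2 F (base u) (base v)) U
     src : All (λ v → ∃ λ p → p ∈ ps × base v ≡ fst p) U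
   build : ∀ ps → (∀ {p} → p ∈ ps → p ∈ exs) → AllPairs (λ p q → Ind2 C (fst p) (fst q)) ps → Built ps
   build [] _ _ = record { U = [] ; len = refl ; ts = [] ; ns = [] ; is = [] ; src = [] }
   build (p ∷ ps) sub (a ∷ aps) = add (build ps (λ m → sub (there m)) aps) (shiftOf (sub (here refl))) where
    add : Built ps → (Σ (Vr C e) λ v → base v ≡ fst p × ∣ τ v ∣ ≡ 2) → Built (p ∷ ps)
    add B (v , eq , t) = record { U = v ∷ U ; len = cong suc len ; ts = t ∷ ts ; ns = subst (Nz F) (sym eq) (x-nz (sub (here refl))) ∷ ns
      ; is = All.map (λ {u} → ind {u}) src ∷ is
      ; src = (p , here refl , eq) ∷ All.map (λ { (q , mq , eq') → q , there mq , eq' }) src } where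
     open Built B
     ind : ∀ {u} → (∃ λ q → q ∈ ps × base u ≡ fst q) → Ind2 F (base v) (base u)
     ind (q , mq , eq') = subst₂ (Ind2 F) (sym eq) (sym eq') (exs-ind S (sub (here refl)) (sub (there mq)) (All-∈ a mq))
   exs≤n : length exs ≤ n
   exs≤n = fin (build exs (λ m → m) exs-ap) where
    fin : Built exs → length exs ≤ n
    fin B = fin2 (Circuits.shifts-independent C nh me ne U ts ns is) where
     open Built B
     fin2 : NzL F (map base U) → length exs ≤ n
     fin2 (z , mz , d) = ≤-trans (≤-reflexive (trans (sym len) (sym (length-map base U)))) (≤-trans (ℕP.m≤m+n (length (map base U)) (length z)) (≤-reflexive (trans (sym (length-++ (map base U))) (rank F _ d))))

 crude₆ : ∀ (C : Config 6) {xs} → Simple C xs → length xs ≤ K₀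
 crude₆ C s = ≤-trans (crude C s) boxes≤K₀

 -- A heavy set gives the bound without surplus; only the sparse case inherits the surplus of the
 -- contraction, reduced by one. From rank 7 on, the requirement 2 ≤ N of the heavy cases holds.
 upper : ∀ j (C : Config (6 ℕ.+ j)) {xs} → Simple C xs → length xs ≤ f1 (5 ℕ.+ j) ℕ.+ (K₀ ∸ j)
 upper zero C s = ≤-trans (crude₆ C s) (ℕP.m≤n+m K₀ (f1 5))
 upper (suc j) C {[]} s = z≤n
 upper (suc j) C {x ∷ xs} s = go (heavy? C 1) (heavy? C 2) (heavy? C 3) (heavy? C 4) where
  N≥2 : ∀ {k} → 2 ≤ 2 ℕ.+ k
  N≥2 = s≤s (s≤s z≤n)
  weak : suc (length xs) ≤ f1 (6 ℕ.+ j) → suc (length xs) ≤ f1 (6 ℕ.+ j) ℕ.+ (K₀ ∸ suc j)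
  weak h = ≤-trans h (ℕP.m≤m+n (f1 (6 ℕ.+ j)) (K₀ ∸ suc j))
  H : ℕ → Set
  H k = Dec (∃ λ S → Ms S × length S ≡ k × Heavy C S)
  go : H 1 → H 2 → H 3 → H 4 → suc (length xs) ≤ f1 (6 ℕ.+ j) ℕ.+ (K₀ ∸ suc j)
  go (yes (_ ∷ [] , m ∷ [] , _ , (ev , nv))) _ _ _ = weak (thm1 (6 ℕ.+ j) C m ev nv s)
  go (no h₁) (yes (_ ∷ _ ∷ [] , m ∷ m' ∷ [] , _ , h)) _ _ = weak (thm2 (5 ℕ.+ j) N≥2 C m m' h s)
  go (no h₁) (no h₂) (yes (_ ∷ _ ∷ _ ∷ [] , m ∷ m' ∷ m'' ∷ [] , _ , h)) _ = weak (thm3 (4 ℕ.+ j) N≥2 C m m' m'' h s)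
  go (no h₁) (no h₂) (no h₃) (yes (_ ∷ _ ∷ _ ∷ _ ∷ [] , m ∷ m' ∷ m'' ∷ m''' ∷ [] , _ , h)) =
   weak (thm4-min (3 ℕ.+ j) N≥2 C m m' m'' m''' h (no-heavy-suc C (no-heavy-suc C (no-heavy-suc C (no-heavy₀ C) h₁) h₂) h₃) s)
  go (no h₁) (no h₂) (no h₃) (no h₄) = fin (sparse-bound C (no-heavy-suc C (no-heavy-suc C (no-heavy-suc C (no-heavy-suc C (no-heavy₀ C) h₁) h₂) h₃) h₄) mx (All.head (nz s)) s) where
   mx = All.head (mem s)
   fin : (∃ λ rs → Simple (C ⟋ mx) rs × suc (length xs) ≤ 1 ℕ.+ (length rs ℕ.+ (6 ℕ.+ j))) → suc (length xs) ≤ f1 (6 ℕ.+ j) ℕ.+ (K₀ ∸ suc j)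
   fin (rs , srs , h) = subst (λ t → suc (length xs) ≤ t ℕ.+ (K₀ ∸ suc j)) (sym (f1-suc (5 ℕ.+ j))) (surplus K₀ j {suc (length xs)} {length rs} {f1 (5 ℕ.+ j)} h (upper j (C ⟋ mx) srs))

-- Determinants as deletion sums

-- Interchange of two finite sums: the deletions act on different lists, so their signs are
-- independent.
W-swap : ∀ {X Y : Set} (φ : X → ℤ) (ψ : Y → ℤ) (H : List Y → List X → ℤ) ys xs →
     W φ (λ us → W ψ (λ vs → H vs us) ys) xs ≡ W ψ (λ vs → W φ (H vs) xs) ys
W-swap φ ψ H [] xs = W-vanish φ _ xs (λ _ x _ _ → *-zeroʳ (φ x))
W-swap φ ψ H (y ∷ ys) xs = trans (W-cong (λ _ → refl) (λ us → l (ψ y * H ys us) _) xs)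
 (trans (W-linʳ φ (+ 1) (λ us → ψ y * H ys us) (- + 1) (λ us → W ψ (λ vs → H (y ∷ vs) us) ys) xs)
  (trans (cong₂ (λ s t → + 1 * s + (- + 1) * t)
    (trans (W-cong (λ _ → refl) (λ us → z (ψ y) (H ys us)) xs) (trans (W-linʳ φ (ψ y) (H ys) (+ 0) (H ys) xs) (sym (z (ψ y) (W φ (H ys) xs)))))
    (W-swap φ ψ (λ vs → H (y ∷ vs)) ys xs))
   (sym (l (ψ y * W φ (H ys) xs) _)))) where
 l = ring-172
 z = ring-173

-- The expansion of `det` along the first row, as a function of its own.
laplace : ∀ k (M : Matrix (suc k) (suc k)) l → ℤ → (Fin l → Fin (suc k)) → ℤ
laplace k M zero s c = + 0
laplace k M (suc l) s c =
 s * M zero (c zero) * det k (λ i j → M (suc i) (Fin.punchIn (c zero) j)) + laplace k M l (- s) (λ i → c (suc i))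

mask : ∀ {n} → Matrix n n → Matrix n n
mask N zero zero = + 0
mask N zero (suc zero) = + 0
mask N i j = N i j

-- The loop local to det has no name outside Defs.  The underscore in the type of
-- det-loop stands for it: probe makes the first two summands of a determinant
-- vanish and abstracts everything but the loop, so that the underscore is
-- determined by unification.
mutual
 det-loop : ∀ k (M : Matrix (suc k) (suc k)) l s (c : Fin l → Fin (suc k)) → _ ≡ laplace k M l s c

 probe : ∀ x (N : Matrix (suc (suc x)) (suc (suc x))) → det (suc (suc x)) (mask N) ≡ det (suc (suc x)) (mask N)
 probe x N with _+_ | suc x | mask N | + 1 | (λ (i : Fin x) → Fin.suc (Fin.suc i))
 ... | f | w | M | s | c = cong (λ t → f (+ 0) (f (+ 0) t)) (trans (det-loop w M x s c) (sym (det-loop w M x s c)))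

 det-loop k M zero s c = refl
 det-loop k M (suc l) s c = cong (λ t → s * M zero (c zero) * det k (λ i j → M (suc i) (Fin.punchIn (c zero) j)) + t)
  (det-loop k M l (- s) (λ i → c (suc i)))

det-laplace : ∀ k (M : Matrix (suc k) (suc k)) → det (suc k) M ≡ laplace k M (suc k) (+ 1) (λ j → j)
det-laplace k M = det-loop k M (suc k) (+ 1) (λ j → j)

det-cong : ∀ k {M N : Matrix k k} → (∀ i j → M i j ≡ N i j) → det k M ≡ det k N
det-cong zero h = refl
det-cong (suc k) {M} {N} h = trans (det-laplace k M) (trans (go (suc k) (+ 1) (λ j → j)) (sym (det-laplace k N))) where
 go : ∀ l s (c : Fin l → Fin (suc k)) → laplace k M l s c ≡ laplace k N l s c
 go zero s c = refl
 go (suc l) s c = cong₂ _+_ (cong₂ (λ a b → s * a * b) (h zero (c zero)) (det-cong k (λ i j → h (suc i) (Fin.punchIn (c zero) j)))) (go l (- s) (λ i → c (suc i)))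

del : {X : Set} → ℕ → List X → List X
del n [] = []
del zero (x ∷ xs) = xs
del (suc n) (x ∷ xs) = x ∷ del n xs

tabulate-punchIn : ∀ {X : Set} {k} (g : Fin (suc k) → X) i → tabulate (λ j → g (Fin.punchIn i j)) ≡ del (Fin.toℕ i) (tabulate g)
tabulate-punchIn g zero = refl
tabulate-punchIn {k = suc k} g (suc i) = cong (g zero ∷_) (tabulate-punchIn (λ j → g (suc j)) i)

module Minors {I V : Set} (p : I → V → ℤ) where

 -- The determinant with entries `p i x`, expanded along one index after the other; lists of
 -- different lengths give 0.
 Δ : List I → List V → ℤ
 Δ [] [] = + 1
 Δ [] (_ ∷ _) = + 0
 Δ (i ∷ is) xs = W (p i) (Δ is) xs

 -- Expansion along a vector instead of an index, that is the determinant of the transpose, by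
 -- exchanging two expansions.
 Δ-row : ∀ is x xs → Δ is (x ∷ xs) ≡ W (λ i → p i x) (λ js → Δ js xs) is
 Δ-row [] x xs = refl
 Δ-row (i ∷ is) x xs = cong (λ t → p i x * Δ is xs - t)
  (trans (W-cong (λ _ → refl) (Δ-row is x) xs) (W-swap (p i) (λ j → p j x) Δ is xs))

 Δ-lin : ∀ a u b v w → (∀ i → p i w ≡ a * p i u + b * p i v) →
     ∀ is us zs → Δ is (us ++ w ∷ zs) ≡ a * Δ is (us ++ u ∷ zs) + b * Δ is (us ++ v ∷ zs)
 Δ-lin a u b v w h is [] zs = trans (Δ-row is w zs) (trans (W-cong h (λ _ → refl) is)
  (trans (W-linˡ a (λ i → p i u) b (λ i → p i v) (λ js → Δ js zs) is)
   (sym (cong₂ (λ s t → a * s + b * t) (Δ-row is u zs) (Δ-row is v zs)))))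
 Δ-lin a u b v w h is (x ∷ us) zs = trans (Δ-row is x _) (trans (W-cong (λ _ → refl) (λ js → Δ-lin a u b v w h js us zs) is)
  (trans (W-linʳ (λ i → p i x) a (λ js → Δ js (us ++ u ∷ zs)) b (λ js → Δ js (us ++ v ∷ zs)) is)
   (sym (cong₂ (λ s t → a * s + b * t) (Δ-row is x (us ++ u ∷ zs)) (Δ-row is x (us ++ v ∷ zs))))))

 Δ-alt : ∀ is → Alt (Δ is)
 Δ-alt is [] u v zs = trans (two u v) (trans (W-anti (λ i → p i u) (λ i → p i v) (λ js → Δ js zs) is) (cong -_ (sym (two v u)))) where
  two : ∀ u v → Δ is (u ∷ v ∷ zs) ≡ W (λ i → p i u) (W (λ i → p i v) (λ js → Δ js zs)) is
  two u v = trans (Δ-row is u (v ∷ zs)) (W-cong (λ _ → refl) (λ js → Δ-row js v zs) is)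
 Δ-alt is (x ∷ us) u v zs = trans (Δ-row is x _) (trans (W-cong (λ _ → refl) (λ js → Δ-alt js us u v zs) is)
  (trans (W-neg (λ i → p i x) (λ js → Δ js (us ++ v ∷ u ∷ zs)) is) (cong -_ (sym (Δ-row is x (us ++ v ∷ u ∷ zs))))))

 Δ-rank : ∀ is xs → 0≢ (Δ is xs) → length xs ≡ length is
 Δ-rank [] [] h = refl
 Δ-rank [] (x ∷ xs) h = ⊥-elim (h refl)
 Δ-rank (i ∷ is) xs h = go (W-find (p i) (Δ is) xs h) where
  go : (∃ λ l → ∃₂ λ x r → xs ≡ l ++ x ∷ r × 0≢ (p i x) × 0≢ (Δ is (l ++ r))) → length xs ≡ suc (length is)
  go (l , x , r , refl , _ , q) = trans (↭-length (PermP.shift x l r)) (cong suc (Δ-rank is (l ++ r) q))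

 Δ-repeat : ∀ {i is} → i ∈ is → ∀ xs → Δ (i ∷ is) xs ≡ + 0
 Δ-repeat {i} {_ ∷ is} (here refl) xs = x≡-x⇒0 _ (W-anti (p i) (p i) (Δ is) xs)
 Δ-repeat {i} {j ∷ is} (there m) xs = trans (W-anti (p i) (p j) (Δ is) xs)
  (cong -_ (W-vanish (p j) _ xs (λ l x r _ → trans (cong (p j x *_) (Δ-repeat m (l ++ r))) (*-zeroʳ (p j x)))))

 -- Expanding the first factor along `x` turns the sum into a combination of determinants with a
 -- repeated index.
 Δ-plücker : ∀ is z xs → W (λ x → Δ is (x ∷ z)) (Δ is) xs ≡ + 0
 Δ-plücker is z xs = trans (W-cong (λ x → Δ-row is x z) (λ _ → refl) xs) (go is (λ js → Δ js z) (λ m → Δ-repeat m xs)) where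
  l = ring-174
  go : ∀ js (K : List I → ℤ) → (∀ {i} → i ∈ js → W (p i) (Δ is) xs ≡ + 0) → W (λ x → W (λ i → p i x) K js) (Δ is) xs ≡ + 0
  go [] K h = W-vanish _ (Δ is) xs (λ _ _ _ _ → refl)
  go (j ∷ js) K h = trans (W-cong (λ x → l (p j x) (K js) (W (λ i → p i x) (λ ks → K (j ∷ ks)) js)) (λ _ → refl) xs)
   (trans (W-linˡ (K js) (p j) (- + 1) (λ x → W (λ i → p i x) (λ ks → K (j ∷ ks)) js) (Δ is) xs)
    (trans (cong₂ (λ s t → K js * s + (- + 1) * t) (h (here refl)) (go js (λ ks → K (j ∷ ks)) (λ m → h (there m)))) (null (K js)))) where
   null = ring-175

 -- The first row of the matrix is the vector `x zero`, so `Δ-row` is the expansion that matches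
 -- `det`. In the loop, `G` keeps the columns already passed.
 det-Δ : ∀ k (g : Fin k → I) (x : Fin k → V) → det k (λ i j → p (g j) (x i)) ≡ Δ (tabulate g) (tabulate x)
 det-Δ zero g x = refl
 det-Δ (suc k) g x = trans (det-laplace k (λ i j → p (g j) (x i))) (trans (go (suc k) (+ 1) (λ j → j) H (λ i → cong H (tabulate-punchIn g i)))
   (trans (ℤP.*-identityˡ _) (sym (Δ-row (tabulate g) (x zero) xs)))) where
  xs : List V
  xs = tabulate (λ i → x (suc i))
  H : List I → ℤ
  H js = Δ js xs
  φ : I → ℤ
  φ i = p i (x zero)
  lem = ring-176
  go : ∀ l s (c : Fin l → Fin (suc k)) (G : List I → ℤ) → (∀ i → H (tabulate (λ j → g (Fin.punchIn (c i) j))) ≡ G (del (Fin.toℕ i) (tabulate (λ j → g (c j))))) →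
     laplace k (λ i j → p (g j) (x i)) l s c ≡ s * W φ G (tabulate (λ j → g (c j)))
  go zero s c G h = sym (*-zeroʳ s)
  go (suc l) s c G h = trans
   (cong₂ (λ d t → s * φ (g (c zero)) * d + t)
    (trans (det-Δ k (λ j → g (Fin.punchIn (c zero) j)) (λ i → x (suc i))) (h zero))
    (go l (- s) (λ i → c (suc i)) (λ js → G (g (c zero) ∷ js)) (λ i → h (suc i))))
   (lem s (φ (g (c zero))) _ _)

 Δ-clash : ∀ {k} (g : Fin k → I) {i j} → i Fin.< j → g i ≡ g j → ∀ xs → Δ (tabulate g) xs ≡ + 0
 Δ-clash g {zero} {suc j} _ e xs = Δ-repeat (subst (_∈ tabulate (λ i → g (suc i))) (sym e) (∈-tabulate⁺ {f = λ i → g (suc i)} j)) xs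
 Δ-clash g {suc i} {suc j} (s≤s lt) e xs = W-vanish (p (g zero)) _ xs
  (λ l x r _ → trans (cong (p (g zero) x *_) (Δ-clash (λ i → g (suc i)) lt e (l ++ r))) (*-zeroʳ (p (g zero) x)))

 Δ-diagonal : ∀ {k} (g : Fin k → I) (x : Fin k → V) → (∀ i → 0≢ (p (g i) (x i))) → (∀ i j → i ≢ j → p (g i) (x j) ≡ + 0) → 0≢ (Δ (tabulate g) (tabulate x))
 Δ-diagonal {zero} g x d o = λ ()
 Δ-diagonal {suc k} g x d o e = *≢0 (d zero) (Δ-diagonal (λ i → g (suc i)) (λ i → x (suc i)) (λ i → d (suc i)) (λ i j ne → o (suc i) (suc j) (λ q → ne (FinP.suc-injective q))))
  (trans (lem _ _) (trans (cong₂ _+_ e (W-vanish (p (g zero)) _ (tabulate (λ i → x (suc i))) van)) refl)) where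
  lem = ring-177
  off : All (λ y → p (g zero) y ≡ + 0) (tabulate (λ i → x (suc i)))
  off = AllP.tabulate⁺ (λ i → o zero (suc i) (λ ()))
  van : ∀ l y r → tabulate (λ i → x (suc i)) ≡ l ++ y ∷ r → p (g zero) y * Δ (tabulate (λ i → g (suc i))) (x zero ∷ (l ++ r)) ≡ + 0
  van l y r eq = cong (_* Δ (tabulate (λ i → g (suc i))) (x zero ∷ (l ++ r))) (All.head (snd (AllP.++⁻ l (subst (All _) eq off))))

-- From a matrix to a configuration

module Reduction {m n r} (A : Matrix m n) (rk : HasRank A r) (md : IsModular 2 r A) (sr : SimpleRows A) where

 Row : Set
 Row = Vec ℤ n

 comb : ℤ → Row → ℤ → Row → Row
 comb a u b v = Vec.zipWith (λ x y → a * x + b * y) u v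

 row : Fin m → Row
 row i = Vec.tabulate (A i)

 opp : Row → Row
 opp v = comb (- + 1) v (+ 0) v

 rows : List Row
 rows = tabulate row

 opp-opp : ∀ {k} (v : Vec ℤ k) → let o = λ (u : Vec ℤ k) → Vec.zipWith (λ x y → - + 1 * x + + 0 * y) u u in o (o v) ≡ v
 opp-opp Vec.[] = refl
 opp-opp (x Vec.∷ v) = cong₂ Vec._∷_ (lem x) (opp-opp v) where
  lem = ring-178

 space : Space
 space = record { V = Row ; lc = comb ; A = rows ++ map opp rows ; neg∈ = λ {v} mv → go v (∈-++⁻ rows mv) } where
  go : ∀ v → v ∈ rows ⊎ v ∈ map opp rows → opp v ∈ rows ++ map opp rows
  go v (inl q) = ∈-++⁺ʳ rows (∈-map⁺ opp q)
  go v (inr q) = fin (∈-map⁻ opp q) where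
   fin : (∃ λ w → w ∈ rows × v ≡ opp w) → opp v ∈ rows ++ map opp rows
   fin (w , mw , refl) = ∈-++⁺ˡ (subst (_∈ rows) (sym (opp-opp w)) mw)

 open Theory space using (Ms; Config; Simple; simple; Nz; Ind2)
 open Minors {Fin n} {Row} (λ j v → Vec.lookup v j)

 at-comb : ∀ a u b v j → Vec.lookup (comb a u b v) j ≡ a * Vec.lookup u j + b * Vec.lookup v j
 at-comb a u b v j = VecP.lookup-zipWith (λ x y → a * x + b * y) j u v

 entry : ∀ i j → Vec.lookup (row i) j ≡ A i j
 entry i j = VecP.lookup∘tabulate (A i) j

 -- Negating a row only changes the sign of a minor, so lists of signed rows have the absolute
 -- minors of lists of rows.
 unsigned : ∀ {z} → Ms z → ∃ λ fs → length fs ≡ length z × (∀ is us → ∣ Δ is (us ++ z) ∣ ≡ ∣ Δ is (us ++ map row fs) ∣)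
 unsigned [] = [] , refl , λ is us → refl
 unsigned {x ∷ z} (mx ∷ mz) = go (∈-++⁻ rows mx) (unsigned mz) where
  Goal : Set
  Goal = ∃ λ fs → length fs ≡ suc (length z) × (∀ is us → ∣ Δ is (us ++ x ∷ z) ∣ ≡ ∣ Δ is (us ++ map row fs) ∣)
  ext : ∀ i fs is us → (∀ is us → ∣ Δ is (us ++ z) ∣ ≡ ∣ Δ is (us ++ map row fs) ∣) → ∣ Δ is (us ++ row i ∷ z) ∣ ≡ ∣ Δ is (us ++ row i ∷ map row fs) ∣
  ext i fs is us h = subst₂ (λ s t → ∣ Δ is s ∣ ≡ ∣ Δ is t ∣) (++-assoc us (row i ∷ []) z) (++-assoc us (row i ∷ []) (map row fs)) (h is (us ++ row i ∷ []))
  go : x ∈ rows ⊎ x ∈ map opp rows → (∃ λ fs → length fs ≡ length z × (∀ is us → ∣ Δ is (us ++ z) ∣ ≡ ∣ Δ is (us ++ map row fs) ∣)) → Goal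
  go (inl q) (fs , len , h) = fin (∈-tabulate⁻ q) where
   fin : (∃ λ i → x ≡ row i) → Goal
   fin (i , refl) = i ∷ fs , cong suc len , λ is us → ext i fs is us h
  go (inr q) (fs , len , h) = fin (∈-map⁻ opp q) where
   fin : (∃ λ w → w ∈ rows × x ≡ opp w) → Goal
   fin (w , mw , refl) = fin2 (∈-tabulate⁻ mw) where
    lem = ring-15
    fin2 : (∃ λ i → w ≡ row i) → Goal
    fin2 (i , refl) = i ∷ fs , cong suc len , λ is us →
     trans (cong ∣_∣ (trans (Δ-lin (- + 1) w (+ 0) w (opp w) (at-comb (- + 1) w (+ 0) w) is us z) (lem (Δ is (us ++ w ∷ z)))))
      (trans (∣-i∣≡∣i∣ (Δ is (us ++ w ∷ z))) (ext i fs is us h))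

 as-minor : ∀ {k} (g : Fin k → Fin n) {z} → Ms z → 0≢ (Δ (tabulate g) z) → ∃ λ f → ∣ Δ (tabulate g) z ∣ ≡ ∣ det k (sub k A f g) ∣
 as-minor {k} g {z} mz ne = go (unsigned mz) where
  pick : ∀ {k} (fs : List (Fin m)) → length fs ≡ k → ∃ λ (f : Fin k → Fin m) → tabulate f ≡ fs
  pick fs refl = lookup fs , tabulate-lookup fs
  go : (∃ λ fs → length fs ≡ length z × (∀ is us → ∣ Δ is (us ++ z) ∣ ≡ ∣ Δ is (us ++ map row fs) ∣)) → ∃ λ f → ∣ Δ (tabulate g) z ∣ ≡ ∣ det k (sub k A f g) ∣
  go (fs , len , h) = fin (pick fs (trans len (trans (Δ-rank (tabulate g) z ne) (length-tabulate g)))) where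
   fin : (∃ λ (f : Fin k → Fin m) → tabulate f ≡ fs) → ∃ λ f → ∣ Δ (tabulate g) z ∣ ≡ ∣ det k (sub k A f g) ∣
   fin (f , refl) = f , trans (h (tabulate g) []) (cong ∣_∣ (trans (cong (Δ (tabulate g)) (map-tabulate f row))
    (trans (sym (det-Δ k g (λ i → row (f i)))) (det-cong k (λ i j → entry (f i) (g j))))))

 f₀ : Fin r → Fin m
 f₀ = fst (fst rk)

 g₀ : Fin r → Fin n
 g₀ = fst (snd (fst rk))

 cols : List (Fin n)
 cols = tabulate g₀

 basis : List Row
 basis = tabulate (λ i → row (f₀ i))

 basis≢0 : 0≢ (Δ cols basis)
 basis≢0 e = snd (snd (fst rk)) (trans (sym (det-cong r (λ i j → entry (f₀ i) (g₀ j)))) (trans (det-Δ r g₀ (λ i → row (f₀ i))) e))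

 row∈ : ∀ i → row i ∈ rows ++ map opp rows
 row∈ i = ∈-++⁺ˡ (∈-tabulate⁺ {f = row} i)

 basis∈ : Ms basis
 basis∈ = AllP.tabulate⁺ (λ i → row∈ (f₀ i))

 -- A nonzero value would be a nonzero minor of order r + 1.
 bordered : ∀ j {z} → Ms z → Δ (j ∷ cols) z ≡ + 0
 bordered j {z} mz = go (Δ (j ∷ cols) z ℤ.≟ + 0) where
  g : Fin (suc r) → Fin n
  g zero = j
  g (suc i) = g₀ i
  go : Dec (Δ (j ∷ cols) z ≡ + 0) → Δ (j ∷ cols) z ≡ + 0
  go (yes e) = e
  go (no ne) = fin (as-minor g mz ne) where
   fin : (∃ λ f → ∣ Δ (tabulate g) z ∣ ≡ ∣ det (suc r) (sub (suc r) A f g) ∣) → Δ (j ∷ cols) z ≡ + 0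
   fin (f , e) = ⊥-elim (ℕP.1+n≰n (snd rk (suc r) f g (λ d → ne (∣i∣≡0⇒i≡0 (trans e (cong ∣_∣ d))))))

 config : Config r
 config = record
  { D    = Δ cols
  ; lin  = λ us a u b v zs → Δ-lin a u b v (comb a u b v) (at-comb a u b v) cols us zs
  ; alt  = Δ-alt cols
  ; gp   = Δ-plücker cols
  ; rank = λ xs ne → trans (Δ-rank cols xs ne) (length-tabulate g₀)
  ; bdd  = λ {z} mz → go mz (Δ cols z ℤ.≟ + 0)
  } where
  go : ∀ {z} → Ms z → Dec (Δ cols z ≡ + 0) → ∣ Δ cols z ∣ ≤ 2
  go mz (yes e) = ≤-trans (≤-reflexive (cong ∣_∣ e)) z≤n
  go {z} mz (no ne) = fin (as-minor g₀ mz ne) where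
   fin : (∃ λ f → ∣ Δ cols z ∣ ≡ ∣ det r (sub r A f g₀) ∣) → ∣ Δ cols z ∣ ≤ 2
   fin (f , e) = ≤-trans (≤-reflexive e) (md f g₀)

 -- Border the basis with row i and a column in which this row has a nonzero entry. The determinant
 -- vanishes, so some term other than that of row i is nonzero, and its cofactor contains row i.
 nonzero : ∀ i → Nz config (row i)
 nonzero i = go (FinP.¬∀⟶∃¬ n (λ j → A i j ≡ + 0) (λ j → A i j ℤ.≟ + 0) (fst sr i)) where
  go : (∃ λ j → 0≢ (A i j)) → Nz config (row i)
  go (j , ne) = fin (W-find (λ v → Vec.lookup v j) (λ ys → Δ cols (row i ∷ ys)) basis
    (λ e → *≢0 (λ q → ne (trans (sym (entry i j)) q)) basis≢0 (trans (i-j≡0⇒i≡j _ _ (bordered j (row∈ i ∷ basis∈))) e))) where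
   fin : (∃ λ l → ∃₂ λ x t → basis ≡ l ++ x ∷ t × 0≢ (Vec.lookup x j) × 0≢ (Δ cols (row i ∷ (l ++ t)))) → Nz config (row i)
   fin (l , x , t , eq , _ , q) = l ++ t , All-mid l (subst Ms eq basis∈) , q

 -- Border rows i and k and a completion of row k with any column j. If the part `S j` always
 -- vanishes, the two remaining terms make the rows proportional, with a nonzero factor for row i.
 independent : ∀ i k → i ≢ k → Ind2 config (row i) (row k)
 independent i k i≢k = go (nonzero k) where
  x y : Row
  x = row i
  y = row k
  go : Nz config y → Ind2 config x y
  go (b , mb , ne) = fin (FinP.any? (λ j → Dec.¬? (S j ℤ.≟ + 0))) where
   S : Fin n → ℤ
   S j = W (λ v → Vec.lookup v j) (λ ys → Δ cols (x ∷ y ∷ ys)) b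
   fin : Dec (∃ λ j → 0≢ (S j)) → Ind2 config x y
   fin (yes (j , q)) = fin2 (W-find (λ v → Vec.lookup v j) (λ ys → Δ cols (x ∷ y ∷ ys)) b q) where
    fin2 : (∃ λ l → ∃₂ λ v t → b ≡ l ++ v ∷ t × 0≢ (Vec.lookup v j) × 0≢ (Δ cols (x ∷ y ∷ (l ++ t)))) → Ind2 config x y
    fin2 (l , v , t , eq , _ , q) = l ++ t , All-mid l (subst Ms eq mb) , q
   fin (no h) = ⊥-elim (snd sr i k i≢k (inl (Δ cols (y ∷ b) , Δ cols (x ∷ b) , ne , prop))) where
    S≡0 : ∀ j → S j ≡ + 0
    S≡0 j = dec (S j ℤ.≟ + 0) where
     dec : Dec (S j ≡ + 0) → S j ≡ + 0
     dec (yes e) = e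
     dec (no q) = ⊥-elim (h (j , q))
    lem : ∀ u d v e s → u * d - (v * e - s) ≡ + 0 → s ≡ + 0 → d * u ≡ e * v
    lem u d v e s p refl = trans (*-comm d u) (trans (i-j≡0⇒i≡j _ _ p) (l2 v e)) where
     l2 = ring-179
    prop : ∀ j → Δ cols (y ∷ b) * A i j ≡ Δ cols (x ∷ b) * A k j
    prop j = subst₂ (λ s t → Δ cols (y ∷ b) * s ≡ Δ cols (x ∷ b) * t) (entry i j) (entry k j)
     (lem (Vec.lookup x j) (Δ cols (y ∷ b)) (Vec.lookup y j) (Δ cols (x ∷ b)) (S j) (bordered j (row∈ i ∷ row∈ k ∷ mb)) (S≡0 j))

 rows-simple : Simple config rows
 rows-simple = simple (AllP.tabulate⁺ row∈) (AllP.tabulate⁺ nonzero) (AllPairsP.tabulate⁺ (λ {i} {k} → independent i k))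

rows-bound : ∀ {m n} j (A : Matrix m n) → HasRank A (6 ℕ.+ j) → IsModular 2 (6 ℕ.+ j) A → SimpleRows A → m ≤ f1 (5 ℕ.+ j) ℕ.+ (K₀ ∸ j)
rows-bound j A rk md sr = subst (_≤ f1 (5 ℕ.+ j) ℕ.+ (K₀ ∸ j)) (length-tabulate row) (Theory.upper space j config rows-simple)
 where open Reduction A rk md sr

-- The extremal example

data Label : Set where
 l- l0 l+ : Label

-- The vertex j is the unit vector of column 1 + j; the labels are the points −1, 0, 1 of the axis of column 0.
data Point : Set where
 lab  : Label → Point
 vert : ℕ → Point

δ : ℕ → ℕ → ℤ
δ zero zero = + 1
δ zero (suc j) = + 0
δ (suc i) zero = + 0
δ (suc i) (suc j) = δ i j

δ-refl : ∀ i → δ i i ≡ + 1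
δ-refl zero = refl
δ-refl (suc i) = δ-refl i

δ-≢ : ∀ {i j} → i ≢ j → δ i j ≡ + 0
δ-≢ {zero} {zero} ne = ⊥-elim (ne refl)
δ-≢ {zero} {suc j} ne = refl
δ-≢ {suc i} {zero} ne = refl
δ-≢ {suc i} {suc j} ne = δ-≢ (λ e → ne (cong suc e))

coord : ℕ → Point → ℤ
coord zero (lab l-) = - + 1
coord zero (lab l0) = + 0
coord zero (lab l+) = + 1
coord zero (vert j) = + 0
coord (suc i) (lab l) = + 0
coord (suc i) (vert j) = δ i j

Edge : Set
Edge = Point × Point

at : ℕ → Edge → ℤ
at i (P , Q) = coord i P - coord i Q

open Minors {ℕ} {Edge} at using () renaming (Δ to Δᵉ; Δ-lin to Δᵉ-lin; Δ-alt to Δᵉ-alt; Δ-repeat to Δᵉ-repeat; det-Δ to det-Δᵉ; Δ-clash to Δᵉ-clash; Δ-diagonal to Δᵉ-diagonal)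

replace : ℕ → Point → Point → Point
replace i Q (lab l) = lab l
replace i Q (vert j) with i ℕ.≟ j
... | yes _ = Q
... | no _ = vert j

-- Substituting Q for vertex i is linear on coordinates: it subtracts a multiple of the vector vert
-- i - Q, and the multiple is the coordinate 1 + i.
coord-replace : ∀ i Q k R → coord k (replace i Q R) ≡ coord k R - coord (suc i) R * (coord k (vert i) - coord k Q)
coord-replace i Q k (lab l) = lem (coord k (lab l)) (coord k (vert i) - coord k Q) where
 lem = ring-180
coord-replace i Q k (vert j) with i ℕ.≟ j
... | yes refl = trans (lem (coord k (vert i)) (coord k Q)) (cong (λ t → coord k (vert i) - t * (coord k (vert i) - coord k Q)) (sym (δ-refl i))) where
 lem = ring-181
... | no ne = trans (lem (coord k (vert j)) (coord k (vert i) - coord k Q)) (cong (λ t → coord k (vert j) - t * (coord k (vert i) - coord k Q)) (sym (δ-≢ ne))) where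
 lem = ring-180

contract : ℕ → Point → Edge → Edge
contract i Q (R , S) = replace i Q R , replace i Q S

at-contract : ∀ i Q k x → at k (contract i Q x) ≡ + 1 * at k x + - at (suc i) x * (coord k (vert i) - coord k Q)
at-contract i Q k (R , S) = trans (cong₂ _-_ (coord-replace i Q k R) (coord-replace i Q k S))
  (lem (coord k R) (coord (suc i) R) (coord k S) (coord (suc i) S) (coord k (vert i) - coord k Q)) where
 lem = ring-182

Small₂ : List ℕ → Set
Small₂ is = ∀ xs → ∣ Δᵉ is xs ∣ ≤ 2

-- Adding multiples of the pivot row y changes no determinant in which y occurs.
sweep : ∀ is y (σ : Edge → Edge) (t : Edge → ℤ) → (∀ k x → at k (σ x) ≡ + 1 * at k x + t x * at k y) →
    ∀ us xs → Δᵉ is (y ∷ us ++ map σ xs) ≡ Δᵉ is (y ∷ us ++ xs)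
sweep is y σ t h us [] = refl
sweep is y σ t h us (x ∷ xs) = trans (cong (λ l → Δᵉ is (y ∷ l)) (sym (++-assoc us (σ x ∷ []) (map σ xs))))
 (trans (sweep is y σ t h (us ++ σ x ∷ []) xs)
  (trans (cong (λ l → Δᵉ is (y ∷ l)) (++-assoc us (σ x ∷ []) xs))
   (trans (Δᵉ-lin (+ 1) x (t x) y (σ x) (λ k → h k x) is (y ∷ us) xs)
    (trans (cong (λ s → + 1 * Δᵉ is (y ∷ us ++ x ∷ xs) + t x * s) twice) (lem (Δᵉ is (y ∷ us ++ x ∷ xs)) (t x)))))) where
 lem = ring-183
 twice : Δᵉ is (y ∷ us ++ y ∷ xs) ≡ + 0
 twice = go (perm± (Δᵉ is) (Δᵉ-alt is) (↭-prep y (PermP.shift y us xs))) where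
  z : Δᵉ is (y ∷ y ∷ us ++ xs) ≡ + 0
  z = x≡-x⇒0 _ (Δᵉ-alt is [] y y (us ++ xs))
  go : (Δᵉ is (y ∷ us ++ y ∷ xs) ≡ Δᵉ is (y ∷ y ∷ us ++ xs)) ⊎ (Δᵉ is (y ∷ us ++ y ∷ xs) ≡ - Δᵉ is (y ∷ y ∷ us ++ xs)) → Δᵉ is (y ∷ us ++ y ∷ xs) ≡ + 0
  go (inl e) = trans e z
  go (inr e) = trans e (cong -_ z)

-- Row operations with y = ±(vert i - Q) turn all other rows into contracted edges and clear column
-- 1 + i, so that the determinant is ± one on the remaining columns.
pivot : ∀ i is y s Q → ∣ s ∣ ≡ 1 → coord (suc i) Q ≡ + 0 → (∀ k → coord k (vert i) - coord k Q ≡ s * at k y) → Small₂ is →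
    ∀ xs → ∣ Δᵉ (suc i ∷ is) (y ∷ xs) ∣ ≤ 2
pivot i is y s Q s1 q0 hy small xs = subst (_≤ 2) (cong ∣_∣ (sweep (suc i ∷ is) y σ t swept [] xs)) bound where
 σ : Edge → Edge
 σ = contract i Q
 t : Edge → ℤ
 t x = - at (suc i) x * s
 swept : ∀ k x → at k (σ x) ≡ + 1 * at k x + t x * at k y
 swept k x = trans (at-contract i Q k x) (trans (cong (λ d → + 1 * at k x + - at (suc i) x * d) (hy k)) (lem (at k x) (at (suc i) x) s (at k y))) where
  lem = ring-184
 gone : ∀ x → at (suc i) (σ x) ≡ + 0
 gone x = trans (at-contract i Q (suc i) x) (trans (cong₂ (λ a b → + 1 * at (suc i) x + - at (suc i) x * (a - b)) (δ-refl i) q0) (lem (at (suc i) x))) where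
  lem = ring-185
 unit : ∣ at (suc i) y ∣ ≡ 1
 unit = trans (sym (ℕP.*-identityˡ ∣ at (suc i) y ∣)) (trans (cong (ℕ._* ∣ at (suc i) y ∣) (sym s1))
  (trans (sym (∣i*j∣≡∣i∣*∣j∣ s (at (suc i) y))) (cong ∣_∣ (trans (sym (hy (suc i))) (cong₂ _-_ (δ-refl i) q0)))))
 all-gone : ∀ xs → All (λ x → at (suc i) x ≡ + 0) (map σ xs)
 all-gone [] = []
 all-gone (x ∷ xs) = gone x ∷ all-gone xs
 rest : W (at (suc i)) (λ ys → Δᵉ is (y ∷ ys)) (map σ xs) ≡ + 0
 rest = W-vanish (at (suc i)) _ (map σ xs) (λ l x r eq → cong (_* Δᵉ is (y ∷ (l ++ r))) (All.head (snd (AllP.++⁻ l (subst (All _) eq (all-gone xs))))))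
 bound : ∣ Δᵉ (suc i ∷ is) (y ∷ map σ xs) ∣ ≤ 2
 bound = subst (_≤ 2) (sym (trans (cong ∣_∣ (trans (cong (λ w → at (suc i) y * Δᵉ is (map σ xs) - w) rest) (lem (at (suc i) y * Δᵉ is (map σ xs)))))
   (trans (∣i*j∣≡∣i∣*∣j∣ (at (suc i) y) (Δᵉ is (map σ xs))) (trans (cong (ℕ._* ∣ Δᵉ is (map σ xs) ∣) unit) (ℕP.*-identityˡ _))))) (small (map σ xs)) where
  lem = ring-186

-- A point is the vertex of column 1 + i, or that coordinate of it vanishes.
is-vert : ∀ i P → P ≡ vert i ⊎ coord (suc i) P ≡ + 0
is-vert i (lab l) = inr refl
is-vert i (vert j) with i ℕ.≟ j
... | yes refl = inl refl
... | no ne = inr (δ-≢ ne)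

-- A nonzero entry in column 1 + i means that exactly one end of the edge is vertex i; the other end
-- is the point to substitute.
pivot-column : ∀ i is → Small₂ is → Small₂ (suc i ∷ is)
pivot-column i is small xs = go (Δᵉ (suc i ∷ is) xs ℤ.≟ + 0) where
 first : ∀ y zs → 0≢ (at (suc i) y) → ∣ Δᵉ (suc i ∷ is) (y ∷ zs) ∣ ≤ 2
 first (P , Q) zs ne = cases (is-vert i P) (is-vert i Q) where
  l1 = ring-187
  l2 = ring-188
  cases : P ≡ vert i ⊎ coord (suc i) P ≡ + 0 → Q ≡ vert i ⊎ coord (suc i) Q ≡ + 0 → ∣ Δᵉ (suc i ∷ is) ((P , Q) ∷ zs) ∣ ≤ 2
  cases (inl refl) (inl refl) = ⊥-elim (ne (+-inverseʳ (coord (suc i) (vert i))))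
  cases (inl refl) (inr q0) = pivot i is (vert i , Q) (+ 1) Q refl q0 (λ k → l1 (coord k (vert i)) (coord k Q)) small zs
  cases (inr p0) (inl refl) = pivot i is (P , vert i) (- + 1) P refl p0 (λ k → l2 (coord k (vert i)) (coord k P)) small zs
  cases (inr p0) (inr q0) = ⊥-elim (ne (cong₂ _-_ p0 q0))
 go : Dec (Δᵉ (suc i ∷ is) xs ≡ + 0) → ∣ Δᵉ (suc i ∷ is) xs ∣ ≤ 2
 go (yes e) = ≤-trans (≤-reflexive (cong ∣_∣ e)) z≤n
 go (no ne) = fin (W-find (at (suc i)) (Δᵉ is) xs ne) where
  fin : (∃ λ l → ∃₂ λ y r → xs ≡ l ++ y ∷ r × 0≢ (at (suc i) y) × 0≢ (Δᵉ is (l ++ r))) → ∣ Δᵉ (suc i ∷ is) xs ∣ ≤ 2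
  fin (l , y , r , refl , ny , _) = fin2 (perm± (Δᵉ (suc i ∷ is)) (Δᵉ-alt (suc i ∷ is)) (PermP.shift y l r)) where
   fin2 : (Δᵉ (suc i ∷ is) (l ++ y ∷ r) ≡ Δᵉ (suc i ∷ is) (y ∷ l ++ r)) ⊎ (Δᵉ (suc i ∷ is) (l ++ y ∷ r) ≡ - Δᵉ (suc i ∷ is) (y ∷ l ++ r)) → ∣ Δᵉ (suc i ∷ is) (l ++ y ∷ r) ∣ ≤ 2
   fin2 (inl e) = ≤-trans (≤-reflexive (cong ∣_∣ e)) (first y (l ++ r) ny)
   fin2 (inr e) = ≤-trans (≤-reflexive (trans (cong ∣_∣ e) (∣-i∣≡∣i∣ (Δᵉ (suc i ∷ is) (y ∷ l ++ r))))) (first y (l ++ r) ny)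

-- The axis column is moved behind all vertex columns. When these are eliminated, one entry remains,
-- a difference of two values among -1, 0, 1.
small-axis : ∀ is → Small₂ (0 ∷ is)
small-axis [] [] = z≤n
small-axis [] (x ∷ []) = subst (_≤ 2) (cong ∣_∣ (lem (at 0 x))) (go x) where
 lem = ring-189
 go : ∀ x → ∣ at 0 x ∣ ≤ 2
 go (P , Q) = ≤-trans (∣i-j∣≤∣i∣+∣j∣ (coord 0 P) (coord 0 Q)) (+-mono-≤ (one P) (one Q)) where
  one : ∀ P → ∣ coord 0 P ∣ ≤ 1
  one (lab l-) = s≤s z≤n
  one (lab l0) = z≤n
  one (lab l+) = s≤s z≤n
  one (vert j) = z≤n
small-axis [] (x ∷ y ∷ xs) = ≤-trans (≤-reflexive (cong ∣_∣ (W-vanish (at 0) (Δᵉ []) (x ∷ y ∷ xs) van))) z≤n where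
 van : ∀ l z r → x ∷ y ∷ xs ≡ l ++ z ∷ r → at 0 z * Δᵉ [] (l ++ r) ≡ + 0
 van [] z (_ ∷ r) e = *-zeroʳ (at 0 z)
 van (_ ∷ l) z r e = *-zeroʳ (at 0 z)
small-axis (zero ∷ is) xs = ≤-trans (≤-reflexive (cong ∣_∣ (Δᵉ-repeat {0} {0 ∷ is} (here refl) xs))) z≤n
small-axis (suc i ∷ is) xs = ≤-trans (≤-reflexive (trans (cong ∣_∣ (W-anti (at 0) (at (suc i)) (Δᵉ is) xs)) (∣-i∣≡∣i∣ (Δᵉ (suc i ∷ 0 ∷ is) xs))))
 (pivot-column i (0 ∷ is) (small-axis is) xs)

small-minors : ∀ is → Small₂ is
small-minors [] [] = s≤s z≤n
small-minors [] (_ ∷ _) = z≤n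
small-minors (zero ∷ is) = small-axis is
small-minors (suc i ∷ is) = pivot-column i is (small-minors is)

points : ℕ → List Point
points zero = lab l- ∷ lab l0 ∷ lab l+ ∷ []
points (suc N) = vert N ∷ points N

arm : ℕ → Point → Edge
arm N P = vert N , P

-- A new vertex is joined to all 3 + N earlier points, which is the increment of `f1`. All edges
-- between labels are parallel, so one of them is taken.
edges : ℕ → List Edge
edges zero = (lab l+ , lab l0) ∷ []
edges (suc N) = map (arm N) (points N) ++ edges N

edges-length : ∀ N → length (edges N) ≡ f1 N
edges-length zero = refl
edges-length (suc N) = trans (length-++ (map (arm N) (points N)) {edges N}) (trans (cong₂ ℕ._+_ block (edges-length N))
  (trans (ℕP.+-comm (3 ℕ.+ N) (f1 N)) (sym (f1-suc N)))) where
 pts : ∀ N → length (points N) ≡ 3 ℕ.+ N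
 pts zero = refl
 pts (suc N) = cong suc (pts N)
 block : length (map (arm N) (points N)) ≡ 3 ℕ.+ N
 block = trans (length-map (arm N) (points N)) (pts N)

points-old : ∀ N M → N ≤ M → All (λ P → coord (suc M) P ≡ + 0) (points N)
points-old zero M _ = refl ∷ refl ∷ refl ∷ []
points-old (suc N) M lt = δ-≢ (λ e → <-irrefl (sym e) lt) ∷ points-old N M (<⇒≤ lt)

edges-old : ∀ N M → N ≤ M → All (λ x → at (suc M) x ≡ + 0) (edges N)
edges-old zero M _ = refl ∷ []
edges-old (suc N) M lt = AllP.++⁺ (AllP.map⁺ (All.map (λ q → cong₂ _-_ (δ-≢ (λ e → <-irrefl (sym e) lt)) q) (points-old N M (<⇒≤ lt)))) (edges-old N M (<⇒≤ lt))

points-distinct : ∀ N → AllPairs (λ P Q → ∃ λ k → k ≤ N × coord k P ≢ coord k Q) (points N)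
points-distinct zero = ((0 , z≤n , λ ()) ∷ (0 , z≤n , λ ()) ∷ []) ∷ ((0 , z≤n , λ ()) ∷ []) ∷ [] ∷ []
points-distinct (suc N) = All.map (λ q → suc N , ≤-refl , λ e → 1≢0 (trans (sym (δ-refl N)) (trans e q))) (points-old N N ≤-refl)
 ∷ AllPairs.map (λ { (k , le , ne) → k , m≤n⇒m≤1+n le , ne }) (points-distinct N) where
 1≢0 : + 1 ≢ + 0
 1≢0 ()

Seen : ℕ → Edge → Set
Seen N x = ∃ λ k → k ≤ N × 0≢ (at k x)

-- Some 2 × 2 minor of the two rows does not vanish.
Apart : ℕ → Edge → Edge → Set
Apart N x y = ∃₂ λ k l → k ≤ N × l ≤ N × at k x * at l y ≢ at l x * at k y

new-unit : ∀ N {P} → coord (suc N) P ≡ + 0 → at (suc N) (vert N , P) ≡ + 1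
new-unit N q = cong₂ _-_ (δ-refl N) q

edges-seen : ∀ N → All (Seen N) (edges N)
edges-seen zero = (0 , z≤n , λ ()) ∷ []
edges-seen (suc N) = AllP.++⁺ (AllP.map⁺ (All.map (λ {P} q → suc N , ≤-refl , λ e → 1≢0 (trans (sym (new-unit N {P} q)) e)) (points-old N N ≤-refl)))
 (All.map (λ { (k , le , ne) → k , m≤n⇒m≤1+n le , ne }) (edges-seen N)) where
 1≢0 : + 1 ≢ + 0
 1≢0 ()

-- Two new edges agree in the new coordinate but end at different points; the new coordinate
-- separates a new edge from an old one.
edges-apart : ∀ N → AllPairs (Apart N) (edges N)
edges-apart zero = [] ∷ []
edges-apart (suc N) = AllPairsP.++⁺ (AllPairsP.map⁺ (within (points N) (points-old N N ≤-refl) (points-distinct N)))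
  (AllPairs.map (λ { (k , l , a , b , ne) → k , l , m≤n⇒m≤1+n a , m≤n⇒m≤1+n b , ne }) (edges-apart N))
  (AllP.map⁺ (All.map (λ {P} q → All.map (λ {y} → across {P} {y} q) (All.zip (edges-seen N , edges-old N N ≤-refl))) (points-old N N ≤-refl))) where
 across : ∀ {P y} → coord (suc N) P ≡ + 0 → Seen N y × at (suc N) y ≡ + 0 → Apart (suc N) (vert N , P) y
 across {P} {y} q ((l , le , ne) , z) = suc N , l , ≤-refl , m≤n⇒m≤1+n le , λ e → ne
  (trans (sym (ℤP.*-identityˡ (at l y))) (trans (cong (_* at l y) (sym (new-unit N {P} q))) (trans e (trans (cong (at l (vert N , P) *_) z) (*-zeroʳ (at l (vert N , P)))))))
 pair : ∀ {P Q} → coord (suc N) P ≡ + 0 → coord (suc N) Q ≡ + 0 → (∃ λ k → k ≤ N × coord k P ≢ coord k Q) → Apart (suc N) (vert N , P) (vert N , Q)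
 pair {P} {Q} p q (l , le , ne) = suc N , l , ≤-refl , m≤n⇒m≤1+n le , λ e → ne
  (lem (coord l (vert N)) (coord l P) (coord l Q)
   (trans (sym (ℤP.*-identityˡ _)) (trans (cong (_* at l (vert N , Q)) (sym (new-unit N {P} p))) (trans e (trans (cong (at l (vert N , P) *_) (new-unit N {Q} q)) (ℤP.*-identityʳ _)))))) where
  lem : ∀ c a b → c - b ≡ c - a → a ≡ b
  lem c a b e = trans (l1 c a) (trans (cong (λ t → c - t) (sym e)) (sym (l1 c b))) where
   l1 = ring-190
 within : ∀ Ps → All (λ P → coord (suc N) P ≡ + 0) Ps → AllPairs (λ P Q → ∃ λ k → k ≤ N × coord k P ≢ coord k Q) Ps →
      AllPairs (λ P Q → Apart (suc N) (vert N , P) (vert N , Q)) Ps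
 within [] [] [] = []
 within (P ∷ Ps) (p ∷ ps) (a ∷ as) = All.map (λ {Q} h → pair {P} {Q} p (fst h) (snd h)) (All.zip (ps , a)) ∷ within Ps ps as

axis∈ : ∀ N → (lab l+ , lab l0) ∈ edges N
axis∈ zero = here refl
axis∈ (suc N) = ∈-++⁺ʳ (map (arm N) (points N)) (axis∈ N)

spoke∈ : ∀ N j → j < N → (vert j , lab l0) ∈ edges N
spoke∈ (suc N) j lt = go (j ℕ.≟ N) where
 zero∈ : ∀ N → lab l0 ∈ points N
 zero∈ zero = there (here refl)
 zero∈ (suc N) = there (zero∈ N)
 go : Dec (j ≡ N) → (vert j , lab l0) ∈ edges (suc N)
 go (yes refl) = ∈-++⁺ˡ (∈-map⁺ (arm N) (zero∈ N))
 go (no ne) = ∈-++⁺ʳ (map (arm N) (points N)) (spoke∈ N j (≤∧≢⇒< (≤-pred lt) ne))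

AllPairs-lookup : ∀ {X : Set} {R : X → X → Set} → (∀ {x y} → R x y → R y x) → ∀ {xs} → AllPairs R xs → ∀ i j → i ≢ j → R (lookup xs i) (lookup xs j)
AllPairs-lookup s (a ∷ as) zero zero ne = ⊥-elim (ne refl)
AllPairs-lookup s {_ ∷ xs} (a ∷ as) zero (suc j) ne = All.lookup a (∈-lookup {xs = xs} j)
AllPairs-lookup s {_ ∷ xs} (a ∷ as) (suc i) zero ne = s (All.lookup a (∈-lookup {xs = xs} i))
AllPairs-lookup s (a ∷ as) (suc i) (suc j) ne = AllPairs-lookup s as i j (λ e → ne (cong suc e))

module Example (N : ℕ) where

 E : Matrix (length (edges N)) (suc N)
 E i j = at (Fin.toℕ j) (lookup (edges N) i)

 minor : ∀ k (f : Fin k → Fin (length (edges N))) (g : Fin k → Fin (suc N)) →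
     det k (sub k E f g) ≡ Δᵉ (tabulate (λ j → Fin.toℕ (g j))) (tabulate (λ i → lookup (edges N) (f i)))
 minor k f g = det-Δᵉ k (λ j → Fin.toℕ (g j)) (λ i → lookup (edges N) (f i))

 modular : IsModular 2 (suc N) E
 modular f g = subst (λ d → ∣ d ∣ ≤ 2) (sym (minor (suc N) f g)) (small-minors (tabulate (λ j → Fin.toℕ (g j))) (tabulate (λ i → lookup (edges N) (f i))))

 -- The edges ending at the origin `lab l0` are the unit vectors, which proves full rank.
 star : ℕ → Edge
 star zero = lab l+ , lab l0
 star (suc j) = vert j , lab l0

 star∈ : ∀ j → j ≤ N → star j ∈ edges N
 star∈ zero _ = axis∈ N
 star∈ (suc j) lt = spoke∈ N j lt

 at-star : ∀ i j → at i (star j) ≡ δ i j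
 at-star zero zero = refl
 at-star zero (suc j) = refl
 at-star (suc i) zero = refl
 at-star (suc i) (suc j) = ℤP.+-identityʳ (δ i j)

 rank : HasRank E (suc N)
 rank = (f , (λ j → j) , λ e → full (trans (sym (minor (suc N) f (λ j → j))) e)) , λ k f g ne → ≮⇒≥ (λ lt → ne (trans (minor k f g) (repeated k g lt (tabulate (λ i → lookup (edges N) (f i)))))) where
  pos : ∀ j → star (Fin.toℕ j) ∈ edges N
  pos j = star∈ (Fin.toℕ j) (≤-pred (FinP.toℕ<n j))
  f : Fin (suc N) → Fin (length (edges N))
  f j = Any.index (pos j)
  value : ∀ (i j : Fin (suc N)) → at (Fin.toℕ i) (lookup (edges N) (f j)) ≡ δ (Fin.toℕ i) (Fin.toℕ j)
  value i j = trans (cong (at (Fin.toℕ i)) (sym (AnyP.lookup-index (pos j)))) (at-star (Fin.toℕ i) (Fin.toℕ j))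
  1≢0 : + 1 ≢ + 0
  1≢0 ()
  full : 0≢ (Δᵉ (tabulate (Fin.toℕ {suc N})) (tabulate (λ i → lookup (edges N) (f i))))
  full = Δᵉ-diagonal (Fin.toℕ {suc N}) (λ i → lookup (edges N) (f i)) (λ i e → 1≢0 (trans (sym (δ-refl (Fin.toℕ i))) (trans (sym (value i i)) e)))
   (λ i j ne → trans (value i j) (δ-≢ (λ e → ne (FinP.toℕ-injective e))))
  repeated : ∀ k (g : Fin k → Fin (suc N)) → suc N < k → ∀ xs → Δᵉ (tabulate (λ j → Fin.toℕ (g j))) xs ≡ + 0
  repeated k g lt xs = go (FinP.pigeonhole lt g) where
   go : (∃₂ λ i j → i Fin.< j × g i ≡ g j) → Δᵉ (tabulate (λ j → Fin.toℕ (g j))) xs ≡ + 0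
   go (i , j , i<j , e) = Δᵉ-clash (λ j → Fin.toℕ (g j)) i<j (cong Fin.toℕ e) xs

 simple-rows : SimpleRows E
 simple-rows = (λ i z → seen i z (All.lookup (edges-seen N) (∈-lookup {xs = edges N} i)))
   , λ i j ne → apart i j (AllPairs-lookup (λ {x} {y} → Apart-sym {x} {y}) (edges-apart N) i j ne) where
  col : ∀ {k} → k ≤ N → Fin (suc N)
  col le = Fin.fromℕ< (s≤s le)
  entry : ∀ {k} (le : k ≤ N) i → E i (col le) ≡ at k (lookup (edges N) i)
  entry le i = cong (λ t → at t (lookup (edges N) i)) (FinP.toℕ-fromℕ< (s≤s le))
  seen : ∀ i → (∀ j → E i j ≡ + 0) → Seen N (lookup (edges N) i) → ⊥
  seen i z (k , le , ne) = ne (trans (sym (entry le i)) (z (col le)))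
  Apart-sym : ∀ {x y} → Apart N x y → Apart N y x
  Apart-sym {x} {y} (k , l , a , b , ne) = l , k , b , a , λ e → ne (trans (*-comm (at k x) (at l y)) (trans e (*-comm (at k y) (at l x))))
  cross : ∀ a b u u' v v' → a ≢ + 0 → a * u ≡ b * v → a * u' ≡ b * v' → u * v' ≡ u' * v
  cross a b u u' v v' a≢0 p q = cancel-≡ (u * v') (u' * v) a≢0 (trans (l1 a u v') (trans (cong (_* v') p) (trans (l2 b v v') (trans (cong (_* v) (sym q)) (sym (l1 a u' v)))))) where
   l1 = ring-191
   l2 = ring-192
  apart : ∀ i j → Apart N (lookup (edges N) i) (lookup (edges N) j) → ¬ Parallel (E i) (E j)
  apart i j (k , l , a , b , ne) par = ne (subst₂ _≡_ (cong₂ _*_ (entry a i) (entry b j)) (cong₂ _*_ (entry b i) (entry a j)) (eq par)) where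
   eq : Parallel (E i) (E j) → E i (col a) * E j (col b) ≡ E i (col b) * E j (col a)
   eq (inl (c , d , c≢0 , h)) = cross c d (E i (col a)) (E i (col b)) (E j (col a)) (E j (col b)) c≢0 (h (col a)) (h (col b))
   eq (inr (c , d , c≢0 , h)) = trans (*-comm (E i (col a)) (E j (col b))) (trans (sym (cross c d (E j (col a)) (E j (col b)) (E i (col a)) (E i (col b)) c≢0 (h (col a)) (h (col b)))) (*-comm (E j (col a)) (E i (col b))))

-- The binomial form of the bound and the theorem

open import Data.Nat.Combinatorics using (_C_; nC1≡n; nCk+nC[k+1]≡[n+1]C[k+1])

tri-binomial : ∀ N → suc N C 2 ≡ tri N
tri-binomial zero = refl
tri-binomial (suc N) = trans (sym (nCk+nC[k+1]≡[n+1]C[k+1] (suc N) 1)) (cong₂ ℕ._+_ (nC1≡n (suc N)) (tri-binomial N))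

f1-binomial : ∀ N → f1 N ≡ ((suc N ℕ.+ 2) C 2) ∸ 2
f1-binomial N = trans (sym (cong (_∸ 2) (lem N (tri N)))) (sym (cong (_∸ 2) (trans (cong (_C 2) (ℕP.+-comm (suc N) 2)) (tri-binomial (suc (suc N)))))) where
 open +-*-Solver
 lem : ∀ n t → suc (suc n) ℕ.+ (suc n ℕ.+ t) ≡ 2 ℕ.+ (t ℕ.+ (n ℕ.+ n) ℕ.+ 1)
 lem = solve 2 (λ n t → con 2 :+ n :+ (con 1 :+ n :+ t) := con 2 :+ (t :+ (n :+ n) :+ con 1)) refl

theorem1p1 : Σ ℕ λ r₀ → ∀ r → r₀ ≤ r → IsMaxRows 2 r (((r ℕ.+ 2) C 2) ∸ 2)
-- With r = 6 + j, the surplus `K₀ ∸ j` has vanished as soon as j ≥ K₀.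
theorem1p1 = 6 ℕ.+ K₀ , λ r le → subst (λ r → IsMaxRows 2 r (((r ℕ.+ 2) C 2) ∸ 2)) (shape r le) (maximum (r ∸ 6) (m+n≤o⇒m≤o∸n K₀ (subst (_≤ r) (ℕP.+-comm 6 K₀) le))) where
 shape : ∀ r → 6 ℕ.+ K₀ ≤ r → 6 ℕ.+ (r ∸ 6) ≡ r
 shape r le = m+[n∸m]≡n (≤-trans (ℕP.m≤m+n 6 K₀) le)
 maximum : ∀ j → K₀ ≤ j → IsMaxRows 2 (6 ℕ.+ j) (((6 ℕ.+ j ℕ.+ 2) C 2) ∸ 2)
 maximum j le = subst (IsMaxRows 2 (6 ℕ.+ j)) (f1-binomial (5 ℕ.+ j))
  ( subst (λ h → Σ ℕ λ n → Σ (Matrix h n) λ A → HasRank A (6 ℕ.+ j) × IsModular 2 (6 ℕ.+ j) A × SimpleRows A) (edges-length (5 ℕ.+ j))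
    (6 ℕ.+ j , E , rank , modular , simple-rows)
  , λ m n A rk md sr → subst (m ≤_) (trans (cong (f1 (5 ℕ.+ j) ℕ.+_) (m≤n⇒m∸n≡0 le)) (ℕP.+-identityʳ _)) (rows-bound j A rk md sr))
  where open Example (5 ℕ.+ j)
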